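{- For all $n\ge0$, $\Delta_n(\mathrm{cQSym}_n)\subseteq\mathrm{cQSym}_n\otimes\mathrm{QSym}_n$ and $\Delta_n(\mathrm{cQSym}^-_n)\subseteq\mathrm{cQSym}^-_n\otimes\mathrm{QSym}_n$, i.e. both are right comodules of $\mathrm{QSym}_n$ under the internal coproduct. Explicitly, for $n>1$ and every orbit $B$ of nonempty proper subsets of $[n]$, \[ \Delta_n(\hat F^{\mathrm{cyc}}_{n,B})=\sum_{A,\,J}\frac{d_A}{d_B}\,\tilde a_B^{AJ}\,\hat F^{\mathrm{cyc}}_{n,A}\otimes F_{n,J}, \] summing over orbits $A$ of nonempty proper subsets of $[n]$ and $J\subseteq[n-1]$, where $\tilde a_B^{AJ}:=\#\{(\sigma_1,\sigma_2)\in\mathfrak{S}_n\times\mathfrak{S}_n:\mathrm{cDes}(\sigma_1)\in A,\ \mathrm{Des}(\sigma_2)=J,\ \sigma_2\sigma_1=\pi\}$ does not depend on the choice of $\pi\in\mathfrak{S}_n$ with $\mathrm{cDes}(\pi)\in B$; the structure constants $\frac{d_A}{d_B}\tilde a_B^{AJ}$ are nonnegative integers. Moreover, for $n\ge1$, $\Delta_n(\hat F^{\mathrm{cyc}}_{n,\varnothing})=\Delta_n(h_n)=\sum_{\lambda\vdash n}s_\lambda\otimes s_\lambda$ and $\Delta_n(\hat F^{\mathrm{cyc}}_{n,[n]})=\Delta_n(e_n)=\sum_{\lambda\vdash n}s_\lambda\otimes s_{\lambda'}$, both lying in $\mathrm{Sym}_n\otimes\mathrm{Sym}_n$.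
   Context: $\mathrm{QSym}_n$ is the group of degree-$n$ quasi-symmetric functions, with fundamental basis $F_{n,J}=\sum x_{i_1}\cdots x_{i_n}$ ($J\subseteq[n-1]$), summing over $i_1\le\cdots\le i_n$ with $i_j<i_{j+1}$ for $j\in J$. For $\pi\in\mathfrak{S}_n$, $\mathrm{Des}(\pi)=\{i\in[n-1]:\pi_i>\pi_{i+1}\}$ and $\mathrm{cDes}(\pi)=\{i\in[n]:\pi_i>\pi_{i+1}\}$ with $\pi_{n+1}:=\pi_1$. Permutations multiply by composition. The internal coproduct $\Delta_n:\mathrm{QSym}_n\to\mathrm{QSym}_n\otimes\mathrm{QSym}_n$ is $\Delta_n(F_{n,K})=\sum_{I,J\subseteq[n-1]}a_K^{IJ}F_{n,I}\otimes F_{n,J}$, with $a_K^{IJ}=\#\{(\sigma_1,\sigma_2):\mathrm{Des}(\sigma_1)=I,\mathrm{Des}(\sigma_2)=J,\sigma_2\sigma_1=\pi\}$ for any $\pi$ with $\mathrm{Des}(\pi)=K$ (this is independent of $\pi$); equivalently $\Delta_n(f)$ is obtained by evaluating $f$ on the lexicographically ordered variables $x_iy_j$. For $J\subseteq[n]$, $F^{\mathrm{cyc}}_{n,J}:=\sum_{(w,k)}x_{w_1}\cdots x_{w_n}$ over pairs $w\in\{1,2,\dots\}^n$, $k\in[n]$ with $w_k\le\cdots\le w_n\le w_1\le\cdots\le w_{k-1}$ and $w_j<w_{j+1}$ for $j\in J\setminus\{k-1\}$ (indices mod $n$). $d_J$ is the order of the stabilizer of $J$ under cyclic shifts mod $n$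 (constant on orbits, written $d_A$), and $\hat F^{\mathrm{cyc}}_{n,A}:=F^{\mathrm{cyc}}_{n,J}/d_J$ for $J\in A$. $\mathrm{cQSym}_n$ is the group of degree-$n$ power series $f$ such that for $i_1<\dots<i_t$, $i'_1<\dots<i'_t$, exponents $m=(m_1,\dots,m_t)$ and any cyclic shift $m'$ of $m$, the coefficients of $x_{i_1}^{m_1}\cdots x_{i_t}^{m_t}$ and $x_{i'_1}^{m'_1}\cdots x_{i'_t}^{m'_t}$ agree. $\mathrm{cQSym}^-_n$ is the $\mathbb{Z}$-span of $\hat F^{\mathrm{cyc}}_{n,J}$, $\varnothing\ne J\ne[n]$, for $n>1$; $\mathrm{cQSym}^-_1=\mathbb{Z}e_1$, $\mathrm{cQSym}^-_0=\mathbb{Z}$. $\lambda'$ is the conjugate partition. -}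

module Defs where

open import Data.Nat as ℕ using (ℕ; zero; suc; _+_; _*_; _∸_; _≤ᵇ_; _<ᵇ_; _≡ᵇ_; _⊔_; NonZero)
open import Data.Nat.DivMod using (_mod_)
open import Data.Integer as ℤ using (ℤ; +_)
open import Data.Fin using (Fin; toℕ; inject₁) renaming (zero to fzero; suc to fsuc)
open import Data.Bool using (Bool; true; false; _∧_; _∨_; not; if_then_else_; T)
open import Data.List using (List; []; _∷_; map; concatMap; foldr; length; upTo; allFin;
                             drop; take; _++_; zipWith; concat)
open import Data.List.Relation.Unary.All using (All)
open import Data.List.Relation.Binary.Permutation.Propositional using (_↭_)
open import Data.Vec as Vec using (Vec; []; _∷_; _∷ʳ_; lookup; toList; replicate)
open import Data.Product using (Σ; _×_; _,_; ∃-syntax)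
open import Function using (_∘_; id)
open import Relation.Binary.PropositionalEquality using (_≡_; refl)

allᵇ : {A : Set} → (A → Bool) → List A → Bool
allᵇ p = foldr (λ x acc → p x ∧ acc) true

anyᵇ : {A : Set} → (A → Bool) → List A → Bool
anyᵇ p = foldr (λ x acc → p x ∨ acc) false

sumℕ : List ℕ → ℕ
sumℕ = foldr _+_ 0

count : {A : Set} → (A → Bool) → List A → ℕ
count p = foldr (λ x acc → if p x then suc acc else acc) 0

sumℤ : List ℤ → ℤ
sumℤ = foldr ℤ._+_ (+ 0)

allVecsOf : {A : Set} → List A → (k : ℕ) → List (Vec A k)
allVecsOf xs zero    = [] ∷ []
allVecsOf xs (suc k) = concatMap (λ v → map (λ x → x ∷ v) xs) (allVecsOf xs k)

bools : List Bool
bools = true ∷ false ∷ []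

eqBool : Bool → Bool → Bool
eqBool true  b = b
eqBool false b = not b

eqVecBool : ∀ {n} → Vec Bool n → Vec Bool n → Bool
eqVecBool []       []       = true
eqVecBool (a ∷ as) (b ∷ bs) = eqBool a b ∧ eqVecBool as bs

eqVecFin : ∀ {m n} → Vec (Fin m) n → Vec (Fin m) n → Bool
eqVecFin []       []       = true
eqVecFin (a ∷ as) (b ∷ bs) = (toℕ a ≡ᵇ toℕ b) ∧ eqVecFin as bs

-- Homogeneous degree-n formal power series in x_0, x_1, x_2, ... over ℤ.
-- A monomial x_{u_0} ... x_{u_{n-1}} of degree n is encoded by the
-- weakly increasing word u : Fin n → ℕ; a series is its coefficient
-- function.  Only the values on weakly increasing words are meaningful.

Word : ℕ → Set
Word n = Fin n → ℕ

Monotone : ∀ {n} → Word n → Set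
Monotone {n} u = ∀ (i j : Fin n) → toℕ i ℕ.≤ toℕ j → u i ℕ.≤ u j

Series : ℕ → Set
Series n = Word n → ℤ

-- series in two alphabets x, y, homogeneous of degree n in each:
-- coefficient of x^u y^v
Series2 : ℕ → Set
Series2 n = Word n → Word n → ℤ

_≈_ : ∀ {n} → Series n → Series n → Set
_≈_ {n} f g = ∀ (u : Word n) → Monotone u → f u ≡ g u

_≈₂_ : ∀ {n} → Series2 n → Series2 n → Set
_≈₂_ {n} f g = ∀ (u v : Word n) → Monotone u → Monotone v → f u v ≡ g u v

infix 4 _≈_ _≈₂_

_⊗_ : ∀ {n} → Series n → Series n → Series2 n
(f ⊗ g) u v = f u ℤ.* g v

sumS2 : ∀ {n} → List (Series n × Series n) → Series2 n
sumS2 ts u v = sumℤ (map (λ { (f , g) → (f ⊗ g) u v }) ts)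

-- h ∈ P ⊗ Q : h is a finite sum of products f(x) g(y) with P f, Q g
-- (ℤ-coefficients are absorbed into the f's)
InTensor : ∀ {n} → (Series n → Set) → (Series n → Set) → Series2 n → Set
InTensor {n} P Q h =
  ∃[ ts ] (All (λ fg → P (Σ.proj₁ fg) × Q (Σ.proj₂ fg)) ts × (h ≈₂ sumS2 ts))
  where open Data.Product

-- Exponent sequence (composition) of the monomial encoded by a sorted word

runsFrom : ℕ → ℕ → List ℕ → List ℕ
runsFrom a c []       = c ∷ []
runsFrom a c (y ∷ ys) = if a ≡ᵇ y then runsFrom a (suc c) ys else c ∷ runsFrom y 1 ys

runs : List ℕ → List ℕ
runs []       = []
runs (x ∷ xs) = runsFrom x 1 xs

comp : ∀ {n} → Word n → List ℕ
comp u = runs (Data.List.tabulate u)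

rotateList : ℕ → List ℕ → List ℕ
rotateList k l = drop k l ++ take k l

IsQSym : ∀ {n} → Series n → Set
IsQSym {n} f = ∀ (u u' : Word n) → Monotone u → Monotone u' →
  comp u ≡ comp u' → f u ≡ f u'

IsCQSym : ∀ {n} → Series n → Set
IsCQSym {n} f = ∀ (u u' : Word n) → Monotone u → Monotone u' →
  (k : ℕ) → rotateList k (comp u) ≡ comp u' → f u ≡ f u'

IsSym : ∀ {n} → Series n → Set
IsSym {n} f = ∀ (u u' : Word n) → Monotone u → Monotone u' →
  comp u ↭ comp u' → f u ≡ f u'

-- Subsets.  J ⊆ [n] is a Vec Bool n, bit i (0-based) ↔ element i+1.
-- J ⊆ [n-1] is a Vec Bool (n ∸ 1), bit i ↔ element i+1.

allSubsets : (k : ℕ) → List (Vec Bool k)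
allSubsets k = allVecsOf bools k

rotL : ∀ {A : Set} {n} → Vec A n → Vec A n
rotL []       = []
rotL (x ∷ xs) = xs ∷ʳ x

rotIter : ∀ {A : Set} {n} → ℕ → Vec A n → Vec A n
rotIter zero    v = v
rotIter (suc s) v = rotL (rotIter s v)

InOrbit : ∀ {n} → Vec Bool n → Vec Bool n → Set
InOrbit X B = ∃[ s ] (rotIter s X ≡ B)

inOrbitᵇ : ∀ {n} → Vec Bool n → Vec Bool n → Bool
inOrbitᵇ {n} X B = anyᵇ (λ s → eqVecBool (rotIter s X) B) (upTo n)

d : ∀ {n} → Vec Bool n → ℕ
d {n} J = count (λ s → eqVecBool (rotIter s J) J) (upTo n)

eqBool-refl : ∀ b → eqBool b b ≡ true
eqBool-refl true  = refl
eqBool-refl false = refl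

eqVecBool-refl : ∀ {n} (J : Vec Bool n) → eqVecBool J J ≡ true
eqVecBool-refl []      = refl
eqVecBool-refl (b ∷ J) rewrite eqBool-refl b | eqVecBool-refl J = refl

d-nonZero : ∀ {m} (J : Vec Bool (suc m)) → NonZero (d J)
d-nonZero J rewrite eqVecBool-refl J = _

nonemptyᵇ : ∀ {n} → Vec Bool n → Bool
nonemptyᵇ J = anyᵇ id (toList J)

properᵇ : ∀ {n} → Vec Bool n → Bool
properᵇ J = not (allᵇ id (toList J))

NonemptyProper : ∀ {n} → Vec Bool n → Set
NonemptyProper J = T (nonemptyᵇ J ∧ properᵇ J)

code : ∀ {n} → Vec Bool n → ℕ
code []       = 0
code (b ∷ bs) = (if b then 1 else 0) + 2 * code bs

isRepᵇ : ∀ {n} → Vec Bool n → Bool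
isRepᵇ {n} A = allᵇ (λ s → code A ≤ᵇ code (rotIter s A)) (upTo n)

orbitReps : (n : ℕ) → List (Vec Bool n)
orbitReps n = Data.List.filterᵇ (λ A → nonemptyᵇ A ∧ properᵇ A ∧ isRepᵇ A) (allSubsets n)

F : ∀ {n} → Vec Bool (n ∸ 1) → Series n
F {zero}  J u = + 1
F {suc m} J u =
  if allᵇ (λ i → not (lookup J i) ∨ (u (inject₁ i) <ᵇ u (fsuc i))) (allFin m)
  then + 1 else + 0

h : (n : ℕ) → Series n
h n u = + 1

e : (n : ℕ) → Series n
e zero    u = + 1
e (suc m) u = if allᵇ (λ i → u (inject₁ i) <ᵇ u (fsuc i)) (allFin m) then + 1 else + 0

-- Cyclic fundamental functions F^cyc_{n,J}, J ⊆ [n].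
-- The coefficient of the monomial with sorted word u counts pairs (w,k)
-- with w_k ≤ … ≤ w_n ≤ w_1 ≤ … ≤ w_{k-1} and x_w = x^u; for each k the
-- word w is forced: w_j = u_{j-k mod n} (0-based).  Then the strictness
-- conditions w_j < w_{j+1} for j ∈ J ∖ {k-1} are checked.

FcycCount : ∀ {n} → Vec Bool n → Word n → ℕ
FcycCount {zero}  J u = 0
FcycCount {suc m} J u = count ok (allFin (suc m))
  where
  n = suc m
  nxt : Fin n → Fin n
  nxt j = (suc (toℕ j)) mod n
  ok : Fin n → Bool
  ok k = allᵇ (λ j → not (lookup J j) ∨ (toℕ (nxt j) ≡ᵇ toℕ k) ∨
                    (w j <ᵇ w (nxt j))) (allFin n)
    where
    w : Fin n → ℕ
    w j = u ((toℕ j + (n ∸ toℕ k)) mod n)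

Fcyc : ∀ {n} → Vec Bool n → Series n
Fcyc J u = + FcycCount J u

-- \hat F^cyc_{n,J} = F^cyc_{n,J} / d_J  (exact division)
hatFcyc : ∀ {n} → Vec Bool n → Series n
hatFcyc {zero}  J u = + 0
hatFcyc {suc m} J u = + (ℕ._/_ (FcycCount J u) (d J) {{d-nonZero J}})

IsCQSymMinus : ∀ {n} → Series n → Set
IsCQSymMinus {zero}        f = Σ ℤ λ c → (f ≈ (λ _ → c))
IsCQSymMinus {suc zero}    f = Σ ℤ λ c → (f ≈ (λ u → c ℤ.* e 1 u))
IsCQSymMinus {suc (suc m)} f =
  Σ (Vec Bool (suc (suc m)) → ℤ) λ c → (f ≈ (λ u → sumℤ (map (λ J → c J ℤ.* hatFcyc J u)
                                (Data.List.filterᵇ (λ J → nonemptyᵇ J ∧ properᵇ J)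
                                                   (allSubsets (suc (suc m)))))))

-- Internal coproduct: evaluate f at the lexicographically ordered
-- variables z_{(i,j)} = x_i y_j.  The coefficient of x^u y^v collects the
-- z-monomials z_{p_0} … z_{p_{n-1}} (p lex-sorted) with first coordinates
-- u and second coordinates q a rearrangement of v, sorted inside blocks
-- of equal u.  Such a z-monomial gets the coefficient of f at the word of
-- ranks of p (order-preserving relabelling of the finitely many variables
-- involved; well defined for quasisymmetric f).

ranksFrom : ∀ {k} → ℕ → ℕ × ℕ → Vec (ℕ × ℕ) k → Vec ℕ k
ranksFrom r p []         = []
ranksFrom r (a , b) ((a' , b') ∷ ps) =
  let r' = if (a ≡ᵇ a') ∧ (b ≡ᵇ b') then r else suc r
  in r' ∷ ranksFrom r' (a' , b') ps

ranks : ∀ {k} → Vec (ℕ × ℕ) k → Vec ℕ k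
ranks []       = []
ranks (p ∷ ps) = 0 ∷ ranksFrom 0 p ps

Δ : ∀ {n} → Series n → Series2 n
Δ {n} f u v = sumℤ (map (λ q → f (lookup (ranks (Vec.tabulate (λ i → u i , lookup q i)))))
                        (Data.List.filterᵇ valid (allVecsOf (upTo B) n)))
  where
  B : ℕ
  B = suc (sumℕ (Data.List.tabulate v))
  cnt : Word n → ℕ → ℕ
  cnt w b = count (λ i → w i ≡ᵇ b) (allFin n)
  valid : Vec ℕ n → Bool
  valid q = allᵇ (λ b → cnt (lookup q) b ≡ᵇ cnt v b) (upTo B)
          ∧ allᵇ (λ i → allᵇ (λ j → not ((toℕ i ≤ᵇ toℕ j) ∧ (u i ≡ᵇ u j))
                                  ∨ (lookup q i ≤ᵇ lookup q j)) (allFin n)) (allFin n)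

-- Permutations in one-line notation; σ₂σ₁ = σ₂ ∘ σ₁.

IsPerm : ∀ {n} → Vec (Fin n) n → Set
IsPerm {n} π = ∀ (i j : Fin n) → lookup π i ≡ lookup π j → i ≡ j

isPermᵇ : ∀ {n} → Vec (Fin n) n → Bool
isPermᵇ {n} σ = allᵇ (λ i → allᵇ (λ j → not (toℕ (lookup σ i) ≡ᵇ toℕ (lookup σ j))
                                      ∨ (toℕ i ≡ᵇ toℕ j)) (allFin n)) (allFin n)

perms : (n : ℕ) → List (Vec (Fin n) n)
perms n = Data.List.filterᵇ isPermᵇ (allVecsOf (allFin n) n)

compose : ∀ {n} → Vec (Fin n) n → Vec (Fin n) n → Vec (Fin n) n
compose σ₂ σ₁ = Vec.map (lookup σ₂) σ₁

Des : ∀ {n} → Vec (Fin n) n → Vec Bool (n ∸ 1)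
Des {zero}  σ = []
Des {suc m} σ = Vec.tabulate (λ (i : Fin m) → toℕ (lookup σ (fsuc i)) <ᵇ toℕ (lookup σ (inject₁ i)))

cDes : ∀ {n} → Vec (Fin n) n → Vec Bool n
cDes σ = Vec.zipWith (λ a b → b <ᵇ a) (Vec.map toℕ σ) (Vec.map toℕ (rotL σ))

ãcount : ∀ {n} → Vec (Fin n) n → Vec Bool n → Vec Bool (n ∸ 1) → ℕ
ãcount {n} π A J =
  sumℕ (map (λ σ₁ → count (λ σ₂ → inOrbitᵇ (cDes σ₁) A ∧ eqVecBool (Des σ₂) J
                                   ∧ eqVecFin (compose σ₂ σ₁) π) (perms n)) (perms n))

nonincᵇ : List ℕ → Bool
nonincᵇ []           = true
nonincᵇ (x ∷ [])     = true
nonincᵇ (x ∷ y ∷ ys) = (y ≤ᵇ x) ∧ nonincᵇ (y ∷ ys)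

nondecᵇ : List ℕ → Bool
nondecᵇ []           = true
nondecᵇ (x ∷ [])     = true
nondecᵇ (x ∷ y ∷ ys) = (x ≤ᵇ y) ∧ nondecᵇ (y ∷ ys)

partitions : (n : ℕ) → List (List ℕ)
partitions n =
  Data.List.filterᵇ (λ l → nonincᵇ l ∧ (sumℕ l ≡ᵇ n))
    (concatMap (λ k → map toList (allVecsOf (map suc (upTo n)) k)) (upTo (suc n)))

conj : List ℕ → List ℕ
conj lam = map (λ j → count (λ p → j ≤ᵇ p) lam) (map suc (upTo (foldr _⊔_ 0 lam)))

fillings : ℕ → List ℕ → List (List (List ℕ))
fillings B []       = [] ∷ []
fillings B (r ∷ rs) = concatMap (λ T → map (λ row → toList row ∷ T) (allVecsOf (upTo B) r))
                                (fillings B rs)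

colStrictᵇ : List (List ℕ) → Bool
colStrictᵇ []            = true
colStrictᵇ (r ∷ [])      = true
colStrictᵇ (r ∷ r' ∷ rs) = allᵇ id (zipWith _<ᵇ_ r r') ∧ colStrictᵇ (r' ∷ rs)

schur : ∀ {n} → List ℕ → Series n
schur {n} lam u = + count isSSYT (fillings B lam)
  where
  B : ℕ
  B = suc (sumℕ (Data.List.tabulate u))
  isSSYT : List (List ℕ) → Bool
  isSSYT T = allᵇ nondecᵇ T ∧ colStrictᵇ T
           ∧ allᵇ (λ b → count (λ x → x ≡ᵇ b) (concat T) ≡ᵇ count (λ i → u i ≡ᵇ b) (allFin n))
                 (upTo B)

{-# OPTIONS --safe #-}
module Submission where

-- Evaluating F_{Des π} at the lexicographically ordered products x_i y_j and standardising the word of y-indices gives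
-- Δ F_{Des π} = ∑_{σ₂σ₁ = π} F_{Des σ₁} ⊗ F_{Des σ₂}.  Since F^cyc_{cDes π} = ∑_k F_{Des (π c^k)}, where c is the long
-- cycle, and π c^k = σ₂ (σ₁ c^k), summing over k gives Δ F^cyc_{cDes π} = ∑_{σ₂σ₁ = π} F^cyc_{cDes σ₁} ⊗ F_{Des σ₂}.
-- The value of F̂^cyc_A at the monomial of a cyclic composition A' is the number of subsets of A' in the orbit A, so the
-- F̂^cyc_A are unitriangular; this yields both the independence of ã from π and the divisibility by d_B.
-- The Schur expansions of Δ h and Δ e are the Cauchy identities.  They follow, by stripping the largest letter from
-- tableaux, from the local commutation rules between adding a horizontal strip and removing a horizontal or vertical
-- one, where each row ranges over an interval and the bijection reflects these intervals.

open import Defs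
open import Data.Nat using (ℕ; zero; suc; _+_; _*_; _∸_; _≤_; _<_; z≤n; s≤s; _≤ᵇ_; _<ᵇ_; _≡ᵇ_; _⊔_; _⊓_; pred; _≤?_; _<?_)
import Data.Nat as ℕ
import Data.Nat.Properties as ℕₚ
open import Data.Nat.DivMod using (_mod_; _%_)
import Data.Nat.DivMod as DM
open import Data.Nat.Tactic.RingSolver using (solve-∀)
open import Data.Integer using (ℤ; +_) renaming (_*_ to _*ℤ_; _+_ to _+ℤ_; -_ to -ℤ_; _-_ to _-ℤ_)
import Data.Integer as ℤ
import Data.Integer.Properties as ℤₚ
open import Data.Integer.Tactic.RingSolver using () renaming (solve-∀ to solve-∀ℤ)
open import Data.Fin using (Fin; toℕ; inject₁; fromℕ; fromℕ<) renaming (zero to fzero; suc to fsuc)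
import Data.Fin as Fin
import Data.Fin.Properties as Finₚ
import Data.Fin.Induction as FinInd
open import Data.Bool using (Bool; true; false; _∧_; _∨_; not; if_then_else_; T)
import Data.Bool.Properties as Boolₚ
open import Data.List using (List; []; _∷_; map; concatMap; foldr; length; upTo; allFin; drop; take; _++_; zipWith; concat; filterᵇ)
import Data.List as List
import Data.List.Properties as Listₚ
open import Data.List.Relation.Unary.All using (All; []; _∷_)
import Data.List.Relation.Unary.All as All
import Data.List.Relation.Unary.All.Properties as Allₚ
open import Data.List.Relation.Unary.Any using (here; there)
open import Data.List.Membership.Propositional using (_∈_)
import Data.List.Membership.Propositional.Properties as ∈ₚ
open import Data.List.Relation.Unary.AllPairs using ([]; _∷_)
open import Data.List.Relation.Unary.Unique.Propositional using (Unique)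
import Data.List.Relation.Unary.Unique.Propositional.Properties as Uniqueₚ
open import Data.List.Relation.Binary.Permutation.Propositional using (_↭_)
import Data.List.Relation.Binary.Permutation.Propositional as Perm
import Data.List.Relation.Binary.Permutation.Propositional.Properties as ↭ₚ
open import Data.Vec using (Vec; []; _∷_; _∷ʳ_; lookup; toList; replicate)
import Data.Vec as Vec
import Data.Vec.Properties as Vecₚ
open import Data.Product using (Σ; _×_; _,_; ∃-syntax; proj₁; proj₂)
open import Data.Sum using (_⊎_; inj₁; inj₂)
open import Data.Empty using (⊥; ⊥-elim)
open import Function using (_∘_; id; case_of_)
open import Relation.Nullary using (¬_; Dec; yes; no; does)
open import Relation.Nullary.Decidable using (dec-true; dec-false)
open import Relation.Binary.Definitions using (DecidableEquality; tri<; tri≈; tri>)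
open import Relation.Binary.PropositionalEquality using (_≡_; _≢_; refl; sym; trans; cong; cong₂; subst; subst₂; module ≡-Reasoning)
import Algebra.Properties.CommutativeSemigroup as CSG
open ≡-Reasoning
open CSG ℤₚ.*-commutativeSemigroup using () renaming (x∙yz≈y∙xz to *-swapℤ)
open CSG ℤₚ.+-commutativeSemigroup using () renaming (interchange to +-interchangeℤ)
open import Algebra.Properties.AbelianGroup ℤₚ.+-0-abelianGroup using () renaming (∙-cancelˡ to +-cancelˡℤ)

-- Counting identities are equations between sums in ℤ over ranges chosen generously, with the
-- actual conditions carried as indicator factors; bijections enter through `∑-bij`. Partitions are
-- accordingly lists of a fixed length `M` with parts at most `t`, where a spare empty row keeps
-- every added strip inside the range. The link between Schur functions and Δ is a count of matrices
-- with given margins. The excess `k` of the first row in the local rules becomes one matrix entry,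
-- arbitrary for two horizontal strips and 0 or 1 if one is vertical; the words contributing to Δ h
-- and Δ e are the same matrices read by rows. The inclusion for all of cQSym does not go through
-- the functions F̂^cyc. It is proved on coefficients: rotating the composition of the x-monomial by
-- whole blocks, together with the word of y-indices, permutes the contributions, and the dependence
-- on y is expanded in monomial quasisymmetric functions. Divisions are postponed: expansions are
-- first proved for F^cyc, and both independence of π and divisibility come from solving one
-- triangular system.

variable
  A B : Set

-- Indicators and finite sums

⟦_⟧ : Bool → ℤ
⟦ b ⟧ = if b then + 1 else + 0

∑ : List A → (A → ℤ) → ℤ
∑ xs f = sumℤ (map f xs)

bool-iff : ∀ {a b} → (a ≡ true → b ≡ true) → (b ≡ true → a ≡ true) → a ≡ b
bool-iff {false} {false} f g = refl
bool-iff {false} {true}  f g = g refl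
bool-iff {true}  {false} f g = sym (f refl)
bool-iff {true}  {true}  f g = refl

T⇒≡true : ∀ {b} → T b → b ≡ true
T⇒≡true {true} _ = refl

≡true⇒T : ∀ {b} → b ≡ true → T b
≡true⇒T refl = _

false≢true : false ≡ true → ⊥
false≢true ()

<ᵇ⁺ : ∀ {m n} → m < n → (m <ᵇ n) ≡ true
<ᵇ⁺ p = T⇒≡true (ℕₚ.<⇒<ᵇ p)

<ᵇ⁻ : ∀ {m n} → (m <ᵇ n) ≡ true → m < n
<ᵇ⁻ {m} {n} p = ℕₚ.<ᵇ⇒< m n (≡true⇒T p)

≤ᵇ⁺ : ∀ {m n} → m ≤ n → (m ≤ᵇ n) ≡ true
≤ᵇ⁺ p = T⇒≡true (ℕₚ.≤⇒≤ᵇ p)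

≤ᵇ⁻ : ∀ {m n} → (m ≤ᵇ n) ≡ true → m ≤ n
≤ᵇ⁻ {m} {n} p = ℕₚ.≤ᵇ⇒≤ m n (≡true⇒T p)

≡ᵇ⁺ : ∀ {m n} → m ≡ n → (m ≡ᵇ n) ≡ true
≡ᵇ⁺ {m} {n} p = T⇒≡true (ℕₚ.≡⇒≡ᵇ m n p)

≡ᵇ⁻ : ∀ {m n} → (m ≡ᵇ n) ≡ true → m ≡ n
≡ᵇ⁻ {m} {n} p = ℕₚ.≡ᵇ⇒≡ m n (≡true⇒T p)

≡false : ∀ {b} → ¬ (b ≡ true) → b ≡ false
≡false {false} _ = refl
≡false {true}  p = ⊥-elim (p refl)

∧⁺ : ∀ {a b} → a ≡ true → b ≡ true → a ∧ b ≡ true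
∧⁺ refl refl = refl

∧⁻ : ∀ {a b} → a ∧ b ≡ true → a ≡ true × b ≡ true
∧⁻ {true} {true} _ = refl , refl

⇒ᵇ⁺ : ∀ {a b} → (a ≡ true → b ≡ true) → not a ∨ b ≡ true
⇒ᵇ⁺ {false} f = refl
⇒ᵇ⁺ {true}  f = f refl

⇒ᵇ⁻ : ∀ {a b} → not a ∨ b ≡ true → a ≡ true → b ≡ true
⇒ᵇ⁻ p refl = p

∨⁻ : ∀ {a b} → a ∨ b ≡ true → a ≡ true ⊎ b ≡ true
∨⁻ {true}  _ = inj₁ refl
∨⁻ {false} p = inj₂ p

∨⁺₂ : ∀ {a b} → b ≡ true → a ∨ b ≡ true
∨⁺₂ {true}  _ = refl
∨⁺₂ {false} p = p

allᵇ⁺ : (p : A → Bool) (xs : List A) → (∀ {x} → x ∈ xs → p x ≡ true) → allᵇ p xs ≡ true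
allᵇ⁺ p []       f = refl
allᵇ⁺ p (x ∷ xs) f = ∧⁺ (f (here refl)) (allᵇ⁺ p xs (f ∘ there))

allᵇ⁻ : (p : A → Bool) (xs : List A) → allᵇ p xs ≡ true → ∀ {x} → x ∈ xs → p x ≡ true
allᵇ⁻ p (x ∷ xs) e (here refl) = proj₁ (∧⁻ e)
allᵇ⁻ p (x ∷ xs) e (there i)   = allᵇ⁻ p xs (proj₂ (∧⁻ {p x} e)) i

anyᵇ⁺ : (p : A → Bool) (xs : List A) → ∀ {x} → x ∈ xs → p x ≡ true → anyᵇ p xs ≡ true
anyᵇ⁺ p (x ∷ xs) (here refl) e rewrite e = refl
anyᵇ⁺ p (x ∷ xs) (there i)   e = ∨⁺₂ {p x} (anyᵇ⁺ p xs i e)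

anyᵇ⁻ : (p : A → Bool) (xs : List A) → anyᵇ p xs ≡ true → Σ A λ x → x ∈ xs × p x ≡ true
anyᵇ⁻ p (x ∷ xs) e with ∨⁻ {p x} e
... | inj₁ px = x , here refl , px
... | inj₂ r with anyᵇ⁻ p xs r
...   | y , i , py = y , there i , py

allFinᵇ⁺ : ∀ {n} (p : Fin n → Bool) → (∀ i → p i ≡ true) → allᵇ p (allFin n) ≡ true
allFinᵇ⁺ p f = allᵇ⁺ p (allFin _) (λ _ → f _)

allFinᵇ⁻ : ∀ {n} (p : Fin n → Bool) → allᵇ p (allFin n) ≡ true → ∀ i → p i ≡ true
allFinᵇ⁻ p e i = allᵇ⁻ p (allFin _) e (∈ₚ.∈-allFin i)

⟦∧⟧ : ∀ a b → ⟦ a ∧ b ⟧ ≡ ⟦ a ⟧ *ℤ ⟦ b ⟧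
⟦∧⟧ false b = refl
⟦∧⟧ true  b = sym (ℤₚ.*-identityˡ ⟦ b ⟧)

-- Range conditions are carried as indicator factors. This rule makes such a condition available as
-- a hypothesis while the other factor is rewritten.
guard : ∀ b {x y} → (b ≡ true → x ≡ y) → ⟦ b ⟧ *ℤ x ≡ ⟦ b ⟧ *ℤ y
guard false f = refl
guard true  f = cong (+ 1 *ℤ_) (f refl)

guard-true : ∀ {b} x → b ≡ true → ⟦ b ⟧ *ℤ x ≡ x
guard-true x refl = ℤₚ.*-identityˡ x

guard-false : ∀ {b} x → b ≡ false → ⟦ b ⟧ *ℤ x ≡ + 0
guard-false x refl = refl

guard-∧ : ∀ a b x → ⟦ a ∧ b ⟧ *ℤ x ≡ ⟦ a ⟧ *ℤ (⟦ b ⟧ *ℤ x)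
guard-∧ a b x = trans (cong (_*ℤ x) (⟦∧⟧ a b)) (ℤₚ.*-assoc ⟦ a ⟧ ⟦ b ⟧ x)

∑-cong-∈ : (xs : List A) {f g : A → ℤ} → (∀ {x} → x ∈ xs → f x ≡ g x) → ∑ xs f ≡ ∑ xs g
∑-cong-∈ []       e = refl
∑-cong-∈ (x ∷ xs) e = cong₂ _+ℤ_ (e (here refl)) (∑-cong-∈ xs (e ∘ there))

∑-cong : (xs : List A) {f g : A → ℤ} → (∀ x → f x ≡ g x) → ∑ xs f ≡ ∑ xs g
∑-cong xs e = ∑-cong-∈ xs (λ _ → e _)

∑-++ : (xs ys : List A) (f : A → ℤ) → ∑ (xs ++ ys) f ≡ ∑ xs f +ℤ ∑ ys f
∑-++ []       ys f = sym (ℤₚ.+-identityˡ _)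
∑-++ (x ∷ xs) ys f = trans (cong (f x +ℤ_) (∑-++ xs ys f)) (sym (ℤₚ.+-assoc (f x) _ _))

∑-map : (g : B → A) (xs : List B) (f : A → ℤ) → ∑ (map g xs) f ≡ ∑ xs (f ∘ g)
∑-map g []       f = refl
∑-map g (x ∷ xs) f = cong (f (g x) +ℤ_) (∑-map g xs f)

∑-concatMap : (g : B → List A) (xs : List B) (f : A → ℤ) → ∑ (concatMap g xs) f ≡ ∑ xs (λ x → ∑ (g x) f)
∑-concatMap g []       f = refl
∑-concatMap g (x ∷ xs) f = trans (∑-++ (g x) (concatMap g xs) f) (cong (∑ (g x) f +ℤ_) (∑-concatMap g xs f))

∑-filter : (p : A → Bool) (xs : List A) (f : A → ℤ) → ∑ (filterᵇ p xs) f ≡ ∑ xs (λ x → ⟦ p x ⟧ *ℤ f x)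
∑-filter p []       f = refl
∑-filter p (x ∷ xs) f with p x
... | false = trans (∑-filter p xs f) (sym (ℤₚ.+-identityˡ _))
... | true  = cong₂ _+ℤ_ (sym (ℤₚ.*-identityˡ (f x))) (∑-filter p xs f)

∑-*ˡ : (xs : List A) (c : ℤ) (f : A → ℤ) → c *ℤ ∑ xs f ≡ ∑ xs (λ x → c *ℤ f x)
∑-*ˡ []       c f = ℤₚ.*-zeroʳ c
∑-*ˡ (x ∷ xs) c f = trans (ℤₚ.*-distribˡ-+ c (f x) _) (cong (c *ℤ f x +ℤ_) (∑-*ˡ xs c f))

∑-*ʳ : (xs : List A) (f : A → ℤ) (c : ℤ) → ∑ xs f *ℤ c ≡ ∑ xs (λ x → f x *ℤ c)
∑-*ʳ xs f c = trans (ℤₚ.*-comm (∑ xs f) c) (trans (∑-*ˡ xs c f) (∑-cong xs (λ x → ℤₚ.*-comm c (f x))))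

∑-0 : (xs : List A) → ∑ xs (λ _ → + 0) ≡ + 0
∑-0 []       = refl
∑-0 (x ∷ xs) = trans (ℤₚ.+-identityˡ _) (∑-0 xs)

∑-zero : (xs : List A) {f : A → ℤ} → (∀ {x} → x ∈ xs → f x ≡ + 0) → ∑ xs f ≡ + 0
∑-zero xs e = trans (∑-cong-∈ xs e) (∑-0 xs)

∑-+ : (xs : List A) (f g : A → ℤ) → ∑ xs (λ x → f x +ℤ g x) ≡ ∑ xs f +ℤ ∑ xs g
∑-+ []       f g = refl
∑-+ (x ∷ xs) f g = trans (cong ((f x +ℤ g x) +ℤ_) (∑-+ xs f g)) (+-interchangeℤ (f x) (g x) _ _)

∑-swap : (xs : List A) (ys : List B) (f : A → B → ℤ) → ∑ xs (λ x → ∑ ys (f x)) ≡ ∑ ys (λ y → ∑ xs (λ x → f x y))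
∑-swap []       ys f = sym (∑-0 ys)
∑-swap (x ∷ xs) ys f = trans (cong (∑ ys (f x) +ℤ_) (∑-swap xs ys f)) (sym (∑-+ ys (f x) _))

count≡∑ : (p : A → Bool) (xs : List A) → + count p xs ≡ ∑ xs (λ x → ⟦ p x ⟧)
count≡∑ p []       = refl
count≡∑ p (x ∷ xs) with p x
... | false = trans (count≡∑ p xs) (sym (ℤₚ.+-identityˡ _))
... | true  = cong (+ 1 +ℤ_) (count≡∑ p xs)

sumℕ≡∑ : (f : A → ℕ) (xs : List A) → + sumℕ (map f xs) ≡ ∑ xs (λ x → + f x)
sumℕ≡∑ f []       = refl
sumℕ≡∑ f (x ∷ xs) = cong (+ f x +ℤ_) (sumℕ≡∑ f xs)

∑-allVecs-suc : (xs : List A) (k : ℕ) (f : Vec A (suc k) → ℤ) →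
  ∑ (allVecsOf xs (suc k)) f ≡ ∑ (allVecsOf xs k) (λ v → ∑ xs (λ x → f (x ∷ v)))
∑-allVecs-suc xs k f = trans (∑-concatMap _ (allVecsOf xs k) f) (∑-cong (allVecsOf xs k) (λ v → ∑-map _ xs f))

∑-upTo-last : ∀ n (f : ℕ → ℤ) → ∑ (upTo (suc n)) f ≡ ∑ (upTo n) f +ℤ f n
∑-upTo-last n f = begin
  ∑ (upTo (suc n)) f             ≡⟨ cong (λ l → ∑ l f) (sym (Listₚ.upTo-∷ʳ n)) ⟩
  ∑ (upTo n ++ n ∷ []) f         ≡⟨ ∑-++ (upTo n) (n ∷ []) f ⟩
  ∑ (upTo n) f +ℤ (f n +ℤ + 0)   ≡⟨ cong (∑ (upTo n) f +ℤ_) (ℤₚ.+-identityʳ (f n)) ⟩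
  ∑ (upTo n) f +ℤ f n            ∎

∑-upTo-first : ∀ n (f : ℕ → ℤ) → ∑ (upTo (suc n)) f ≡ f 0 +ℤ ∑ (upTo n) (f ∘ suc)
∑-upTo-first n f = cong (f 0 +ℤ_) (begin
  ∑ (List.applyUpTo suc n) f     ≡⟨ cong (λ l → ∑ l f) (sym (Listₚ.map-upTo suc n)) ⟩
  ∑ (map suc (upTo n)) f         ≡⟨ ∑-map suc (upTo n) f ⟩
  ∑ (upTo n) (f ∘ suc)           ∎)

∑-allFin-first : ∀ n (f : Fin (suc n) → ℤ) → ∑ (allFin (suc n)) f ≡ f fzero +ℤ ∑ (allFin n) (f ∘ fsuc)
∑-allFin-first n f = cong (f fzero +ℤ_) (begin
  ∑ (List.tabulate fsuc) f       ≡⟨ cong (λ l → ∑ l f) (sym (Listₚ.map-tabulate id fsuc)) ⟩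
  ∑ (map fsuc (allFin n)) f      ≡⟨ ∑-map fsuc (allFin n) f ⟩
  ∑ (allFin n) (f ∘ fsuc)        ∎)

∑-allFin : ∀ n (f : ℕ → ℤ) → ∑ (allFin n) (f ∘ toℕ) ≡ ∑ (upTo n) f
∑-allFin zero    f = refl
∑-allFin (suc n) f = begin
  ∑ (allFin (suc n)) (f ∘ toℕ)                ≡⟨ ∑-allFin-first n (f ∘ toℕ) ⟩
  f 0 +ℤ ∑ (allFin n) (λ i → f (suc (toℕ i))) ≡⟨ cong (f 0 +ℤ_) (∑-allFin n (f ∘ suc)) ⟩
  f 0 +ℤ ∑ (upTo n) (f ∘ suc)                 ≡⟨ sym (∑-upTo-first n f) ⟩
  ∑ (upTo (suc n)) f                          ∎

count-cong : (p q : A → Bool) (xs : List A) → (∀ x → p x ≡ q x) → count p xs ≡ count q xs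
count-cong p q []       e = refl
count-cong p q (x ∷ xs) e rewrite e x | count-cong p q xs e = refl

-- x occurs exactly once in xs, in the form in which it is applied

Once : DecidableEquality A → List A → A → Set
Once _≟_ xs x = ∀ (f : _ → ℤ) → ∑ xs (λ y → ⟦ does (y ≟ x) ⟧ *ℤ f y) ≡ f x

does-true : {P : Set} (P? : Dec P) → does P? ≡ true → P
does-true (yes p) _ = p

Unique⇒Once : (_≟_ : DecidableEquality A) (xs : List A) → Unique xs → ∀ {x} → x ∈ xs → Once _≟_ xs x
Unique⇒Once _≟_ (x ∷ xs) (x∉ ∷ u) (here refl) f = begin
  ⟦ does (x ≟ x) ⟧ *ℤ f x +ℤ _  ≡⟨ cong₂ _+ℤ_ (guard-true (f x) (dec-true (x ≟ x) refl))
                                      (∑-zero xs (λ {y} y∈ → guard-false (f y) (dec-false (y ≟ x) (λ y≡x → All.lookup x∉ y∈ (sym y≡x))))) ⟩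
  f x +ℤ + 0                    ≡⟨ ℤₚ.+-identityʳ (f x) ⟩
  f x                           ∎
Unique⇒Once _≟_ (x ∷ xs) (x∉ ∷ u) {y} (there y∈) f = begin
  ⟦ does (x ≟ y) ⟧ *ℤ f x +ℤ _  ≡⟨ cong₂ _+ℤ_ (guard-false (f x) (dec-false (x ≟ y) (All.lookup x∉ y∈)))
                                      (Unique⇒Once _≟_ xs u y∈ f) ⟩
  + 0 +ℤ f y                    ≡⟨ ℤₚ.+-identityˡ (f y) ⟩
  f y                           ∎

Once-upTo : ∀ {n i} → i < n → Once ℕₚ._≟_ (upTo n) i
Once-upTo {n} i<n = Unique⇒Once ℕₚ._≟_ (upTo n) (Uniqueₚ.upTo⁺ n) (∈ₚ.∈-upTo⁺ i<n)

Once-allFin : ∀ {n} (i : Fin n) → Once Finₚ._≟_ (allFin n) i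
Once-allFin {n} i = Unique⇒Once Finₚ._≟_ (allFin n) (Uniqueₚ.allFin⁺ n) (∈ₚ.∈-allFin i)

Once-bools : ∀ b → Once Boolₚ._≟_ bools b
Once-bools true  f = trans (ℤₚ.+-identityʳ _) (ℤₚ.*-identityˡ (f true))
Once-bools false f = trans (ℤₚ.+-identityˡ _) (trans (ℤₚ.+-identityʳ _) (ℤₚ.*-identityˡ (f false)))

∷-δ : (_≟_ : DecidableEquality A) {k : ℕ} (_≟ᵥ_ : DecidableEquality (Vec A (suc k))) (_≟ᵥ'_ : DecidableEquality (Vec A k))
  (x y : A) (v w : Vec A k) → does ((x ∷ v) ≟ᵥ (y ∷ w)) ≡ does (x ≟ y) ∧ does (v ≟ᵥ' w)
∷-δ _≟_ _≟ᵥ_ _≟ᵥ'_ x y v w = bool-iff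
  (λ e → case does-true ((x ∷ v) ≟ᵥ (y ∷ w)) e of λ where
    refl → ∧⁺ (dec-true (x ≟ y) refl) (dec-true (v ≟ᵥ' w) refl))
  (λ e → dec-true ((x ∷ v) ≟ᵥ (y ∷ w))
    (cong₂ _∷_ (does-true (x ≟ y) (proj₁ (∧⁻ e))) (does-true (v ≟ᵥ' w) (proj₂ (∧⁻ {does (x ≟ y)} e)))))

-- The equality test on vectors is a parameter: the induction replaces it by `Vecₚ.≡-dec` on the
-- tail, and `∷-δ` shows that only its truth value enters.
Once-allVecs : (_≟_ : DecidableEquality A) (xs : List A) {k : ℕ} (_≟ᵥ_ : DecidableEquality (Vec A k))
  (v : Vec A k) → (∀ i → Once _≟_ xs (lookup v i)) → Once _≟ᵥ_ (allVecsOf xs k) v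
Once-allVecs _≟_ xs {zero}  _≟ᵥ_ [] o f = trans (ℤₚ.+-identityʳ _) (guard-true (f []) (dec-true ([] ≟ᵥ []) refl))
Once-allVecs _≟_ xs {suc k} _≟ᵥ_ (x ∷ v) o f = begin
  ∑ (allVecsOf xs (suc k)) (λ w → ⟦ does (w ≟ᵥ (x ∷ v)) ⟧ *ℤ f w)
    ≡⟨ ∑-allVecs-suc xs k _ ⟩
  ∑ (allVecsOf xs k) (λ w → ∑ xs (λ y → ⟦ does ((y ∷ w) ≟ᵥ (x ∷ v)) ⟧ *ℤ f (y ∷ w)))
    ≡⟨ ∑-cong (allVecsOf xs k) (λ w → begin
      ∑ xs (λ y → ⟦ does ((y ∷ w) ≟ᵥ (x ∷ v)) ⟧ *ℤ f (y ∷ w))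
        ≡⟨ ∑-cong xs (λ y → trans (cong (λ b → ⟦ b ⟧ *ℤ f (y ∷ w)) (∷-δ _≟_ _≟ᵥ_ _≟ᵥ'_ y x w v)) (guard-∧ (does (y ≟ x)) _ _)) ⟩
      ∑ xs (λ y → ⟦ does (y ≟ x) ⟧ *ℤ (⟦ does (w ≟ᵥ' v) ⟧ *ℤ f (y ∷ w)))
        ≡⟨ o fzero (λ y → ⟦ does (w ≟ᵥ' v) ⟧ *ℤ f (y ∷ w)) ⟩
      ⟦ does (w ≟ᵥ' v) ⟧ *ℤ f (x ∷ w) ∎) ⟩
  ∑ (allVecsOf xs k) (λ w → ⟦ does (w ≟ᵥ' v) ⟧ *ℤ f (x ∷ w))
    ≡⟨ Once-allVecs _≟_ xs _≟ᵥ'_ v (o ∘ fsuc) (λ w → f (x ∷ w)) ⟩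
  f (x ∷ v) ∎
  where
  _≟ᵥ'_ : DecidableEquality (Vec _ k)
  _≟ᵥ'_ = Vecₚ.≡-dec _≟_

-- Both sums equal the double sum over the pairs with `y ≡ φ x`, equivalently `x ≡ ψ y`; `Once`
-- inserts the inner sum on one side and removes it on the other. The maps have to be inverse only
-- where the tests `p` and `q` hold.
∑-bij : (_≟₁_ : DecidableEquality A) (_≟₂_ : DecidableEquality B) (xs : List A) (ys : List B)
  (p : A → Bool) (q : B → Bool) (φ : A → B) (ψ : B → A) →
  (∀ {x} → x ∈ xs → p x ≡ true → q (φ x) ≡ true × ψ (φ x) ≡ x × Once _≟₂_ ys (φ x)) →
  (∀ {y} → y ∈ ys → q y ≡ true → p (ψ y) ≡ true × φ (ψ y) ≡ y × Once _≟₁_ xs (ψ y)) →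
  (w : B → ℤ) → ∑ xs (λ x → ⟦ p x ⟧ *ℤ w (φ x)) ≡ ∑ ys (λ y → ⟦ q y ⟧ *ℤ w y)
∑-bij _≟₁_ _≟₂_ xs ys p q φ ψ to from w = begin
  ∑ xs (λ x → ⟦ p x ⟧ *ℤ w (φ x))
    ≡⟨ ∑-cong-∈ xs (λ {x} x∈ → guard (p x) (λ px → sym (trans
         (proj₂ (proj₂ (to x∈ px)) (λ y → ⟦ q y ⟧ *ℤ w y)) (guard-true _ (proj₁ (to x∈ px)))))) ⟩
  ∑ xs (λ x → ⟦ p x ⟧ *ℤ ∑ ys (λ y → ⟦ does (y ≟₂ φ x) ⟧ *ℤ (⟦ q y ⟧ *ℤ w y)))
    ≡⟨ ∑-cong xs (λ x → ∑-*ˡ ys ⟦ p x ⟧ _) ⟩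
  ∑ xs (λ x → ∑ ys (λ y → ⟦ p x ⟧ *ℤ (⟦ does (y ≟₂ φ x) ⟧ *ℤ (⟦ q y ⟧ *ℤ w y))))
    ≡⟨ ∑-cong-∈ xs (λ {x} x∈ → ∑-cong-∈ ys (λ {y} y∈ → term x y x∈ y∈)) ⟩
  ∑ xs (λ x → ∑ ys (λ y → ⟦ q y ⟧ *ℤ (⟦ does (x ≟₁ ψ y) ⟧ *ℤ (⟦ p x ⟧ *ℤ w y))))
    ≡⟨ ∑-swap xs ys _ ⟩
  ∑ ys (λ y → ∑ xs (λ x → ⟦ q y ⟧ *ℤ (⟦ does (x ≟₁ ψ y) ⟧ *ℤ (⟦ p x ⟧ *ℤ w y))))
    ≡⟨ ∑-cong ys (λ y → sym (∑-*ˡ xs ⟦ q y ⟧ _)) ⟩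
  ∑ ys (λ y → ⟦ q y ⟧ *ℤ ∑ xs (λ x → ⟦ does (x ≟₁ ψ y) ⟧ *ℤ (⟦ p x ⟧ *ℤ w y)))
    ≡⟨ ∑-cong-∈ ys (λ {y} y∈ → guard (q y) (λ qy → trans
         (proj₂ (proj₂ (from y∈ qy)) (λ x → ⟦ p x ⟧ *ℤ w y)) (guard-true _ (proj₁ (from y∈ qy))))) ⟩
  ∑ ys (λ y → ⟦ q y ⟧ *ℤ w y) ∎
  where
  term : ∀ x y → x ∈ xs → y ∈ ys →
    ⟦ p x ⟧ *ℤ (⟦ does (y ≟₂ φ x) ⟧ *ℤ (⟦ q y ⟧ *ℤ w y)) ≡ ⟦ q y ⟧ *ℤ (⟦ does (x ≟₁ ψ y) ⟧ *ℤ (⟦ p x ⟧ *ℤ w y))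
  term x y x∈ y∈ with p x in px | q y in qy
  ... | false | false = refl
  ... | false | true  = sym (trans (ℤₚ.*-identityˡ (⟦ does (x ≟₁ ψ y) ⟧ *ℤ + 0)) (ℤₚ.*-zeroʳ ⟦ does (x ≟₁ ψ y) ⟧))
  ... | true  | false = trans (ℤₚ.*-identityˡ (⟦ does (y ≟₂ φ x) ⟧ *ℤ + 0)) (ℤₚ.*-zeroʳ ⟦ does (y ≟₂ φ x) ⟧)
  ... | true  | true  = cong (λ b → + 1 *ℤ (⟦ b ⟧ *ℤ (+ 1 *ℤ w y))) (bool-iff
    (λ e → dec-true (x ≟₁ ψ y) (trans (sym (proj₁ (proj₂ (to x∈ px)))) (cong ψ (sym (does-true (y ≟₂ φ x) e)))))
    (λ e → dec-true (y ≟₂ φ x) (trans (sym (proj₁ (proj₂ (from y∈ qy)))) (cong φ (sym (does-true (x ≟₁ ψ y) e))))))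

-- Enumerations of lists, and splitting off the last letter of sorted lists

listsOf : List A → ℕ → List (List A)
listsOf xs zero    = [] ∷ []
listsOf xs (suc k) = concatMap (λ v → map (λ x → x ∷ v) xs) (listsOf xs k)

∑-lists-suc : (xs : List A) (k : ℕ) (f : List A → ℤ) →
  ∑ (listsOf xs (suc k)) f ≡ ∑ (listsOf xs k) (λ v → ∑ xs (λ x → f (x ∷ v)))
∑-lists-suc xs k f = trans (∑-concatMap _ (listsOf xs k) f) (∑-cong (listsOf xs k) (λ v → ∑-map _ xs f))

∑-toList : (xs : List A) (k : ℕ) (f : List A → ℤ) → ∑ (allVecsOf xs k) (f ∘ toList) ≡ ∑ (listsOf xs k) f
∑-toList xs zero    f = refl
∑-toList xs (suc k) f = begin
  ∑ (allVecsOf xs (suc k)) (f ∘ toList)                        ≡⟨ ∑-allVecs-suc xs k (f ∘ toList) ⟩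
  ∑ (allVecsOf xs k) (λ v → ∑ xs (λ x → f (x ∷ toList v)))     ≡⟨ ∑-toList xs k (λ v → ∑ xs (λ x → f (x ∷ v))) ⟩
  ∑ (listsOf xs k) (λ v → ∑ xs (λ x → f (x ∷ v)))              ≡⟨ sym (∑-lists-suc xs k f) ⟩
  ∑ (listsOf xs (suc k)) f                                     ∎

∈-listsOf⁻ : (xs : List A) (k : ℕ) {v : List A} → v ∈ listsOf xs k → length v ≡ k × All (_∈ xs) v
∈-listsOf⁻ xs zero    (here refl) = refl , []
∈-listsOf⁻ xs (suc k) {v} v∈ with ∈ₚ.∈-concat⁻′ (map (λ w → map (λ x → x ∷ w) xs) (listsOf xs k)) v∈
... | l , v∈l , l∈ with ∈ₚ.∈-map⁻ (λ w → map (λ x → x ∷ w) xs) l∈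
... | w , w∈ , refl with ∈ₚ.∈-map⁻ (λ x → x ∷ w) v∈l
... | x , x∈ , refl = cong suc (proj₁ (∈-listsOf⁻ xs k w∈)) , x∈ ∷ proj₂ (∈-listsOf⁻ xs k w∈)

_≟ₗ_ : DecidableEquality (List ℕ)
_≟ₗ_ = Listₚ.≡-dec ℕₚ._≟_

Once-lists : (xs : List ℕ) (v : List ℕ) → All (Once ℕₚ._≟_ xs) v → Once _≟ₗ_ (listsOf xs (length v)) v
Once-lists xs [] [] f = trans (ℤₚ.+-identityʳ _) (guard-true {does ([] ≟ₗ [])} (f []) refl)
Once-lists xs (x ∷ v) (ox ∷ o) f = begin
  ∑ (listsOf xs (suc (length v))) (λ w → ⟦ does (w ≟ₗ (x ∷ v)) ⟧ *ℤ f w)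
    ≡⟨ ∑-lists-suc xs (length v) _ ⟩
  ∑ (listsOf xs (length v)) (λ w → ∑ xs (λ y → ⟦ does ((y ∷ w) ≟ₗ (x ∷ v)) ⟧ *ℤ f (y ∷ w)))
    ≡⟨ ∑-cong (listsOf xs (length v)) (λ w → trans
         (∑-cong xs (λ y → trans (cong (λ b → ⟦ b ⟧ *ℤ f (y ∷ w)) (δ y w)) (guard-∧ (does (y ℕₚ.≟ x)) _ _)))
         (ox (λ y → ⟦ does (w ≟ₗ v) ⟧ *ℤ f (y ∷ w)))) ⟩
  ∑ (listsOf xs (length v)) (λ w → ⟦ does (w ≟ₗ v) ⟧ *ℤ f (x ∷ w))
    ≡⟨ Once-lists xs v o (λ w → f (x ∷ w)) ⟩
  f (x ∷ v) ∎
  where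
  δ : ∀ y w → does ((y ∷ w) ≟ₗ (x ∷ v)) ≡ does (y ℕₚ.≟ x) ∧ does (w ≟ₗ v)
  δ y w = bool-iff
    (λ e → case does-true ((y ∷ w) ≟ₗ (x ∷ v)) e of λ where
      refl → ∧⁺ (dec-true (y ℕₚ.≟ y) refl) (dec-true (w ≟ₗ w) refl))
    (λ e → dec-true ((y ∷ w) ≟ₗ (x ∷ v))
      (cong₂ _∷_ (does-true (y ℕₚ.≟ x) (proj₁ (∧⁻ e))) (does-true (w ≟ₗ v) (proj₂ (∧⁻ {does (y ℕₚ.≟ x)} e)))))

headOK : (ℕ → ℕ → Bool) → ℕ → List ℕ → Bool
headOK R x []      = true
headOK R x (y ∷ _) = R x y

sortedᵇ : (ℕ → ℕ → Bool) → List ℕ → Bool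
sortedᵇ R []       = true
sortedᵇ R (x ∷ xs) = headOK R x xs ∧ sortedᵇ R xs

nondec≡sorted : ∀ xs → nondecᵇ xs ≡ sortedᵇ _≤ᵇ_ xs
nondec≡sorted []           = refl
nondec≡sorted (x ∷ [])     = refl
nondec≡sorted (x ∷ y ∷ ys) = cong ((x ≤ᵇ y) ∧_) (nondec≡sorted (y ∷ ys))

_≥ᵇ_ : ℕ → ℕ → Bool
x ≥ᵇ y = y ≤ᵇ x

noninc≡sorted : ∀ xs → nonincᵇ xs ≡ sortedᵇ _≥ᵇ_ xs
noninc≡sorted []           = refl
noninc≡sorted (x ∷ [])     = refl
noninc≡sorted (x ∷ y ∷ ys) = cong ((y ≤ᵇ x) ∧_) (noninc≡sorted (y ∷ ys))

rep : ℕ → ℕ → List ℕ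
rep = List.replicate

-- The part of the sum with exactly `m` letters from `xs`, followed by `a ∸ m` copies of `z`. The
-- power of `z` has its own sortedness factor, since a strict `R` allows `z` at most once.
splitSum : (ℕ → ℕ → Bool) → List ℕ → ℕ → ℕ → (List ℕ → ℤ) → ℕ → ℤ
splitSum R xs z a g m =
  ∑ (listsOf xs m) (λ q → ⟦ sortedᵇ R q ⟧ *ℤ (⟦ sortedᵇ R (rep (a ∸ m) z) ⟧ *ℤ g (q ++ rep (a ∸ m) z)))

-- z is a letter that may only be followed by itself, so a sorted word is a sorted word without z, then a power of z.
split-sorted : (R : ℕ → ℕ → Bool) (xs ys : List ℕ) (z : ℕ) →
  (∀ f → ∑ ys f ≡ ∑ xs f +ℤ f z) → (∀ {x} → x ∈ xs → R x z ≡ true) → (∀ {x} → x ∈ xs → R z x ≡ false) →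
  ∀ a (g : List ℕ → ℤ) →
  ∑ (listsOf ys a) (λ q → ⟦ sortedᵇ R q ⟧ *ℤ g q) ≡ ∑ (upTo (suc a)) (splitSum R xs z a g)
split-sorted R xs ys z ext Rxz Rzx zero g = cong (_+ℤ + 0) (begin
  + 1 *ℤ g []                             ≡⟨ sym (ℤₚ.*-identityˡ _) ⟩
  + 1 *ℤ (+ 1 *ℤ g [])                    ≡⟨ sym (ℤₚ.+-identityʳ _) ⟩
  + 1 *ℤ (+ 1 *ℤ g []) +ℤ + 0             ∎)
split-sorted R xs ys z ext Rxz Rzx (suc a) g = begin
  ∑ (listsOf ys (suc a)) (λ q → ⟦ sortedᵇ R q ⟧ *ℤ g q)
    ≡⟨ ∑-lists-suc ys a _ ⟩
  ∑ (listsOf ys a) (λ q → ∑ ys (λ x → ⟦ headOK R x q ∧ sortedᵇ R q ⟧ *ℤ g (x ∷ q)))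
    ≡⟨ ∑-cong (listsOf ys a) (λ q → pull ys q) ⟩
  ∑ (listsOf ys a) (λ q → ⟦ sortedᵇ R q ⟧ *ℤ g' q)
    ≡⟨ split-sorted R xs ys z ext Rxz Rzx a g' ⟩
  ∑ (upTo (suc a)) (splitSum R xs z a g')
    ≡⟨ ∑-cong (upTo (suc a)) (λ m → term m) ⟩
  ∑ (upTo (suc a)) (λ m → splitSum R xs z (suc a) g (suc m) +ℤ Z m)
    ≡⟨ ∑-+ (upTo (suc a)) (λ m → splitSum R xs z (suc a) g (suc m)) Z ⟩
  ∑ (upTo (suc a)) (λ m → splitSum R xs z (suc a) g (suc m)) +ℤ ∑ (upTo (suc a)) Z
    ≡⟨ cong (∑ (upTo (suc a)) (λ m → splitSum R xs z (suc a) g (suc m)) +ℤ_) (begin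
       ∑ (upTo (suc a)) Z          ≡⟨ ∑-upTo-first a Z ⟩
       Z 0 +ℤ ∑ (upTo a) (Z ∘ suc) ≡⟨ cong₂ _+ℤ_ Z0 (∑-zero (upTo a) (λ {m} _ → Zsuc m)) ⟩
       splitSum R xs z (suc a) g 0 +ℤ + 0 ≡⟨ ℤₚ.+-identityʳ _ ⟩
       splitSum R xs z (suc a) g 0 ∎) ⟩
  ∑ (upTo (suc a)) (λ m → splitSum R xs z (suc a) g (suc m)) +ℤ splitSum R xs z (suc a) g 0
    ≡⟨ ℤₚ.+-comm _ (splitSum R xs z (suc a) g 0) ⟩
  splitSum R xs z (suc a) g 0 +ℤ ∑ (upTo (suc a)) (λ m → splitSum R xs z (suc a) g (suc m))
    ≡⟨ sym (∑-upTo-first (suc a) (splitSum R xs z (suc a) g)) ⟩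
  ∑ (upTo (suc (suc a))) (splitSum R xs z (suc a) g) ∎
  where
  g' : List ℕ → ℤ
  g' q = ∑ ys (λ x → ⟦ headOK R x q ⟧ *ℤ g (x ∷ q))
  pull : ∀ ws q → ∑ ws (λ x → ⟦ headOK R x q ∧ sortedᵇ R q ⟧ *ℤ g (x ∷ q)) ≡
    ⟦ sortedᵇ R q ⟧ *ℤ ∑ ws (λ x → ⟦ headOK R x q ⟧ *ℤ g (x ∷ q))
  pull ws q = trans
    (∑-cong ws (λ x → trans (guard-∧ (headOK R x q) (sortedᵇ R q) _) (*-swapℤ ⟦ headOK R x q ⟧ ⟦ sortedᵇ R q ⟧ _)))
    (sym (∑-*ˡ ws ⟦ sortedᵇ R q ⟧ _))
  tail : ℕ → List ℕ
  tail m = rep (a ∸ m) z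
  c : ℕ → ℤ
  c m = ⟦ sortedᵇ R (tail m) ⟧
  -- The words whose new first letter is `z`. For `m` = 0 they supply the term without letters from
  -- `xs`; for `m` > 0 they vanish, because `z` cannot precede a letter of `xs`.
  Z : ℕ → ℤ
  Z m = ∑ (listsOf xs m) (λ q → ⟦ sortedᵇ R q ⟧ *ℤ (c m *ℤ (⟦ headOK R z (q ++ tail m) ⟧ *ℤ g (z ∷ q ++ tail m))))
  headOK-++ : ∀ {x} j q → x ∈ xs → headOK R x (q ++ rep j z) ≡ headOK R x q
  headOK-++ zero    []      x∈ = refl
  headOK-++ (suc j) []      x∈ = Rxz x∈
  headOK-++ j       (y ∷ q) x∈ = refl
  term : ∀ m → splitSum R xs z a g' m ≡ splitSum R xs z (suc a) g (suc m) +ℤ Z m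
  term m = begin
    ∑ (listsOf xs m) (λ q → ⟦ sortedᵇ R q ⟧ *ℤ (c m *ℤ g' (q ++ tail m)))
      ≡⟨ ∑-cong (listsOf xs m) (λ q → begin
        ⟦ sortedᵇ R q ⟧ *ℤ (c m *ℤ g' (q ++ tail m))
          ≡⟨ cong (λ e → ⟦ sortedᵇ R q ⟧ *ℤ (c m *ℤ e)) (ext _) ⟩
        ⟦ sortedᵇ R q ⟧ *ℤ (c m *ℤ (∑ xs (λ x → ⟦ headOK R x (q ++ tail m) ⟧ *ℤ g (x ∷ q ++ tail m)) +ℤ
                                     ⟦ headOK R z (q ++ tail m) ⟧ *ℤ g (z ∷ q ++ tail m)))
          ≡⟨ cong (⟦ sortedᵇ R q ⟧ *ℤ_) (ℤₚ.*-distribˡ-+ (c m) _ _) ⟩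
        ⟦ sortedᵇ R q ⟧ *ℤ (c m *ℤ (∑ xs (λ x → ⟦ headOK R x (q ++ tail m) ⟧ *ℤ g (x ∷ q ++ tail m))) +ℤ
                                     c m *ℤ (⟦ headOK R z (q ++ tail m) ⟧ *ℤ g (z ∷ q ++ tail m)))
          ≡⟨ ℤₚ.*-distribˡ-+ ⟦ sortedᵇ R q ⟧ _ _ ⟩
        ⟦ sortedᵇ R q ⟧ *ℤ (c m *ℤ ∑ xs (λ x → ⟦ headOK R x (q ++ tail m) ⟧ *ℤ g (x ∷ q ++ tail m))) +ℤ
        ⟦ sortedᵇ R q ⟧ *ℤ (c m *ℤ (⟦ headOK R z (q ++ tail m) ⟧ *ℤ g (z ∷ q ++ tail m)))
          ≡⟨ cong (_+ℤ ⟦ sortedᵇ R q ⟧ *ℤ (c m *ℤ (⟦ headOK R z (q ++ tail m) ⟧ *ℤ g (z ∷ q ++ tail m)))) (row q) ⟩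
        ∑ xs (λ x → ⟦ sortedᵇ R (x ∷ q) ⟧ *ℤ (c m *ℤ g (x ∷ q ++ tail m))) +ℤ
        ⟦ sortedᵇ R q ⟧ *ℤ (c m *ℤ (⟦ headOK R z (q ++ tail m) ⟧ *ℤ g (z ∷ q ++ tail m))) ∎) ⟩
    ∑ (listsOf xs m) (λ q → ∑ xs (λ x → ⟦ sortedᵇ R (x ∷ q) ⟧ *ℤ (c m *ℤ g (x ∷ q ++ tail m))) +ℤ
        ⟦ sortedᵇ R q ⟧ *ℤ (c m *ℤ (⟦ headOK R z (q ++ tail m) ⟧ *ℤ g (z ∷ q ++ tail m))))
      ≡⟨ ∑-+ (listsOf xs m) _ _ ⟩
    ∑ (listsOf xs m) (λ q → ∑ xs (λ x → ⟦ sortedᵇ R (x ∷ q) ⟧ *ℤ (c m *ℤ g (x ∷ q ++ tail m)))) +ℤ Z m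
      ≡⟨ cong (_+ℤ Z m) (sym (∑-lists-suc xs m _)) ⟩
    splitSum R xs z (suc a) g (suc m) +ℤ Z m ∎
    where
    row : ∀ q → ⟦ sortedᵇ R q ⟧ *ℤ (c m *ℤ ∑ xs (λ x → ⟦ headOK R x (q ++ tail m) ⟧ *ℤ g (x ∷ q ++ tail m))) ≡
      ∑ xs (λ x → ⟦ sortedᵇ R (x ∷ q) ⟧ *ℤ (c m *ℤ g (x ∷ q ++ tail m)))
    row q = begin
      ⟦ sortedᵇ R q ⟧ *ℤ (c m *ℤ ∑ xs (λ x → ⟦ headOK R x (q ++ tail m) ⟧ *ℤ g (x ∷ q ++ tail m)))
        ≡⟨ cong (⟦ sortedᵇ R q ⟧ *ℤ_) (∑-*ˡ xs (c m) _) ⟩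
      ⟦ sortedᵇ R q ⟧ *ℤ ∑ xs (λ x → c m *ℤ (⟦ headOK R x (q ++ tail m) ⟧ *ℤ g (x ∷ q ++ tail m)))
        ≡⟨ ∑-*ˡ xs ⟦ sortedᵇ R q ⟧ _ ⟩
      ∑ xs (λ x → ⟦ sortedᵇ R q ⟧ *ℤ (c m *ℤ (⟦ headOK R x (q ++ tail m) ⟧ *ℤ g (x ∷ q ++ tail m))))
        ≡⟨ ∑-cong-∈ xs (λ {x} x∈ → begin
          ⟦ sortedᵇ R q ⟧ *ℤ (c m *ℤ (⟦ headOK R x (q ++ tail m) ⟧ *ℤ g (x ∷ q ++ tail m)))
            ≡⟨ cong (⟦ sortedᵇ R q ⟧ *ℤ_) (*-swapℤ (c m) ⟦ headOK R x (q ++ tail m) ⟧ _) ⟩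
          ⟦ sortedᵇ R q ⟧ *ℤ (⟦ headOK R x (q ++ tail m) ⟧ *ℤ (c m *ℤ g (x ∷ q ++ tail m)))
            ≡⟨ *-swapℤ ⟦ sortedᵇ R q ⟧ ⟦ headOK R x (q ++ tail m) ⟧ _ ⟩
          ⟦ headOK R x (q ++ tail m) ⟧ *ℤ (⟦ sortedᵇ R q ⟧ *ℤ (c m *ℤ g (x ∷ q ++ tail m)))
            ≡⟨ cong (λ b → ⟦ b ⟧ *ℤ (⟦ sortedᵇ R q ⟧ *ℤ (c m *ℤ g (x ∷ q ++ tail m)))) (headOK-++ (a ∸ m) q x∈) ⟩
          ⟦ headOK R x q ⟧ *ℤ (⟦ sortedᵇ R q ⟧ *ℤ (c m *ℤ g (x ∷ q ++ tail m)))
            ≡⟨ sym (guard-∧ (headOK R x q) (sortedᵇ R q) _) ⟩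
          ⟦ sortedᵇ R (x ∷ q) ⟧ *ℤ (c m *ℤ g (x ∷ q ++ tail m)) ∎) ⟩
      ∑ xs (λ x → ⟦ sortedᵇ R (x ∷ q) ⟧ *ℤ (c m *ℤ g (x ∷ q ++ tail m))) ∎
  Z0 : Z 0 ≡ splitSum R xs z (suc a) g 0
  Z0 = cong (λ e → + 1 *ℤ e +ℤ + 0) (begin
    ⟦ sortedᵇ R (rep a z) ⟧ *ℤ (⟦ headOK R z (rep a z) ⟧ *ℤ g (z ∷ rep a z))
      ≡⟨ *-swapℤ ⟦ sortedᵇ R (rep a z) ⟧ ⟦ headOK R z (rep a z) ⟧ _ ⟩
    ⟦ headOK R z (rep a z) ⟧ *ℤ (⟦ sortedᵇ R (rep a z) ⟧ *ℤ g (z ∷ rep a z))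
      ≡⟨ sym (guard-∧ (headOK R z (rep a z)) _ _) ⟩
    ⟦ headOK R z (rep a z) ∧ sortedᵇ R (rep a z) ⟧ *ℤ g (z ∷ rep a z) ∎)
  Zsuc : ∀ m → Z (suc m) ≡ + 0
  Zsuc m = trans (∑-lists-suc xs m _) (∑-zero (listsOf xs m) (λ {q} _ → ∑-zero xs (λ {x} x∈ →
    trans (cong (λ b → ⟦ sortedᵇ R (x ∷ q) ⟧ *ℤ (c (suc m) *ℤ (⟦ b ⟧ *ℤ g (z ∷ x ∷ q ++ tail (suc m))))) (Rzx x∈))
      (trans (cong (⟦ sortedᵇ R (x ∷ q) ⟧ *ℤ_) (ℤₚ.*-zeroʳ (c (suc m)))) (ℤₚ.*-zeroʳ ⟦ sortedᵇ R (x ∷ q) ⟧)))))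

∑-upTo-guard : ∀ a N → a < N → (f : ℕ → ℤ) → ∑ (upTo N) (λ m → ⟦ m ≤ᵇ a ⟧ *ℤ f m) ≡ ∑ (upTo (suc a)) f
∑-upTo-guard a N a<N f = trans
  (∑-bij ℕₚ._≟_ ℕₚ._≟_ (upTo N) (upTo (suc a)) (_≤ᵇ a) (λ _ → true) id id
    (λ _ m≤a → refl , refl , Once-upTo (s≤s (≤ᵇ⁻ m≤a)))
    (λ m∈ _ → ≤ᵇ⁺ (ℕₚ.≤-pred (∈ₚ.∈-upTo⁻ m∈)) , refl , Once-upTo (ℕₚ.<-≤-trans (∈ₚ.∈-upTo⁻ m∈) a<N))
    f)
  (∑-cong (upTo (suc a)) (λ m → ℤₚ.*-identityˡ (f m)))

-- Horizontal and vertical strips, and their local commutation rules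

shift-interval : ∀ lo hi N → hi < N → (w : ℕ → ℤ) →
  ∑ (upTo N) (λ x → ⟦ (lo ≤ᵇ x) ∧ (x ≤ᵇ hi) ⟧ *ℤ w x) ≡ ∑ (upTo N) (λ k → ⟦ k + lo ≤ᵇ hi ⟧ *ℤ w (k + lo))
shift-interval lo hi N hi<N w = sym (∑-bij ℕₚ._≟_ ℕₚ._≟_ (upTo N) (upTo N) (λ k → k + lo ≤ᵇ hi)
  (λ x → (lo ≤ᵇ x) ∧ (x ≤ᵇ hi)) (_+ lo) (_∸ lo)
  (λ {k} _ e → ∧⁺ (≤ᵇ⁺ (ℕₚ.m≤n+m lo k)) e , ℕₚ.m+n∸n≡m k lo , Once-upTo (ℕₚ.≤-<-trans (≤ᵇ⁻ {k + lo} e) hi<N))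
  (λ {x} x∈ e → let lo≤x = ≤ᵇ⁻ {lo} (proj₁ (∧⁻ {lo ≤ᵇ x} e)) in
     subst (λ y → (y ≤ᵇ hi) ≡ true) (sym (ℕₚ.m∸n+n≡m lo≤x)) (proj₂ (∧⁻ {lo ≤ᵇ x} e)) ,
     ℕₚ.m∸n+n≡m lo≤x , Once-upTo (ℕₚ.≤-<-trans (ℕₚ.m∸n≤m x lo) (∈ₚ.∈-upTo⁻ x∈)))
  w)

-- `shift-interval` measures a point of [lo, hi] by its distance from the lower end, this lemma by
-- its distance from the upper end; together they realise the reflection of the interval.
reflect-interval : ∀ lo hi N → hi < N → (w : ℕ → ℤ) →
  ∑ (upTo N) (λ y → ⟦ (lo ≤ᵇ y) ∧ (y ≤ᵇ hi) ⟧ *ℤ w (hi ∸ y)) ≡ ∑ (upTo N) (λ k → ⟦ k + lo ≤ᵇ hi ⟧ *ℤ w k)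
reflect-interval lo hi N hi<N w = ∑-bij ℕₚ._≟_ ℕₚ._≟_ (upTo N) (upTo N) (λ y → (lo ≤ᵇ y) ∧ (y ≤ᵇ hi))
  (λ k → k + lo ≤ᵇ hi) (hi ∸_) (hi ∸_)
  (λ {y} y∈ e → let lo≤y = ≤ᵇ⁻ {lo} (proj₁ (∧⁻ {lo ≤ᵇ y} e)); y≤hi = ≤ᵇ⁻ {y} (proj₂ (∧⁻ {lo ≤ᵇ y} e)) in
     ≤ᵇ⁺ (ℕₚ.≤-trans (ℕₚ.+-monoʳ-≤ (hi ∸ y) lo≤y) (ℕₚ.≤-reflexive (ℕₚ.m∸n+n≡m y≤hi))) ,
     ℕₚ.m∸[m∸n]≡n y≤hi , Once-upTo (ℕₚ.≤-<-trans (ℕₚ.m∸n≤m hi y) hi<N))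
  (λ {k} k∈ e → let k+lo≤hi = ≤ᵇ⁻ {k + lo} e; k≤hi = ℕₚ.≤-trans (ℕₚ.m≤m+n k lo) k+lo≤hi in
     ∧⁺ (≤ᵇ⁺ (ℕₚ.≤-trans (ℕₚ.≤-reflexive (sym (ℕₚ.m+n∸m≡n k lo))) (ℕₚ.∸-monoˡ-≤ k k+lo≤hi))) (≤ᵇ⁺ (ℕₚ.m∸n≤m hi k)) ,
     ℕₚ.m∸[m∸n]≡n k≤hi , Once-upTo (ℕₚ.≤-<-trans (ℕₚ.m∸n≤m hi k) hi<N))
  w

hd : List ℕ → ℕ
hd []      = 0
hd (x ∷ _) = x

hd+drop : ∀ λs → hd λs + sumℕ (drop 1 λs) ≡ sumℕ λs
hd+drop []      = refl
hd+drop (x ∷ l) = refl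

-- `lastOr t μ ≡ 0` says that the last row of μ is empty, so that adding a horizontal strip needs no
-- row beyond the fixed length. The default `t` is the row above μ, which makes the condition pass
-- to the tail unchanged.
lastOr : ℕ → List ℕ → ℕ
lastOr t []       = t
lastOr t (x ∷ xs) = lastOr x xs

-- The interlacing t ≥ l₁ ≥ μ₁ ≥ l₂ ≥ μ₂ ≥ ..., that is, l/μ is a horizontal strip whose first row
-- is at most t. The running bound is the preceding part of μ, which makes the chain a structural
-- recursion.
hsT : ℕ → List ℕ → List ℕ → Bool
hsT t []       []       = true
hsT t (x ∷ xs) (y ∷ ys) = (y ≤ᵇ x) ∧ ((x ≤ᵇ t) ∧ hsT y xs ys)
hsT t _        _        = false

vsᵇ : List ℕ → List ℕ → Bool
vsᵇ []       []       = true
vsᵇ (x ∷ xs) (y ∷ ys) = (y ≤ᵇ x) ∧ ((x ≤ᵇ suc y) ∧ vsᵇ xs ys)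
vsᵇ _        _        = false

ninc : ℕ → List ℕ → Bool
ninc t []       = true
ninc t (x ∷ xs) = (x ≤ᵇ t) ∧ ninc x xs

hsT⁻ : ∀ t x y xs ys → hsT t (x ∷ xs) (y ∷ ys) ≡ true → y ≤ x × x ≤ t × hsT y xs ys ≡ true
hsT⁻ t x y xs ys e with ∧⁻ {y ≤ᵇ x} e
... | y≤x , r with ∧⁻ {x ≤ᵇ t} r
...   | x≤t , h = ≤ᵇ⁻ {y} y≤x , ≤ᵇ⁻ {x} x≤t , h

vs⁻ : ∀ x y xs ys → vsᵇ (x ∷ xs) (y ∷ ys) ≡ true → y ≤ x × x ≤ suc y × vsᵇ xs ys ≡ true
vs⁻ x y xs ys e with ∧⁻ {y ≤ᵇ x} e
... | y≤x , r with ∧⁻ {x ≤ᵇ suc y} r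
...   | x≤y , h = ≤ᵇ⁻ {y} y≤x , ≤ᵇ⁻ {x} x≤y , h

ninc⁻ : ∀ t x xs → ninc t (x ∷ xs) ≡ true → x ≤ t × ninc x xs ≡ true
ninc⁻ t x xs e with ∧⁻ {x ≤ᵇ t} e
... | a , b = ≤ᵇ⁻ {x} a , b

hsT-sum : ∀ t l μ → hsT t l μ ≡ true → sumℕ μ ≤ sumℕ l
hsT-sum t []       []       e = z≤n
hsT-sum t (x ∷ xs) (y ∷ ys) e with hsT⁻ t x y xs ys e
... | y≤x , _ , h = ℕₚ.+-mono-≤ y≤x (hsT-sum y xs ys h)

vs-sum : ∀ l μ → vsᵇ l μ ≡ true → sumℕ μ ≤ sumℕ l
vs-sum []       []       e = z≤n
vs-sum (x ∷ xs) (y ∷ ys) e with vs⁻ x y xs ys e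
... | y≤x , _ , h = ℕₚ.+-mono-≤ y≤x (vs-sum xs ys h)

-- The running bound concerns the first part only, so it may be loosened from `y` to `m` if that
-- part is tested against `y` separately. In the row inductions this detaches the tail from the row
-- just chosen.
hsT-top : ∀ {y m} → y ≤ m → ∀ μ κ → hsT y μ κ ≡ (hd μ ≤ᵇ y) ∧ hsT m μ κ
hsT-top y≤m []      []      = refl
hsT-top y≤m []      (_ ∷ _) = refl
hsT-top {y} y≤m (x ∷ μ) []      = sym (Boolₚ.∧-zeroʳ (x ≤ᵇ y))
hsT-top {y} {m} y≤m (x ∷ μ) (z ∷ κ) = bool-iff
  (λ e → let (a , b , c) = hsT⁻ y x z μ κ e in ∧⁺ (≤ᵇ⁺ b) (∧⁺ (≤ᵇ⁺ a) (∧⁺ (≤ᵇ⁺ (ℕₚ.≤-trans b y≤m)) c)))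
  (λ e → let (a , r) = ∧⁻ {x ≤ᵇ y} e ; (b , _ , c) = hsT⁻ m x z μ κ r in ∧⁺ (≤ᵇ⁺ b) (∧⁺ a c))

hd≤sum : ∀ μ → hd μ ≤ sumℕ μ
hd≤sum []      = z≤n
hd≤sum (x ∷ μ) = ℕₚ.m≤m+n x (sumℕ μ)

∸-interchange : ∀ a b c d → c ≤ a → d ≤ b → (a + b) ∸ (c + d) ≡ (a ∸ c) + (b ∸ d)
∸-interchange a b c d c≤a d≤b = begin
  (a + b) ∸ (c + d)      ≡⟨ sym (ℕₚ.∸-+-assoc (a + b) c d) ⟩
  (a + b) ∸ c ∸ d        ≡⟨ cong (_∸ d) (ℕₚ.+-∸-comm b c≤a) ⟩
  ((a ∸ c) + b) ∸ d      ≡⟨ ℕₚ.+-∸-assoc (a ∸ c) d≤b ⟩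
  (a ∸ c) + (b ∸ d)      ∎

⊔+⊓ : ∀ m n → (m ⊔ n) + (m ⊓ n) ≡ m + n
⊔+⊓ m n with ℕₚ.≤-total m n
... | inj₁ m≤n rewrite ℕₚ.m≤n⇒m⊔n≡n m≤n | ℕₚ.m≤n⇒m⊓n≡m m≤n = ℕₚ.+-comm n m
... | inj₂ n≤m rewrite ℕₚ.m≥n⇒m⊔n≡m n≤m | ℕₚ.m≥n⇒m⊓n≡n n≤m = refl

weight-step : ∀ k m n y s r c → y ≤ m + n → c ≤ s + r →
  k + (((m + s) + (n + r)) ∸ (y + c)) ≡ (k + ((m + n) ∸ y)) + ((s + r) ∸ c)
weight-step k m n y s r c y≤ c≤ = begin
  k + (((m + s) + (n + r)) ∸ (y + c))    ≡⟨ cong (λ z → k + (z ∸ (y + c))) (lem m s n r) ⟩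
  k + (((m + n) + (s + r)) ∸ (y + c))    ≡⟨ cong (ℕ._+_ k) (∸-interchange (m + n) (s + r) y c y≤ c≤) ⟩
  k + (((m + n) ∸ y) + ((s + r) ∸ c))    ≡⟨ sym (ℕₚ.+-assoc k _ _) ⟩
  (k + ((m + n) ∸ y)) + ((s + r) ∸ c)    ∎
  where
  lem : ∀ m s n r → (m + s) + (n + r) ≡ (m + n) + (s + r)
  lem = solve-∀

-- Strips λ/μ, λ/ν versus strips μ/κ, ν/κ: writing λ₁ = k + (μ₁ ⊔ ν₁) and reflecting each further
-- row of λ in the interval [ μᵢ₊₁ ⊔ νᵢ₊₁ , μᵢ ⊓ νᵢ ] in which both λᵢ₊₁ and κᵢ range.
local-hh : ∀ N t₁ t₂ μ ν → length μ ≡ length ν → t₁ < N → lastOr t₁ μ ≡ 0 → (g : ℕ → ℤ) →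
  ∑ (listsOf (upTo N) (length μ)) (λ l → ⟦ hsT t₁ l μ ∧ hsT t₂ l ν ⟧ *ℤ g (sumℕ l)) ≡
  ∑ (upTo N) (λ k → ⟦ k + (hd μ ⊔ hd ν) ≤ᵇ t₁ ⊓ t₂ ⟧ *ℤ
    ∑ (listsOf (upTo N) (length μ)) (λ κ → ⟦ hsT t₁ μ κ ∧ hsT t₂ ν κ ⟧ *ℤ g (k + (sumℕ μ + sumℕ ν ∸ sumℕ κ))))
-- Here `lastOr t₁ [] ≡ 0` forces `t₁` to be 0, so only `k` = 0 survives on the right.
local-hh N _ t₂ [] [] _ 0<N refl g = sym (begin
  ∑ (upTo N) (λ k → ⟦ k + 0 ≤ᵇ 0 ⟧ *ℤ (+ 1 *ℤ g (k + 0) +ℤ + 0))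
    ≡⟨ ∑-cong (upTo N) (λ k → cong (λ j → ⟦ j ≤ᵇ 0 ⟧ *ℤ (+ 1 *ℤ g j +ℤ + 0)) (ℕₚ.+-identityʳ k)) ⟩
  ∑ (upTo N) (λ k → ⟦ k ≤ᵇ 0 ⟧ *ℤ (+ 1 *ℤ g k +ℤ + 0))
    ≡⟨ ∑-upTo-guard 0 N 0<N _ ⟩
  (+ 1 *ℤ g 0 +ℤ + 0) +ℤ + 0 ≡⟨ ℤₚ.+-identityʳ _ ⟩
  + 1 *ℤ g 0 +ℤ + 0 ∎)
local-hh N t₁ t₂ (m ∷ μ) (n ∷ ν) len t₁<N last≡0 g = begin
  ∑ (listsOf U (suc L)) (λ l → ⟦ hsT t₁ l (m ∷ μ) ∧ hsT t₂ l (n ∷ ν) ⟧ *ℤ g (sumℕ l))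
    ≡⟨ ∑-lists-suc U L _ ⟩
  ∑ P (λ l → ∑ U (λ x → ⟦ hsT t₁ (x ∷ l) (m ∷ μ) ∧ hsT t₂ (x ∷ l) (n ∷ ν) ⟧ *ℤ g (x + sumℕ l)))
    ≡⟨ ∑-swap P U _ ⟩
  ∑ U (λ x → ∑ P (λ l → ⟦ hsT t₁ (x ∷ l) (m ∷ μ) ∧ hsT t₂ (x ∷ l) (n ∷ ν) ⟧ *ℤ g (x + sumℕ l)))
    ≡⟨ ∑-cong-∈ U (λ {x} x∈ → begin
      ∑ P (λ l → ⟦ hsT t₁ (x ∷ l) (m ∷ μ) ∧ hsT t₂ (x ∷ l) (n ∷ ν) ⟧ *ℤ g (x + sumℕ l))
        ≡⟨ ∑-cong P (λ l → trans (cong (λ b → ⟦ b ⟧ *ℤ g (x + sumℕ l)) (bl x l)) (guard-∧ (inL x) _ _)) ⟩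
      ∑ P (λ l → ⟦ inL x ⟧ *ℤ (⟦ hsT m l μ ∧ hsT n l ν ⟧ *ℤ g (x + sumℕ l)))
        ≡⟨ sym (∑-*ˡ P ⟦ inL x ⟧ _) ⟩
      ⟦ inL x ⟧ *ℤ ∑ P (λ l → ⟦ hsT m l μ ∧ hsT n l ν ⟧ *ℤ g (x + sumℕ l))
        ≡⟨ guard (inL x) (λ e → local-hh N m n μ ν (ℕₚ.suc-injective len)
             (ℕₚ.≤-<-trans (ℕₚ.≤-trans (ℕₚ.m≤m⊔n m n) (≤ᵇ⁻ {m ⊔ n} (proj₁ (∧⁻ {m ⊔ n ≤ᵇ x} e)))) (∈ₚ.∈-upTo⁻ x∈)) last≡0 (λ j → g (x + j))) ⟩
      ⟦ inL x ⟧ *ℤ ∑ U (λ k → ⟦ k + lo' ≤ᵇ hi' ⟧ *ℤ ∑ P (λ κ → ⟦ hsT m μ κ ∧ hsT n ν κ ⟧ *ℤ g (x + (k + (sumℕ μ + sumℕ ν ∸ sumℕ κ)))))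
        ≡⟨ cong (⟦ inL x ⟧ *ℤ_) (∑-cong U (λ k → cong (⟦ k + lo' ≤ᵇ hi' ⟧ *ℤ_) (∑-cong P (λ κ →
             cong (λ j → ⟦ hsT m μ κ ∧ hsT n ν κ ⟧ *ℤ g j) (sym (ℕₚ.+-assoc x k _)))))) ⟩
      ⟦ inL x ⟧ *ℤ W x ∎) ⟩
  ∑ U (λ x → ⟦ inL x ⟧ *ℤ W x)
    -- The first row of λ is written as `k + lo`; this `k` is the outer variable of the right-hand
    -- side.
    ≡⟨ shift-interval lo hi N (ℕₚ.≤-<-trans (ℕₚ.m⊓n≤m t₁ t₂) t₁<N) W ⟩
  ∑ U (λ k → ⟦ k + lo ≤ᵇ hi ⟧ *ℤ W (k + lo))
    ≡⟨ ∑-cong U (λ k → guard (k + lo ≤ᵇ hi) (λ e → rhs k (≤ᵇ⁻ {k + lo} e))) ⟩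
  ∑ U (λ k → ⟦ k + lo ≤ᵇ hi ⟧ *ℤ
    ∑ (listsOf U (suc L)) (λ κ → ⟦ hsT t₁ (m ∷ μ) κ ∧ hsT t₂ (n ∷ ν) κ ⟧ *ℤ g (k + (sumℕ (m ∷ μ) + sumℕ (n ∷ ν) ∸ sumℕ κ)))) ∎
  where
  U = upTo N
  L = length μ
  P = listsOf U L
  lo = m ⊔ n
  hi = t₁ ⊓ t₂
  lo' = hd μ ⊔ hd ν
  hi' = m ⊓ n
  inL : ℕ → Bool
  inL x = (lo ≤ᵇ x) ∧ (x ≤ᵇ hi)
  ρ : ℕ → ℤ
  ρ j = ∑ P (λ κ → ⟦ hsT m μ κ ∧ hsT n ν κ ⟧ *ℤ g (j + (sumℕ μ + sumℕ ν ∸ sumℕ κ)))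
  W : ℕ → ℤ
  W x = ∑ U (λ k → ⟦ k + lo' ≤ᵇ hi' ⟧ *ℤ ρ (x + k))
  bl : ∀ x l → hsT t₁ (x ∷ l) (m ∷ μ) ∧ hsT t₂ (x ∷ l) (n ∷ ν) ≡ inL x ∧ (hsT m l μ ∧ hsT n l ν)
  bl x l = bool-iff
    (λ e → let (e₁ , e₂) = ∧⁻ {hsT t₁ (x ∷ l) (m ∷ μ)} e
               (a , b , c) = hsT⁻ t₁ x m l μ e₁
               (a' , b' , c') = hsT⁻ t₂ x n l ν e₂
           in ∧⁺ (∧⁺ (≤ᵇ⁺ (ℕₚ.⊔-lub a a')) (≤ᵇ⁺ (ℕₚ.⊓-glb b b'))) (∧⁺ c c'))
    (λ e → let (e₁ , e₂) = ∧⁻ {inL x} e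
               (p , q) = ∧⁻ {lo ≤ᵇ x} e₁
               (c , c') = ∧⁻ {hsT m l μ} e₂
               p' = ≤ᵇ⁻ {lo} p
               q' = ≤ᵇ⁻ {x} q
           in ∧⁺ (∧⁺ (≤ᵇ⁺ (ℕₚ.m⊔n≤o⇒m≤o m n p')) (∧⁺ (≤ᵇ⁺ (ℕₚ.m≤n⊓o⇒m≤n t₁ t₂ q')) c))
                 (∧⁺ (≤ᵇ⁺ (ℕₚ.m⊔n≤o⇒n≤o m n p')) (∧⁺ (≤ᵇ⁺ (ℕₚ.m≤n⊓o⇒m≤o t₁ t₂ q')) c')))
  rhs : ∀ k → k + lo ≤ hi → W (k + lo) ≡
    ∑ (listsOf U (suc L)) (λ κ → ⟦ hsT t₁ (m ∷ μ) κ ∧ hsT t₂ (n ∷ ν) κ ⟧ *ℤ g (k + (sumℕ (m ∷ μ) + sumℕ (n ∷ ν) ∸ sumℕ κ)))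
  rhs k k+lo≤hi = sym (begin
    ∑ (listsOf U (suc L)) (λ κ → ⟦ hsT t₁ (m ∷ μ) κ ∧ hsT t₂ (n ∷ ν) κ ⟧ *ℤ g (k + (sumℕ (m ∷ μ) + sumℕ (n ∷ ν) ∸ sumℕ κ)))
      ≡⟨ ∑-lists-suc U L _ ⟩
    ∑ P (λ κ → ∑ U (λ y → ⟦ hsT t₁ (m ∷ μ) (y ∷ κ) ∧ hsT t₂ (n ∷ ν) (y ∷ κ) ⟧ *ℤ g (k + (sumℕ (m ∷ μ) + sumℕ (n ∷ ν) ∸ (y + sumℕ κ)))))
      ≡⟨ ∑-swap P U _ ⟩
    ∑ U (λ y → ∑ P (λ κ → ⟦ hsT t₁ (m ∷ μ) (y ∷ κ) ∧ hsT t₂ (n ∷ ν) (y ∷ κ) ⟧ *ℤ g (k + (sumℕ (m ∷ μ) + sumℕ (n ∷ ν) ∸ (y + sumℕ κ)))))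
      ≡⟨ ∑-cong U (λ y → trans
           (∑-cong P (λ κ → begin
             ⟦ hsT t₁ (m ∷ μ) (y ∷ κ) ∧ hsT t₂ (n ∷ ν) (y ∷ κ) ⟧ *ℤ g (k + (sumℕ (m ∷ μ) + sumℕ (n ∷ ν) ∸ (y + sumℕ κ)))
               ≡⟨ cong (λ b → ⟦ b ⟧ *ℤ g (k + (sumℕ (m ∷ μ) + sumℕ (n ∷ ν) ∸ (y + sumℕ κ)))) (bl' y κ) ⟩
             ⟦ inR y ∧ (hsT m μ κ ∧ hsT n ν κ) ⟧ *ℤ g (k + (sumℕ (m ∷ μ) + sumℕ (n ∷ ν) ∸ (y + sumℕ κ)))
               ≡⟨ guard-∧ (inR y) _ _ ⟩
             ⟦ inR y ⟧ *ℤ (⟦ hsT m μ κ ∧ hsT n ν κ ⟧ *ℤ g (k + (sumℕ (m ∷ μ) + sumℕ (n ∷ ν) ∸ (y + sumℕ κ))))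
               ≡⟨ guard (inR y) (λ ey → guard (hsT m μ κ ∧ hsT n ν κ) (λ eκ → cong g (wt y κ (≤ᵇ⁻ {y} (proj₂ (∧⁻ {lo' ≤ᵇ y} ey)))
                    (hsT-sum m μ κ (proj₁ (∧⁻ {hsT m μ κ} eκ)))))) ⟩
             ⟦ inR y ⟧ *ℤ (⟦ hsT m μ κ ∧ hsT n ν κ ⟧ *ℤ g (((k + lo) + (hi' ∸ y)) + (sumℕ μ + sumℕ ν ∸ sumℕ κ))) ∎))
           (sym (∑-*ˡ P ⟦ inR y ⟧ _))) ⟩
    ∑ U (λ y → ⟦ inR y ⟧ *ℤ ρ ((k + lo) + (hi' ∸ y)))
      -- The excess of the second row of λ over `lo'`, produced by the induction hypothesis, is
      -- matched with the first row `y` of κ by `y` ↦ `hi' ∸ y`.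
      ≡⟨ reflect-interval lo' hi' N (ℕₚ.≤-<-trans m⊓n≤t₁ t₁<N) (λ j → ρ ((k + lo) + j)) ⟩
    W (k + lo) ∎)
    where
    m≤t₁ : m ≤ t₁
    m≤t₁ = ℕₚ.≤-trans (ℕₚ.m≤m⊔n m n) (ℕₚ.≤-trans (ℕₚ.m≤n+m lo k) (ℕₚ.≤-trans k+lo≤hi (ℕₚ.m⊓n≤m t₁ t₂)))
    n≤t₂ : n ≤ t₂
    n≤t₂ = ℕₚ.≤-trans (ℕₚ.m≤n⊔m m n) (ℕₚ.≤-trans (ℕₚ.m≤n+m lo k) (ℕₚ.≤-trans k+lo≤hi (ℕₚ.m⊓n≤n t₁ t₂)))
    m⊓n≤t₁ : m ⊓ n ≤ t₁
    m⊓n≤t₁ = ℕₚ.≤-trans (ℕₚ.m⊓n≤m m n) m≤t₁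
    inR : ℕ → Bool
    inR y = (lo' ≤ᵇ y) ∧ (y ≤ᵇ hi')
    wt : ∀ y κ → y ≤ hi' → sumℕ κ ≤ sumℕ μ →
      k + (sumℕ (m ∷ μ) + sumℕ (n ∷ ν) ∸ (y + sumℕ κ)) ≡ ((k + lo) + (hi' ∸ y)) + (sumℕ μ + sumℕ ν ∸ sumℕ κ)
    wt y κ y≤ κ≤ = trans
      (weight-step k m n y (sumℕ μ) (sumℕ ν) (sumℕ κ) (ℕₚ.≤-trans y≤ (ℕₚ.≤-trans (ℕₚ.m⊓n≤m m n) (ℕₚ.m≤m+n m n)))
        (ℕₚ.≤-trans κ≤ (ℕₚ.m≤m+n _ _)))
      (cong (_+ (sumℕ μ + sumℕ ν ∸ sumℕ κ)) (begin
        k + (m + n ∸ y)        ≡⟨ cong (λ z → k + (z ∸ y)) (sym (⊔+⊓ m n)) ⟩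
        k + (lo + hi' ∸ y)     ≡⟨ cong (ℕ._+_ k) (ℕₚ.+-∸-assoc lo y≤) ⟩
        k + (lo + (hi' ∸ y))   ≡⟨ sym (ℕₚ.+-assoc k lo _) ⟩
        (k + lo) + (hi' ∸ y)   ∎))
    bl' : ∀ y κ → hsT t₁ (m ∷ μ) (y ∷ κ) ∧ hsT t₂ (n ∷ ν) (y ∷ κ) ≡ inR y ∧ (hsT m μ κ ∧ hsT n ν κ)
    bl' y κ = bool-iff
      (λ e → let (e₁ , e₂) = ∧⁻ {hsT t₁ (m ∷ μ) (y ∷ κ)} e
                 (a , _ , c) = hsT⁻ t₁ m y μ κ e₁
                 (a' , _ , c') = hsT⁻ t₂ n y ν κ e₂
                 (q , r) = ∧⁻ {hd μ ≤ᵇ y} (trans (sym (hsT-top a μ κ)) c)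
                 (q' , r') = ∧⁻ {hd ν ≤ᵇ y} (trans (sym (hsT-top a' ν κ)) c')
             in ∧⁺ (∧⁺ (≤ᵇ⁺ (ℕₚ.⊔-lub (≤ᵇ⁻ {hd μ} q) (≤ᵇ⁻ {hd ν} q'))) (≤ᵇ⁺ (ℕₚ.⊓-glb a a'))) (∧⁺ r r'))
      (λ e → let (e₁ , e₂) = ∧⁻ {inR y} e
                 (p , q) = ∧⁻ {lo' ≤ᵇ y} e₁
                 (c , c') = ∧⁻ {hsT m μ κ} e₂
                 p' = ≤ᵇ⁻ {lo'} p
                 q' = ≤ᵇ⁻ {y} q
                 y≤m = ℕₚ.m≤n⊓o⇒m≤n m n q'
                 y≤n = ℕₚ.m≤n⊓o⇒m≤o m n q'
             in ∧⁺ (∧⁺ (≤ᵇ⁺ y≤m) (∧⁺ (≤ᵇ⁺ m≤t₁) (trans (hsT-top y≤m μ κ) (∧⁺ (≤ᵇ⁺ (ℕₚ.m⊔n≤o⇒m≤o (hd μ) (hd ν) p')) c))))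
                   (∧⁺ (≤ᵇ⁺ y≤n) (∧⁺ (≤ᵇ⁺ n≤t₂) (trans (hsT-top y≤n ν κ) (∧⁺ (≤ᵇ⁺ (ℕₚ.m⊔n≤o⇒n≤o (hd μ) (hd ν) p')) c')))))

∑-two : ∀ n N → suc n < N → (f : ℕ → ℤ) →
  ∑ (upTo N) (λ x → ⟦ (n ≤ᵇ x) ∧ (x ≤ᵇ suc n) ⟧ *ℤ f x) ≡ f n +ℤ f (suc n)
∑-two n N n<N f = begin
  ∑ (upTo N) (λ x → ⟦ (n ≤ᵇ x) ∧ (x ≤ᵇ suc n) ⟧ *ℤ f x)
    ≡⟨ shift-interval n (suc n) N n<N f ⟩
  ∑ (upTo N) (λ k → ⟦ k + n ≤ᵇ suc n ⟧ *ℤ f (k + n))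
    ≡⟨ ∑-cong (upTo N) (λ k → cong (λ b → ⟦ b ⟧ *ℤ f (k + n)) (bool-iff
         (λ e → ≤ᵇ⁺ (ℕₚ.+-cancelʳ-≤ n k 1 (≤ᵇ⁻ {k + n} e))) (λ e → ≤ᵇ⁺ (ℕₚ.+-monoˡ-≤ n (≤ᵇ⁻ {k} e))))) ⟩
  ∑ (upTo N) (λ k → ⟦ k ≤ᵇ 1 ⟧ *ℤ f (k + n))
    ≡⟨ ∑-upTo-guard 1 N (ℕₚ.≤-<-trans (s≤s z≤n) n<N) _ ⟩
  f n +ℤ (f (suc n) +ℤ + 0)
    ≡⟨ cong (f n +ℤ_) (ℤₚ.+-identityʳ _) ⟩
  f n +ℤ f (suc n) ∎

≤ᵇ-suc : ∀ a b → (suc a ≤ᵇ suc b) ≡ (a ≤ᵇ b)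
≤ᵇ-suc a b = bool-iff (λ e → ≤ᵇ⁺ (ℕₚ.≤-pred (≤ᵇ⁻ {suc a} {suc b} e))) (λ e → ≤ᵇ⁺ (s≤s (≤ᵇ⁻ {a} {b} e)))

≤-true : ∀ {m n} → m ≤ n → ∀ x → ⟦ m ≤ᵇ n ⟧ *ℤ x ≡ x
≤-true m≤n x = guard-true x (≤ᵇ⁺ m≤n)

≤-false : ∀ {m n} → n < m → ∀ x → ⟦ m ≤ᵇ n ⟧ *ℤ x ≡ + 0
≤-false {m} {n} n<m x = guard-false x (≡false (λ e → ℕₚ.<⇒≱ n<m (≤ᵇ⁻ {m} e)))

-- The contribution of one row to both sides of local-hv.
hv-row : ∀ N t t' m n h (ρ : ℕ → ℤ) → suc t < N → suc t' < N → m ≤ t → n ≤ t' → h ≤ n →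
  ∑ (upTo N) (λ x → ⟦ (n ≤ᵇ x) ∧ (x ≤ᵇ suc n) ⟧ *ℤ (⟦ m ≤ᵇ x ⟧ *ℤ (⟦ x ≤ᵇ t ⟧ *ℤ
    ∑ (upTo 2) (λ k → ⟦ k + h ≤ᵇ m ⟧ *ℤ ρ (x + k))))) ≡
  ∑ (upTo 2) (λ k → ⟦ k + n ≤ᵇ t ⟧ *ℤ
    ∑ (upTo N) (λ y → ⟦ y ≤ᵇ m ⟧ *ℤ (⟦ m ≤ᵇ suc y ⟧ *ℤ (⟦ y ≤ᵇ n ⟧ *ℤ (⟦ h ≤ᵇ y ⟧ *ℤ ρ (k + (m + n ∸ y)))))))
hv-row N t t' m n h ρ t<N t'<N m≤t n≤t' h≤n = trans
  (∑-two n N (ℕₚ.≤-<-trans (s≤s n≤t') t'<N) (λ x → ⟦ m ≤ᵇ x ⟧ *ℤ (⟦ x ≤ᵇ t ⟧ *ℤ W x)))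
  (trans (main m m≤t) (cong (⟦ n ≤ᵇ t ⟧ *ℤ X m 0 +ℤ_) (sym (ℤₚ.+-identityʳ _))))
  where
  W' : ℕ → ℕ → ℤ
  W' m x = ∑ (upTo 2) (λ k → ⟦ k + h ≤ᵇ m ⟧ *ℤ ρ (x + k))
  W = W' m
  X : ℕ → ℕ → ℤ
  X m k = ∑ (upTo N) (λ y → ⟦ y ≤ᵇ m ⟧ *ℤ (⟦ m ≤ᵇ suc y ⟧ *ℤ (⟦ y ≤ᵇ n ⟧ *ℤ (⟦ h ≤ᵇ y ⟧ *ℤ ρ (k + (m + n ∸ y))))))
  W-two : ∀ m x → W' m x ≡ ⟦ h ≤ᵇ m ⟧ *ℤ ρ x +ℤ ⟦ suc h ≤ᵇ m ⟧ *ℤ ρ (suc x)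
  W-two m x = cong₂ _+ℤ_ (cong (λ j → ⟦ h ≤ᵇ m ⟧ *ℤ ρ j) (ℕₚ.+-identityʳ x))
    (trans (ℤₚ.+-identityʳ _) (cong (λ j → ⟦ suc h ≤ᵇ m ⟧ *ℤ ρ j) (trans (ℕₚ.+-suc x 0) (cong suc (ℕₚ.+-identityʳ x)))))
  X-zero : ∀ k → X 0 k ≡ ⟦ h ≤ᵇ 0 ⟧ *ℤ ρ (k + n)
  X-zero k = begin
    X 0 k                         ≡⟨ ∑-upTo-guard 0 N (ℕₚ.≤-<-trans z≤n t<N) _ ⟩
    (+ 1 *ℤ (+ 1 *ℤ (⟦ h ≤ᵇ 0 ⟧ *ℤ ρ (k + n)))) +ℤ + 0 ≡⟨ ℤₚ.+-identityʳ _ ⟩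
    + 1 *ℤ (+ 1 *ℤ (⟦ h ≤ᵇ 0 ⟧ *ℤ ρ (k + n))) ≡⟨ trans (ℤₚ.*-identityˡ _) (ℤₚ.*-identityˡ _) ⟩
    ⟦ h ≤ᵇ 0 ⟧ *ℤ ρ (k + n) ∎
  X-suc : ∀ m' k → suc m' ≤ t → X (suc m') k ≡
    ⟦ m' ≤ᵇ n ⟧ *ℤ (⟦ h ≤ᵇ m' ⟧ *ℤ ρ (k + suc n)) +ℤ ⟦ suc m' ≤ᵇ n ⟧ *ℤ (⟦ h ≤ᵇ suc m' ⟧ *ℤ ρ (k + n))
  X-suc m' k m≤t = begin
    X (suc m') k
      ≡⟨ ∑-cong (upTo N) (λ y → trans (sym (guard-∧ (y ≤ᵇ suc m') (suc m' ≤ᵇ suc y) (f y)))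
           (cong (λ b → ⟦ b ⟧ *ℤ f y) (trans (Boolₚ.∧-comm (y ≤ᵇ suc m') _) (cong (_∧ (y ≤ᵇ suc m')) (≤ᵇ-suc m' y))))) ⟩
    ∑ (upTo N) (λ y → ⟦ (m' ≤ᵇ y) ∧ (y ≤ᵇ suc m') ⟧ *ℤ f y)
      ≡⟨ ∑-two m' N (ℕₚ.≤-<-trans m≤t (ℕₚ.<-trans (ℕₚ.n<1+n t) t<N)) f ⟩
    f m' +ℤ f (suc m')
      ≡⟨ cong₂ (λ a b → ⟦ m' ≤ᵇ n ⟧ *ℤ (⟦ h ≤ᵇ m' ⟧ *ℤ ρ (k + a)) +ℤ ⟦ suc m' ≤ᵇ n ⟧ *ℤ (⟦ h ≤ᵇ suc m' ⟧ *ℤ ρ (k + b)))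
           (trans (cong (_∸ m') (sym (ℕₚ.+-suc m' n))) (ℕₚ.m+n∸m≡n m' (suc n))) (ℕₚ.m+n∸m≡n (suc m') n) ⟩
    ⟦ m' ≤ᵇ n ⟧ *ℤ (⟦ h ≤ᵇ m' ⟧ *ℤ ρ (k + suc n)) +ℤ ⟦ suc m' ≤ᵇ n ⟧ *ℤ (⟦ h ≤ᵇ suc m' ⟧ *ℤ ρ (k + n)) ∎
    where
    f : ℕ → ℤ
    f y = ⟦ y ≤ᵇ n ⟧ *ℤ (⟦ h ≤ᵇ y ⟧ *ℤ ρ (k + (suc m' + n ∸ y)))
  main : ∀ m → m ≤ t → ⟦ m ≤ᵇ n ⟧ *ℤ (⟦ n ≤ᵇ t ⟧ *ℤ W' m n) +ℤ ⟦ m ≤ᵇ suc n ⟧ *ℤ (⟦ suc n ≤ᵇ t ⟧ *ℤ W' m (suc n)) ≡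
    ⟦ n ≤ᵇ t ⟧ *ℤ X m 0 +ℤ ⟦ suc n ≤ᵇ t ⟧ *ℤ X m 1
  main zero m≤t = cong₂ _+ℤ_
    (trans (ℤₚ.*-identityˡ _) (cong (⟦ n ≤ᵇ t ⟧ *ℤ_) (trans (W-two 0 n) (trans (ℤₚ.+-identityʳ _) (sym (X-zero 0))))))
    (trans (ℤₚ.*-identityˡ _) (cong (⟦ suc n ≤ᵇ t ⟧ *ℤ_) (trans (W-two 0 (suc n)) (trans (ℤₚ.+-identityʳ _) (sym (X-zero 1))))))
  -- If the row m of μ is at most n, the sides agree for each `k` separately. If m is n + 1, two
  -- terms remain on each side, indexed by the inner `k` on the left and by the outer `k` on the
  -- right. If m is larger, both sides vanish.
  main (suc m') m≤t with ℕₚ.<-cmp m' n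
  ... | tri< m'<n _ _ = cong₂ _+ℤ_
          (trans (≤-true m'<n _) (cong (⟦ n ≤ᵇ t ⟧ *ℤ_) (same n 0 refl)))
          (trans (≤-true (ℕₚ.m≤n⇒m≤1+n m'<n) _) (cong (⟦ suc n ≤ᵇ t ⟧ *ℤ_) (same (suc n) 1 refl)))
    where
    same : ∀ x k → x ≡ k + n → W' (suc m') x ≡ X (suc m') k
    same _ k refl = begin
      W' (suc m') (k + n)   ≡⟨ W-two (suc m') (k + n) ⟩
      ⟦ h ≤ᵇ suc m' ⟧ *ℤ ρ (k + n) +ℤ ⟦ suc h ≤ᵇ suc m' ⟧ *ℤ ρ (suc (k + n))
        ≡⟨ ℤₚ.+-comm _ (⟦ suc h ≤ᵇ suc m' ⟧ *ℤ ρ (suc (k + n))) ⟩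
      ⟦ suc h ≤ᵇ suc m' ⟧ *ℤ ρ (suc (k + n)) +ℤ ⟦ h ≤ᵇ suc m' ⟧ *ℤ ρ (k + n)
        ≡⟨ cong₂ _+ℤ_ (cong₂ (λ b j → ⟦ b ⟧ *ℤ ρ j)
             (≤ᵇ-suc h m') (sym (ℕₚ.+-suc k n))) refl ⟩
      ⟦ h ≤ᵇ m' ⟧ *ℤ ρ (k + suc n) +ℤ ⟦ h ≤ᵇ suc m' ⟧ *ℤ ρ (k + n)
        ≡⟨ sym (cong₂ _+ℤ_ (≤-true (ℕₚ.<⇒≤ m'<n) _) (≤-true m'<n _)) ⟩
      ⟦ m' ≤ᵇ n ⟧ *ℤ (⟦ h ≤ᵇ m' ⟧ *ℤ ρ (k + suc n)) +ℤ ⟦ suc m' ≤ᵇ n ⟧ *ℤ (⟦ h ≤ᵇ suc m' ⟧ *ℤ ρ (k + n))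
        ≡⟨ sym (X-suc m' k m≤t) ⟩
      X (suc m') k ∎
  ... | tri≈ _ refl _ = begin
      ⟦ suc n ≤ᵇ n ⟧ *ℤ (⟦ n ≤ᵇ t ⟧ *ℤ W' (suc n) n) +ℤ ⟦ suc n ≤ᵇ suc n ⟧ *ℤ (⟦ suc n ≤ᵇ t ⟧ *ℤ W' (suc n) (suc n))
        ≡⟨ cong₂ _+ℤ_ (≤-false (ℕₚ.n<1+n n) (⟦ n ≤ᵇ t ⟧ *ℤ W' (suc n) n))
             (trans (≤-true (ℕₚ.≤-refl {suc n}) (⟦ suc n ≤ᵇ t ⟧ *ℤ W' (suc n) (suc n))) (≤-true m≤t (W' (suc n) (suc n)))) ⟩
      + 0 +ℤ W' (suc n) (suc n)
        ≡⟨ trans (ℤₚ.+-identityˡ _) (W-two (suc n) (suc n)) ⟩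
      ⟦ h ≤ᵇ suc n ⟧ *ℤ ρ (suc n) +ℤ ⟦ suc h ≤ᵇ suc n ⟧ *ℤ ρ (suc (suc n))
        ≡⟨ cong₂ _+ℤ_ (≤-true (ℕₚ.m≤n⇒m≤1+n h≤n) (ρ (suc n))) (≤-true (s≤s h≤n) (ρ (suc (suc n)))) ⟩
      ρ (suc n) +ℤ ρ (suc (suc n))
        ≡⟨ sym (cong₂ _+ℤ_ (trans (≤-true (ℕₚ.<⇒≤ m≤t) (X (suc n) 0)) (X-eq 0)) (trans (≤-true m≤t (X (suc n) 1)) (X-eq 1))) ⟩
      ⟦ n ≤ᵇ t ⟧ *ℤ X (suc n) 0 +ℤ ⟦ suc n ≤ᵇ t ⟧ *ℤ X (suc n) 1 ∎
    where
    X-eq : ∀ k → X (suc n) k ≡ ρ (k + suc n)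
    X-eq k = begin
      X (suc n) k ≡⟨ X-suc n k m≤t ⟩
      ⟦ n ≤ᵇ n ⟧ *ℤ (⟦ h ≤ᵇ n ⟧ *ℤ ρ (k + suc n)) +ℤ ⟦ suc n ≤ᵇ n ⟧ *ℤ (⟦ h ≤ᵇ suc n ⟧ *ℤ ρ (k + n))
        ≡⟨ cong₂ _+ℤ_ (trans (≤-true (ℕₚ.≤-refl {n}) (⟦ h ≤ᵇ n ⟧ *ℤ ρ (k + suc n))) (≤-true h≤n (ρ (k + suc n))))
             (≤-false (ℕₚ.n<1+n n) (⟦ h ≤ᵇ suc n ⟧ *ℤ ρ (k + n))) ⟩
      ρ (k + suc n) +ℤ + 0 ≡⟨ ℤₚ.+-identityʳ _ ⟩
      ρ (k + suc n) ∎
  ... | tri> _ _ n<m' = begin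
      ⟦ suc m' ≤ᵇ n ⟧ *ℤ (⟦ n ≤ᵇ t ⟧ *ℤ W' (suc m') n) +ℤ ⟦ suc m' ≤ᵇ suc n ⟧ *ℤ (⟦ suc n ≤ᵇ t ⟧ *ℤ W' (suc m') (suc n))
        ≡⟨ cong₂ _+ℤ_ (≤-false (ℕₚ.<-trans n<m' (ℕₚ.n<1+n m')) (⟦ n ≤ᵇ t ⟧ *ℤ W' (suc m') n))
             (≤-false (s≤s n<m') (⟦ suc n ≤ᵇ t ⟧ *ℤ W' (suc m') (suc n))) ⟩
      + 0 ≡⟨ sym (cong₂ _+ℤ_ (trans (cong (⟦ n ≤ᵇ t ⟧ *ℤ_) (X-eq 0)) (ℤₚ.*-zeroʳ ⟦ n ≤ᵇ t ⟧))
                             (trans (cong (⟦ suc n ≤ᵇ t ⟧ *ℤ_) (X-eq 1)) (ℤₚ.*-zeroʳ ⟦ suc n ≤ᵇ t ⟧))) ⟩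
      ⟦ n ≤ᵇ t ⟧ *ℤ X (suc m') 0 +ℤ ⟦ suc n ≤ᵇ t ⟧ *ℤ X (suc m') 1 ∎
    where
    X-eq : ∀ k → X (suc m') k ≡ + 0
    X-eq k = trans (X-suc m' k m≤t) (cong₂ _+ℤ_ (≤-false n<m' (⟦ h ≤ᵇ m' ⟧ *ℤ ρ (k + suc n)))
      (≤-false (ℕₚ.<-trans n<m' (ℕₚ.n<1+n m')) (⟦ h ≤ᵇ suc m' ⟧ *ℤ ρ (k + n))))

-- The same induction on rows as in `local-hh`, for a horizontal and a vertical strip. A row of λ
-- now has at most two values, so the reflection is replaced by the comparison in `hv-row`, and `k`
-- is 0 or 1. Vertical strips do not force the rows to decrease, hence the hypotheses `ninc`.
local-hv : ∀ N t t' μ ν → length μ ≡ length ν → suc t < N → suc t' < N →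
  ninc t μ ≡ true → ninc t' ν ≡ true → lastOr t μ ≡ 0 → (g : ℕ → ℤ) →
  ∑ (listsOf (upTo N) (length μ)) (λ l → ⟦ hsT t l μ ∧ vsᵇ l ν ⟧ *ℤ g (sumℕ l)) ≡
  ∑ (upTo 2) (λ k → ⟦ k + hd ν ≤ᵇ t ⟧ *ℤ
    ∑ (listsOf (upTo N) (length μ)) (λ κ → ⟦ vsᵇ μ κ ∧ hsT t' ν κ ⟧ *ℤ g (k + (sumℕ μ + sumℕ ν ∸ sumℕ κ))))
local-hv N _ t' [] [] _ _ _ _ _ refl g = sym (begin
  + 1 *ℤ (+ 1 *ℤ g 0 +ℤ + 0) +ℤ + 0 ≡⟨ ℤₚ.+-identityʳ _ ⟩
  + 1 *ℤ (+ 1 *ℤ g 0 +ℤ + 0)        ≡⟨ ℤₚ.*-identityˡ _ ⟩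
  + 1 *ℤ g 0 +ℤ + 0 ∎)
local-hv N t t' (m ∷ μ) (n ∷ ν) len t<N t'<N nμ nν last≡0 g = begin
  ∑ (listsOf U (suc L)) (λ l → ⟦ hsT t l (m ∷ μ) ∧ vsᵇ l (n ∷ ν) ⟧ *ℤ g (sumℕ l))
    ≡⟨ ∑-lists-suc U L _ ⟩
  ∑ P (λ l → ∑ U (λ x → ⟦ hsT t (x ∷ l) (m ∷ μ) ∧ vsᵇ (x ∷ l) (n ∷ ν) ⟧ *ℤ g (x + sumℕ l)))
    ≡⟨ ∑-swap P U _ ⟩
  ∑ U (λ x → ∑ P (λ l → ⟦ hsT t (x ∷ l) (m ∷ μ) ∧ vsᵇ (x ∷ l) (n ∷ ν) ⟧ *ℤ g (x + sumℕ l)))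
    ≡⟨ ∑-cong U (λ x → begin
      ∑ P (λ l → ⟦ hsT t (x ∷ l) (m ∷ μ) ∧ vsᵇ (x ∷ l) (n ∷ ν) ⟧ *ℤ g (x + sumℕ l))
        ≡⟨ ∑-cong P (λ l → trans (cong (λ b → ⟦ b ⟧ *ℤ g (x + sumℕ l)) (bl x l)) (guard-∧ (inL x) _ _)) ⟩
      ∑ P (λ l → ⟦ inL x ⟧ *ℤ (⟦ hsT m l μ ∧ vsᵇ l ν ⟧ *ℤ g (x + sumℕ l)))
        ≡⟨ sym (∑-*ˡ P ⟦ inL x ⟧ _) ⟩
      ⟦ inL x ⟧ *ℤ ∑ P (λ l → ⟦ hsT m l μ ∧ vsᵇ l ν ⟧ *ℤ g (x + sumℕ l))
        ≡⟨ cong (⟦ inL x ⟧ *ℤ_) (local-hv N m n μ ν (ℕₚ.suc-injective len)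
             (ℕₚ.≤-<-trans (s≤s m≤t) t<N) (ℕₚ.≤-<-trans (s≤s n≤t') t'<N) (proj₂ (ninc⁻ t m μ nμ)) nν' last≡0 (λ j → g (x + j))) ⟩
      ⟦ inL x ⟧ *ℤ ∑ (upTo 2) (λ k → ⟦ k + hd ν ≤ᵇ m ⟧ *ℤ ∑ P (λ κ → ⟦ vsᵇ μ κ ∧ hsT n ν κ ⟧ *ℤ g (x + (k + (sumℕ μ + sumℕ ν ∸ sumℕ κ)))))
        ≡⟨ cong (⟦ inL x ⟧ *ℤ_) (∑-cong (upTo 2) (λ k → cong (⟦ k + hd ν ≤ᵇ m ⟧ *ℤ_) (∑-cong P (λ κ →
             cong (λ j → ⟦ vsᵇ μ κ ∧ hsT n ν κ ⟧ *ℤ g j) (sym (ℕₚ.+-assoc x k (sumℕ μ + sumℕ ν ∸ sumℕ κ))))))) ⟩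
      ⟦ inL x ⟧ *ℤ W x
        ≡⟨ guard-∧ ((n ≤ᵇ x) ∧ (x ≤ᵇ suc n)) _ _ ⟩
      ⟦ (n ≤ᵇ x) ∧ (x ≤ᵇ suc n) ⟧ *ℤ (⟦ (m ≤ᵇ x) ∧ (x ≤ᵇ t) ⟧ *ℤ W x)
        ≡⟨ cong (⟦ (n ≤ᵇ x) ∧ (x ≤ᵇ suc n) ⟧ *ℤ_) (guard-∧ (m ≤ᵇ x) (x ≤ᵇ t) (W x)) ⟩
      ⟦ (n ≤ᵇ x) ∧ (x ≤ᵇ suc n) ⟧ *ℤ (⟦ m ≤ᵇ x ⟧ *ℤ (⟦ x ≤ᵇ t ⟧ *ℤ W x)) ∎) ⟩
  ∑ U (λ x → ⟦ (n ≤ᵇ x) ∧ (x ≤ᵇ suc n) ⟧ *ℤ (⟦ m ≤ᵇ x ⟧ *ℤ (⟦ x ≤ᵇ t ⟧ *ℤ W x)))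
    ≡⟨ hv-row N t t' m n (hd ν) ρ t<N t'<N m≤t n≤t' (hd≤ ν nν') ⟩
  ∑ (upTo 2) (λ k → ⟦ k + n ≤ᵇ t ⟧ *ℤ
    ∑ U (λ y → ⟦ y ≤ᵇ m ⟧ *ℤ (⟦ m ≤ᵇ suc y ⟧ *ℤ (⟦ y ≤ᵇ n ⟧ *ℤ (⟦ hd ν ≤ᵇ y ⟧ *ℤ ρ (k + (m + n ∸ y)))))))
    ≡⟨ ∑-cong (upTo 2) (λ k → cong (⟦ k + n ≤ᵇ t ⟧ *ℤ_) (rhs k)) ⟩
  ∑ (upTo 2) (λ k → ⟦ k + n ≤ᵇ t ⟧ *ℤ
    ∑ (listsOf U (suc L)) (λ κ → ⟦ vsᵇ (m ∷ μ) κ ∧ hsT t' (n ∷ ν) κ ⟧ *ℤ g (k + (sumℕ (m ∷ μ) + sumℕ (n ∷ ν) ∸ sumℕ κ)))) ∎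
  where
  U = upTo N
  L = length μ
  P = listsOf U L
  m≤t = proj₁ (ninc⁻ t m μ nμ)
  n≤t' = proj₁ (ninc⁻ t' n ν nν)
  nν' = proj₂ (ninc⁻ t' n ν nν)
  hd≤ : ∀ ν → ninc n ν ≡ true → hd ν ≤ n
  hd≤ []      _ = z≤n
  hd≤ (x ∷ ν) e = proj₁ (ninc⁻ n x ν e)
  inL : ℕ → Bool
  inL x = ((n ≤ᵇ x) ∧ (x ≤ᵇ suc n)) ∧ ((m ≤ᵇ x) ∧ (x ≤ᵇ t))
  inR : ℕ → Bool
  inR y = (y ≤ᵇ m) ∧ ((m ≤ᵇ suc y) ∧ ((y ≤ᵇ n) ∧ (hd ν ≤ᵇ y)))
  ρ : ℕ → ℤ
  ρ j = ∑ P (λ κ → ⟦ vsᵇ μ κ ∧ hsT n ν κ ⟧ *ℤ g (j + (sumℕ μ + sumℕ ν ∸ sumℕ κ)))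
  W : ℕ → ℤ
  W x = ∑ (upTo 2) (λ k → ⟦ k + hd ν ≤ᵇ m ⟧ *ℤ ρ (x + k))
  bl : ∀ x l → hsT t (x ∷ l) (m ∷ μ) ∧ vsᵇ (x ∷ l) (n ∷ ν) ≡ inL x ∧ (hsT m l μ ∧ vsᵇ l ν)
  bl x l = bool-iff
    (λ e → let (e₁ , e₂) = ∧⁻ {hsT t (x ∷ l) (m ∷ μ)} e
               (a , b , c) = hsT⁻ t x m l μ e₁
               (a' , b' , c') = vs⁻ x n l ν e₂
           in ∧⁺ (∧⁺ (∧⁺ (≤ᵇ⁺ a') (≤ᵇ⁺ b')) (∧⁺ (≤ᵇ⁺ a) (≤ᵇ⁺ b))) (∧⁺ c c'))
    (λ e → let (e₁ , e₂) = ∧⁻ {inL x} e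
               (p , q) = ∧⁻ {(n ≤ᵇ x) ∧ (x ≤ᵇ suc n)} e₁
               (p₁ , p₂) = ∧⁻ {n ≤ᵇ x} p
               (q₁ , q₂) = ∧⁻ {m ≤ᵇ x} q
               (c , c') = ∧⁻ {hsT m l μ} e₂
           in ∧⁺ (∧⁺ q₁ (∧⁺ q₂ c)) (∧⁺ p₁ (∧⁺ p₂ c')))
  bl' : ∀ y κ → vsᵇ (m ∷ μ) (y ∷ κ) ∧ hsT t' (n ∷ ν) (y ∷ κ) ≡ inR y ∧ (vsᵇ μ κ ∧ hsT n ν κ)
  bl' y κ = bool-iff
    (λ e → let (e₁ , e₂) = ∧⁻ {vsᵇ (m ∷ μ) (y ∷ κ)} e
               (a , b , c) = vs⁻ m y μ κ e₁
               (a' , _ , c') = hsT⁻ t' n y ν κ e₂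
               (q , r) = ∧⁻ {hd ν ≤ᵇ y} (trans (sym (hsT-top a' ν κ)) c')
           in ∧⁺ (∧⁺ (≤ᵇ⁺ a) (∧⁺ (≤ᵇ⁺ b) (∧⁺ (≤ᵇ⁺ a') q))) (∧⁺ c r))
    (λ e → let (e₁ , e₂) = ∧⁻ {inR y} e
               (a , r₁) = ∧⁻ {y ≤ᵇ m} e₁
               (b , r₂) = ∧⁻ {m ≤ᵇ suc y} r₁
               (a' , q) = ∧⁻ {y ≤ᵇ n} r₂
               (c , c') = ∧⁻ {vsᵇ μ κ} e₂
           in ∧⁺ (∧⁺ a (∧⁺ b c)) (∧⁺ a' (∧⁺ (≤ᵇ⁺ n≤t') (trans (hsT-top (≤ᵇ⁻ {y} a') ν κ) (∧⁺ q c')))))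
  rhs : ∀ k → ∑ U (λ y → ⟦ y ≤ᵇ m ⟧ *ℤ (⟦ m ≤ᵇ suc y ⟧ *ℤ (⟦ y ≤ᵇ n ⟧ *ℤ (⟦ hd ν ≤ᵇ y ⟧ *ℤ ρ (k + (m + n ∸ y)))))) ≡
    ∑ (listsOf U (suc L)) (λ κ → ⟦ vsᵇ (m ∷ μ) κ ∧ hsT t' (n ∷ ν) κ ⟧ *ℤ g (k + (sumℕ (m ∷ μ) + sumℕ (n ∷ ν) ∸ sumℕ κ)))
  rhs k = sym (begin
    ∑ (listsOf U (suc L)) (λ κ → ⟦ vsᵇ (m ∷ μ) κ ∧ hsT t' (n ∷ ν) κ ⟧ *ℤ g (k + (sumℕ (m ∷ μ) + sumℕ (n ∷ ν) ∸ sumℕ κ)))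
      ≡⟨ ∑-lists-suc U L _ ⟩
    ∑ P (λ κ → ∑ U (λ y → ⟦ vsᵇ (m ∷ μ) (y ∷ κ) ∧ hsT t' (n ∷ ν) (y ∷ κ) ⟧ *ℤ G y κ))
      ≡⟨ ∑-swap P U _ ⟩
    ∑ U (λ y → ∑ P (λ κ → ⟦ vsᵇ (m ∷ μ) (y ∷ κ) ∧ hsT t' (n ∷ ν) (y ∷ κ) ⟧ *ℤ G y κ))
      ≡⟨ ∑-cong U (λ y → begin
        ∑ P (λ κ → ⟦ vsᵇ (m ∷ μ) (y ∷ κ) ∧ hsT t' (n ∷ ν) (y ∷ κ) ⟧ *ℤ G y κ)
          ≡⟨ ∑-cong P (λ κ → trans (cong (λ b → ⟦ b ⟧ *ℤ G y κ) (bl' y κ)) (trans (guard-∧ (inR y) _ _)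
               (guard (inR y) (λ ey → guard (vsᵇ μ κ ∧ hsT n ν κ) (λ eκ → cong g
                 (weight-step k m n y (sumℕ μ) (sumℕ ν) (sumℕ κ)
                   (ℕₚ.≤-trans (≤ᵇ⁻ {y} (proj₁ (∧⁻ {y ≤ᵇ m} ey))) (ℕₚ.m≤m+n m n))
                   (ℕₚ.≤-trans (vs-sum μ κ (proj₁ (∧⁻ {vsᵇ μ κ} eκ))) (ℕₚ.m≤m+n _ _)))))))) ⟩
        ∑ P (λ κ → ⟦ inR y ⟧ *ℤ (⟦ vsᵇ μ κ ∧ hsT n ν κ ⟧ *ℤ g ((k + (m + n ∸ y)) + (sumℕ μ + sumℕ ν ∸ sumℕ κ))))
          ≡⟨ sym (∑-*ˡ P ⟦ inR y ⟧ _) ⟩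
        ⟦ inR y ⟧ *ℤ ρ (k + (m + n ∸ y))
          ≡⟨ trans (guard-∧ (y ≤ᵇ m) _ _) (cong (⟦ y ≤ᵇ m ⟧ *ℤ_) (trans (guard-∧ (m ≤ᵇ suc y) _ _)
               (cong (⟦ m ≤ᵇ suc y ⟧ *ℤ_) (guard-∧ (y ≤ᵇ n) (hd ν ≤ᵇ y) _)))) ⟩
        ⟦ y ≤ᵇ m ⟧ *ℤ (⟦ m ≤ᵇ suc y ⟧ *ℤ (⟦ y ≤ᵇ n ⟧ *ℤ (⟦ hd ν ≤ᵇ y ⟧ *ℤ ρ (k + (m + n ∸ y))))) ∎) ⟩
    ∑ U (λ y → ⟦ y ≤ᵇ m ⟧ *ℤ (⟦ m ≤ᵇ suc y ⟧ *ℤ (⟦ y ≤ᵇ n ⟧ *ℤ (⟦ hd ν ≤ᵇ y ⟧ *ℤ ρ (k + (m + n ∸ y)))))) ∎)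
    where
    G : ℕ → List ℕ → ℤ
    G y κ = g (k + (sumℕ (m ∷ μ) + sumℕ (n ∷ ν) ∸ (y + sumℕ κ)))

-- Kostka numbers as strip chains, the Pieri rule and the Cauchy identities

≤-∸ : ∀ a {b c} → c ≤ b → a ≤ a + b ∸ c
≤-∸ a {b} {c} c≤b = ℕₚ.≤-trans (ℕₚ.m≤m+n a (b ∸ c)) (ℕₚ.≤-reflexive (sym (ℕₚ.+-∸-assoc a c≤b)))

-- Throughout, a partition is a list of fixed length bounded by t; the flag s selects horizontal (false)
-- or vertical (true) strips, weakly or strictly sorted words, and multiplicity bound ∞ or 1.
module Cauchy (t M : ℕ) where

  N : ℕ
  N = suc (suc t)

  P : List (List ℕ)
  P = listsOf (upTo N) M

  -- Interlacing already makes both lists weakly decreasing and bounded by `t`; for vertical strips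
  -- this has to be demanded.
  st : Bool → List ℕ → List ℕ → Bool
  st false l μ = hsT t l μ
  st true  l μ = vsᵇ l μ ∧ (ninc t l ∧ ninc t μ)

  mult : Bool → ℕ → Bool
  mult false k = true
  mult true  k = k ≤ᵇ 1

  zeroᵇ : List ℕ → Bool
  zeroᵇ = allᵇ (_≡ᵇ 0)

  -- `K false α l` is the Kostka number of shape `l`, with the multiplicity of the largest letter at
  -- the head of α. With vertical strips it becomes the Kostka number of the conjugate shape, see
  -- `K-conj`.
  K : Bool → List ℕ → List ℕ → ℤ
  K s []      l = ⟦ zeroᵇ l ⟧
  K s (a ∷ α) l = ∑ P (λ μ → ⟦ st s l μ ⟧ *ℤ (⟦ sumℕ l ≡ᵇ sumℕ μ + a ⟧ *ℤ K s α μ))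

  -- sums φ over all ways of taking a units away from β, respecting the multiplicity bound
  removals : Bool → ℕ → List ℕ → (List ℕ → ℤ) → ℤ
  removals s a []      φ = ⟦ a ≡ᵇ 0 ⟧ *ℤ φ []
  removals s a (b ∷ β) φ = ∑ (upTo N) (λ k → ⟦ mult s k ⟧ *ℤ (⟦ (k ≤ᵇ a) ∧ (k ≤ᵇ b) ⟧ *ℤ
    removals s (a ∸ k) β (λ β' → φ (b ∸ k ∷ β'))))

  -- For row sums below `N`, the number of matrices with row sums α and column sums β, with entries
  -- in ℕ or in {0, 1} according to the flag.
  matrices : Bool → List ℕ → List ℕ → ℤ
  matrices s []      β = ⟦ zeroᵇ β ⟧
  matrices s (a ∷ α) β = removals s a β (matrices s α)

  hsT-ninc : ∀ u l μ → hsT u l μ ≡ true → ninc u l ≡ true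
  hsT-ninc u []      []      e = refl
  hsT-ninc u (x ∷ l) (y ∷ μ) e with hsT⁻ u x y l μ e
  ... | y≤x , x≤u , h = ∧⁺ (≤ᵇ⁺ x≤u) (ninc-mono l y≤x (hsT-ninc y l μ h))
    where
    ninc-mono : ∀ {a b} l → a ≤ b → ninc a l ≡ true → ninc b l ≡ true
    ninc-mono []      a≤b e = refl
    ninc-mono {a} (x ∷ l) a≤b e = ∧⁺ (≤ᵇ⁺ (ℕₚ.≤-trans (proj₁ (ninc⁻ a x l e)) a≤b)) (proj₂ (ninc⁻ a x l e))

  hsT-ninc₂ : ∀ u l μ → hsT u l μ ≡ true → ninc u μ ≡ true
  hsT-ninc₂ u []      []      e = refl
  hsT-ninc₂ u (x ∷ l) (y ∷ μ) e with hsT⁻ u x y l μ e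
  ... | y≤x , x≤u , h = ∧⁺ (≤ᵇ⁺ (ℕₚ.≤-trans y≤x x≤u)) (hsT-ninc₂ y l μ h)

  st-ninc : ∀ s l μ → st s l μ ≡ true → ninc t l ≡ true
  st-ninc false l μ e = hsT-ninc t l μ e
  st-ninc true  l μ e = proj₁ (∧⁻ {ninc t l} (proj₂ (∧⁻ {vsᵇ l μ} e)))

  st-ninc₂ : ∀ s l μ → st s l μ ≡ true → ninc t μ ≡ true
  st-ninc₂ false l μ e = hsT-ninc₂ t l μ e
  st-ninc₂ true  l μ e = proj₂ (∧⁻ {ninc t l} (proj₂ (∧⁻ {vsᵇ l μ} e)))

  st-sum : ∀ s l μ → st s l μ ≡ true → sumℕ μ ≤ sumℕ l
  st-sum false l μ e = hsT-sum t l μ e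
  st-sum true  l μ e = vs-sum l μ (proj₁ (∧⁻ {vsᵇ l μ} e))

  hsT-last : ∀ w u u' l μ → u' ≤ u → hsT w l μ ≡ true → lastOr u' μ ≤ lastOr u l
  hsT-last w u u' []      []      u'≤u e = u'≤u
  hsT-last w u u' (x ∷ l) (y ∷ μ) u'≤u e with hsT⁻ w x y l μ e
  ... | y≤x , _ , h = hsT-last y x y l μ y≤x h

  vs-last : ∀ u l μ → vsᵇ l μ ≡ true → lastOr u μ ≤ lastOr u l
  vs-last u l μ = go u u l μ ℕₚ.≤-refl
    where
    go : ∀ u u' l μ → u' ≤ u → vsᵇ l μ ≡ true → lastOr u' μ ≤ lastOr u l
    go u u' []      []      u'≤u e = u'≤u
    go u u' (x ∷ l) (y ∷ μ) u'≤u e with vs⁻ x y l μ e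
    ... | y≤x , _ , h = go x y l μ y≤x h

  st-last : ∀ s l μ → st s l μ ≡ true → lastOr t l ≡ 0 → lastOr t μ ≡ 0
  st-last false l μ e z = ℕₚ.n≤0⇒n≡0 (ℕₚ.≤-trans (hsT-last t t t l μ ℕₚ.≤-refl e) (ℕₚ.≤-reflexive z))
  st-last true  l μ e z = ℕₚ.n≤0⇒n≡0 (ℕₚ.≤-trans (vs-last t l μ (proj₁ (∧⁻ {vsᵇ l μ} e))) (ℕₚ.≤-reflexive z))

  -- No part is smaller than the last, so the length times the last part is at most the sum; with
  -- fewer cells than rows the last part must be 0.
  last≡0 : ∀ u μ → ninc u μ ≡ true → sumℕ μ < length μ → lastOr u μ ≡ 0
  last≡0 u μ e lt with lastOr u μ | bound u μ e
    where
    last≤ : ∀ u μ → ninc u μ ≡ true → lastOr u μ ≤ u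
    last≤ u []      e = ℕₚ.≤-refl
    last≤ u (x ∷ μ) e = ℕₚ.≤-trans (last≤ x μ (proj₂ (ninc⁻ u x μ e))) (proj₁ (ninc⁻ u x μ e))
    bound : ∀ u μ → ninc u μ ≡ true → length μ * lastOr u μ ≤ sumℕ μ
    bound u []      e = z≤n
    bound u (x ∷ μ) e = ℕₚ.+-mono-≤ (last≤ x μ (proj₂ (ninc⁻ u x μ e))) (bound x μ (proj₂ (ninc⁻ u x μ e)))
  ... | zero  | _ = refl
  ... | suc c | b = ⊥-elim (ℕₚ.<⇒≱ lt (ℕₚ.≤-trans (ℕₚ.m≤m*n (length μ) (suc c)) b))

  -- If `k + h` exceeds `t`, every admissible κ has weight `k + w κ` above `t`, where `g` vanishes;
  -- the explicit bound on `k` therefore changes nothing.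
  dropGuard : ∀ k h (b : List ℕ → Bool) (w : List ℕ → ℕ) (g : ℕ → ℤ) → (∀ x → t < x → g x ≡ + 0) →
    (∀ κ → b κ ≡ true → h ≤ w κ) →
    ⟦ k + h ≤ᵇ t ⟧ *ℤ ∑ P (λ κ → ⟦ b κ ⟧ *ℤ g (k + w κ)) ≡ ∑ P (λ κ → ⟦ b κ ⟧ *ℤ g (k + w κ))
  dropGuard k h b w g vanish h≤w with k + h ≤? t
  ... | yes p = ≤-true p _
  ... | no ¬p = trans (≤-false (ℕₚ.≰⇒> ¬p) _) (sym (∑-zero P (λ {κ} _ → trans
    (guard (b κ) (λ e → vanish (k + w κ) (ℕₚ.<-≤-trans (ℕₚ.≰⇒> ¬p) (ℕₚ.+-monoʳ-≤ k (h≤w κ e))))) (ℤₚ.*-zeroʳ ⟦ b κ ⟧))))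

  -- Common form of the two local rules. As `g` vanishes above `t`, the bounds on `k` disappear, and
  -- the kinds of strip differ only through `mult`.
  commutation : ∀ s μ ν → length μ ≡ M → length ν ≡ M → ninc t μ ≡ true → lastOr t μ ≡ 0 →
    (g : ℕ → ℤ) → (∀ x → t < x → g x ≡ + 0) →
    ∑ P (λ l → ⟦ hsT t l μ ⟧ *ℤ (⟦ st s l ν ⟧ *ℤ g (sumℕ l))) ≡
    ∑ (upTo N) (λ k → ⟦ mult s k ⟧ *ℤ ∑ P (λ κ → ⟦ st s μ κ ⟧ *ℤ (⟦ hsT t ν κ ⟧ *ℤ g (k + (sumℕ μ + sumℕ ν ∸ sumℕ κ)))))
  commutation false μ ν lμ lν nμ z g vanish = begin
    ∑ P (λ l → ⟦ hsT t l μ ⟧ *ℤ (⟦ hsT t l ν ⟧ *ℤ g (sumℕ l)))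
      ≡⟨ ∑-cong P (λ l → sym (guard-∧ (hsT t l μ) (hsT t l ν) _)) ⟩
    ∑ P (λ l → ⟦ hsT t l μ ∧ hsT t l ν ⟧ *ℤ g (sumℕ l))
      ≡⟨ subst (λ L → ∑ (listsOf (upTo N) L) (λ l → ⟦ hsT t l μ ∧ hsT t l ν ⟧ *ℤ g (sumℕ l)) ≡
           ∑ (upTo N) (λ k → ⟦ k + (hd μ ⊔ hd ν) ≤ᵇ t ⊓ t ⟧ *ℤ
             ∑ (listsOf (upTo N) L) (λ κ → ⟦ hsT t μ κ ∧ hsT t ν κ ⟧ *ℤ g (k + (sumℕ μ + sumℕ ν ∸ sumℕ κ))))) lμ
           (local-hh N t t μ ν (trans lμ (sym lν)) (ℕₚ.m<n⇒m<1+n (ℕₚ.n<1+n t)) z g) ⟩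
    ∑ (upTo N) (λ k → ⟦ k + (hd μ ⊔ hd ν) ≤ᵇ t ⊓ t ⟧ *ℤ
             ∑ P (λ κ → ⟦ hsT t μ κ ∧ hsT t ν κ ⟧ *ℤ g (k + (sumℕ μ + sumℕ ν ∸ sumℕ κ))))
      ≡⟨ ∑-cong (upTo N) (λ k → begin
        ⟦ k + (hd μ ⊔ hd ν) ≤ᵇ t ⊓ t ⟧ *ℤ ∑ P (λ κ → ⟦ hsT t μ κ ∧ hsT t ν κ ⟧ *ℤ g (k + (sumℕ μ + sumℕ ν ∸ sumℕ κ)))
          ≡⟨ cong (λ u → ⟦ k + (hd μ ⊔ hd ν) ≤ᵇ u ⟧ *ℤ ∑ P (λ κ → ⟦ hsT t μ κ ∧ hsT t ν κ ⟧ *ℤ g (k + (sumℕ μ + sumℕ ν ∸ sumℕ κ)))) (ℕₚ.⊓-idem t) ⟩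
        ⟦ k + (hd μ ⊔ hd ν) ≤ᵇ t ⟧ *ℤ ∑ P (λ κ → ⟦ hsT t μ κ ∧ hsT t ν κ ⟧ *ℤ g (k + (sumℕ μ + sumℕ ν ∸ sumℕ κ)))
          ≡⟨ dropGuard k (hd μ ⊔ hd ν) (λ κ → hsT t μ κ ∧ hsT t ν κ) (λ κ → sumℕ μ + sumℕ ν ∸ sumℕ κ) g vanish (λ κ e →
               let (e₁ , e₂) = ∧⁻ {hsT t μ κ} e in ℕₚ.⊔-lub
                 (ℕₚ.≤-trans (hd≤sum μ) (≤-∸ (sumℕ μ) (hsT-sum t ν κ e₂)))
                 (ℕₚ.≤-trans (hd≤sum ν) (subst (λ x → sumℕ ν ≤ x ∸ sumℕ κ) (ℕₚ.+-comm (sumℕ ν) (sumℕ μ)) (≤-∸ (sumℕ ν) (hsT-sum t μ κ e₁))))) ⟩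
        ∑ P (λ κ → ⟦ hsT t μ κ ∧ hsT t ν κ ⟧ *ℤ g (k + (sumℕ μ + sumℕ ν ∸ sumℕ κ)))
          ≡⟨ ∑-cong P (λ κ → guard-∧ (hsT t μ κ) (hsT t ν κ) _) ⟩
        ∑ P (λ κ → ⟦ hsT t μ κ ⟧ *ℤ (⟦ hsT t ν κ ⟧ *ℤ g (k + (sumℕ μ + sumℕ ν ∸ sumℕ κ))))
          ≡⟨ sym (ℤₚ.*-identityˡ _) ⟩
        + 1 *ℤ ∑ P (λ κ → ⟦ hsT t μ κ ⟧ *ℤ (⟦ hsT t ν κ ⟧ *ℤ g (k + (sumℕ μ + sumℕ ν ∸ sumℕ κ)))) ∎) ⟩
    ∑ (upTo N) (λ k → + 1 *ℤ ∑ P (λ κ → ⟦ hsT t μ κ ⟧ *ℤ (⟦ hsT t ν κ ⟧ *ℤ g (k + (sumℕ μ + sumℕ ν ∸ sumℕ κ))))) ∎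
  commutation true μ ν lμ lν nμ z g vanish with ninc t ν in nν
  -- If ν is not a partition, no strip on either side involves it and both sums are zero.
  ... | false = trans (∑-zero P (λ {l} _ → trans (cong (λ b → ⟦ hsT t l μ ⟧ *ℤ (⟦ b ⟧ *ℤ g (sumℕ l)))
                  (trans (cong (vsᵇ l ν ∧_) (Boolₚ.∧-zeroʳ (ninc t l))) (Boolₚ.∧-zeroʳ (vsᵇ l ν)))) (ℤₚ.*-zeroʳ ⟦ hsT t l μ ⟧)))
                (sym (∑-zero (upTo N) (λ {k} _ → trans (cong (⟦ k ≤ᵇ 1 ⟧ *ℤ_) (∑-zero P (λ {κ} _ →
                  trans (cong (⟦ st true μ κ ⟧ *ℤ_) (guard-false _ (≡false (λ e → false≢true (trans (sym nν) (hsT-ninc t ν κ e))))))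
                    (ℤₚ.*-zeroʳ ⟦ st true μ κ ⟧)))) (ℤₚ.*-zeroʳ ⟦ k ≤ᵇ 1 ⟧))))
  ... | true = begin
    ∑ P (λ l → ⟦ hsT t l μ ⟧ *ℤ (⟦ vsᵇ l ν ∧ (ninc t l ∧ true) ⟧ *ℤ g (sumℕ l)))
      ≡⟨ ∑-cong P (λ l → trans (sym (guard-∧ (hsT t l μ) _ (g (sumℕ l)))) (cong (λ b → ⟦ b ⟧ *ℤ g (sumℕ l)) (bool-iff
           (λ e → let (e₁ , e₂) = ∧⁻ {hsT t l μ} e in ∧⁺ e₁ (proj₁ (∧⁻ {vsᵇ l ν} e₂)))
           (λ e → let (e₁ , e₂) = ∧⁻ {hsT t l μ} e in ∧⁺ e₁ (∧⁺ e₂ (∧⁺ (hsT-ninc t l μ e₁) refl)))))) ⟩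
    ∑ P (λ l → ⟦ hsT t l μ ∧ vsᵇ l ν ⟧ *ℤ g (sumℕ l))
      ≡⟨ subst (λ L → ∑ (listsOf (upTo N) L) (λ l → ⟦ hsT t l μ ∧ vsᵇ l ν ⟧ *ℤ g (sumℕ l)) ≡
           ∑ (upTo 2) (λ k → ⟦ k + hd ν ≤ᵇ t ⟧ *ℤ
             ∑ (listsOf (upTo N) L) (λ κ → ⟦ vsᵇ μ κ ∧ hsT t ν κ ⟧ *ℤ g (k + (sumℕ μ + sumℕ ν ∸ sumℕ κ))))) lμ
           (local-hv N t t μ ν (trans lμ (sym lν)) ℕₚ.≤-refl ℕₚ.≤-refl nμ nν z g) ⟩
    ∑ (upTo 2) (λ k → ⟦ k + hd ν ≤ᵇ t ⟧ *ℤ ∑ P (λ κ → ⟦ vsᵇ μ κ ∧ hsT t ν κ ⟧ *ℤ g (k + (sumℕ μ + sumℕ ν ∸ sumℕ κ))))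
      ≡⟨ ∑-cong (upTo 2) (λ k → begin
        ⟦ k + hd ν ≤ᵇ t ⟧ *ℤ ∑ P (λ κ → ⟦ vsᵇ μ κ ∧ hsT t ν κ ⟧ *ℤ g (k + (sumℕ μ + sumℕ ν ∸ sumℕ κ)))
          ≡⟨ dropGuard k (hd ν) (λ κ → vsᵇ μ κ ∧ hsT t ν κ) (λ κ → sumℕ μ + sumℕ ν ∸ sumℕ κ) g vanish (λ κ e →
               ℕₚ.≤-trans (hd≤sum ν) (subst (λ x → sumℕ ν ≤ x ∸ sumℕ κ) (ℕₚ.+-comm (sumℕ ν) (sumℕ μ))
                 (≤-∸ (sumℕ ν) (vs-sum μ κ (proj₁ (∧⁻ {vsᵇ μ κ} e)))))) ⟩
        ∑ P (λ κ → ⟦ vsᵇ μ κ ∧ hsT t ν κ ⟧ *ℤ g (k + (sumℕ μ + sumℕ ν ∸ sumℕ κ)))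
          ≡⟨ ∑-cong P (λ κ → trans (cong (λ b → ⟦ b ⟧ *ℤ g (k + (sumℕ μ + sumℕ ν ∸ sumℕ κ))) (bool-iff
               (λ e → let (e₁ , e₂) = ∧⁻ {vsᵇ μ κ} e in ∧⁺ (∧⁺ e₁ (∧⁺ nμ (hsT-ninc₂ t ν κ e₂))) e₂)
               (λ e → let (e₁ , e₂) = ∧⁻ {st true μ κ} e in ∧⁺ (proj₁ (∧⁻ {vsᵇ μ κ} e₁)) e₂))) (guard-∧ (st true μ κ) (hsT t ν κ) _)) ⟩
        ∑ P (λ κ → ⟦ st true μ κ ⟧ *ℤ (⟦ hsT t ν κ ⟧ *ℤ g (k + (sumℕ μ + sumℕ ν ∸ sumℕ κ)))) ∎) ⟩
    ∑ (upTo 2) (λ k → ∑ P (λ κ → ⟦ st true μ κ ⟧ *ℤ (⟦ hsT t ν κ ⟧ *ℤ g (k + (sumℕ μ + sumℕ ν ∸ sumℕ κ)))))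
      ≡⟨ sym (∑-upTo-guard 1 N (s≤s (s≤s z≤n)) (λ k → ∑ P (λ κ → ⟦ st true μ κ ⟧ *ℤ (⟦ hsT t ν κ ⟧ *ℤ g (k + (sumℕ μ + sumℕ ν ∸ sumℕ κ)))))) ⟩
    ∑ (upTo N) (λ k → ⟦ k ≤ᵇ 1 ⟧ *ℤ ∑ P (λ κ → ⟦ st true μ κ ⟧ *ℤ (⟦ hsT t ν κ ⟧ *ℤ g (k + (sumℕ μ + sumℕ ν ∸ sumℕ κ))))) ∎

  removals-cong : ∀ s a β {φ ψ : List ℕ → ℤ} → (∀ β' → φ β' ≡ ψ β') → removals s a β φ ≡ removals s a β ψ
  removals-cong s a []      e = cong (⟦ a ≡ᵇ 0 ⟧ *ℤ_) (e [])
  removals-cong s a (b ∷ β) e = ∑-cong (upTo N) (λ k → cong (λ x → ⟦ mult s k ⟧ *ℤ (⟦ (k ≤ᵇ a) ∧ (k ≤ᵇ b) ⟧ *ℤ x))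
    (removals-cong s (a ∸ k) β (λ β' → e (b ∸ k ∷ β'))))

  removals-∑ : ∀ s a β (xs : List A) (c : A → ℤ) (φ : A → List ℕ → ℤ) →
    removals s a β (λ β' → ∑ xs (λ x → c x *ℤ φ x β')) ≡ ∑ xs (λ x → c x *ℤ removals s a β (φ x))
  removals-∑ s a [] xs c φ = trans (∑-*ˡ xs ⟦ a ≡ᵇ 0 ⟧ _) (∑-cong xs (λ x → *-swapℤ ⟦ a ≡ᵇ 0 ⟧ (c x) _))
  removals-∑ s a (b ∷ β) xs c φ = begin
    ∑ (upTo N) (λ k → C k *ℤ (D k *ℤ removals s (a ∸ k) β (λ β' → ∑ xs (λ x → c x *ℤ φ x (b ∸ k ∷ β')))))
      ≡⟨ ∑-cong (upTo N) (λ k → begin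
        C k *ℤ (D k *ℤ removals s (a ∸ k) β (λ β' → ∑ xs (λ x → c x *ℤ φ x (b ∸ k ∷ β'))))
          ≡⟨ cong (λ y → C k *ℤ (D k *ℤ y)) (removals-∑ s (a ∸ k) β xs c (λ x β' → φ x (b ∸ k ∷ β'))) ⟩
        C k *ℤ (D k *ℤ ∑ xs (λ x → c x *ℤ Y k x))
          ≡⟨ trans (cong (C k *ℤ_) (∑-*ˡ xs (D k) _)) (∑-*ˡ xs (C k) _) ⟩
        ∑ xs (λ x → C k *ℤ (D k *ℤ (c x *ℤ Y k x)))
          ≡⟨ ∑-cong xs (λ x → trans (cong (C k *ℤ_) (*-swapℤ (D k) (c x) _)) (*-swapℤ (C k) (c x) _)) ⟩
        ∑ xs (λ x → c x *ℤ (C k *ℤ (D k *ℤ Y k x))) ∎) ⟩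
    ∑ (upTo N) (λ k → ∑ xs (λ x → c x *ℤ (C k *ℤ (D k *ℤ Y k x))))
      ≡⟨ ∑-swap (upTo N) xs _ ⟩
    ∑ xs (λ x → ∑ (upTo N) (λ k → c x *ℤ (C k *ℤ (D k *ℤ Y k x))))
      ≡⟨ ∑-cong xs (λ x → sym (∑-*ˡ (upTo N) (c x) _)) ⟩
    ∑ xs (λ x → c x *ℤ removals s a (b ∷ β) (φ x)) ∎
    where
    C D : ℕ → ℤ
    C k = ⟦ mult s k ⟧
    D k = ⟦ (k ≤ᵇ a) ∧ (k ≤ᵇ b) ⟧
    Y : ℕ → _ → ℤ
    Y k x = removals s (a ∸ k) β (λ β' → φ x (b ∸ k ∷ β'))

  sum≡0⇒zero : ∀ l → sumℕ l ≡ 0 → zeroᵇ l ≡ true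
  sum≡0⇒zero []      e = refl
  sum≡0⇒zero (x ∷ l) e = ∧⁺ (≡ᵇ⁺ (ℕₚ.m+n≡0⇒m≡0 x e)) (sum≡0⇒zero l (ℕₚ.m+n≡0⇒n≡0 x e))

  zero⇒sum≡0 : ∀ l → zeroᵇ l ≡ true → sumℕ l ≡ 0
  zero⇒sum≡0 []      e = refl
  zero⇒sum≡0 (x ∷ l) e = cong₂ _+_ (≡ᵇ⁻ {x} (proj₁ (∧⁻ e))) (zero⇒sum≡0 l (proj₂ (∧⁻ {x ≡ᵇ 0} e)))

  zero⇒rep : ∀ l → zeroᵇ l ≡ true → l ≡ rep (length l) 0
  zero⇒rep []      e = refl
  zero⇒rep (x ∷ l) e = cong₂ _∷_ (≡ᵇ⁻ {x} (proj₁ (∧⁻ e))) (zero⇒rep l (proj₂ (∧⁻ {x ≡ᵇ 0} e)))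

  zero-rep : ∀ k → zeroᵇ (rep k 0) ≡ true
  zero-rep zero    = refl
  zero-rep (suc k) = zero-rep k

  hsT-rep : ∀ u k → hsT u (rep k 0) (rep k 0) ≡ true
  hsT-rep u zero    = refl
  hsT-rep u (suc k) = hsT-rep 0 k

  vs-rep : ∀ k → vsᵇ (rep k 0) (rep k 0) ≡ true
  vs-rep zero    = refl
  vs-rep (suc k) = vs-rep k

  ninc-rep : ∀ u k → ninc u (rep k 0) ≡ true
  ninc-rep u zero    = refl
  ninc-rep u (suc k) = ninc-rep 0 k

  st-rep : ∀ s k → st s (rep k 0) (rep k 0) ≡ true
  st-rep false k = hsT-rep t k
  st-rep true  k = ∧⁺ (vs-rep k) (∧⁺ (ninc-rep t k) (ninc-rep t k))

  length-rep : ∀ k → length (rep k 0) ≡ k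
  length-rep k = Listₚ.length-replicate k

  Once-P : ∀ l → length l ≡ M → All (_< N) l → Once _≟ₗ_ P l
  Once-P l len b = subst (λ k → Once _≟ₗ_ (listsOf (upTo N) k) l) len (Once-lists (upTo N) l (All.map Once-upTo b))

  ∑-zeroᵇ : (f : List ℕ → ℤ) → ∑ P (λ l → ⟦ zeroᵇ l ⟧ *ℤ f l) ≡ f (rep M 0)
  ∑-zeroᵇ f = trans
    (∑-cong-∈ P (λ {l} l∈ → cong (λ b → ⟦ b ⟧ *ℤ f l) (bool-iff
      (λ e → dec-true (l ≟ₗ rep M 0) (trans (zero⇒rep l e) (cong (λ k → rep k 0) (proj₁ (∈-listsOf⁻ (upTo N) M l∈)))))
      (λ e → subst (λ z → zeroᵇ z ≡ true) (sym (does-true (l ≟ₗ rep M 0) e)) (zero-rep M)))))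
    (Once-P (rep M 0) (length-rep M) (Allₚ.replicate⁺ M (s≤s z≤n)) f)

  -- The tested weight is |λ| in the commutation rule. Since |λ| - |μ| = k + |ν| - |κ| and |λ| - |ν|
  -- = k + |μ| - |κ|, strips of sizes `a` and `b` above correspond to strips of sizes a - k and b -
  -- k below, with k at most both.
  weight-split : ∀ k a b sμ sν sκ → sκ ≤ sμ → sκ ≤ sν →
    (k + (sμ + sν ∸ sκ) ≡ᵇ sμ + a) ∧ (k + (sμ + sν ∸ sκ) ≡ᵇ sν + b) ≡
    ((k ≤ᵇ a) ∧ (k ≤ᵇ b)) ∧ ((sμ ≡ᵇ sκ + (b ∸ k)) ∧ (sν ≡ᵇ sκ + (a ∸ k)))
  weight-split k a b sμ sν sκ κ≤μ κ≤ν with ℕₚ.m≤n⇒∃[o]m+o≡n κ≤μ | ℕₚ.m≤n⇒∃[o]m+o≡n κ≤ν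
  ... | x , refl | y , refl = bool-iff
    (λ e → let (e₁ , e₂) = ∧⁻ {k + (sκ + x + (sκ + y) ∸ sκ) ≡ᵇ sκ + x + a} e
               p : k + y ≡ a
               p = ℕₚ.+-cancelˡ-≡ (sκ + x) (k + y) a (trans (sym (expand₁ k x y)) (≡ᵇ⁻ {k + (sκ + x + (sκ + y) ∸ sκ)} e₁))
               q : k + x ≡ b
               q = ℕₚ.+-cancelˡ-≡ (sκ + y) (k + x) b (trans (sym (expand₂ k x y)) (≡ᵇ⁻ {k + (sκ + x + (sκ + y) ∸ sκ)} e₂))
           in ∧⁺ (∧⁺ (≤ᵇ⁺ (subst (k ≤_) p (ℕₚ.m≤m+n k y))) (≤ᵇ⁺ (subst (k ≤_) q (ℕₚ.m≤m+n k x))))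
                 (∧⁺ (≡ᵇ⁺ (cong (ℕ._+_ sκ) (sym (trans (cong (_∸ k) (sym q)) (ℕₚ.m+n∸m≡n k x)))))
                     (≡ᵇ⁺ (cong (ℕ._+_ sκ) (sym (trans (cong (_∸ k) (sym p)) (ℕₚ.m+n∸m≡n k y)))))))
    (λ e → let (e₁ , e₂) = ∧⁻ {(k ≤ᵇ a) ∧ (k ≤ᵇ b)} e
               (k≤a , k≤b) = ∧⁻ {k ≤ᵇ a} e₁
               (p , q) = ∧⁻ {sκ + x ≡ᵇ sκ + (b ∸ k)} e₂
               x≡ = ℕₚ.+-cancelˡ-≡ sκ x (b ∸ k) (≡ᵇ⁻ {sκ + x} p)
               y≡ = ℕₚ.+-cancelˡ-≡ sκ y (a ∸ k) (≡ᵇ⁻ {sκ + y} q)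
           in ∧⁺ (≡ᵇ⁺ (trans (expand₁ k x y) (cong (ℕ._+_ (sκ + x)) (trans (cong (ℕ._+_ k) y≡) (ℕₚ.m+[n∸m]≡n (≤ᵇ⁻ {k} k≤a))))))
                 (≡ᵇ⁺ (trans (expand₂ k x y) (cong (ℕ._+_ (sκ + y)) (trans (cong (ℕ._+_ k) x≡) (ℕₚ.m+[n∸m]≡n (≤ᵇ⁻ {k} k≤b)))))))
    where
    base : ∀ k x y → k + (sκ + x + (sκ + y) ∸ sκ) ≡ k + (x + (sκ + y))
    base k x y = cong (ℕ._+_ k) (trans (cong (_∸ sκ) (ℕₚ.+-assoc sκ x (sκ + y))) (ℕₚ.m+n∸m≡n sκ (x + (sκ + y))))
    arr₁ : ∀ c k x y → k + (x + (c + y)) ≡ (c + x) + (k + y)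
    arr₁ = solve-∀
    arr₂ : ∀ c k x y → k + (x + (c + y)) ≡ (c + y) + (k + x)
    arr₂ = solve-∀
    expand₁ : ∀ k x y → k + (sκ + x + (sκ + y) ∸ sκ) ≡ (sκ + x) + (k + y)
    expand₁ k x y = trans (base k x y) (arr₁ sκ k x y)
    expand₂ : ∀ k x y → k + (sκ + x + (sκ + y) ∸ sκ) ≡ (sκ + y) + (k + x)
    expand₂ k x y = trans (base k x y) (arr₂ sκ k x y)

  -- The coefficient of x^α in s_μ h_a = ∑ s_λ, or for the flag `true` in the conjugate rule s_μ'
  -- e_a = ∑ s_λ': the factor h_a or e_a takes a monomial of degree `a` out of x^α. The induction
  -- moves the horizontal strip past one strip of the chain at a time; the `k` cells it loses there
  -- are the units taken from that entry of α.
  pieri : ∀ s α a μ → length μ ≡ M → ninc t μ ≡ true → lastOr t μ ≡ 0 → sumℕ μ + a ≤ t →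
    ∑ P (λ l → ⟦ hsT t l μ ⟧ *ℤ (⟦ sumℕ l ≡ᵇ sumℕ μ + a ⟧ *ℤ K s α l)) ≡ removals s a α (λ α' → K s α' μ)
  pieri s [] a μ lμ nμ z bound = begin
    ∑ P (λ l → ⟦ hsT t l μ ⟧ *ℤ (⟦ sumℕ l ≡ᵇ sumℕ μ + a ⟧ *ℤ ⟦ zeroᵇ l ⟧))
      ≡⟨ ∑-cong P (λ l → rot ⟦ hsT t l μ ⟧ ⟦ sumℕ l ≡ᵇ sumℕ μ + a ⟧ ⟦ zeroᵇ l ⟧) ⟩
    ∑ P (λ l → ⟦ zeroᵇ l ⟧ *ℤ (⟦ hsT t l μ ⟧ *ℤ ⟦ sumℕ l ≡ᵇ sumℕ μ + a ⟧))
      ≡⟨ ∑-zeroᵇ (λ l → ⟦ hsT t l μ ⟧ *ℤ ⟦ sumℕ l ≡ᵇ sumℕ μ + a ⟧) ⟩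
    ⟦ hsT t (rep M 0) μ ⟧ *ℤ ⟦ sumℕ (rep M 0) ≡ᵇ sumℕ μ + a ⟧
      ≡⟨ sym (⟦∧⟧ (hsT t (rep M 0) μ) _) ⟩
    ⟦ hsT t (rep M 0) μ ∧ (sumℕ (rep M 0) ≡ᵇ sumℕ μ + a) ⟧
      ≡⟨ cong ⟦_⟧ (bool-iff
           (λ e → let s0 = sym (trans (sym (zero⇒sum≡0 (rep M 0) (zero-rep M))) (≡ᵇ⁻ {sumℕ (rep M 0)} (proj₂ (∧⁻ {hsT t (rep M 0) μ} e))))
                  in ∧⁺ (≡ᵇ⁺ (ℕₚ.m+n≡0⇒n≡0 (sumℕ μ) s0)) (sum≡0⇒zero μ (ℕₚ.m+n≡0⇒m≡0 (sumℕ μ) s0)))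
           (λ e → let (a0 , μ0) = ∧⁻ {a ≡ᵇ 0} e in
                  ∧⁺ (subst (λ x → hsT t (rep M 0) x ≡ true) (sym (trans (zero⇒rep μ μ0) (cong (λ k → rep k 0) lμ))) (hsT-rep t M))
                     (≡ᵇ⁺ (trans (zero⇒sum≡0 (rep M 0) (zero-rep M)) (sym (cong₂ _+_ (zero⇒sum≡0 μ μ0) (≡ᵇ⁻ {a} a0))))))) ⟩
    ⟦ (a ≡ᵇ 0) ∧ zeroᵇ μ ⟧
      ≡⟨ ⟦∧⟧ (a ≡ᵇ 0) (zeroᵇ μ) ⟩
    ⟦ a ≡ᵇ 0 ⟧ *ℤ ⟦ zeroᵇ μ ⟧ ∎
    where
    rot : ∀ x y z → x *ℤ (y *ℤ z) ≡ z *ℤ (x *ℤ y)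
    rot = solve-∀ℤ
  pieri s (b ∷ β) a μ lμ nμ z bound = begin
    ∑ P (λ l → ⟦ hsT t l μ ⟧ *ℤ (⟦ sumℕ l ≡ᵇ sumℕ μ + a ⟧ *ℤ ∑ P (λ ν → ⟦ st s l ν ⟧ *ℤ (⟦ sumℕ l ≡ᵇ sumℕ ν + b ⟧ *ℤ K s β ν))))
      ≡⟨ ∑-cong P (λ l → trans (trans (cong (⟦ hsT t l μ ⟧ *ℤ_) (∑-*ˡ P ⟦ sumℕ l ≡ᵇ sumℕ μ + a ⟧ _)) (∑-*ˡ P ⟦ hsT t l μ ⟧ _))
           (∑-cong P (λ ν → arr₁ ⟦ hsT t l μ ⟧ ⟦ sumℕ l ≡ᵇ sumℕ μ + a ⟧ ⟦ st s l ν ⟧ ⟦ sumℕ l ≡ᵇ sumℕ ν + b ⟧ (K s β ν)))) ⟩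
    ∑ P (λ l → ∑ P (λ ν → K s β ν *ℤ (⟦ hsT t l μ ⟧ *ℤ (⟦ st s l ν ⟧ *ℤ g ν (sumℕ l)))))
      ≡⟨ ∑-swap P P _ ⟩
    ∑ P (λ ν → ∑ P (λ l → K s β ν *ℤ (⟦ hsT t l μ ⟧ *ℤ (⟦ st s l ν ⟧ *ℤ g ν (sumℕ l)))))
      ≡⟨ ∑-cong-∈ P (λ {ν} ν∈ → trans (sym (∑-*ˡ P (K s β ν) _)) (cong (K s β ν *ℤ_)
           (commutation s μ ν lμ (proj₁ (∈-listsOf⁻ (upTo N) M ν∈)) nμ z (g ν) (vanish ν)))) ⟩
    ∑ P (λ ν → K s β ν *ℤ ∑ (upTo N) (λ k → ⟦ mult s k ⟧ *ℤ ∑ P (λ κ → ⟦ st s μ κ ⟧ *ℤ (⟦ hsT t ν κ ⟧ *ℤ g ν (w k ν κ)))))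
      ≡⟨ ∑-cong P (λ ν → trans (∑-*ˡ (upTo N) (K s β ν) _) (∑-cong (upTo N) (λ k → *-swapℤ (K s β ν) ⟦ mult s k ⟧ _))) ⟩
    ∑ P (λ ν → ∑ (upTo N) (λ k → ⟦ mult s k ⟧ *ℤ (K s β ν *ℤ ∑ P (λ κ → ⟦ st s μ κ ⟧ *ℤ (⟦ hsT t ν κ ⟧ *ℤ g ν (w k ν κ))))))
      ≡⟨ ∑-swap P (upTo N) _ ⟩
    ∑ (upTo N) (λ k → ∑ P (λ ν → ⟦ mult s k ⟧ *ℤ (K s β ν *ℤ ∑ P (λ κ → ⟦ st s μ κ ⟧ *ℤ (⟦ hsT t ν κ ⟧ *ℤ g ν (w k ν κ))))))
      ≡⟨ ∑-cong (upTo N) (λ k → trans (sym (∑-*ˡ P ⟦ mult s k ⟧ _)) (cong (⟦ mult s k ⟧ *ℤ_) (inner k))) ⟩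
    removals s a (b ∷ β) (λ α' → K s α' μ) ∎
    where
    arr₁ : ∀ x y z v k → x *ℤ (y *ℤ (z *ℤ (v *ℤ k))) ≡ k *ℤ (x *ℤ (z *ℤ (y *ℤ v)))
    arr₁ = solve-∀ℤ
    arr₂ : ∀ k x y c p q → x *ℤ (y *ℤ (c *ℤ (p *ℤ q))) *ℤ k ≡ c *ℤ (x *ℤ (p *ℤ (y *ℤ (q *ℤ k))))
    arr₂ = solve-∀ℤ
    g : List ℕ → ℕ → ℤ
    g ν x = ⟦ x ≡ᵇ sumℕ μ + a ⟧ *ℤ ⟦ x ≡ᵇ sumℕ ν + b ⟧
    vanish : ∀ ν x → t < x → g ν x ≡ + 0
    vanish ν x t<x = guard-false _ (≡false (λ e → ℕₚ.<⇒≱ t<x (ℕₚ.≤-trans (ℕₚ.≤-reflexive (≡ᵇ⁻ {x} e)) bound)))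
    w : ℕ → List ℕ → List ℕ → ℕ
    w k ν κ = k + (sumℕ μ + sumℕ ν ∸ sumℕ κ)
    inner : ∀ k → ∑ P (λ ν → K s β ν *ℤ ∑ P (λ κ → ⟦ st s μ κ ⟧ *ℤ (⟦ hsT t ν κ ⟧ *ℤ g ν (w k ν κ)))) ≡
      ⟦ (k ≤ᵇ a) ∧ (k ≤ᵇ b) ⟧ *ℤ removals s (a ∸ k) β (λ β' → K s (b ∸ k ∷ β') μ)
    inner k = begin
      ∑ P (λ ν → K s β ν *ℤ ∑ P (λ κ → ⟦ st s μ κ ⟧ *ℤ (⟦ hsT t ν κ ⟧ *ℤ g ν (w k ν κ))))
        ≡⟨ ∑-cong P (λ ν → trans (ℤₚ.*-comm (K s β ν) _) (∑-*ʳ P _ (K s β ν))) ⟩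
      ∑ P (λ ν → ∑ P (λ κ → ⟦ st s μ κ ⟧ *ℤ (⟦ hsT t ν κ ⟧ *ℤ g ν (w k ν κ)) *ℤ K s β ν))
        ≡⟨ ∑-cong P (λ ν → ∑-cong P (λ κ → trans (cong (_*ℤ K s β ν) (term ν κ))
             (arr₂ (K s β ν) ⟦ st s μ κ ⟧ ⟦ hsT t ν κ ⟧ E ⟦ sumℕ μ ≡ᵇ sumℕ κ + (b ∸ k) ⟧ ⟦ sumℕ ν ≡ᵇ sumℕ κ + (a ∸ k) ⟧))) ⟩
      ∑ P (λ ν → ∑ P (λ κ → E *ℤ (⟦ st s μ κ ⟧ *ℤ (⟦ sumℕ μ ≡ᵇ sumℕ κ + (b ∸ k) ⟧ *ℤ
          (⟦ hsT t ν κ ⟧ *ℤ (⟦ sumℕ ν ≡ᵇ sumℕ κ + (a ∸ k) ⟧ *ℤ K s β ν))))))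
        ≡⟨ ∑-swap P P _ ⟩
      ∑ P (λ κ → ∑ P (λ ν → E *ℤ (⟦ st s μ κ ⟧ *ℤ (⟦ sumℕ μ ≡ᵇ sumℕ κ + (b ∸ k) ⟧ *ℤ
          (⟦ hsT t ν κ ⟧ *ℤ (⟦ sumℕ ν ≡ᵇ sumℕ κ + (a ∸ k) ⟧ *ℤ K s β ν))))))
        ≡⟨ ∑-cong P (λ κ → sym (trans (cong (λ x → E *ℤ (⟦ st s μ κ ⟧ *ℤ x)) (∑-*ˡ P ⟦ sumℕ μ ≡ᵇ sumℕ κ + (b ∸ k) ⟧ _))
             (trans (cong (E *ℤ_) (∑-*ˡ P ⟦ st s μ κ ⟧ _)) (∑-*ˡ P E _)))) ⟩
      ∑ P (λ κ → E *ℤ (⟦ st s μ κ ⟧ *ℤ (⟦ sumℕ μ ≡ᵇ sumℕ κ + (b ∸ k) ⟧ *ℤ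
          ∑ P (λ ν → ⟦ hsT t ν κ ⟧ *ℤ (⟦ sumℕ ν ≡ᵇ sumℕ κ + (a ∸ k) ⟧ *ℤ K s β ν)))))
        ≡⟨ sym (∑-*ˡ P E _) ⟩
      E *ℤ ∑ P (λ κ → ⟦ st s μ κ ⟧ *ℤ (⟦ sumℕ μ ≡ᵇ sumℕ κ + (b ∸ k) ⟧ *ℤ
          ∑ P (λ ν → ⟦ hsT t ν κ ⟧ *ℤ (⟦ sumℕ ν ≡ᵇ sumℕ κ + (a ∸ k) ⟧ *ℤ K s β ν))))
        ≡⟨ cong (E *ℤ_) (∑-cong-∈ P (λ {κ} κ∈ → trans (guard (st s μ κ) (λ e → cong (⟦ sumℕ μ ≡ᵇ sumℕ κ + (b ∸ k) ⟧ *ℤ_)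
             (pieri s β (a ∸ k) κ (proj₁ (∈-listsOf⁻ (upTo N) M κ∈)) (st-ninc₂ s μ κ e) (st-last s μ κ e z)
               (ℕₚ.≤-trans (ℕₚ.+-mono-≤ (st-sum s μ κ e) (ℕₚ.m∸n≤m a k)) bound))))
             (sym (ℤₚ.*-assoc ⟦ st s μ κ ⟧ _ _)))) ⟩
      E *ℤ ∑ P (λ κ → (⟦ st s μ κ ⟧ *ℤ ⟦ sumℕ μ ≡ᵇ sumℕ κ + (b ∸ k) ⟧) *ℤ removals s (a ∸ k) β (λ β' → K s β' κ))
        ≡⟨ cong (E *ℤ_) (sym (removals-∑ s (a ∸ k) β P (λ κ → ⟦ st s μ κ ⟧ *ℤ ⟦ sumℕ μ ≡ᵇ sumℕ κ + (b ∸ k) ⟧) (λ κ β' → K s β' κ))) ⟩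
      E *ℤ removals s (a ∸ k) β (λ β' → ∑ P (λ κ → (⟦ st s μ κ ⟧ *ℤ ⟦ sumℕ μ ≡ᵇ sumℕ κ + (b ∸ k) ⟧) *ℤ K s β' κ))
        ≡⟨ cong (E *ℤ_) (removals-cong s (a ∸ k) β (λ β' → ∑-cong P (λ κ → ℤₚ.*-assoc ⟦ st s μ κ ⟧ _ _))) ⟩
      E *ℤ removals s (a ∸ k) β (λ β' → K s (b ∸ k ∷ β') μ) ∎
      where
      E : ℤ
      E = ⟦ (k ≤ᵇ a) ∧ (k ≤ᵇ b) ⟧
      term : ∀ ν κ → ⟦ st s μ κ ⟧ *ℤ (⟦ hsT t ν κ ⟧ *ℤ g ν (w k ν κ)) ≡
        ⟦ st s μ κ ⟧ *ℤ (⟦ hsT t ν κ ⟧ *ℤ (E *ℤ (⟦ sumℕ μ ≡ᵇ sumℕ κ + (b ∸ k) ⟧ *ℤ ⟦ sumℕ ν ≡ᵇ sumℕ κ + (a ∸ k) ⟧)))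
      term ν κ = guard (st s μ κ) (λ e₁ → guard (hsT t ν κ) (λ e₂ → begin
        g ν (w k ν κ)  ≡⟨ sym (⟦∧⟧ (w k ν κ ≡ᵇ sumℕ μ + a) _) ⟩
        ⟦ (w k ν κ ≡ᵇ sumℕ μ + a) ∧ (w k ν κ ≡ᵇ sumℕ ν + b) ⟧
          ≡⟨ cong ⟦_⟧ (weight-split k a b (sumℕ μ) (sumℕ ν) (sumℕ κ) (st-sum s μ κ e₁) (hsT-sum t ν κ e₂)) ⟩
        ⟦ ((k ≤ᵇ a) ∧ (k ≤ᵇ b)) ∧ ((sumℕ μ ≡ᵇ sumℕ κ + (b ∸ k)) ∧ (sumℕ ν ≡ᵇ sumℕ κ + (a ∸ k))) ⟧
          ≡⟨ trans (⟦∧⟧ ((k ≤ᵇ a) ∧ (k ≤ᵇ b)) _) (cong (E *ℤ_) (⟦∧⟧ (sumℕ μ ≡ᵇ sumℕ κ + (b ∸ k)) _)) ⟩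
        E *ℤ (⟦ sumℕ μ ≡ᵇ sumℕ κ + (b ∸ k) ⟧ *ℤ ⟦ sumℕ ν ≡ᵇ sumℕ κ + (a ∸ k) ⟧) ∎))

  -- A nonzero `K` comes from an actual chain of strips down to the empty shape. Inserting this
  -- indicator supplies the hypotheses of `pieri` inside a sum over all lists.
  K-support : ∀ s α l → K s α l ≡ ⟦ ninc t l ∧ (sumℕ l ≡ᵇ sumℕ α) ⟧ *ℤ K s α l
  K-support s [] l with zeroᵇ l in e
  ... | false = sym (ℤₚ.*-zeroʳ ⟦ ninc t l ∧ (sumℕ l ≡ᵇ 0) ⟧)
  ... | true  = sym (guard-true (+ 1) (∧⁺ (subst (λ x → ninc t x ≡ true) (sym (zero⇒rep l e)) (ninc-rep t (length l)))
                  (≡ᵇ⁺ (zero⇒sum≡0 l e))))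
  K-support s (a ∷ α) l = sym (trans (∑-*ˡ P C _) (∑-cong P (λ μ → begin
    C *ℤ (⟦ st s l μ ⟧ *ℤ (⟦ sumℕ l ≡ᵇ sumℕ μ + a ⟧ *ℤ K s α μ))
      ≡⟨ trans (*-swapℤ C ⟦ st s l μ ⟧ _) (cong (⟦ st s l μ ⟧ *ℤ_) (*-swapℤ C ⟦ sumℕ l ≡ᵇ sumℕ μ + a ⟧ _)) ⟩
    ⟦ st s l μ ⟧ *ℤ (⟦ sumℕ l ≡ᵇ sumℕ μ + a ⟧ *ℤ (C *ℤ K s α μ))
      ≡⟨ guard (st s l μ) (λ e₁ → guard (sumℕ l ≡ᵇ sumℕ μ + a) (λ e₂ → begin
           C *ℤ K s α μ              ≡⟨ cong (C *ℤ_) (K-support s α μ) ⟩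
           C *ℤ (⟦ D μ ⟧ *ℤ K s α μ) ≡⟨ *-swapℤ C ⟦ D μ ⟧ _ ⟩
           ⟦ D μ ⟧ *ℤ (C *ℤ K s α μ) ≡⟨ guard (D μ) (λ e₃ → guard-true (K s α μ) (∧⁺ (st-ninc s l μ e₁) (≡ᵇ⁺
              (trans (≡ᵇ⁻ {sumℕ l} e₂) (trans (cong (_+ a) (≡ᵇ⁻ {sumℕ μ} (proj₂ (∧⁻ {ninc t μ} e₃)))) (ℕₚ.+-comm (sumℕ α) a)))))) ⟩
           ⟦ D μ ⟧ *ℤ K s α μ        ≡⟨ sym (K-support s α μ) ⟩
           K s α μ                   ∎)) ⟩
    ⟦ st s l μ ⟧ *ℤ (⟦ sumℕ l ≡ᵇ sumℕ μ + a ⟧ *ℤ K s α μ) ∎)))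
    where
    C : ℤ
    C = ⟦ ninc t l ∧ (sumℕ l ≡ᵇ sumℕ (a ∷ α)) ⟧
    D : List ℕ → Bool
    D μ = ninc t μ ∧ (sumℕ μ ≡ᵇ sumℕ α)

  K-zero : ∀ s β → K s β (rep M 0) ≡ ⟦ zeroᵇ β ⟧
  K-zero s []      = cong ⟦_⟧ (zero-rep M)
  K-zero s (b ∷ β) = begin
    ∑ P (λ μ → ⟦ st s (rep M 0) μ ⟧ *ℤ (⟦ sumℕ (rep M 0) ≡ᵇ sumℕ μ + b ⟧ *ℤ K s β μ))
      ≡⟨ ∑-cong-∈ P (λ {μ} μ∈ → begin
        ⟦ st s (rep M 0) μ ⟧ *ℤ (⟦ sumℕ (rep M 0) ≡ᵇ sumℕ μ + b ⟧ *ℤ K s β μ)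
          ≡⟨ sym (guard-∧ (st s (rep M 0) μ) _ _) ⟩
        ⟦ st s (rep M 0) μ ∧ (sumℕ (rep M 0) ≡ᵇ sumℕ μ + b) ⟧ *ℤ K s β μ
          ≡⟨ cong (λ c → ⟦ c ⟧ *ℤ K s β μ) (bool-iff
               (λ e → let s0 = sym (trans (sym (zero⇒sum≡0 (rep M 0) (zero-rep M))) (≡ᵇ⁻ {sumℕ (rep M 0)} (proj₂ (∧⁻ {st s (rep M 0) μ} e))))
                      in ∧⁺ (sum≡0⇒zero μ (ℕₚ.m+n≡0⇒m≡0 (sumℕ μ) s0)) (≡ᵇ⁺ (ℕₚ.m+n≡0⇒n≡0 (sumℕ μ) s0)))
               (λ e → let (μ0 , b0) = ∧⁻ {zeroᵇ μ} e in
                      ∧⁺ (subst (λ x → st s (rep M 0) x ≡ true)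
                           (sym (trans (zero⇒rep μ μ0) (cong (λ k → rep k 0) (proj₁ (∈-listsOf⁻ (upTo N) M μ∈))))) (st-rep s M))
                         (≡ᵇ⁺ (trans (zero⇒sum≡0 (rep M 0) (zero-rep M)) (sym (cong₂ _+_ (zero⇒sum≡0 μ μ0) (≡ᵇ⁻ {b} b0))))))) ⟩
        ⟦ zeroᵇ μ ∧ (b ≡ᵇ 0) ⟧ *ℤ K s β μ
          ≡⟨ guard-∧ (zeroᵇ μ) (b ≡ᵇ 0) _ ⟩
        ⟦ zeroᵇ μ ⟧ *ℤ (⟦ b ≡ᵇ 0 ⟧ *ℤ K s β μ) ∎) ⟩
    ∑ P (λ μ → ⟦ zeroᵇ μ ⟧ *ℤ (⟦ b ≡ᵇ 0 ⟧ *ℤ K s β μ))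
      ≡⟨ ∑-zeroᵇ (λ μ → ⟦ b ≡ᵇ 0 ⟧ *ℤ K s β μ) ⟩
    ⟦ b ≡ᵇ 0 ⟧ *ℤ K s β (rep M 0)
      ≡⟨ cong (⟦ b ≡ᵇ 0 ⟧ *ℤ_) (K-zero s β) ⟩
    ⟦ b ≡ᵇ 0 ⟧ *ℤ ⟦ zeroᵇ β ⟧
      ≡⟨ sym (⟦∧⟧ (b ≡ᵇ 0) _) ⟩
    ⟦ zeroᵇ (b ∷ β) ⟧ ∎

  -- Unfolding the outermost strip of the first chain leaves, for fixed μ, a sum over λ to which
  -- `pieri` applies; this produces the first row of the matrix. As `M` exceeds every size that
  -- occurs, the last row of μ is empty.
  cauchy : t < M → ∀ s α β → sumℕ α ≤ t → ∑ P (λ l → K false α l *ℤ K s β l) ≡ matrices s α β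
  cauchy t<M s [] β _ = trans (∑-zeroᵇ (K s β)) (K-zero s β)
  cauchy t<M s (a ∷ α) β bound = begin
    ∑ P (λ l → K false (a ∷ α) l *ℤ K s β l)
      ≡⟨ ∑-cong P (λ l → trans (∑-*ʳ P _ (K s β l)) (∑-cong P (λ μ → arr ⟦ hsT t l μ ⟧ ⟦ sumℕ l ≡ᵇ sumℕ μ + a ⟧ (K false α μ) (K s β l)))) ⟩
    ∑ P (λ l → ∑ P (λ μ → K false α μ *ℤ (⟦ hsT t l μ ⟧ *ℤ (⟦ sumℕ l ≡ᵇ sumℕ μ + a ⟧ *ℤ K s β l))))
      ≡⟨ ∑-swap P P _ ⟩
    ∑ P (λ μ → ∑ P (λ l → K false α μ *ℤ (⟦ hsT t l μ ⟧ *ℤ (⟦ sumℕ l ≡ᵇ sumℕ μ + a ⟧ *ℤ K s β l))))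
      ≡⟨ ∑-cong-∈ P (λ {μ} μ∈ → trans (sym (∑-*ˡ P (K false α μ) _)) (step μ (proj₁ (∈-listsOf⁻ (upTo N) M μ∈)))) ⟩
    ∑ P (λ μ → K false α μ *ℤ removals s a β (λ β' → K s β' μ))
      ≡⟨ sym (removals-∑ s a β P (K false α) (λ μ β' → K s β' μ)) ⟩
    removals s a β (λ β' → ∑ P (λ μ → K false α μ *ℤ K s β' μ))
      ≡⟨ removals-cong s a β (λ β' → cauchy t<M s α β' (ℕₚ.≤-trans (ℕₚ.m≤n+m (sumℕ α) a) bound)) ⟩
    removals s a β (matrices s α) ∎
    where
    arr : ∀ x y z w → x *ℤ (y *ℤ z) *ℤ w ≡ z *ℤ (x *ℤ (y *ℤ w))
    arr = solve-∀ℤ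
    step : ∀ μ → length μ ≡ M → K false α μ *ℤ ∑ P (λ l → ⟦ hsT t l μ ⟧ *ℤ (⟦ sumℕ l ≡ᵇ sumℕ μ + a ⟧ *ℤ K s β l)) ≡
      K false α μ *ℤ removals s a β (λ β' → K s β' μ)
    step μ lμ = begin
      K false α μ *ℤ X                     ≡⟨ cong (_*ℤ X) (K-support false α μ) ⟩
      ⟦ D ⟧ *ℤ K false α μ *ℤ X            ≡⟨ ℤₚ.*-assoc ⟦ D ⟧ _ X ⟩
      ⟦ D ⟧ *ℤ (K false α μ *ℤ X)          ≡⟨ guard D (λ e → cong (K false α μ *ℤ_)
          (let (e₁ , e₂) = ∧⁻ {ninc t μ} e
               bd : sumℕ μ + a ≤ t
               bd = ℕₚ.≤-trans (ℕₚ.≤-reflexive (trans (cong (_+ a) (≡ᵇ⁻ {sumℕ μ} e₂)) (ℕₚ.+-comm (sumℕ α) a))) bound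
           in pieri s β a μ lμ e₁ (last≡0 t μ e₁ (ℕₚ.≤-<-trans (ℕₚ.≤-trans (ℕₚ.m≤m+n (sumℕ μ) a) bd) (subst (t <_) (sym lμ) t<M))) bd)) ⟩
      ⟦ D ⟧ *ℤ (K false α μ *ℤ Y)          ≡⟨ sym (ℤₚ.*-assoc ⟦ D ⟧ _ Y) ⟩
      ⟦ D ⟧ *ℤ K false α μ *ℤ Y            ≡⟨ cong (_*ℤ Y) (sym (K-support false α μ)) ⟩
      K false α μ *ℤ Y                     ∎
      where
      X Y : ℤ
      X = ∑ P (λ l → ⟦ hsT t l μ ⟧ *ℤ (⟦ sumℕ l ≡ᵇ sumℕ μ + a ⟧ *ℤ K s β l))
      Y = removals s a β (λ β' → K s β' μ)
      D : Bool
      D = ninc t μ ∧ (sumℕ μ ≡ᵇ sumℕ α)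

-- Counting words with prescribed content

cntL : List ℕ → ℕ → ℕ
cntL q b = count (_≡ᵇ b) q

contᵇ leᵇ : ℕ → (ℕ → ℕ) → List ℕ → Bool
contᵇ l c q = allᵇ (λ b → cntL q b ≡ᵇ c b) (upTo l)
leᵇ   l c q = allᵇ (λ b → cntL q b ≤ᵇ c b) (upTo l)

Rel : Bool → ℕ → ℕ → Bool
Rel false = _≤ᵇ_
Rel true  = _<ᵇ_

-- q is R-sorted along each block of equal letters of u
linkᵇ : (ℕ → ℕ → Bool) → ℕ → ℕ → List ℕ → List ℕ → Bool
linkᵇ R x y (x' ∷ _) (y' ∷ _) = not (x ≡ᵇ x') ∨ R y y'
linkᵇ R x y _        _        = true

bsᵇ : (ℕ → ℕ → Bool) → List ℕ → List ℕ → Bool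
bsᵇ R (x ∷ u) (y ∷ q) = linkᵇ R x y u q ∧ bsᵇ R u q
bsᵇ R _       _       = true

count-++ : (p : A → Bool) (xs ys : List A) → count p (xs ++ ys) ≡ count p xs + count p ys
count-++ p []       ys = refl
count-++ p (x ∷ xs) ys with p x
... | true  = cong suc (count-++ p xs ys)
... | false = count-++ p xs ys

cntL-rep : ∀ k z → cntL (rep k z) z ≡ k
cntL-rep zero    z = refl
cntL-rep (suc k) z rewrite ≡ᵇ⁺ {z} refl = cong suc (cntL-rep k z)

cntL-notin : ∀ {b} q → All (_≢ b) q → cntL q b ≡ 0
cntL-notin []      []         = refl
cntL-notin {b} (x ∷ q) (x≢b ∷ a) rewrite ≡false (λ e → x≢b (≡ᵇ⁻ {x} {b} e)) = cntL-notin q a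

cntL-rep-≢ : ∀ k {z b} → z ≢ b → cntL (rep k z) b ≡ 0
cntL-rep-≢ k z≢b = cntL-notin (rep k _) (Allₚ.replicate⁺ k z≢b)

cntL-++rep-≡ : ∀ k a u → All (_< k) u → cntL (u ++ rep a k) k ≡ a
cntL-++rep-≡ k a u b = trans (count-++ (_≡ᵇ k) u (rep a k)) (cong₂ _+_ (cntL-notin u (All.map ℕₚ.<⇒≢ b)) (cntL-rep a k))

cntL-++rep-< : ∀ k a u {x} → x < k → cntL (u ++ rep a k) x ≡ cntL u x
cntL-++rep-< k a u {x} x<k = trans (count-++ (_≡ᵇ x) u (rep a k)) (trans (cong (ℕ._+_ (cntL u x)) (cntL-rep-≢ a (ℕₚ.>⇒≢ x<k))) (ℕₚ.+-identityʳ _))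

allᵇ-upTo-suc : (p : ℕ → Bool) (l : ℕ) → allᵇ p (upTo (suc l)) ≡ allᵇ p (upTo l) ∧ p l
allᵇ-upTo-suc p l = bool-iff
  (λ e → ∧⁺ (allᵇ⁺ p (upTo l) (λ x∈ → allᵇ⁻ p (upTo (suc l)) e (∈ₚ.∈-upTo⁺ (ℕₚ.m<n⇒m<1+n (∈ₚ.∈-upTo⁻ x∈)))))
            (allᵇ⁻ p (upTo (suc l)) e (∈ₚ.∈-upTo⁺ (ℕₚ.n<1+n l))))
  (λ e → allᵇ⁺ p (upTo (suc l)) (λ {x} x∈ → case ℕₚ.m≤n⇒m<n∨m≡n (ℕₚ.≤-pred (∈ₚ.∈-upTo⁻ x∈)) of λ where
    (inj₁ x<l)  → allᵇ⁻ p (upTo l) (proj₁ (∧⁻ {allᵇ p (upTo l)} e)) (∈ₚ.∈-upTo⁺ x<l)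
    (inj₂ refl) → proj₂ (∧⁻ {allᵇ p (upTo l)} e)))

allᵇ-cong-∈ : (p q : A → Bool) (xs : List A) → (∀ {x} → x ∈ xs → p x ≡ q x) → allᵇ p xs ≡ allᵇ q xs
allᵇ-cong-∈ p q []       e = refl
allᵇ-cong-∈ p q (x ∷ xs) e = cong₂ _∧_ (e (here refl)) (allᵇ-cong-∈ p q xs (e ∘ there))

map-cong-upTo : ∀ {f g : ℕ → ℕ} l → (∀ {x} → x < l → f x ≡ g x) → map f (List.downFrom l) ≡ map g (List.downFrom l)
map-cong-upTo zero    e = refl
map-cong-upTo (suc l) e = cong₂ _∷_ (e (ℕₚ.n<1+n l)) (map-cong-upTo l (e ∘ ℕₚ.m<n⇒m<1+n))

∑-lists-+ : (xs : List A) (m a : ℕ) (f : List A → ℤ) →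
  ∑ (listsOf xs (m + a)) f ≡ ∑ (listsOf xs m) (λ q₁ → ∑ (listsOf xs a) (λ q₂ → f (q₁ ++ q₂)))
∑-lists-+ xs zero    a f = sym (ℤₚ.+-identityʳ _)
∑-lists-+ xs (suc m) a f = begin
  ∑ (listsOf xs (suc (m + a))) f
    ≡⟨ ∑-lists-suc xs (m + a) f ⟩
  ∑ (listsOf xs (m + a)) (λ q → ∑ xs (λ x → f (x ∷ q)))
    ≡⟨ ∑-lists-+ xs m a _ ⟩
  ∑ (listsOf xs m) (λ q₁ → ∑ (listsOf xs a) (λ q₂ → ∑ xs (λ x → f (x ∷ q₁ ++ q₂))))
    ≡⟨ ∑-cong (listsOf xs m) (λ q₁ → ∑-swap (listsOf xs a) xs _) ⟩
  ∑ (listsOf xs m) (λ q₁ → ∑ xs (λ x → ∑ (listsOf xs a) (λ q₂ → f (x ∷ q₁ ++ q₂))))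
    ≡⟨ sym (∑-lists-suc xs m _) ⟩
  ∑ (listsOf xs (suc m)) (λ q₁ → ∑ (listsOf xs a) (λ q₂ → f (q₁ ++ q₂))) ∎

-- `splitSum` is indexed by the letters that remain, `removals` by the copies split off; this passes
-- from one index to the other.
∑-upTo-reverse : ∀ a N → a < N → (f : ℕ → ℤ) → ∑ (upTo (suc a)) f ≡ ∑ (upTo N) (λ k → ⟦ k ≤ᵇ a ⟧ *ℤ f (a ∸ k))
∑-upTo-reverse a N a<N f = begin
  ∑ (upTo (suc a)) f                                        ≡⟨ sym (∑-upTo-guard a N a<N f) ⟩
  ∑ (upTo N) (λ m → ⟦ m ≤ᵇ a ⟧ *ℤ f m)                      ≡⟨ ∑-cong (upTo N) (λ m → cong (λ x → ⟦ x ≤ᵇ a ⟧ *ℤ f m) (sym (ℕₚ.+-identityʳ m))) ⟩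
  ∑ (upTo N) (λ m → ⟦ m + 0 ≤ᵇ a ⟧ *ℤ f m)                  ≡⟨ sym (reflect-interval 0 a N a<N f) ⟩
  ∑ (upTo N) (λ k → ⟦ k ≤ᵇ a ⟧ *ℤ f (a ∸ k))                ∎

split-upTo : (R : ℕ → ℕ → Bool) (l : ℕ) → (∀ {x} → x < l → R x l ≡ true) → (∀ {x} → x < l → R l x ≡ false) →
  ∀ a (g : List ℕ → ℤ) →
  ∑ (listsOf (upTo (suc l)) a) (λ q → ⟦ sortedᵇ R q ⟧ *ℤ g q) ≡ ∑ (upTo (suc a)) (splitSum R (upTo l) l a g)
split-upTo R l p₁ p₂ = split-sorted R (upTo l) (upTo (suc l)) l (∑-upTo-last l) (p₁ ∘ ∈ₚ.∈-upTo⁻) (p₂ ∘ ∈ₚ.∈-upTo⁻)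

Rel-< : ∀ s {x y} → x < y → Rel s x y ≡ true
Rel-< false x<y = ≤ᵇ⁺ (ℕₚ.<⇒≤ x<y)
Rel-< true  x<y = <ᵇ⁺ x<y

Rel-> : ∀ s {x y} → x < y → Rel s y x ≡ false
Rel-> false {x} {y} x<y = ≡false (λ e → ℕₚ.<⇒≱ x<y (≤ᵇ⁻ {y} e))
Rel-> true  {x} {y} x<y = ≡false (λ e → ℕₚ.<-asym x<y (<ᵇ⁻ {y} e))

sorted-last : ∀ k (u : List ℕ) → All (_< suc k) u → sortedᵇ _≤ᵇ_ u ≡ true →
  Σ (List ℕ) λ u₁ → Σ ℕ λ a → u ≡ u₁ ++ rep a k × All (_< k) u₁ × sortedᵇ _≤ᵇ_ u₁ ≡ true
sorted-last k [] _ _ = [] , 0 , refl , [] , refl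
sorted-last k (x ∷ u) (x<k ∷ b) e with sorted-last k u b (proj₂ (∧⁻ {headOK _≤ᵇ_ x u} e))
... | y ∷ u₁ , a , refl , y<k ∷ b₁ , s₁ = x ∷ y ∷ u₁ , a , refl , ℕₚ.≤-<-trans (≤ᵇ⁻ {x} (proj₁ (∧⁻ {x ≤ᵇ y} e))) y<k ∷ y<k ∷ b₁ ,
      ∧⁺ (proj₁ (∧⁻ {x ≤ᵇ y} e)) s₁
... | [] , a , refl , [] , s₁ with ℕₚ.m≤n⇒m<n∨m≡n (ℕₚ.≤-pred x<k)
...   | inj₁ lt   = x ∷ [] , a , refl , lt ∷ [] , refl
...   | inj₂ refl = [] , suc a , refl , [] , refl

bs-++ : ∀ R k u₁ q₁ a q₂ → All (_< k) u₁ → length q₁ ≡ length u₁ → length q₂ ≡ a →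
  bsᵇ R (u₁ ++ rep a k) (q₁ ++ q₂) ≡ bsᵇ R u₁ q₁ ∧ sortedᵇ R q₂
bs-++ R k [] [] a q₂ _ _ refl = block q₂
  where
  block : ∀ q → bsᵇ R (rep (length q) k) q ≡ sortedᵇ R q
  block []          = refl
  block (y ∷ [])    = refl
  block (y ∷ z ∷ q) = cong₂ _∧_ (cong (λ b → not b ∨ R y z) (≡ᵇ⁺ {k} refl)) (block (z ∷ q))
bs-++ R k (x ∷ u₁) (y ∷ q₁) a q₂ (x<k ∷ b) l₁ l₂ = trans
  (cong₂ _∧_ (link u₁ q₁ (ℕₚ.suc-injective l₁) a q₂ l₂) (bs-++ R k u₁ q₁ a q₂ b (ℕₚ.suc-injective l₁) l₂))
  (sym (Boolₚ.∧-assoc (linkᵇ R x y u₁ q₁) _ _))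
  where
  link : ∀ u₁ q₁ → length q₁ ≡ length u₁ → ∀ a q₂ → length q₂ ≡ a → linkᵇ R x y (u₁ ++ rep a k) (q₁ ++ q₂) ≡ linkᵇ R x y u₁ q₁
  link []      []      _ zero    []       _ = refl
  link []      []      _ (suc a) (z ∷ q₂) _ = cong (λ b → not b ∨ R y z) (≡false (λ e → ℕₚ.<⇒≢ x<k (≡ᵇ⁻ {x} e)))
  link (_ ∷ _) (_ ∷ _) _ a q₂ _ = refl

cont-++ : ∀ l c q₁ q₂ → contᵇ l c (q₁ ++ q₂) ≡ leᵇ l c q₂ ∧ contᵇ l (λ b → c b ∸ cntL q₂ b) q₁
cont-++ l c q₁ q₂ = bool-iff
  (λ e → let f : ∀ {b} → b ∈ upTo l → cntL q₁ b + cntL q₂ b ≡ c b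
             f {b} b∈ = trans (sym (count-++ (_≡ᵇ b) q₁ q₂)) (≡ᵇ⁻ {cntL (q₁ ++ q₂) b} (allᵇ⁻ (λ b → cntL (q₁ ++ q₂) b ≡ᵇ c b) (upTo l) e b∈))
         in ∧⁺ (allᵇ⁺ _ (upTo l) (λ {b} b∈ → ≤ᵇ⁺ (subst (cntL q₂ b ≤_) (f b∈) (ℕₚ.m≤n+m _ (cntL q₁ b)))))
               (allᵇ⁺ _ (upTo l) (λ {b} b∈ → ≡ᵇ⁺ (sym (trans (cong (_∸ cntL q₂ b) (sym (f b∈))) (ℕₚ.m+n∸n≡m (cntL q₁ b) (cntL q₂ b)))))))
  (λ e → let (e₁ , e₂) = ∧⁻ {leᵇ l c q₂} e in allᵇ⁺ _ (upTo l) (λ {b} b∈ → ≡ᵇ⁺ (trans (count-++ (_≡ᵇ b) q₁ q₂)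
    (trans (cong (_+ cntL q₂ b) (≡ᵇ⁻ {cntL q₁ b} (allᵇ⁻ (λ b → cntL q₁ b ≡ᵇ c b ∸ cntL q₂ b) (upTo l) e₂ b∈)))
      (ℕₚ.m∸n+n≡m (≤ᵇ⁻ {cntL q₂ b} (allᵇ⁻ (λ b → cntL q₂ b ≤ᵇ c b) (upTo l) e₁ b∈)))))))

module Words (t M : ℕ) where
  open Cauchy t M

  sorted-rep : ∀ s k z → sortedᵇ (Rel s) (rep k z) ≡ mult s k
  sorted-rep false zero          z = refl
  sorted-rep false (suc zero)    z = refl
  sorted-rep false (suc (suc k)) z = ∧⁺ (≤ᵇ⁺ (ℕₚ.≤-refl {z})) (sorted-rep false (suc k) z)
  sorted-rep true  zero          z = refl
  sorted-rep true  (suc zero)    z = refl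
  sorted-rep true  (suc (suc k)) z = cong (_∧ sortedᵇ _<ᵇ_ (z ∷ rep k z)) (≡false (λ e → ℕₚ.<-irrefl refl (<ᵇ⁻ {z} e)))

  -- A sorted word is determined by its multiplicities. Splitting off the copies of the largest
  -- letter chooses one `k` of `removals`, and `φ` receives what remains of the content `c`, largest
  -- letter first.
  words⇒removals : ∀ s l a (c : ℕ → ℕ) (φ : List ℕ → ℤ) → a < N →
    ∑ (listsOf (upTo l) a) (λ q → ⟦ sortedᵇ (Rel s) q ⟧ *ℤ (⟦ leᵇ l c q ⟧ *ℤ φ (map (λ b → c b ∸ cntL q b) (List.downFrom l)))) ≡
    removals s a (map c (List.downFrom l)) φ
  words⇒removals s zero zero c φ _ = trans (ℤₚ.+-identityʳ _) (ℤₚ.*-identityˡ _)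
  words⇒removals s zero (suc a) c φ _ = trans (∑-lists-suc [] a _) (∑-0 (listsOf [] a))
  words⇒removals s (suc l) a c φ a<N = begin
    ∑ (listsOf (upTo (suc l)) a) (λ q → ⟦ sortedᵇ (Rel s) q ⟧ *ℤ g q)
      ≡⟨ split-upTo (Rel s) l (Rel-< s) (Rel-> s) a g ⟩
    ∑ (upTo (suc a)) (splitSum (Rel s) (upTo l) l a g)
      ≡⟨ ∑-upTo-reverse a N a<N (splitSum (Rel s) (upTo l) l a g) ⟩
    ∑ (upTo N) (λ k → ⟦ k ≤ᵇ a ⟧ *ℤ splitSum (Rel s) (upTo l) l a g (a ∸ k))
      ≡⟨ ∑-cong (upTo N) (λ k → trans (guard (k ≤ᵇ a) (λ e → part k (≤ᵇ⁻ {k} e)))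
           (arr ⟦ k ≤ᵇ a ⟧ ⟦ mult s k ⟧ ⟦ k ≤ᵇ c l ⟧ _)) ⟩
    ∑ (upTo N) (λ k → ⟦ mult s k ⟧ *ℤ (⟦ k ≤ᵇ a ⟧ *ℤ ⟦ k ≤ᵇ c l ⟧ *ℤ removals s (a ∸ k) (map c (List.downFrom l)) (λ β' → φ (c l ∸ k ∷ β'))))
      ≡⟨ ∑-cong (upTo N) (λ k → cong (λ x → ⟦ mult s k ⟧ *ℤ (x *ℤ removals s (a ∸ k) (map c (List.downFrom l)) (λ β' → φ (c l ∸ k ∷ β'))))
           (sym (⟦∧⟧ (k ≤ᵇ a) (k ≤ᵇ c l)))) ⟩
    removals s a (map c (List.downFrom (suc l))) φ ∎
    where
    arr : ∀ x y z w → x *ℤ (y *ℤ (z *ℤ w)) ≡ y *ℤ (x *ℤ z *ℤ w)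
    arr = solve-∀ℤ
    arr₂ : ∀ x y z w v → x *ℤ (y *ℤ (z *ℤ w *ℤ v)) ≡ (y *ℤ w) *ℤ (x *ℤ (z *ℤ v))
    arr₂ = solve-∀ℤ
    g : List ℕ → ℤ
    g q = ⟦ leᵇ (suc l) c q ⟧ *ℤ φ (map (λ b → c b ∸ cntL q b) (List.downFrom (suc l)))
    part : ∀ k → k ≤ a → splitSum (Rel s) (upTo l) l a g (a ∸ k) ≡
      ⟦ mult s k ⟧ *ℤ (⟦ k ≤ᵇ c l ⟧ *ℤ removals s (a ∸ k) (map c (List.downFrom l)) (λ β' → φ (c l ∸ k ∷ β')))
    part k k≤a = begin
      ∑ L (λ q → ⟦ sortedᵇ (Rel s) q ⟧ *ℤ (⟦ sortedᵇ (Rel s) (rep (a ∸ (a ∸ k)) l) ⟧ *ℤ g (q ++ rep (a ∸ (a ∸ k)) l)))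
        ≡⟨ ∑-cong-∈ L (λ {q} q∈ → begin
          ⟦ sortedᵇ (Rel s) q ⟧ *ℤ (⟦ sortedᵇ (Rel s) (rep (a ∸ (a ∸ k)) l) ⟧ *ℤ g (q ++ rep (a ∸ (a ∸ k)) l))
            ≡⟨ cong (λ j → ⟦ sortedᵇ (Rel s) q ⟧ *ℤ (⟦ sortedᵇ (Rel s) (rep j l) ⟧ *ℤ g (q ++ rep j l))) (ℕₚ.m∸[m∸n]≡n k≤a) ⟩
          ⟦ sortedᵇ (Rel s) q ⟧ *ℤ (⟦ sortedᵇ (Rel s) (rep k l) ⟧ *ℤ g (q ++ rep k l))
            ≡⟨ cong₂ (λ b x → ⟦ sortedᵇ (Rel s) q ⟧ *ℤ (⟦ b ⟧ *ℤ x)) (sorted-rep s k l) (g-eq q q∈) ⟩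
          ⟦ sortedᵇ (Rel s) q ⟧ *ℤ (⟦ mult s k ⟧ *ℤ (⟦ leᵇ l c q ⟧ *ℤ ⟦ k ≤ᵇ c l ⟧ *ℤ φ (c l ∸ k ∷ map (λ b → c b ∸ cntL q b) (List.downFrom l))))
            ≡⟨ arr₂ ⟦ sortedᵇ (Rel s) q ⟧ ⟦ mult s k ⟧ ⟦ leᵇ l c q ⟧ ⟦ k ≤ᵇ c l ⟧ _ ⟩
          (⟦ mult s k ⟧ *ℤ ⟦ k ≤ᵇ c l ⟧) *ℤ (⟦ sortedᵇ (Rel s) q ⟧ *ℤ (⟦ leᵇ l c q ⟧ *ℤ φ (c l ∸ k ∷ map (λ b → c b ∸ cntL q b) (List.downFrom l)))) ∎) ⟩
      ∑ L (λ q → (⟦ mult s k ⟧ *ℤ ⟦ k ≤ᵇ c l ⟧) *ℤ (⟦ sortedᵇ (Rel s) q ⟧ *ℤ (⟦ leᵇ l c q ⟧ *ℤ φ (c l ∸ k ∷ map (λ b → c b ∸ cntL q b) (List.downFrom l)))))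
        ≡⟨ sym (∑-*ˡ L (⟦ mult s k ⟧ *ℤ ⟦ k ≤ᵇ c l ⟧) _) ⟩
      (⟦ mult s k ⟧ *ℤ ⟦ k ≤ᵇ c l ⟧) *ℤ ∑ L (λ q → ⟦ sortedᵇ (Rel s) q ⟧ *ℤ (⟦ leᵇ l c q ⟧ *ℤ φ (c l ∸ k ∷ map (λ b → c b ∸ cntL q b) (List.downFrom l))))
        ≡⟨ cong ((⟦ mult s k ⟧ *ℤ ⟦ k ≤ᵇ c l ⟧) *ℤ_) (words⇒removals s l (a ∸ k) c (λ β' → φ (c l ∸ k ∷ β')) (ℕₚ.≤-<-trans (ℕₚ.m∸n≤m a k) a<N)) ⟩
      (⟦ mult s k ⟧ *ℤ ⟦ k ≤ᵇ c l ⟧) *ℤ removals s (a ∸ k) (map c (List.downFrom l)) (λ β' → φ (c l ∸ k ∷ β'))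
        ≡⟨ ℤₚ.*-assoc ⟦ mult s k ⟧ _ _ ⟩
      ⟦ mult s k ⟧ *ℤ (⟦ k ≤ᵇ c l ⟧ *ℤ removals s (a ∸ k) (map c (List.downFrom l)) (λ β' → φ (c l ∸ k ∷ β'))) ∎
      where
      L = listsOf (upTo l) (a ∸ k)
      cnt-l : ∀ q → q ∈ L → cntL (q ++ rep k l) l ≡ k
      cnt-l q q∈ = cntL-++rep-≡ l k q (All.map ∈ₚ.∈-upTo⁻ (proj₂ (∈-listsOf⁻ (upTo l) (a ∸ k) q∈)))
      g-eq : ∀ q → q ∈ L → g (q ++ rep k l) ≡ ⟦ leᵇ l c q ⟧ *ℤ ⟦ k ≤ᵇ c l ⟧ *ℤ φ (c l ∸ k ∷ map (λ b → c b ∸ cntL q b) (List.downFrom l))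
      g-eq q q∈ = cong₂ _*ℤ_
        (trans (cong ⟦_⟧ (trans (allᵇ-upTo-suc _ l) (cong₂ _∧_
          (allᵇ-cong-∈ _ _ (upTo l) (λ {b} b∈ → cong (_≤ᵇ c b) (cntL-++rep-< l k q (∈ₚ.∈-upTo⁻ b∈)))) (cong (_≤ᵇ c l) (cnt-l q q∈)))))
          (⟦∧⟧ (leᵇ l c q) (k ≤ᵇ c l)))
        (cong φ (cong₂ _∷_ (cong (c l ∸_) (cnt-l q q∈)) (map-cong-upTo l (λ {b} b<l → cong (c b ∸_) (cntL-++rep-< l k q b<l)))))

  -- Entry (i, j) of the matrix is the number of positions with letter i in `u` and letter j in the
  -- word summed over. The last block of `u`, carrying a sorted word of its own, is one row.
  words⇒matrices : ∀ s k u l (c : ℕ → ℕ) → All (_< k) u → sortedᵇ _≤ᵇ_ u ≡ true → length u < N →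
    ∑ (listsOf (upTo l) (length u)) (λ q → ⟦ bsᵇ (Rel s) u q ⟧ *ℤ ⟦ contᵇ l c q ⟧) ≡
    matrices s (map (cntL u) (List.downFrom k)) (map c (List.downFrom l))
  words⇒matrices s zero [] l c _ _ _ = trans (ℤₚ.+-identityʳ _) (trans (ℤₚ.*-identityˡ _) (cong ⟦_⟧ (zeros l)))
    where
    zeros : ∀ l → contᵇ l c [] ≡ zeroᵇ (map c (List.downFrom l))
    zeros zero    = refl
    zeros (suc l) = trans (allᵇ-upTo-suc _ l) (trans (Boolₚ.∧-comm (contᵇ l c []) _) (cong₂ _∧_
      (bool-iff (λ e → ≡ᵇ⁺ {c l} (sym (≡ᵇ⁻ {0} {c l} e))) (λ e → ≡ᵇ⁺ {0} (sym (≡ᵇ⁻ {c l} e)))) (zeros l)))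
  words⇒matrices s zero (_ ∷ _) l c (() ∷ _) _ _
  words⇒matrices s (suc k) u l c b e len with sorted-last k u b e
  ... | u₁ , a , refl , b₁ , e₁ = begin
    ∑ (listsOf (upTo l) (length (u₁ ++ rep a k))) (λ q → ⟦ bsᵇ (Rel s) (u₁ ++ rep a k) q ⟧ *ℤ ⟦ contᵇ l c q ⟧)
      ≡⟨ cong (λ n → ∑ (listsOf (upTo l) n) (λ q → ⟦ bsᵇ (Rel s) (u₁ ++ rep a k) q ⟧ *ℤ ⟦ contᵇ l c q ⟧)) len-u ⟩
    ∑ (listsOf (upTo l) (length u₁ + a)) (λ q → ⟦ bsᵇ (Rel s) (u₁ ++ rep a k) q ⟧ *ℤ ⟦ contᵇ l c q ⟧)
      ≡⟨ ∑-lists-+ (upTo l) (length u₁) a _ ⟩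
    ∑ L₁ (λ q₁ → ∑ L₂ (λ q₂ → ⟦ bsᵇ (Rel s) (u₁ ++ rep a k) (q₁ ++ q₂) ⟧ *ℤ ⟦ contᵇ l c (q₁ ++ q₂) ⟧))
      ≡⟨ ∑-cong-∈ L₁ (λ {q₁} q₁∈ → ∑-cong-∈ L₂ (λ {q₂} q₂∈ → trans
           (cong₂ _*ℤ_
             (trans (cong ⟦_⟧ (bs-++ (Rel s) k u₁ q₁ a q₂ b₁ (proj₁ (∈-listsOf⁻ (upTo l) (length u₁) q₁∈)) (proj₁ (∈-listsOf⁻ (upTo l) a q₂∈))))
               (⟦∧⟧ (bsᵇ (Rel s) u₁ q₁) (sortedᵇ (Rel s) q₂)))
             (trans (cong ⟦_⟧ (cont-++ l c q₁ q₂)) (⟦∧⟧ (leᵇ l c q₂) _)))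
           (arr ⟦ bsᵇ (Rel s) u₁ q₁ ⟧ ⟦ sortedᵇ (Rel s) q₂ ⟧ ⟦ leᵇ l c q₂ ⟧ ⟦ contᵇ l (c' q₂) q₁ ⟧))) ⟩
    ∑ L₁ (λ q₁ → ∑ L₂ (λ q₂ → ⟦ sortedᵇ (Rel s) q₂ ⟧ *ℤ (⟦ leᵇ l c q₂ ⟧ *ℤ (⟦ bsᵇ (Rel s) u₁ q₁ ⟧ *ℤ ⟦ contᵇ l (c' q₂) q₁ ⟧))))
      ≡⟨ ∑-swap L₁ L₂ _ ⟩
    ∑ L₂ (λ q₂ → ∑ L₁ (λ q₁ → ⟦ sortedᵇ (Rel s) q₂ ⟧ *ℤ (⟦ leᵇ l c q₂ ⟧ *ℤ (⟦ bsᵇ (Rel s) u₁ q₁ ⟧ *ℤ ⟦ contᵇ l (c' q₂) q₁ ⟧))))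
      ≡⟨ ∑-cong L₂ (λ q₂ → sym (trans (cong (⟦ sortedᵇ (Rel s) q₂ ⟧ *ℤ_) (∑-*ˡ L₁ ⟦ leᵇ l c q₂ ⟧ _)) (∑-*ˡ L₁ ⟦ sortedᵇ (Rel s) q₂ ⟧ _))) ⟩
    ∑ L₂ (λ q₂ → ⟦ sortedᵇ (Rel s) q₂ ⟧ *ℤ (⟦ leᵇ l c q₂ ⟧ *ℤ ∑ L₁ (λ q₁ → ⟦ bsᵇ (Rel s) u₁ q₁ ⟧ *ℤ ⟦ contᵇ l (c' q₂) q₁ ⟧)))
      ≡⟨ ∑-cong L₂ (λ q₂ → cong (λ x → ⟦ sortedᵇ (Rel s) q₂ ⟧ *ℤ (⟦ leᵇ l c q₂ ⟧ *ℤ x))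
           (words⇒matrices s k u₁ l (c' q₂) b₁ e₁ (ℕₚ.≤-<-trans (subst (length u₁ ≤_) (sym len-u) (ℕₚ.m≤m+n _ a)) len))) ⟩
    ∑ L₂ (λ q₂ → ⟦ sortedᵇ (Rel s) q₂ ⟧ *ℤ (⟦ leᵇ l c q₂ ⟧ *ℤ matrices s (map (cntL u₁) (List.downFrom k)) (map (c' q₂) (List.downFrom l))))
      ≡⟨ words⇒removals s l a c (matrices s (map (cntL u₁) (List.downFrom k)))
           (ℕₚ.≤-<-trans (subst (a ≤_) (sym len-u) (ℕₚ.m≤n+m a _)) len) ⟩
    matrices s (a ∷ map (cntL u₁) (List.downFrom k)) (map c (List.downFrom l))
      ≡⟨ cong (λ α → matrices s α (map c (List.downFrom l))) (sym (cong₂ _∷_ (cntL-++rep-≡ k a u₁ b₁) (map-cong-upTo k (cntL-++rep-< k a u₁)))) ⟩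
    matrices s (map (cntL (u₁ ++ rep a k)) (List.downFrom (suc k))) (map c (List.downFrom l)) ∎
    where
    L₁ = listsOf (upTo l) (length u₁)
    L₂ = listsOf (upTo l) a
    arr : ∀ x y z w → (x *ℤ y) *ℤ (z *ℤ w) ≡ y *ℤ (z *ℤ (x *ℤ w))
    arr = solve-∀ℤ
    c' : List ℕ → ℕ → ℕ
    c' q₂ x = c x ∸ cntL q₂ x
    len-u : length (u₁ ++ rep a k) ≡ length u₁ + a
    len-u = trans (Listₚ.length-++ u₁) (cong (ℕ._+_ (length u₁)) (Listₚ.length-replicate a))

-- Semistandard tableaux as chains of horizontal strips

∑-fillings : ∀ B r rs (f : List (List ℕ) → ℤ) →
  ∑ (fillings B (r ∷ rs)) f ≡ ∑ (fillings B rs) (λ T → ∑ (listsOf (upTo B) r) (λ row → f (row ∷ T)))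
∑-fillings B r rs f = trans (∑-concatMap _ (fillings B rs) f) (∑-cong (fillings B rs) (λ T →
  trans (∑-map (λ row → toList row ∷ T) (allVecsOf (upTo B) r) f) (∑-toList (upTo B) r (λ row → f (row ∷ T)))))

-- What membership in `fillings l μ` guarantees, namely row lengths and range of letters, in a form
-- suited to recursion on the rows.
data Shaped (l : ℕ) : List ℕ → List (List ℕ) → Set where
  []  : Shaped l [] []
  _∷_ : ∀ {μ r T} → All (_< l) r → Shaped l μ T → Shaped l (length r ∷ μ) (r ∷ T)

∑-fillings-cong : ∀ l μ {f g : List (List ℕ) → ℤ} → (∀ {T} → Shaped l μ T → f T ≡ g T) → ∑ (fillings l μ) f ≡ ∑ (fillings l μ) g
∑-fillings-cong l []      e = cong (_+ℤ + 0) (e [])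
∑-fillings-cong l (y ∷ μ) {f} {g} e = begin
  ∑ (fillings l (y ∷ μ)) f                                              ≡⟨ ∑-fillings l y μ f ⟩
  ∑ (fillings l μ) (λ T → ∑ (listsOf (upTo l) y) (λ row → f (row ∷ T))) ≡⟨ ∑-fillings-cong l μ (λ {T} sh → ∑-cong-∈ (listsOf (upTo l) y) (λ {r} r∈ →
      e (subst (λ k → Shaped l (k ∷ μ) (r ∷ T)) (proj₁ (∈-listsOf⁻ (upTo l) y r∈))
          (All.map ∈ₚ.∈-upTo⁻ (proj₂ (∈-listsOf⁻ (upTo l) y r∈)) ∷ sh)))) ⟩
  ∑ (fillings l μ) (λ T → ∑ (listsOf (upTo l) y) (λ row → g (row ∷ T))) ≡⟨ sym (∑-fillings l y μ g) ⟩
  ∑ (fillings l (y ∷ μ)) g                                              ∎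

subᵇ : List ℕ → List ℕ → Bool
subᵇ []      []      = true
subᵇ (x ∷ l) (y ∷ μ) = (y ≤ᵇ x) ∧ subᵇ l μ
subᵇ _       _       = false

fill : ℕ → List ℕ → List (List ℕ) → List (List ℕ)
fill l (x ∷ λs) (r ∷ T) = (r ++ rep (x ∸ length r) l) ∷ fill l λs T
fill l _        _       = []

rowsᵇ : List (List ℕ) → Bool
rowsᵇ = allᵇ nondecᵇ

-- Each weakly increasing row is a row in smaller letters followed by copies of the largest letter
-- `l`, and μ records the lengths of the shortened rows. Columns are not yet considered, so μ is
-- merely contained in `λs`.
fillings-suc : ∀ N l λs → All (_< N) λs → (g : List (List ℕ) → ℤ) →
  ∑ (fillings (suc l) λs) (λ T → ⟦ rowsᵇ T ⟧ *ℤ g T) ≡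
  ∑ (listsOf (upTo N) (length λs)) (λ μ → ⟦ subᵇ λs μ ⟧ *ℤ ∑ (fillings l μ) (λ T → ⟦ rowsᵇ T ⟧ *ℤ g (fill l λs T)))
fillings-suc N l [] [] g = cong (_+ℤ + 0) (sym (trans (ℤₚ.*-identityˡ (+ 1 *ℤ g [] +ℤ + 0)) (ℤₚ.+-identityʳ (+ 1 *ℤ g []))))
fillings-suc N l (x ∷ λs) (x<N ∷ b) g = begin
  ∑ (fillings (suc l) (x ∷ λs)) (λ T → ⟦ rowsᵇ T ⟧ *ℤ g T)
    ≡⟨ ∑-fillings (suc l) x λs _ ⟩
  ∑ (fillings (suc l) λs) (λ T → ∑ (listsOf (upTo (suc l)) x) (λ r → ⟦ nondecᵇ r ∧ rowsᵇ T ⟧ *ℤ g (r ∷ T)))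
    ≡⟨ ∑-cong (fillings (suc l) λs) (λ T → trans
         (∑-cong (listsOf (upTo (suc l)) x) (λ r → trans (guard-∧ (nondecᵇ r) (rowsᵇ T) _)
           (trans (*-swapℤ ⟦ nondecᵇ r ⟧ ⟦ rowsᵇ T ⟧ _) (cong (λ b → ⟦ rowsᵇ T ⟧ *ℤ (⟦ b ⟧ *ℤ g (r ∷ T))) (nondec≡sorted r)))))
         (sym (∑-*ˡ (listsOf (upTo (suc l)) x) ⟦ rowsᵇ T ⟧ _))) ⟩
  ∑ (fillings (suc l) λs) (λ T → ⟦ rowsᵇ T ⟧ *ℤ g' T)
    ≡⟨ fillings-suc N l λs b g' ⟩
  ∑ Q (λ μ → ⟦ subᵇ λs μ ⟧ *ℤ ∑ (fillings l μ) (λ T → ⟦ rowsᵇ T ⟧ *ℤ g' (fill l λs T)))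
    ≡⟨ ∑-cong Q (λ μ → trans (cong (⟦ subᵇ λs μ ⟧ *ℤ_) (step μ)) (trans (∑-*ˡ (upTo N) ⟦ subᵇ λs μ ⟧ _)
         (∑-cong (upTo N) (λ y → trans (*-swapℤ ⟦ subᵇ λs μ ⟧ ⟦ y ≤ᵇ x ⟧ _) (sym (guard-∧ (y ≤ᵇ x) (subᵇ λs μ) _)))))) ⟩
  ∑ Q (λ μ → ∑ (upTo N) (λ y → ⟦ subᵇ (x ∷ λs) (y ∷ μ) ⟧ *ℤ ∑ (fillings l (y ∷ μ)) (λ T → ⟦ rowsᵇ T ⟧ *ℤ g (fill l (x ∷ λs) T))))
    ≡⟨ sym (∑-lists-suc (upTo N) (length λs) _) ⟩
  ∑ (listsOf (upTo N) (suc (length λs))) (λ μ → ⟦ subᵇ (x ∷ λs) μ ⟧ *ℤ ∑ (fillings l μ) (λ T → ⟦ rowsᵇ T ⟧ *ℤ g (fill l (x ∷ λs) T))) ∎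
  where
  Q = listsOf (upTo N) (length λs)
  g' : List (List ℕ) → ℤ
  g' T = ∑ (listsOf (upTo (suc l)) x) (λ r → ⟦ sortedᵇ _≤ᵇ_ r ⟧ *ℤ g (r ∷ T))
  row : ∀ T → g' T ≡ ∑ (upTo N) (λ y → ⟦ y ≤ᵇ x ⟧ *ℤ ∑ (listsOf (upTo l) y) (λ r → ⟦ nondecᵇ r ⟧ *ℤ g ((r ++ rep (x ∸ length r) l) ∷ T)))
  row T = begin
    g' T
      ≡⟨ split-upTo _≤ᵇ_ l (Rel-< false) (Rel-> false) x (λ r → g (r ∷ T)) ⟩
    ∑ (upTo (suc x)) (splitSum _≤ᵇ_ (upTo l) l x (λ r → g (r ∷ T)))
      ≡⟨ sym (∑-upTo-guard x N x<N (splitSum _≤ᵇ_ (upTo l) l x (λ r → g (r ∷ T)))) ⟩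
    ∑ (upTo N) (λ y → ⟦ y ≤ᵇ x ⟧ *ℤ splitSum _≤ᵇ_ (upTo l) l x (λ r → g (r ∷ T)) y)
      ≡⟨ ∑-cong (upTo N) (λ y → cong (⟦ y ≤ᵇ x ⟧ *ℤ_) (∑-cong-∈ (listsOf (upTo l) y) (λ {r} r∈ →
           cong₂ (λ b z → ⟦ b ⟧ *ℤ z) (sym (nondec≡sorted r)) (trans (guard-true _ (sorted-rep≤ (x ∸ y)))
             (cong (λ k → g ((r ++ rep (x ∸ k) l) ∷ T)) (sym (proj₁ (∈-listsOf⁻ (upTo l) y r∈)))))))) ⟩
    ∑ (upTo N) (λ y → ⟦ y ≤ᵇ x ⟧ *ℤ ∑ (listsOf (upTo l) y) (λ r → ⟦ nondecᵇ r ⟧ *ℤ g ((r ++ rep (x ∸ length r) l) ∷ T))) ∎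
    where
    sorted-rep≤ : ∀ k → sortedᵇ _≤ᵇ_ (rep k l) ≡ true
    sorted-rep≤ zero          = refl
    sorted-rep≤ (suc zero)    = refl
    sorted-rep≤ (suc (suc k)) = ∧⁺ (≤ᵇ⁺ (ℕₚ.≤-refl {l})) (sorted-rep≤ (suc k))
  step : ∀ μ → ∑ (fillings l μ) (λ T → ⟦ rowsᵇ T ⟧ *ℤ g' (fill l λs T)) ≡
    ∑ (upTo N) (λ y → ⟦ y ≤ᵇ x ⟧ *ℤ ∑ (fillings l (y ∷ μ)) (λ T → ⟦ rowsᵇ T ⟧ *ℤ g (fill l (x ∷ λs) T)))
  step μ = begin
    ∑ (fillings l μ) (λ T → ⟦ rowsᵇ T ⟧ *ℤ g' (fill l λs T))
      ≡⟨ ∑-cong (fillings l μ) (λ T → trans (cong (⟦ rowsᵇ T ⟧ *ℤ_) (row (fill l λs T)))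
           (trans (∑-*ˡ (upTo N) ⟦ rowsᵇ T ⟧ _) (∑-cong (upTo N) (λ y → *-swapℤ ⟦ rowsᵇ T ⟧ ⟦ y ≤ᵇ x ⟧ _)))) ⟩
    ∑ (fillings l μ) (λ T → ∑ (upTo N) (λ y → ⟦ y ≤ᵇ x ⟧ *ℤ (⟦ rowsᵇ T ⟧ *ℤ Y T y)))
      ≡⟨ ∑-swap (fillings l μ) (upTo N) _ ⟩
    ∑ (upTo N) (λ y → ∑ (fillings l μ) (λ T → ⟦ y ≤ᵇ x ⟧ *ℤ (⟦ rowsᵇ T ⟧ *ℤ Y T y)))
      ≡⟨ ∑-cong (upTo N) (λ y → sym (∑-*ˡ (fillings l μ) ⟦ y ≤ᵇ x ⟧ _)) ⟩
    ∑ (upTo N) (λ y → ⟦ y ≤ᵇ x ⟧ *ℤ ∑ (fillings l μ) (λ T → ⟦ rowsᵇ T ⟧ *ℤ Y T y))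
      ≡⟨ ∑-cong (upTo N) (λ y → cong (⟦ y ≤ᵇ x ⟧ *ℤ_) (trans
           (∑-cong (fillings l μ) (λ T → trans (∑-*ˡ (listsOf (upTo l) y) ⟦ rowsᵇ T ⟧ _) (∑-cong (listsOf (upTo l) y) (λ r →
             trans (*-swapℤ ⟦ rowsᵇ T ⟧ ⟦ nondecᵇ r ⟧ _) (sym (guard-∧ (nondecᵇ r) (rowsᵇ T) _))))))
           (sym (∑-fillings l y μ _)))) ⟩
    ∑ (upTo N) (λ y → ⟦ y ≤ᵇ x ⟧ *ℤ ∑ (fillings l (y ∷ μ)) (λ T → ⟦ rowsᵇ T ⟧ *ℤ g (fill l (x ∷ λs) T))) ∎
    where
    Y : List (List ℕ) → ℕ → ℤ
    Y T y = ∑ (listsOf (upTo l) y) (λ r → ⟦ nondecᵇ r ⟧ *ℤ g ((r ++ rep (x ∸ length r) l) ∷ fill l λs T))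

<ᵇ-cmp : List ℕ → List ℕ → Bool
<ᵇ-cmp r r' = allᵇ id (zipWith _<ᵇ_ r r')

<ᵇ-cmp-[] : ∀ r → <ᵇ-cmp r [] ≡ true
<ᵇ-cmp-[] []      = refl
<ᵇ-cmp-[] (_ ∷ _) = refl

-- Filling up two rows with the letter l keeps columns strict iff no new letter lies above another cell.
fill-columns : ∀ l r r' a b → All (_< l) r → All (_< l) r' → length r' + b ≤ length r + a →
  <ᵇ-cmp (r ++ rep a l) (r' ++ rep b l) ≡ (length r' + b ≤ᵇ length r) ∧ <ᵇ-cmp r r'
fill-columns l [] [] a       zero    _ _ _ = <ᵇ-cmp-[] (rep a l)
fill-columns l [] [] (suc a) (suc b) _ _ _ = cong (_∧ <ᵇ-cmp (rep a l) (rep b l)) (≡false (λ e → ℕₚ.<-irrefl refl (<ᵇ⁻ {l} e)))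
fill-columns l [] (y ∷ r') (suc a) b _ (y<l ∷ _) _ = cong (_∧ <ᵇ-cmp (rep a l) (r' ++ rep b l)) (≡false (λ e → ℕₚ.<-asym y<l (<ᵇ⁻ {l} e)))
fill-columns l (x ∷ r) [] a zero    _ _ _ = refl
fill-columns l (x ∷ r) [] a (suc b) (x<l ∷ p) q (s≤s le) =
  trans (cong₂ _∧_ (<ᵇ⁺ x<l) (fill-columns l r [] a b p [] le))
    (cong₂ _∧_ (sym (≤ᵇ-suc b (length r))) (<ᵇ-cmp-[] r))
fill-columns l (x ∷ r) (y ∷ r') a b (_ ∷ p) (_ ∷ q) (s≤s le) =
  trans (cong ((x <ᵇ y) ∧_) (fill-columns l r r' a b p q le))
    (bool-iff
      (λ e → let (e₁ , e') = ∧⁻ {x <ᵇ y} e ; (e₂ , e₃) = ∧⁻ {length r' + b ≤ᵇ length r} e'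
             in ∧⁺ (≤ᵇ⁺ (s≤s (≤ᵇ⁻ {length r' + b} e₂))) (∧⁺ e₁ e₃))
      (λ e → let (e₂ , e') = ∧⁻ {suc (length r' + b) ≤ᵇ suc (length r)} e ; (e₁ , e₃) = ∧⁻ {x <ᵇ y} e'
             in ∧⁺ e₁ (∧⁺ (≤ᵇ⁺ (ℕₚ.≤-pred (≤ᵇ⁻ {suc (length r' + b)} e₂))) e₃)))

hsT-sub : ∀ t λs μ → hsT t λs μ ≡ true → subᵇ λs μ ≡ true
hsT-sub t []       []      e = refl
hsT-sub t (x ∷ λs) (y ∷ μ) e with hsT⁻ t x y λs μ e
... | y≤x , _ , h = ∧⁺ (≤ᵇ⁺ y≤x) (hsT-sub y λs μ h)

fill-colStrict-step : ∀ l t x x' λs μ r r' T → All (_< l) r → All (_< l) r' → ninc t (x ∷ x' ∷ λs) ≡ true →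
  subᵇ (x' ∷ λs) (length r' ∷ μ) ∧ colStrictᵇ (fill l (x' ∷ λs) (r' ∷ T)) ≡ hsT x (x' ∷ λs) (length r' ∷ μ) ∧ colStrictᵇ (r' ∷ T) →
  subᵇ (x ∷ x' ∷ λs) (length r ∷ length r' ∷ μ) ∧ colStrictᵇ (fill l (x ∷ x' ∷ λs) (r ∷ r' ∷ T)) ≡
  hsT t (x ∷ x' ∷ λs) (length r ∷ length r' ∷ μ) ∧ colStrictᵇ (r ∷ r' ∷ T)
fill-colStrict-step l t x x' λs μ r r' T p p' e IH = bool-iff
  (λ a → let (a₁ , a₂) = ∧⁻ {subᵇ (x ∷ x' ∷ λs) (length r ∷ length r' ∷ μ)} a
             (b₁ , b₂) = ∧⁻ {length r ≤ᵇ x} a₁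
             (b₃ , b₄) = ∧⁻ {length r' ≤ᵇ x'} b₂
             (c₁ , c₂) = ∧⁻ {<ᵇ-cmp (r ++ rep (x ∸ length r) l) (r' ++ rep (x' ∸ length r') l)} a₂
             (d₁ , d₂) = ∧⁻ {length r' + (x' ∸ length r') ≤ᵇ length r} (trans (sym (cols (≤ᵇ⁻ {length r} b₁) (≤ᵇ⁻ {length r'} b₃))) c₁)
             x'≤r = subst (_≤ length r) (ℕₚ.m+[n∸m]≡n (≤ᵇ⁻ {length r'} b₃)) (≤ᵇ⁻ {length r' + (x' ∸ length r')} d₁)
             (f₁ , f₂) = ∧⁻ {hsT x (x' ∷ λs) (length r' ∷ μ)} (trans (sym IH) (∧⁺ b₂ c₂))
         in ∧⁺ (∧⁺ b₁ (∧⁺ (≤ᵇ⁺ x≤t) (trans (hsT-top (≤ᵇ⁻ {length r} b₁) (x' ∷ λs) (length r' ∷ μ)) (∧⁺ (≤ᵇ⁺ x'≤r) f₁)))) (∧⁺ d₂ f₂))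
  (λ a → let (a₁ , a₂) = ∧⁻ {hsT t (x ∷ x' ∷ λs) (length r ∷ length r' ∷ μ)} a
             (r≤x , _ , h) = hsT⁻ t x (length r) (x' ∷ λs) (length r' ∷ μ) a₁
             (r'≤x' , x'≤r , _) = hsT⁻ (length r) x' (length r') λs μ h
             (d₂ , f₂) = ∧⁻ {<ᵇ-cmp r r'} a₂
             (g₁ , g₂) = ∧⁻ {subᵇ (x' ∷ λs) (length r' ∷ μ)} (trans IH (∧⁺ {hsT x (x' ∷ λs) (length r' ∷ μ)}
                (proj₂ (∧⁻ {x' ≤ᵇ length r} (trans (sym (hsT-top r≤x (x' ∷ λs) (length r' ∷ μ))) h))) f₂))
         in ∧⁺ (∧⁺ (≤ᵇ⁺ r≤x) g₁) (∧⁺ (trans (cols r≤x r'≤x') (∧⁺ (≤ᵇ⁺ (subst (_≤ length r) (sym (ℕₚ.m+[n∸m]≡n r'≤x')) x'≤r)) d₂)) g₂))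
  where
  x≤t = proj₁ (ninc⁻ t x (x' ∷ λs) e)
  x'≤x = proj₁ (ninc⁻ x x' λs (proj₂ (ninc⁻ t x (x' ∷ λs) e)))
  cols : length r ≤ x → length r' ≤ x' → <ᵇ-cmp (r ++ rep (x ∸ length r) l) (r' ++ rep (x' ∸ length r') l) ≡
    (length r' + (x' ∸ length r') ≤ᵇ length r) ∧ <ᵇ-cmp r r'
  cols r≤x r'≤x' = fill-columns l r r' (x ∸ length r) (x' ∸ length r') p p'
    (subst (_≤ length r + (x ∸ length r)) (sym (ℕₚ.m+[n∸m]≡n r'≤x')) (subst (x' ≤_) (sym (ℕₚ.m+[n∸m]≡n r≤x)) x'≤x))

-- By `fill-columns`, two adjacent rows stay column-strict exactly if the lower row, after filling,
-- is no longer than the upper row before filling. Together with containment this is the interlacing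
-- of `hsT`.
fill-colStrict : ∀ l t λs {μ T} → Shaped l μ T → ninc t λs ≡ true →
  subᵇ λs μ ∧ colStrictᵇ (fill l λs T) ≡ hsT t λs μ ∧ colStrictᵇ T
fill-colStrict l t [] [] e = refl
fill-colStrict l t [] (_∷_ _ _) e = refl
fill-colStrict l t (x ∷ λs) [] e = refl
fill-colStrict l t (x ∷ []) (_∷_ {μ} {r} p []) e = begin
  ((length r ≤ᵇ x) ∧ true) ∧ true   ≡⟨ cong (λ b → ((length r ≤ᵇ x) ∧ b) ∧ true) (sym (trans (Boolₚ.∧-identityʳ _) (proj₁ (∧⁻ {x ≤ᵇ t} e)))) ⟩
  ((length r ≤ᵇ x) ∧ ((x ≤ᵇ t) ∧ true)) ∧ true ∎
fill-colStrict l t (x ∷ []) (_∷_ {μ} {r} p (_∷_ _ _)) e = begin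
  ((length r ≤ᵇ x) ∧ false) ∧ true   ≡⟨ cong (_∧ true) (Boolₚ.∧-zeroʳ (length r ≤ᵇ x)) ⟩
  false ≡⟨ cong (_∧ _) (sym (trans (cong ((length r ≤ᵇ x) ∧_) (Boolₚ.∧-zeroʳ (x ≤ᵇ t))) (Boolₚ.∧-zeroʳ (length r ≤ᵇ x)))) ⟩
  _ ∎
fill-colStrict l t (x ∷ x' ∷ λs) (_∷_ {μ} {r} p []) e = begin
  ((length r ≤ᵇ x) ∧ false) ∧ true   ≡⟨ cong (_∧ true) (Boolₚ.∧-zeroʳ (length r ≤ᵇ x)) ⟩
  false ≡⟨ cong (_∧ _) (sym (trans (cong ((length r ≤ᵇ x) ∧_) (Boolₚ.∧-zeroʳ (x ≤ᵇ t))) (Boolₚ.∧-zeroʳ (length r ≤ᵇ x)))) ⟩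
  _ ∎
fill-colStrict l t (x ∷ x' ∷ λs) (_∷_ {_} {r} {_} p (_∷_ {μ} {r'} {T} p' sh)) e =
  fill-colStrict-step l t x x' λs μ r r' T p p' e (fill-colStrict l x (x' ∷ λs) (p' ∷ sh) (proj₂ (ninc⁻ t x (x' ∷ λs) e)))

fill-cnt-< : ∀ l λs {μ T} → Shaped l μ T → subᵇ λs μ ≡ true → ∀ {b} → b < l → cntL (concat (fill l λs T)) b ≡ cntL (concat T) b
fill-cnt-< l [] [] e b<l = refl
fill-cnt-< l (x ∷ λs) (_∷_ {μ} {r} {T} p sh) e {b} b<l = begin
  cntL ((r ++ rep (x ∸ length r) l) ++ concat (fill l λs T)) b
    ≡⟨ trans (count-++ (_≡ᵇ b) (r ++ rep (x ∸ length r) l) _) (cong (_+ cntL (concat (fill l λs T)) b) (count-++ (_≡ᵇ b) r _)) ⟩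
  (cntL r b + cntL (rep (x ∸ length r) l) b) + cntL (concat (fill l λs T)) b
    ≡⟨ cong₂ (λ y z → (cntL r b + y) + z) (cntL-rep-≢ (x ∸ length r) (ℕₚ.>⇒≢ b<l)) (fill-cnt-< l λs sh (proj₂ (∧⁻ {length r ≤ᵇ x} e)) b<l) ⟩
  (cntL r b + 0) + cntL (concat T) b
    ≡⟨ cong (_+ cntL (concat T) b) (ℕₚ.+-identityʳ _) ⟩
  cntL r b + cntL (concat T) b
    ≡⟨ sym (count-++ (_≡ᵇ b) r (concat T)) ⟩
  cntL (r ++ concat T) b ∎

fill-cnt-≡ : ∀ l λs {μ T} → Shaped l μ T → subᵇ λs μ ≡ true → sumℕ μ + cntL (concat (fill l λs T)) l ≡ sumℕ λs
fill-cnt-≡ l [] [] e = refl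
fill-cnt-≡ l (x ∷ λs) (_∷_ {μ} {r} {T} p sh) e = begin
  (length r + sumℕ μ) + cntL ((r ++ rep (x ∸ length r) l) ++ concat (fill l λs T)) l
    ≡⟨ cong (ℕ._+_ (length r + sumℕ μ)) (trans (count-++ (_≡ᵇ l) (r ++ rep (x ∸ length r) l) _)
         (cong (_+ cntL (concat (fill l λs T)) l) (trans (count-++ (_≡ᵇ l) r _)
           (cong₂ _+_ (cntL-notin r (All.map ℕₚ.<⇒≢ p)) (cntL-rep (x ∸ length r) l))))) ⟩
  (length r + sumℕ μ) + ((x ∸ length r) + cntL (concat (fill l λs T)) l)
    ≡⟨ arr (length r) (sumℕ μ) (x ∸ length r) _ ⟩
  (length r + (x ∸ length r)) + (sumℕ μ + cntL (concat (fill l λs T)) l)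
    ≡⟨ cong₂ _+_ (ℕₚ.m+[n∸m]≡n (≤ᵇ⁻ {length r} (proj₁ (∧⁻ {length r ≤ᵇ x} e)))) (fill-cnt-≡ l λs sh (proj₂ (∧⁻ {length r ≤ᵇ x} e))) ⟩
  x + sumℕ λs ∎
  where
  arr : ∀ a b c d → (a + b) + (c + d) ≡ (a + c) + (b + d)
  arr = solve-∀

tableaux : ℕ → (ℕ → ℕ) → List ℕ → ℤ
tableaux l c λs = ∑ (fillings l λs) (λ T → ⟦ rowsᵇ T ⟧ *ℤ (⟦ colStrictᵇ T ⟧ *ℤ ⟦ contᵇ l c (concat T) ⟧))

ninc-All : ∀ t λs → ninc t λs ≡ true → All (_≤ t) λs
ninc-All t []       e = []
ninc-All t (x ∷ λs) e = let (x≤t , r) = ninc⁻ t x λs e in x≤t ∷ All.map (λ y≤x → ℕₚ.≤-trans y≤x x≤t) (ninc-All x λs r)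

module Tableaux (t M : ℕ) where
  open Cauchy t M

  -- Induction on the number of letters: the cells of the largest letter form the outermost
  -- horizontal strip, and without letters only the empty shape has a filling.
  tableaux≡K : ∀ l c λs → length λs ≡ M → ninc t λs ≡ true → tableaux l c λs ≡ K false (map c (List.downFrom l)) λs
  tableaux≡K zero c λs _ _ = go λs
    where
    none : ∀ r → r ≢ 0 → (f : List ℕ → ℤ) → ∑ (listsOf [] r) f ≡ + 0
    none zero    r≢0 f = ⊥-elim (r≢0 refl)
    none (suc r) r≢0 f = trans (∑-lists-suc [] r f) (∑-0 (listsOf [] r))
    go' : ∀ λs → (f : List (List ℕ) → ℤ) → ∑ (fillings 0 λs) f ≡ ⟦ zeroᵇ λs ⟧ *ℤ f (List.map (λ _ → []) λs)
    go' [] f = trans (ℤₚ.+-identityʳ _) (sym (ℤₚ.*-identityˡ _))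
    go' (zero ∷ λs) f = trans (∑-fillings 0 0 λs f) (trans (go' λs (λ T → ∑ (listsOf [] 0) (λ row → f (row ∷ T))))
      (cong (⟦ zeroᵇ λs ⟧ *ℤ_) (ℤₚ.+-identityʳ _)))
    go' (suc x ∷ λs) f = trans (∑-fillings 0 (suc x) λs f) (∑-zero (fillings 0 λs) (λ {T} _ → none (suc x) (λ ()) (λ row → f (row ∷ T))))
    rows : ∀ (λs : List ℕ) → rowsᵇ (List.map (λ _ → []) λs) ≡ true
    rows []       = refl
    rows (x ∷ λs) = rows λs
    cols : ∀ (λs : List ℕ) → colStrictᵇ (List.map (λ _ → []) λs) ≡ true
    cols []            = refl
    cols (x ∷ [])      = refl
    cols (x ∷ y ∷ λs)  = cols (y ∷ λs)
    go : ∀ λs → tableaux 0 c λs ≡ ⟦ zeroᵇ λs ⟧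
    go λs = begin
      tableaux 0 c λs ≡⟨ go' λs (λ T → ⟦ rowsᵇ T ⟧ *ℤ (⟦ colStrictᵇ T ⟧ *ℤ + 1)) ⟩
      ⟦ zeroᵇ λs ⟧ *ℤ (⟦ rowsᵇ (List.map (λ _ → []) λs) ⟧ *ℤ (⟦ colStrictᵇ (List.map (λ _ → []) λs) ⟧ *ℤ + 1))
        ≡⟨ cong₂ (λ a b → ⟦ zeroᵇ λs ⟧ *ℤ (⟦ a ⟧ *ℤ (⟦ b ⟧ *ℤ + 1))) (rows λs) (cols λs) ⟩
      ⟦ zeroᵇ λs ⟧ *ℤ + 1 ≡⟨ ℤₚ.*-identityʳ _ ⟩
      ⟦ zeroᵇ λs ⟧ ∎
  tableaux≡K (suc l) c λs len nλ = begin
    tableaux (suc l) c λs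
      ≡⟨ fillings-suc N l λs (All.map (λ x≤t → ℕₚ.m<n⇒m<1+n (s≤s x≤t)) (ninc-All t λs nλ)) g ⟩
    ∑ (listsOf (upTo N) (length λs)) (λ μ → ⟦ subᵇ λs μ ⟧ *ℤ ∑ (fillings l μ) (λ T → ⟦ rowsᵇ T ⟧ *ℤ g (fill l λs T)))
      ≡⟨ cong (λ k → ∑ (listsOf (upTo N) k) (λ μ → ⟦ subᵇ λs μ ⟧ *ℤ ∑ (fillings l μ) (λ T → ⟦ rowsᵇ T ⟧ *ℤ g (fill l λs T)))) len ⟩
    ∑ P (λ μ → ⟦ subᵇ λs μ ⟧ *ℤ ∑ (fillings l μ) (λ T → ⟦ rowsᵇ T ⟧ *ℤ g (fill l λs T)))
      ≡⟨ ∑-cong-∈ P (λ {μ} μ∈ → step μ (proj₁ (∈-listsOf⁻ (upTo N) M μ∈))) ⟩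
    ∑ P (λ μ → ⟦ hsT t λs μ ⟧ *ℤ (⟦ sumℕ λs ≡ᵇ sumℕ μ + c l ⟧ *ℤ K false (map c (List.downFrom l)) μ)) ∎
    where
    g : List (List ℕ) → ℤ
    g T = ⟦ colStrictᵇ T ⟧ *ℤ ⟦ contᵇ (suc l) c (concat T) ⟧
    arr₁ : ∀ s r x y → s *ℤ (r *ℤ (x *ℤ y)) ≡ (s *ℤ x) *ℤ (r *ℤ y)
    arr₁ = solve-∀ℤ
    arr₂ : ∀ h x r y w → (h *ℤ x) *ℤ (r *ℤ (y *ℤ w)) ≡ h *ℤ (w *ℤ (r *ℤ (x *ℤ y)))
    arr₂ = solve-∀ℤ
    step : ∀ μ → length μ ≡ M → ⟦ subᵇ λs μ ⟧ *ℤ ∑ (fillings l μ) (λ T → ⟦ rowsᵇ T ⟧ *ℤ g (fill l λs T)) ≡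
      ⟦ hsT t λs μ ⟧ *ℤ (⟦ sumℕ λs ≡ᵇ sumℕ μ + c l ⟧ *ℤ K false (map c (List.downFrom l)) μ)
    step μ lμ = begin
      ⟦ subᵇ λs μ ⟧ *ℤ ∑ (fillings l μ) (λ T → ⟦ rowsᵇ T ⟧ *ℤ g (fill l λs T))
        ≡⟨ ∑-*ˡ (fillings l μ) ⟦ subᵇ λs μ ⟧ _ ⟩
      ∑ (fillings l μ) (λ T → ⟦ subᵇ λs μ ⟧ *ℤ (⟦ rowsᵇ T ⟧ *ℤ g (fill l λs T)))
        ≡⟨ ∑-fillings-cong l μ (λ {T} sh → begin
          ⟦ subᵇ λs μ ⟧ *ℤ (⟦ rowsᵇ T ⟧ *ℤ g (fill l λs T))
            ≡⟨ arr₁ ⟦ subᵇ λs μ ⟧ ⟦ rowsᵇ T ⟧ ⟦ colStrictᵇ (fill l λs T) ⟧ _ ⟩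
          (⟦ subᵇ λs μ ⟧ *ℤ ⟦ colStrictᵇ (fill l λs T) ⟧) *ℤ (⟦ rowsᵇ T ⟧ *ℤ ⟦ contᵇ (suc l) c (concat (fill l λs T)) ⟧)
            ≡⟨ cong (_*ℤ (⟦ rowsᵇ T ⟧ *ℤ ⟦ contᵇ (suc l) c (concat (fill l λs T)) ⟧)) (trans (sym (⟦∧⟧ (subᵇ λs μ) _))
                 (trans (cong ⟦_⟧ (fill-colStrict l t λs sh nλ)) (⟦∧⟧ (hsT t λs μ) (colStrictᵇ T)))) ⟩
          (⟦ hsT t λs μ ⟧ *ℤ ⟦ colStrictᵇ T ⟧) *ℤ (⟦ rowsᵇ T ⟧ *ℤ ⟦ contᵇ (suc l) c (concat (fill l λs T)) ⟧)
            ≡⟨ ℤₚ.*-assoc ⟦ hsT t λs μ ⟧ _ _ ⟩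
          ⟦ hsT t λs μ ⟧ *ℤ (⟦ colStrictᵇ T ⟧ *ℤ (⟦ rowsᵇ T ⟧ *ℤ ⟦ contᵇ (suc l) c (concat (fill l λs T)) ⟧))
            ≡⟨ guard (hsT t λs μ) (λ e → cong (λ z → ⟦ colStrictᵇ T ⟧ *ℤ (⟦ rowsᵇ T ⟧ *ℤ z)) (content sh (hsT-sub t λs μ e))) ⟩
          ⟦ hsT t λs μ ⟧ *ℤ (⟦ colStrictᵇ T ⟧ *ℤ (⟦ rowsᵇ T ⟧ *ℤ (⟦ contᵇ l c (concat T) ⟧ *ℤ ⟦ sumℕ λs ≡ᵇ sumℕ μ + c l ⟧)))
            ≡⟨ sym (ℤₚ.*-assoc ⟦ hsT t λs μ ⟧ _ _) ⟩
          (⟦ hsT t λs μ ⟧ *ℤ ⟦ colStrictᵇ T ⟧) *ℤ (⟦ rowsᵇ T ⟧ *ℤ (⟦ contᵇ l c (concat T) ⟧ *ℤ ⟦ sumℕ λs ≡ᵇ sumℕ μ + c l ⟧))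
            ≡⟨ arr₂ ⟦ hsT t λs μ ⟧ ⟦ colStrictᵇ T ⟧ ⟦ rowsᵇ T ⟧ ⟦ contᵇ l c (concat T) ⟧ ⟦ sumℕ λs ≡ᵇ sumℕ μ + c l ⟧ ⟩
          ⟦ hsT t λs μ ⟧ *ℤ (⟦ sumℕ λs ≡ᵇ sumℕ μ + c l ⟧ *ℤ (⟦ rowsᵇ T ⟧ *ℤ (⟦ colStrictᵇ T ⟧ *ℤ ⟦ contᵇ l c (concat T) ⟧))) ∎) ⟩
      ∑ (fillings l μ) (λ T → ⟦ hsT t λs μ ⟧ *ℤ (⟦ sumℕ λs ≡ᵇ sumℕ μ + c l ⟧ *ℤ (⟦ rowsᵇ T ⟧ *ℤ (⟦ colStrictᵇ T ⟧ *ℤ ⟦ contᵇ l c (concat T) ⟧))))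
        ≡⟨ sym (trans (cong (⟦ hsT t λs μ ⟧ *ℤ_) (∑-*ˡ (fillings l μ) ⟦ sumℕ λs ≡ᵇ sumℕ μ + c l ⟧ _)) (∑-*ˡ (fillings l μ) ⟦ hsT t λs μ ⟧ _)) ⟩
      ⟦ hsT t λs μ ⟧ *ℤ (⟦ sumℕ λs ≡ᵇ sumℕ μ + c l ⟧ *ℤ tableaux l c μ)
        ≡⟨ guard (hsT t λs μ) (λ e → cong (⟦ sumℕ λs ≡ᵇ sumℕ μ + c l ⟧ *ℤ_) (tableaux≡K l c μ lμ (hsT-ninc₂ t λs μ e))) ⟩
      ⟦ hsT t λs μ ⟧ *ℤ (⟦ sumℕ λs ≡ᵇ sumℕ μ + c l ⟧ *ℤ K false (map c (List.downFrom l)) μ) ∎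
      where
      content : ∀ {T} → Shaped l μ T → subᵇ λs μ ≡ true →
        ⟦ contᵇ (suc l) c (concat (fill l λs T)) ⟧ ≡ ⟦ contᵇ l c (concat T) ⟧ *ℤ ⟦ sumℕ λs ≡ᵇ sumℕ μ + c l ⟧
      content {T} sh e = trans (cong ⟦_⟧ (trans (allᵇ-upTo-suc _ l) (cong₂ _∧_
        (allᵇ-cong-∈ _ _ (upTo l) (λ {b} b∈ → cong (_≡ᵇ c b) (fill-cnt-< l λs sh e (∈ₚ.∈-upTo⁻ b∈))))
        (bool-iff
          (λ q → ≡ᵇ⁺ (trans (sym (fill-cnt-≡ l λs sh e)) (cong (ℕ._+_ (sumℕ μ)) (≡ᵇ⁻ {cntL (concat (fill l λs T)) l} q))))
          (λ q → ≡ᵇ⁺ (ℕₚ.+-cancelˡ-≡ (sumℕ μ) _ _ (trans (fill-cnt-≡ l λs sh e) (≡ᵇ⁻ {sumℕ λs} q))))))))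
        (⟦∧⟧ (contᵇ l c (concat T)) _)

-- Symmetry of Kostka numbers

-- For fixed outer and inner partition, each row of the middle one ranges over an interval; reflect it.
middle-reflection : ∀ N w s λs ν → length λs ≡ length ν → s < N → (g : ℕ → ℤ) →
  ∑ (listsOf (upTo N) (length λs)) (λ μ → ⟦ hsT w λs μ ∧ hsT s μ ν ⟧ *ℤ g (sumℕ μ)) ≡
  ∑ (listsOf (upTo N) (length λs)) (λ μ → ⟦ hsT w λs μ ∧ hsT s μ ν ⟧ *ℤ
    g ((s ⊓ hd λs) + sumℕ (drop 1 λs) + sumℕ ν ∸ sumℕ μ))
middle-reflection N w s [] [] _ _ g =
  cong (λ j → + 1 *ℤ g (j + 0 + 0) +ℤ + 0) (sym (ℕₚ.n≤0⇒n≡0 (ℕₚ.m⊓n≤n s 0)))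
middle-reflection N w s (m ∷ λs) (n ∷ ν) len s<N g = begin
  ∑ (listsOf U (suc L)) (λ μ → ⟦ hsT w (m ∷ λs) μ ∧ hsT s μ (n ∷ ν) ⟧ *ℤ g (sumℕ μ))
    ≡⟨ expand g ⟩
  ∑ U (λ y → ⟦ inR y ⟧ *ℤ ∑ Q (λ μ → ⟦ hsT m λs μ ∧ hsT n μ ν ⟧ *ℤ g (y + sumℕ μ)))
    ≡⟨ ∑-cong-∈ U (λ {y} y∈ → guard (inR y) (λ e → middle-reflection N m n λs ν (ℕₚ.suc-injective len)
         (ℕₚ.≤-<-trans (ℕₚ.≤-trans (ℕₚ.m≤m⊔n n (hd λs)) (≤ᵇ⁻ {lo} (proj₁ (∧⁻ {lo ≤ᵇ y} e)))) (∈ₚ.∈-upTo⁻ y∈)) (λ j → g (y + j)))) ⟩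
  ∑ U (λ y → ⟦ inR y ⟧ *ℤ ∑ Q (λ μ → ⟦ hsT m λs μ ∧ hsT n μ ν ⟧ *ℤ g (y + (C ∸ sumℕ μ))))
    ≡⟨ reflect (λ y → ∑ Q (λ μ → ⟦ hsT m λs μ ∧ hsT n μ ν ⟧ *ℤ g (y + (C ∸ sumℕ μ)))) ⟩
  ∑ U (λ y → ⟦ inR y ⟧ *ℤ ∑ Q (λ μ → ⟦ hsT m λs μ ∧ hsT n μ ν ⟧ *ℤ g ((lo + hi ∸ y) + (C ∸ sumℕ μ))))
    ≡⟨ ∑-cong U (λ y → guard (inR y) (λ e → ∑-cong Q (λ μ → guard (hsT m λs μ ∧ hsT n μ ν) (λ e' → cong g
         (wt y μ (≤ᵇ⁻ {y} (proj₁ (∧⁻ {y ≤ᵇ hi} (proj₂ (∧⁻ {lo ≤ᵇ y} e))))) (proj₁ (∧⁻ {hsT m λs μ} e')) (proj₂ (∧⁻ {hsT m λs μ} e'))))))) ⟩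
  ∑ U (λ y → ⟦ inR y ⟧ *ℤ ∑ Q (λ μ → ⟦ hsT m λs μ ∧ hsT n μ ν ⟧ *ℤ g (S ∸ (y + sumℕ μ))))
    ≡⟨ sym (expand (λ j → g (S ∸ j))) ⟩
  ∑ (listsOf U (suc L)) (λ μ → ⟦ hsT w (m ∷ λs) μ ∧ hsT s μ (n ∷ ν) ⟧ *ℤ g (S ∸ sumℕ μ)) ∎
  where
  U = upTo N
  L = length λs
  Q = listsOf U L
  lo = n ⊔ hd λs
  hi = s ⊓ m
  C = (n ⊓ hd λs) + sumℕ (drop 1 λs) + sumℕ ν
  S = (s ⊓ m) + sumℕ λs + sumℕ (n ∷ ν)
  inI inR : ℕ → Bool
  inI y = (lo ≤ᵇ y) ∧ (y ≤ᵇ hi)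
  inR y = (lo ≤ᵇ y) ∧ ((y ≤ᵇ hi) ∧ (m ≤ᵇ w))
  bl : ∀ y μ → hsT w (m ∷ λs) (y ∷ μ) ∧ hsT s (y ∷ μ) (n ∷ ν) ≡ inR y ∧ (hsT m λs μ ∧ hsT n μ ν)
  bl y μ = bool-iff
    (λ e → let (e₁ , e₂) = ∧⁻ {hsT w (m ∷ λs) (y ∷ μ)} e
               (y≤m , m≤w , h₁) = hsT⁻ w m y λs μ e₁
               (n≤y , y≤s , h₂) = hsT⁻ s y n μ ν e₂
               (a , b) = ∧⁻ {hd λs ≤ᵇ y} (trans (sym (hsT-top y≤m λs μ)) h₁)
           in ∧⁺ (∧⁺ (≤ᵇ⁺ (ℕₚ.⊔-lub n≤y (≤ᵇ⁻ {hd λs} a))) (∧⁺ (≤ᵇ⁺ (ℕₚ.⊓-glb y≤s y≤m)) (≤ᵇ⁺ m≤w))) (∧⁺ b h₂))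
    (λ e → let (e₁ , e₂) = ∧⁻ {inR y} e
               (p , e₃) = ∧⁻ {lo ≤ᵇ y} e₁
               (q , m≤w) = ∧⁻ {y ≤ᵇ hi} e₃
               (b , h₂) = ∧⁻ {hsT m λs μ} e₂
               y≤m = ℕₚ.m≤n⊓o⇒m≤o s m (≤ᵇ⁻ {y} q)
           in ∧⁺ (∧⁺ (≤ᵇ⁺ y≤m) (∧⁺ m≤w (trans (hsT-top y≤m λs μ) (∧⁺ (≤ᵇ⁺ (ℕₚ.m⊔n≤o⇒n≤o n (hd λs) (≤ᵇ⁻ {lo} p))) b))))
                 (∧⁺ (≤ᵇ⁺ (ℕₚ.m⊔n≤o⇒m≤o n (hd λs) (≤ᵇ⁻ {lo} p))) (∧⁺ (≤ᵇ⁺ (ℕₚ.m≤n⊓o⇒m≤n s m (≤ᵇ⁻ {y} q))) h₂)))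
  expand : (f : ℕ → ℤ) → ∑ (listsOf U (suc L)) (λ μ → ⟦ hsT w (m ∷ λs) μ ∧ hsT s μ (n ∷ ν) ⟧ *ℤ f (sumℕ μ)) ≡
    ∑ U (λ y → ⟦ inR y ⟧ *ℤ ∑ Q (λ μ → ⟦ hsT m λs μ ∧ hsT n μ ν ⟧ *ℤ f (y + sumℕ μ)))
  expand f = begin
    ∑ (listsOf U (suc L)) (λ μ → ⟦ hsT w (m ∷ λs) μ ∧ hsT s μ (n ∷ ν) ⟧ *ℤ f (sumℕ μ))
      ≡⟨ ∑-lists-suc U L _ ⟩
    ∑ Q (λ μ → ∑ U (λ y → ⟦ hsT w (m ∷ λs) (y ∷ μ) ∧ hsT s (y ∷ μ) (n ∷ ν) ⟧ *ℤ f (y + sumℕ μ)))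
      ≡⟨ ∑-swap Q U _ ⟩
    ∑ U (λ y → ∑ Q (λ μ → ⟦ hsT w (m ∷ λs) (y ∷ μ) ∧ hsT s (y ∷ μ) (n ∷ ν) ⟧ *ℤ f (y + sumℕ μ)))
      ≡⟨ ∑-cong U (λ y → trans (∑-cong Q (λ μ → trans (cong (λ b → ⟦ b ⟧ *ℤ f (y + sumℕ μ)) (bl y μ)) (guard-∧ (inR y) _ _)))
           (sym (∑-*ˡ Q ⟦ inR y ⟧ _))) ⟩
    ∑ U (λ y → ⟦ inR y ⟧ *ℤ ∑ Q (λ μ → ⟦ hsT m λs μ ∧ hsT n μ ν ⟧ *ℤ f (y + sumℕ μ))) ∎
  reflect : (W : ℕ → ℤ) → ∑ U (λ y → ⟦ inR y ⟧ *ℤ W y) ≡ ∑ U (λ y → ⟦ inR y ⟧ *ℤ W (lo + hi ∸ y))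
  reflect W = begin
    ∑ U (λ y → ⟦ inR y ⟧ *ℤ W y)                         ≡⟨ ∑-cong U (λ y → split y (W y)) ⟩
    ∑ U (λ y → ⟦ inI y ⟧ *ℤ (⟦ m ≤ᵇ w ⟧ *ℤ W y))          ≡⟨ shift-interval lo hi N hi<N (λ y → ⟦ m ≤ᵇ w ⟧ *ℤ W y) ⟩
    ∑ U (λ k → ⟦ k + lo ≤ᵇ hi ⟧ *ℤ (⟦ m ≤ᵇ w ⟧ *ℤ W (k + lo)))  ≡⟨ sym (reflect-interval lo hi N hi<N (λ k → ⟦ m ≤ᵇ w ⟧ *ℤ W (k + lo))) ⟩
    ∑ U (λ y → ⟦ inI y ⟧ *ℤ (⟦ m ≤ᵇ w ⟧ *ℤ W ((hi ∸ y) + lo))) ≡⟨ ∑-cong U (λ y → guard (inI y) (λ e → cong (λ j → ⟦ m ≤ᵇ w ⟧ *ℤ W j)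
         (trans (ℕₚ.+-comm (hi ∸ y) lo) (sym (ℕₚ.+-∸-assoc lo (≤ᵇ⁻ {y} (proj₂ (∧⁻ {lo ≤ᵇ y} e)))))))) ⟩
    ∑ U (λ y → ⟦ inI y ⟧ *ℤ (⟦ m ≤ᵇ w ⟧ *ℤ W (lo + hi ∸ y))) ≡⟨ ∑-cong U (λ y → sym (split y (W (lo + hi ∸ y)))) ⟩
    ∑ U (λ y → ⟦ inR y ⟧ *ℤ W (lo + hi ∸ y)) ∎
    where
    hi<N : hi < N
    hi<N = ℕₚ.≤-<-trans (ℕₚ.m⊓n≤m s m) s<N
    split : ∀ y z → ⟦ inR y ⟧ *ℤ z ≡ ⟦ inI y ⟧ *ℤ (⟦ m ≤ᵇ w ⟧ *ℤ z)
    split y z = trans (cong (λ b → ⟦ b ⟧ *ℤ z) (sym (Boolₚ.∧-assoc (lo ≤ᵇ y) (y ≤ᵇ hi) (m ≤ᵇ w)))) (guard-∧ (inI y) (m ≤ᵇ w) z)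
  total : (lo + hi) + C ≡ S
  total = begin
    (lo + hi) + ((n ⊓ hd λs) + sumℕ (drop 1 λs) + sumℕ ν) ≡⟨ arr lo hi (n ⊓ hd λs) (sumℕ (drop 1 λs)) (sumℕ ν) ⟩
    hi + ((lo + (n ⊓ hd λs)) + sumℕ (drop 1 λs)) + sumℕ ν ≡⟨ cong (λ z → hi + (z + sumℕ (drop 1 λs)) + sumℕ ν) (⊔+⊓ n (hd λs)) ⟩
    hi + ((n + hd λs) + sumℕ (drop 1 λs)) + sumℕ ν       ≡⟨ cong (λ z → hi + z + sumℕ ν) (trans (ℕₚ.+-assoc n _ _) (cong (ℕ._+_ n) (hd+drop λs))) ⟩
    hi + (n + sumℕ λs) + sumℕ ν                          ≡⟨ arr' hi n (sumℕ λs) (sumℕ ν) ⟩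
    hi + sumℕ λs + (n + sumℕ ν) ∎
    where
    arr : ∀ a b c d e → (a + b) + (c + d + e) ≡ b + ((a + c) + d) + e
    arr = solve-∀
    arr' : ∀ a b c d → a + (b + c) + d ≡ a + c + (b + d)
    arr' = solve-∀
  sum-C : ∀ μ → hsT m λs μ ≡ true → hsT n μ ν ≡ true → sumℕ μ ≤ C
  sum-C μ e₁ e₂ = go μ λs ν e₁ e₂
    where
    go : ∀ {n m} μ λs ν → hsT m λs μ ≡ true → hsT n μ ν ≡ true → sumℕ μ ≤ (n ⊓ hd λs) + sumℕ (drop 1 λs) + sumℕ ν
    go [] [] [] _ _ = z≤n
    go {n} {m} (y ∷ μ) (x ∷ λs) (z ∷ ν) e₁ e₂ with hsT⁻ m x y λs μ e₁ | hsT⁻ n y z μ ν e₂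
    ... | y≤x , _ , h₁ | _ , y≤n , _ = ℕₚ.≤-trans (ℕₚ.+-mono-≤ (ℕₚ.⊓-glb y≤n y≤x) (hsT-sum y λs μ h₁)) (ℕₚ.m≤m+n _ _)
  wt : ∀ y μ → y ≤ hi → hsT m λs μ ≡ true → hsT n μ ν ≡ true → (lo + hi ∸ y) + (C ∸ sumℕ μ) ≡ S ∸ (y + sumℕ μ)
  wt y μ y≤hi e₁ e₂ = sym (trans (cong (_∸ (y + sumℕ μ)) (sym total))
    (∸-interchange (lo + hi) C y (sumℕ μ) (ℕₚ.≤-trans y≤hi (ℕₚ.m≤n+m hi lo)) (sum-C μ e₁ e₂)))

module Symmetry (t M : ℕ) where
  open Cauchy t M

  -- A Bender-Knuth exchange of the two largest letters: reflecting the partition μ between λ and ν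
  -- sends |μ| to |λ| + |ν| - |μ|, hence interchanges the sizes of the two strips.
  K-swap : ∀ a b α λs → length λs ≡ M → ninc t λs ≡ true → K false (a ∷ b ∷ α) λs ≡ K false (b ∷ a ∷ α) λs
  K-swap a b α λs len nλ = trans (two a b) (trans (∑-cong-∈ P (λ {ν} ν∈ → cong (K false α ν *ℤ_)
      (mid ν (proj₁ (∈-listsOf⁻ (upTo N) M ν∈))))) (sym (two b a)))
    where
    g : ℕ → ℕ → List ℕ → ℕ → ℤ
    g a b ν x = ⟦ sumℕ λs ≡ᵇ x + a ⟧ *ℤ ⟦ x ≡ᵇ sumℕ ν + b ⟧
    arr : ∀ x y z w k → x *ℤ (y *ℤ (z *ℤ (w *ℤ k))) ≡ k *ℤ ((x *ℤ z) *ℤ (y *ℤ w))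
    arr = solve-∀ℤ
    two : ∀ a b → K false (a ∷ b ∷ α) λs ≡ ∑ P (λ ν → K false α ν *ℤ ∑ P (λ μ → ⟦ hsT t λs μ ∧ hsT t μ ν ⟧ *ℤ g a b ν (sumℕ μ)))
    two a b = begin
      ∑ P (λ μ → ⟦ hsT t λs μ ⟧ *ℤ (⟦ sumℕ λs ≡ᵇ sumℕ μ + a ⟧ *ℤ ∑ P (λ ν → ⟦ hsT t μ ν ⟧ *ℤ (⟦ sumℕ μ ≡ᵇ sumℕ ν + b ⟧ *ℤ K false α ν))))
        ≡⟨ ∑-cong P (λ μ → trans (trans (cong (⟦ hsT t λs μ ⟧ *ℤ_) (∑-*ˡ P ⟦ sumℕ λs ≡ᵇ sumℕ μ + a ⟧ _)) (∑-*ˡ P ⟦ hsT t λs μ ⟧ _))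
             (∑-cong P (λ ν → trans (arr ⟦ hsT t λs μ ⟧ ⟦ sumℕ λs ≡ᵇ sumℕ μ + a ⟧ ⟦ hsT t μ ν ⟧ ⟦ sumℕ μ ≡ᵇ sumℕ ν + b ⟧ (K false α ν))
               (cong (λ x → K false α ν *ℤ (x *ℤ g a b ν (sumℕ μ))) (sym (⟦∧⟧ (hsT t λs μ) (hsT t μ ν))))))) ⟩
      ∑ P (λ μ → ∑ P (λ ν → K false α ν *ℤ (⟦ hsT t λs μ ∧ hsT t μ ν ⟧ *ℤ g a b ν (sumℕ μ))))
        ≡⟨ ∑-swap P P _ ⟩
      ∑ P (λ ν → ∑ P (λ μ → K false α ν *ℤ (⟦ hsT t λs μ ∧ hsT t μ ν ⟧ *ℤ g a b ν (sumℕ μ))))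
        ≡⟨ ∑-cong P (λ ν → sym (∑-*ˡ P (K false α ν) _)) ⟩
      ∑ P (λ ν → K false α ν *ℤ ∑ P (λ μ → ⟦ hsT t λs μ ∧ hsT t μ ν ⟧ *ℤ g a b ν (sumℕ μ))) ∎
    hd≤t : ∀ t λs → ninc t λs ≡ true → hd λs ≤ t
    hd≤t t []      _ = z≤n
    hd≤t t (x ∷ λs) e = proj₁ (ninc⁻ t x λs e)
    mid : ∀ ν → length ν ≡ M → ∑ P (λ μ → ⟦ hsT t λs μ ∧ hsT t μ ν ⟧ *ℤ g a b ν (sumℕ μ)) ≡ ∑ P (λ μ → ⟦ hsT t λs μ ∧ hsT t μ ν ⟧ *ℤ g b a ν (sumℕ μ))
    mid ν lν = begin
      ∑ P (λ μ → ⟦ hsT t λs μ ∧ hsT t μ ν ⟧ *ℤ g a b ν (sumℕ μ))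
        ≡⟨ subst (λ k → ∑ (listsOf (upTo N) k) (λ μ → ⟦ hsT t λs μ ∧ hsT t μ ν ⟧ *ℤ g a b ν (sumℕ μ)) ≡
             ∑ (listsOf (upTo N) k) (λ μ → ⟦ hsT t λs μ ∧ hsT t μ ν ⟧ *ℤ g a b ν ((t ⊓ hd λs) + sumℕ (drop 1 λs) + sumℕ ν ∸ sumℕ μ))) len
             (middle-reflection N t t λs ν (trans len (sym lν)) (ℕₚ.m<n⇒m<1+n (ℕₚ.n<1+n t)) (g a b ν)) ⟩
      ∑ P (λ μ → ⟦ hsT t λs μ ∧ hsT t μ ν ⟧ *ℤ g a b ν ((t ⊓ hd λs) + sumℕ (drop 1 λs) + sumℕ ν ∸ sumℕ μ))
        ≡⟨ ∑-cong P (λ μ → guard (hsT t λs μ ∧ hsT t μ ν) (λ e → trans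
             (cong (λ z → g a b ν (z + sumℕ ν ∸ sumℕ μ)) (trans (cong (_+ sumℕ (drop 1 λs)) (ℕₚ.m≥n⇒m⊓n≡n (hd≤t t λs nλ))) (hd+drop λs)))
             (weights (sumℕ λs) (sumℕ ν) (sumℕ μ) (hsT-sum t λs μ (proj₁ (∧⁻ {hsT t λs μ} e))) (hsT-sum t μ ν (proj₂ (∧⁻ {hsT t λs μ} e)))))) ⟩
      ∑ P (λ μ → ⟦ hsT t λs μ ∧ hsT t μ ν ⟧ *ℤ g b a ν (sumℕ μ)) ∎
      where
      weights : ∀ L V x → x ≤ L → V ≤ x →
        ⟦ L ≡ᵇ (L + V ∸ x) + a ⟧ *ℤ ⟦ L + V ∸ x ≡ᵇ V + b ⟧ ≡ ⟦ L ≡ᵇ x + b ⟧ *ℤ ⟦ x ≡ᵇ V + a ⟧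
      weights L V x x≤L V≤x with ℕₚ.m≤n⇒∃[o]m+o≡n V≤x
      ... | p , refl with ℕₚ.m≤n⇒∃[o]m+o≡n x≤L
      ... | q , refl = trans (ℤₚ.*-comm ⟦ V + p + q ≡ᵇ (V + p + q + V ∸ (V + p)) + a ⟧ _) (cong₂ (λ c d → ⟦ c ⟧ *ℤ ⟦ d ⟧)
          (bool-iff
            (λ e → ≡ᵇ⁺ (cong (ℕ._+_ (V + p)) (ℕₚ.+-cancelˡ-≡ V q b (trans (sym z) (≡ᵇ⁻ {V + p + q + V ∸ (V + p)} e)))))
            (λ e → ≡ᵇ⁺ (trans z (cong (ℕ._+_ V) (ℕₚ.+-cancelˡ-≡ (V + p) q b (≡ᵇ⁻ {V + p + q} e))))))
          (bool-iff
            (λ e → ≡ᵇ⁺ (cong (ℕ._+_ V) (ℕₚ.+-cancelˡ-≡ (V + q) p a (trans (arr₁ V p q) (trans (≡ᵇ⁻ {V + p + q} e) (cong (_+ a) z))))))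
            (λ e → ≡ᵇ⁺ (trans (sym (arr₁ V p q)) (trans (cong (ℕ._+_ (V + q)) (ℕₚ.+-cancelˡ-≡ V p a (≡ᵇ⁻ {V + p} e))) (cong (_+ a) (sym z)))))))
        where
        arr₁ : ∀ V p q → (V + q) + p ≡ V + p + q
        arr₁ = solve-∀
        arr₂ : ∀ V p q → V + p + q + V ≡ (V + p) + (V + q)
        arr₂ = solve-∀
        z : V + p + q + V ∸ (V + p) ≡ V + q
        z = trans (cong (_∸ (V + p)) (arr₂ V p q)) (ℕₚ.m+n∸m≡n (V + p) (V + q))

  K-cons-cong : ∀ a α β → (∀ λs → length λs ≡ M → ninc t λs ≡ true → K false α λs ≡ K false β λs) →
    ∀ λs → K false (a ∷ α) λs ≡ K false (a ∷ β) λs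
  K-cons-cong a α β e λs = ∑-cong-∈ P (λ {μ} μ∈ → guard (hsT t λs μ) (λ h →
    cong (⟦ sumℕ λs ≡ᵇ sumℕ μ + a ⟧ *ℤ_) (e μ (proj₁ (∈-listsOf⁻ (upTo N) M μ∈)) (hsT-ninc₂ t λs μ h))))

  K-↭ : ∀ {α β} → α ↭ β → ∀ λs → length λs ≡ M → ninc t λs ≡ true → K false α λs ≡ K false β λs
  K-↭ Perm.refl λs len nλ = refl
  K-↭ (Perm.prep {α} {β} a p) λs len nλ = K-cons-cong a α β (K-↭ p) λs
  K-↭ (Perm.swap {α} {β} a b p) λs len nλ = trans (K-cons-cong a (b ∷ α) (b ∷ β) (λ μ _ _ → K-cons-cong b α β (K-↭ p) μ) λs)
    (K-swap a b β λs len nλ)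
  K-↭ (Perm.trans p q) λs len nλ = trans (K-↭ p λs len nλ) (K-↭ q λs len nλ)

  -- A strip of size 0 leaves the partition unchanged. This removes letters that do not occur, which
  -- a content lists and a composition omits.
  K-drop0 : ∀ α λs → length λs ≡ M → ninc t λs ≡ true → K false (0 ∷ α) λs ≡ K false α λs
  K-drop0 α λs len nλ = trans
    (∑-cong P (λ μ → trans (sym (guard-∧ (hsT t λs μ) _ _)) (cong (λ b → ⟦ b ⟧ *ℤ K false α μ) (bool-iff
      (λ e → let (e₁ , e₂) = ∧⁻ {hsT t λs μ} e in dec-true (μ ≟ₗ λs)
        (eq t λs μ e₁ (trans (≡ᵇ⁻ {sumℕ λs} e₂) (ℕₚ.+-identityʳ (sumℕ μ)))))
      (λ e → subst (λ z → hsT t λs z ∧ (sumℕ λs ≡ᵇ sumℕ z + 0) ≡ true) (sym (does-true (μ ≟ₗ λs) e))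
        (∧⁺ (self t λs nλ) (≡ᵇ⁺ (sym (ℕₚ.+-identityʳ (sumℕ λs))))))))))
    (Once-P λs len (All.map (λ x≤t → ℕₚ.m<n⇒m<1+n (s≤s x≤t)) (ninc-All t λs nλ)) (K false α))
    where
    self : ∀ t λs → ninc t λs ≡ true → hsT t λs λs ≡ true
    self t []       e = refl
    self t (x ∷ λs) e = let (x≤t , r) = ninc⁻ t x λs e in ∧⁺ (≤ᵇ⁺ (ℕₚ.≤-refl {x})) (∧⁺ (≤ᵇ⁺ x≤t) (self x λs r))
    eq : ∀ t λs μ → hsT t λs μ ≡ true → sumℕ λs ≡ sumℕ μ → μ ≡ λs
    eq t []       []      e s = refl
    eq t (x ∷ λs) (y ∷ μ) e s with hsT⁻ t x y λs μ e
    ... | y≤x , _ , h with ℕₚ.m≤n⇒m<n∨m≡n y≤x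
    ...   | inj₁ y<x  = ⊥-elim (ℕₚ.<⇒≢ (ℕₚ.+-mono-<-≤ y<x (hsT-sum y λs μ h)) (sym s))
    ...   | inj₂ refl = cong (x ∷_) (eq x λs μ h (ℕₚ.+-cancelˡ-≡ x _ _ s))

runs-++ : ∀ k a xs → All (_< k) xs → runs (xs ++ rep (suc a) k) ≡ runs xs ++ suc a ∷ []
runs-++ k a [] _ = block k 1 a
  where
  block : ∀ k c a → runsFrom k c (rep a k) ≡ c + a ∷ []
  block k c zero    = cong (_∷ []) (sym (ℕₚ.+-identityʳ c))
  block k c (suc a) rewrite ≡ᵇ⁺ {k} refl = trans (block k (suc c) a) (cong (_∷ []) (sym (ℕₚ.+-suc c a)))
runs-++ k a (x ∷ xs) (x<k ∷ b) = go x 1 xs x<k b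
  where
  go : ∀ x c xs → x < k → All (_< k) xs → runsFrom x c (xs ++ rep (suc a) k) ≡ runsFrom x c xs ++ suc a ∷ []
  go x c [] x<k _ rewrite ≡false (λ e → ℕₚ.<⇒≢ x<k (≡ᵇ⁻ {x} {k} e)) = cong (c ∷_) (runs-++ k a [] [])
  go x c (y ∷ xs) x<k (y<k ∷ b) with x ≡ᵇ y
  ... | true  = go x (suc c) xs x<k b
  ... | false = cong (c ∷_) (go y 1 xs y<k b)

module Contents (t M : ℕ) where
  open Cauchy t M
  open Symmetry t M

  -- The content lists multiplicities from the largest letter down, zeros included; the composition
  -- lists the positive ones from the smallest letter up. The symmetry of Kostka numbers bridges the
  -- two orders.
  K-content≡runs : ∀ k u → All (_< k) u → sortedᵇ _≤ᵇ_ u ≡ true → ∀ λs → length λs ≡ M → ninc t λs ≡ true →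
    K false (map (cntL u) (List.downFrom k)) λs ≡ K false (runs u) λs
  K-content≡runs zero [] _ _ λs len nλ = refl
  K-content≡runs zero (_ ∷ _) (() ∷ _) _ λs len nλ
  K-content≡runs (suc k) u b e λs len nλ with sorted-last k u b e
  ... | u₁ , a , refl , b₁ , e₁ = begin
    K false (cntL (u₁ ++ rep a k) k ∷ map (cntL (u₁ ++ rep a k)) (List.downFrom k)) λs
      ≡⟨ cong (λ α → K false α λs) (cong₂ _∷_ (cntL-++rep-≡ k a u₁ b₁) (map-cong-upTo k (cntL-++rep-< k a u₁))) ⟩
    K false (a ∷ map (cntL u₁) (List.downFrom k)) λs
      ≡⟨ K-cons-cong a (map (cntL u₁) (List.downFrom k)) (runs u₁) (K-content≡runs k u₁ b₁ e₁) λs ⟩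
    K false (a ∷ runs u₁) λs
      ≡⟨ last a ⟩
    K false (runs (u₁ ++ rep a k)) λs ∎
    where
    last : ∀ a → K false (a ∷ runs u₁) λs ≡ K false (runs (u₁ ++ rep a k)) λs
    last zero    = trans (K-drop0 (runs u₁) λs len nλ) (cong (λ z → K false (runs z) λs) (sym (Listₚ.++-identityʳ u₁)))
    last (suc a) = trans (K-↭ (↭ₚ.∷↭∷ʳ (suc a) (runs u₁)) λs len nλ) (cong (λ α → K false α λs) (sym (runs-++ k a u₁ b₁)))

-- The internal coproduct on words

toList-lookup : ∀ {n} (q : Vec A n) → toList q ≡ List.tabulate (lookup q)
toList-lookup []      = refl
toList-lookup (x ∷ q) = cong (x ∷_) (toList-lookup q)

count-map : (p : B → Bool) (f : A → B) (xs : List A) → count p (map f xs) ≡ count (p ∘ f) xs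
count-map p f []       = refl
count-map p f (x ∷ xs) rewrite count-map p f xs = refl

count-tabulate : ∀ {n} (p : A → Bool) (u : Fin n → A) → count p (List.tabulate u) ≡ count (p ∘ u) (allFin n)
count-tabulate p u = trans (cong (count p) (sym (Listₚ.map-tabulate id u))) (count-map p u (allFin _))

bound : ∀ {n} → Word n → ℕ
bound v = suc (sumℕ (List.tabulate v))

<bound : ∀ {n} (v : Word n) i → v i < bound v
<bound v i = s≤s (≤sum v i)
  where
  ≤sum : ∀ {n} (v : Word n) i → v i ≤ sumℕ (List.tabulate v)
  ≤sum v fzero    = ℕₚ.m≤m+n (v fzero) _
  ≤sum v (fsuc i) = ℕₚ.≤-trans (≤sum (v ∘ fsuc) i) (ℕₚ.m≤n+m _ (v fzero))

cnt : ∀ {n} → Word n → ℕ → ℕ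
cnt {n} w b = count (λ i → w i ≡ᵇ b) (allFin n)

sameContentᵇ : ∀ {n} → Word n → Vec ℕ n → Bool
sameContentᵇ v q = allᵇ (λ b → cnt (lookup q) b ≡ᵇ cnt v b) (upTo (bound v))

inBlocksᵇ : ∀ {n} → Word n → Vec ℕ n → Bool
inBlocksᵇ {n} u q = allᵇ (λ i → allᵇ (λ j → not ((toℕ i ≤ᵇ toℕ j) ∧ (u i ≡ᵇ u j)) ∨ (lookup q i ≤ᵇ lookup q j)) (allFin n)) (allFin n)

rk : ∀ {n} → Word n → Vec ℕ n → Word n
rk u q = lookup (ranks (Vec.tabulate (λ i → u i , lookup q i)))

Δ≡ : ∀ {n} (f : Series n) (u v : Word n) →
  Δ f u v ≡ ∑ (allVecsOf (upTo (bound v)) n) (λ q → ⟦ sameContentᵇ v q ∧ inBlocksᵇ u q ⟧ *ℤ f (rk u q))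
Δ≡ {n} f u v = ∑-filter (λ q → sameContentᵇ v q ∧ inBlocksᵇ u q) (allVecsOf (upTo (bound v)) n) (λ q → f (rk u q))

-- Upward induction starting at `i`; it spreads relations between neighbouring positions over longer
-- stretches.
chain : ∀ {m} (Q : Fin (suc m) → Set) (i : Fin (suc m)) → Q i →
  (∀ (j : Fin m) → toℕ i ≤ toℕ j → Q (inject₁ j) → Q (fsuc j)) → ∀ k → toℕ i ≤ toℕ k → Q k
chain {m} Q fzero q₀ step k _ = go k
  where
  go : ∀ k → Q k
  go k = FinInd.<-weakInduction Q q₀ (λ j → step j z≤n) k
chain {suc m} Q (fsuc i) qᵢ step (fsuc k) (s≤s i≤k) = chain (Q ∘ fsuc) i qᵢ (λ j i≤j → step (fsuc j) (s≤s i≤j)) k i≤k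

inBlocks⁻ : ∀ {n} (u : Word n) q → inBlocksᵇ u q ≡ true → ∀ i j → toℕ i ≤ toℕ j → u i ≡ u j → lookup q i ≤ lookup q j
inBlocks⁻ u q e i j i≤j ui≡uj = ≤ᵇ⁻ {lookup q i} (⇒ᵇ⁻ {(toℕ i ≤ᵇ toℕ j) ∧ (u i ≡ᵇ u j)}
  (allFinᵇ⁻ (λ j → not ((toℕ i ≤ᵇ toℕ j) ∧ (u i ≡ᵇ u j)) ∨ (lookup q i ≤ᵇ lookup q j)) (allFinᵇ⁻ _ e i) j)
  (∧⁺ (≤ᵇ⁺ i≤j) (≡ᵇ⁺ ui≡uj)))

inBlocks⁺ : ∀ {n} (u : Word n) q → (∀ i j → toℕ i ≤ toℕ j → u i ≡ u j → lookup q i ≤ lookup q j) → inBlocksᵇ u q ≡ true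
inBlocks⁺ u q f = allFinᵇ⁺ _ (λ i → allFinᵇ⁺ _ (λ j → ⇒ᵇ⁺ {(toℕ i ≤ᵇ toℕ j) ∧ (u i ≡ᵇ u j)} (λ e →
  let (a , b) = ∧⁻ {toℕ i ≤ᵇ toℕ j} e in ≤ᵇ⁺ (f i j (≤ᵇ⁻ {toℕ i} a) (≡ᵇ⁻ {u i} b)))))

inject₁≤suc : ∀ {m} (j : Fin m) → toℕ (inject₁ j) ≤ toℕ (fsuc j)
inject₁≤suc j = ℕₚ.≤-trans (ℕₚ.≤-reflexive (Finₚ.toℕ-inject₁ j)) (ℕₚ.n≤1+n (toℕ j))

-- Positions between two equal letters of a monotone word carry the same letter, so comparing
-- neighbours within a block is enough.
inBlocks-step : ∀ {m} (u : Word (suc m)) q → Monotone u →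
  (∀ (j : Fin m) → u (inject₁ j) ≡ u (fsuc j) → lookup q (inject₁ j) ≤ lookup q (fsuc j)) → inBlocksᵇ u q ≡ true
inBlocks-step {m} u q mu f = inBlocks⁺ u q (λ i j i≤j → chain (λ k → u i ≡ u k → lookup q i ≤ lookup q k) i (λ _ → ℕₚ.≤-refl)
  (λ k i≤k IH ui≡ → let
      a : u i ≤ u (inject₁ k)
      a = mu i (inject₁ k) (subst (toℕ i ≤_) (sym (Finₚ.toℕ-inject₁ k)) i≤k)
      b : u (inject₁ k) ≤ u (fsuc k)
      b = mu (inject₁ k) (fsuc k) (inject₁≤suc k)
      e : u i ≡ u (inject₁ k)
      e = ℕₚ.≤-antisym a (ℕₚ.≤-trans b (ℕₚ.≤-reflexive (sym ui≡)))
    in ℕₚ.≤-trans (IH e) (f k (trans (sym e) ui≡))) j i≤j)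

_≡²_ : ℕ × ℕ → ℕ × ℕ → Bool
(a , b) ≡² (a' , b') = (a ≡ᵇ a') ∧ (b ≡ᵇ b')

ranks-step : ∀ {k} (ps : Vec (ℕ × ℕ) (suc k)) (i : Fin k) →
  lookup (ranks ps) (fsuc i) ≡ (if lookup ps (inject₁ i) ≡² lookup ps (fsuc i) then lookup (ranks ps) (inject₁ i) else suc (lookup (ranks ps) (inject₁ i)))
ranks-step (p ∷ ps) i = go 0 p ps i
  where
  go : ∀ {k} r p (ps : Vec (ℕ × ℕ) k) (i : Fin k) → lookup (ranksFrom r p ps) i ≡
    (if lookup (p ∷ ps) (inject₁ i) ≡² lookup ps i then lookup (r ∷ ranksFrom r p ps) (inject₁ i) else suc (lookup (r ∷ ranksFrom r p ps) (inject₁ i)))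
  go r p (p' ∷ ps) fzero    = refl
  go r p (p' ∷ ps) (fsuc i) = go _ p' ps i

module _ {m} (u : Word (suc m)) (q : Vec ℕ (suc m)) where

  private
    ps : Vec (ℕ × ℕ) (suc m)
    ps = Vec.tabulate (λ i → u i , lookup q i)
    psᵢ : ∀ i → lookup ps i ≡ (u i , lookup q i)
    psᵢ = Vecₚ.lookup∘tabulate (λ i → u i , lookup q i)

  sameᵇ : Fin m → Bool
  sameᵇ i = (u (inject₁ i) ≡ᵇ u (fsuc i)) ∧ (lookup q (inject₁ i) ≡ᵇ lookup q (fsuc i))

  rk-step : ∀ i → rk u q (fsuc i) ≡ (if sameᵇ i then rk u q (inject₁ i) else suc (rk u q (inject₁ i)))
  rk-step i = trans (ranks-step ps i) (cong (λ b → if b then rk u q (inject₁ i) else suc (rk u q (inject₁ i)))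
    (cong₂ _≡²_ (psᵢ (inject₁ i)) (psᵢ (fsuc i))))

  rk-≤ : ∀ i → rk u q (inject₁ i) ≤ rk u q (fsuc i)
  rk-≤ i with sameᵇ i | rk-step i
  ... | true  | e = ℕₚ.≤-reflexive (sym e)
  ... | false | e = ℕₚ.≤-trans (ℕₚ.n≤1+n _) (ℕₚ.≤-reflexive (sym e))

  rk-<ᵇ : ∀ i → (rk u q (inject₁ i) <ᵇ rk u q (fsuc i)) ≡ not (sameᵇ i)
  rk-<ᵇ i with sameᵇ i | rk-step i
  ... | true  | e = ≡false (λ e' → ℕₚ.<-irrefl (sym e) (<ᵇ⁻ {rk u q (inject₁ i)} e'))
  ... | false | e = <ᵇ⁺ (subst (rk u q (inject₁ i) <_) (sym e) (ℕₚ.n<1+n _))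

  rk-≡ᵇ : ∀ i → (rk u q (inject₁ i) ≡ᵇ rk u q (fsuc i)) ≡ sameᵇ i
  rk-≡ᵇ i with sameᵇ i | rk-step i
  ... | true  | e = ≡ᵇ⁺ (sym e)
  ... | false | e = ≡false (λ e' → ℕₚ.<⇒≢ (ℕₚ.n<1+n (rk u q (inject₁ i))) (trans (≡ᵇ⁻ {rk u q (inject₁ i)} e') e))

rk-monotone : ∀ {n} (u : Word n) q → Monotone (rk u q)
rk-monotone {suc m} u q i j i≤j = chain (λ k → rk u q i ≤ rk u q k) i ℕₚ.≤-refl (λ k _ le → ℕₚ.≤-trans le (rk-≤ u q k)) j i≤j

Δ-cong : ∀ {n} {f g : Series n} → f ≈ g → ∀ u v → Δ f u v ≡ Δ g u v
Δ-cong {n} {f} {g} f≈g u v = trans (Δ≡ f u v) (trans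
  (∑-cong (allVecsOf (upTo (bound v)) n) (λ q → cong (⟦ sameContentᵇ v q ∧ inBlocksᵇ u q ⟧ *ℤ_) (f≈g (rk u q) (rk-monotone u q))))
  (sym (Δ≡ g u v)))

Δ-∑ : ∀ {n} (xs : List A) (c : A → ℤ) (f : A → Series n) (u v : Word n) →
  Δ (λ w → ∑ xs (λ x → c x *ℤ f x w)) u v ≡ ∑ xs (λ x → c x *ℤ Δ (f x) u v)
Δ-∑ {n = n} xs c f u v = begin
  Δ (λ w → ∑ xs (λ x → c x *ℤ f x w)) u v
    ≡⟨ Δ≡ (λ w → ∑ xs (λ x → c x *ℤ f x w)) u v ⟩
  ∑ Q (λ q → V q *ℤ ∑ xs (λ x → c x *ℤ f x (rk u q)))
    ≡⟨ ∑-cong Q (λ q → trans (∑-*ˡ xs (V q) _) (∑-cong xs (λ x → *-swapℤ (V q) (c x) _))) ⟩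
  ∑ Q (λ q → ∑ xs (λ x → c x *ℤ (V q *ℤ f x (rk u q))))
    ≡⟨ ∑-swap Q xs _ ⟩
  ∑ xs (λ x → ∑ Q (λ q → c x *ℤ (V q *ℤ f x (rk u q))))
    ≡⟨ ∑-cong xs (λ x → trans (sym (∑-*ˡ Q (c x) _)) (cong (c x *ℤ_) (sym (Δ≡ (f x) u v)))) ⟩
  ∑ xs (λ x → c x *ℤ Δ (f x) u v) ∎
  where
  Q = allVecsOf (upTo (bound v)) n
  V : Vec ℕ n → ℤ
  V q = ⟦ sameContentᵇ v q ∧ inBlocksᵇ u q ⟧

-- Conjugate partitions

at : List ℕ → ℕ → ℕ
at []       i       = 0
at (x ∷ xs) zero    = x
at (x ∷ xs) (suc i) = at xs i

at-ext : ∀ xs ys → length xs ≡ length ys → (∀ i → at xs i ≡ at ys i) → xs ≡ ys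
at-ext []       []       _ _ = refl
at-ext (x ∷ xs) (y ∷ ys) l e = cong₂ _∷_ (e 0) (at-ext xs ys (ℕₚ.suc-injective l) (e ∘ suc))

at-++0 : ∀ xs k i → at (xs ++ rep k 0) i ≡ at xs i
at-++0 []       zero    i       = refl
at-++0 []       (suc k) zero    = refl
at-++0 []       (suc k) (suc i) = at-++0 [] k i
at-++0 (x ∷ xs) k       zero    = refl
at-++0 (x ∷ xs) k       (suc i) = at-++0 xs k i

at-map-< : ∀ (f : ℕ → ℕ) k j → j < k → at (map f (upTo k)) j ≡ f j
at-map-< f k j j<k = trans (cong (λ l → at l j) (Listₚ.map-upTo f k)) (go f k j j<k)
  where
  go : ∀ (f : ℕ → ℕ) k j → j < k → at (List.applyUpTo f k) j ≡ f j
  go f (suc k) zero    _         = refl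
  go f (suc k) (suc j) (s≤s j<k) = go (f ∘ suc) k j j<k

at-map-≥ : ∀ (f : ℕ → ℕ) k j → k ≤ j → at (map f (upTo k)) j ≡ 0
at-map-≥ f k j k≤j = trans (cong (λ l → at l j) (Listₚ.map-upTo f k)) (go f k j k≤j)
  where
  go : ∀ (f : ℕ → ℕ) k j → k ≤ j → at (List.applyUpTo f k) j ≡ 0
  go f zero    j       _         = refl
  go f (suc k) (suc j) (s≤s k≤j) = go (f ∘ suc) k j k≤j

hsT-at⁺ : ∀ t λs μ → length λs ≡ length μ → at λs 0 ≤ t → (∀ i → at μ i ≤ at λs i) → (∀ i → at λs (suc i) ≤ at μ i) → hsT t λs μ ≡ true
hsT-at⁺ t []       []      _ _ _ _ = refl
hsT-at⁺ t (x ∷ λs) (y ∷ μ) l b p q = ∧⁺ (≤ᵇ⁺ (p 0)) (∧⁺ (≤ᵇ⁺ b) (hsT-at⁺ y λs μ (ℕₚ.suc-injective l) (q 0) (p ∘ suc) (q ∘ suc)))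

hsT-at⁻ : ∀ t λs μ → hsT t λs μ ≡ true → at λs 0 ≤ t × (∀ i → at μ i ≤ at λs i) × (∀ i → at λs (suc i) ≤ at μ i)
hsT-at⁻ t []       []      e = z≤n , (λ _ → z≤n) , (λ _ → z≤n)
hsT-at⁻ t (x ∷ λs) (y ∷ μ) e with hsT⁻ t x y λs μ e
... | y≤x , x≤t , h with hsT-at⁻ y λs μ h
...   | a , p , q = x≤t , (λ { zero → y≤x ; (suc i) → p i }) , (λ { zero → a ; (suc i) → q i })

vs-at⁺ : ∀ λs μ → length λs ≡ length μ → (∀ i → at μ i ≤ at λs i) → (∀ i → at λs i ≤ suc (at μ i)) → vsᵇ λs μ ≡ true
vs-at⁺ []       []      _ _ _ = refl
vs-at⁺ (x ∷ λs) (y ∷ μ) l p q = ∧⁺ (≤ᵇ⁺ (p 0)) (∧⁺ (≤ᵇ⁺ (q 0)) (vs-at⁺ λs μ (ℕₚ.suc-injective l) (p ∘ suc) (q ∘ suc)))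

vs-at⁻ : ∀ λs μ → vsᵇ λs μ ≡ true → (∀ i → at μ i ≤ at λs i) × (∀ i → at λs i ≤ suc (at μ i))
vs-at⁻ []       []      e = (λ _ → z≤n) , (λ _ → z≤n)
vs-at⁻ (x ∷ λs) (y ∷ μ) e with vs⁻ x y λs μ e
... | y≤x , x≤y , h with vs-at⁻ λs μ h
...   | p , q = (λ { zero → y≤x ; (suc i) → p i }) , (λ { zero → x≤y ; (suc i) → q i })

ninc-at⁺ : ∀ t λs → at λs 0 ≤ t → (∀ i → at λs (suc i) ≤ at λs i) → ninc t λs ≡ true
ninc-at⁺ t []       _ _ = refl
ninc-at⁺ t (x ∷ λs) b p = ∧⁺ (≤ᵇ⁺ b) (ninc-at⁺ x λs (p 0) (p ∘ suc))

ninc-at-≤ : ∀ t λs → ninc t λs ≡ true → ∀ i → at λs i ≤ t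
ninc-at-≤ t []       e i       = z≤n
ninc-at-≤ t (x ∷ λs) e zero    = proj₁ (ninc⁻ t x λs e)
ninc-at-≤ t (x ∷ λs) e (suc i) = let (x≤t , r) = ninc⁻ t x λs e in ℕₚ.≤-trans (ninc-at-≤ x λs r i) x≤t

-- The parts of a partition exceeding `j` form an initial segment. In the form i < λ'_j iff j < λ_i
-- this characterises the conjugate, and the order properties of conjugation are read off from it.
count-<-galois : ∀ t λs j → ninc t λs ≡ true → ∀ i →
  (i < count (j <ᵇ_) λs → j < at λs i) × (j < at λs i → i < count (j <ᵇ_) λs)
count-<-galois t []       j e i = (λ ()) , (λ ())
count-<-galois t (x ∷ λs) j e i with j <ᵇ x in j<x
count-<-galois t (x ∷ λs) j e zero    | true = (λ _ → <ᵇ⁻ {j} j<x) , (λ _ → s≤s z≤n)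
count-<-galois t (x ∷ λs) j e (suc i) | true with count-<-galois x λs j (proj₂ (ninc⁻ t x λs e)) i
... | f , g = (λ { (s≤s p) → f p }) , (λ p → s≤s (g p))
count-<-galois t (x ∷ λs) j e i | false = (λ p → ⊥-elim (ℕₚ.n≮0 (subst (i <_) (none λs (proj₂ (ninc⁻ t x λs e))) p))) ,
  (λ p → ⊥-elim (false≢true (trans (sym j<x) (<ᵇ⁺ (ℕₚ.<-≤-trans p (at≤x i))))))
  where
  at≤x : ∀ i → at (x ∷ λs) i ≤ x
  at≤x zero    = ℕₚ.≤-refl
  at≤x (suc i) = ninc-at-≤ x λs (proj₂ (ninc⁻ t x λs e)) i
  none : ∀ ys → ninc x ys ≡ true → count (j <ᵇ_) ys ≡ 0
  none ys n = go ys (ninc-All x ys n)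
    where
    go : ∀ ys → All (_≤ x) ys → count (j <ᵇ_) ys ≡ 0
    go []       _         = refl
    go (y ∷ ys) (y≤x ∷ a) rewrite ≡false (λ e' → false≢true (trans (sym j<x) (<ᵇ⁺ (ℕₚ.<-≤-trans (<ᵇ⁻ {j} {y} e') y≤x)))) = go ys a

≤-from-< : ∀ m n → (∀ i → i < m → i < n) → m ≤ n
≤-from-< zero    n f = z≤n
≤-from-< (suc m) n f = f m (ℕₚ.n<1+n m)

∑-const-1 : (xs : List A) → ∑ xs (λ _ → + 1) ≡ + length xs
∑-const-1 []       = refl
∑-const-1 (x ∷ xs) = cong (+ 1 +ℤ_) (∑-const-1 xs)

∑-<ᵇ : ∀ x k → x ≤ k → ∑ (upTo k) (λ j → ⟦ j <ᵇ x ⟧) ≡ + x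
∑-<ᵇ zero    k _   = ∑-zero (upTo k) (λ {j} _ → cong ⟦_⟧ (≡false (λ e → ℕₚ.n≮0 (<ᵇ⁻ {j} {0} e))))
∑-<ᵇ (suc x) k x<k = begin
  ∑ (upTo k) (λ j → ⟦ j <ᵇ suc x ⟧)               ≡⟨ ∑-cong (upTo k) (λ j → trans (cong ⟦_⟧ (bool-iff
                                                      (λ e → ≤ᵇ⁺ (ℕₚ.≤-pred (<ᵇ⁻ {j} {suc x} e))) (λ e → <ᵇ⁺ (s≤s (≤ᵇ⁻ {j} e))))) (sym (ℤₚ.*-identityʳ _))) ⟩
  ∑ (upTo k) (λ j → ⟦ j ≤ᵇ x ⟧ *ℤ + 1)            ≡⟨ ∑-upTo-guard x k x<k (λ _ → + 1) ⟩
  ∑ (upTo (suc x)) (λ _ → + 1)                    ≡⟨ trans (∑-const-1 (upTo (suc x))) (cong +_ (Listₚ.length-upTo (suc x))) ⟩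
  + suc x ∎

module Conjugation (t : ℕ) where
  -- One more than the number of rows, and of columns, that a partition of size at most `t` can
  -- have: lists of this length are closed under conjugation and leave the last row empty.
  M : ℕ
  M = suc t
  open Cauchy t M

  conjM : List ℕ → List ℕ
  conjM λs = map (λ j → count (j <ᵇ_) λs) (upTo M)

  record Good (λs : List ℕ) : Set where
    constructor good
    field
      len   : length λs ≡ M
      ninc≡ : ninc t λs ≡ true
      sum≤  : sumℕ λs ≤ t
  open Good

  galois : ∀ {λs} → Good λs → ∀ i j → (i < at (conjM λs) j → j < at λs i) × (j < at λs i → i < at (conjM λs) j)
  galois {λs} (good _ nλ _) i j with j <? M
  ... | yes j<M = (λ p → proj₁ (count-<-galois t λs j nλ i) (subst (i <_) (at-map-< _ M j j<M) p)) ,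
                  (λ p → subst (i <_) (sym (at-map-< _ M j j<M)) (proj₂ (count-<-galois t λs j nλ i) p))
  ... | no ¬j<M = (λ p → ⊥-elim (ℕₚ.n≮0 (subst (i <_) (at-map-≥ _ M j (ℕₚ.≮⇒≥ ¬j<M)) p))) ,
                  (λ p → ⊥-elim (¬j<M (s≤s (ℕₚ.≤-trans (ℕₚ.<⇒≤ p) (ninc-at-≤ t λs nλ i)))))

  length-conjM : ∀ λs → length (conjM λs) ≡ M
  length-conjM λs = trans (Listₚ.length-map _ (upTo M)) (Listₚ.length-upTo M)

  sum-conjM : ∀ λs → All (_≤ t) λs → sumℕ (conjM λs) ≡ sumℕ λs
  sum-conjM λs b = ℤₚ.+-injective (begin
    + sumℕ (conjM λs)                                         ≡⟨ sumℕ≡∑ (λ j → count (j <ᵇ_) λs) (upTo M) ⟩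
    ∑ (upTo M) (λ j → + count (j <ᵇ_) λs)                      ≡⟨ ∑-cong (upTo M) (λ j → count≡∑ (j <ᵇ_) λs) ⟩
    ∑ (upTo M) (λ j → ∑ λs (λ x → ⟦ j <ᵇ x ⟧))                 ≡⟨ ∑-swap (upTo M) λs _ ⟩
    ∑ λs (λ x → ∑ (upTo M) (λ j → ⟦ j <ᵇ x ⟧))                 ≡⟨ ∑-cong-∈ λs (λ {x} x∈ → ∑-<ᵇ x M (ℕₚ.m≤n⇒m≤1+n (All.lookup b x∈))) ⟩
    ∑ λs (λ x → + x)                                          ≡⟨ sym (sumℕ≡∑ id λs) ⟩
    + sumℕ (map id λs)                                        ≡⟨ cong (λ l → + sumℕ l) (Listₚ.map-id λs) ⟩
    + sumℕ λs                                                 ∎)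

  conjM-good : ∀ {λs} → Good λs → Good (conjM λs)
  conjM-good {λs} gd@(good _ nλ s≤t) = good (length-conjM λs)
    (ninc-at⁺ t (conjM λs) (≤-from-< _ _ (λ i p → ℕₚ.<-≤-trans (go t λs i nλ (proj₁ (galois gd i 0) p)) s≤t))
      (λ j → ≤-from-< _ _ (λ i p → proj₂ (galois gd i j) (ℕₚ.<-trans (ℕₚ.n<1+n j) (proj₁ (galois gd i (suc j)) p)))))
    (ℕₚ.≤-trans (ℕₚ.≤-reflexive (sum-conjM λs (ninc-All t λs nλ))) s≤t)
    where
    -- A nonzero part at position `i` makes all earlier parts nonzero, so the sum exceeds `i`; this
    -- bounds the first column.
    go : ∀ u λs i → ninc u λs ≡ true → 0 < at λs i → i < sumℕ λs
    go u (x ∷ λs) zero    n p = ℕₚ.<-≤-trans p (ℕₚ.m≤m+n x (sumℕ λs))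
    go u (x ∷ λs) (suc i) n p = let r = proj₂ (ninc⁻ u x λs n) in
      ℕₚ.+-mono-≤ (ℕₚ.≤-trans p (ninc-at-≤ x λs r i)) (go x λs i r p)

  conjM-involutive : ∀ {λs} → Good λs → conjM (conjM λs) ≡ λs
  conjM-involutive {λs} gd = at-ext (conjM (conjM λs)) λs (trans (length-conjM (conjM λs)) (sym (len gd))) (λ i → ℕₚ.≤-antisym
    (≤-from-< _ _ (λ j p → proj₁ (galois gd i j) (proj₁ (galois (conjM-good gd) j i) p)))
    (≤-from-< _ _ (λ j p → proj₂ (galois (conjM-good gd) j i) (proj₂ (galois gd i j) p))))

  -- Through `galois`, the condition λ_i ≤ μ_i + 1 on rows turns into λ'_{j+1} ≤ μ'_j on columns,
  -- which is interlacing.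
  vs⇒hs : ∀ {λs μ} → Good λs → Good μ → vsᵇ λs μ ≡ true → hsT t (conjM λs) (conjM μ) ≡ true
  vs⇒hs {λs} {μ} gλ gμ e = hsT-at⁺ t (conjM λs) (conjM μ) (trans (length-conjM λs) (sym (length-conjM μ)))
    (ninc-at-≤ t (conjM λs) (ninc≡ (conjM-good gλ)) 0)
    (λ j → ≤-from-< _ _ (λ i p → proj₂ (galois gλ i j) (ℕₚ.<-≤-trans (proj₁ (galois gμ i j) p) (proj₁ v i))))
    (λ j → ≤-from-< _ _ (λ i p → proj₂ (galois gμ i j) (ℕₚ.≤-pred (ℕₚ.≤-trans (proj₁ (galois gλ i (suc j)) p) (proj₂ v i)))))
    where
    v = vs-at⁻ λs μ e

  hs⇒vs : ∀ {λs ν} → Good λs → Good ν → hsT t (conjM λs) ν ≡ true → vsᵇ λs (conjM ν) ≡ true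
  hs⇒vs {λs} {ν} gλ gν e = vs-at⁺ λs (conjM ν) (trans (len gλ) (sym (length-conjM ν)))
    (λ i → ≤-from-< _ _ (λ j p → proj₁ (galois gλ i j) (ℕₚ.<-≤-trans (proj₁ (galois gν j i) p) (proj₁ (proj₂ strip) j))))
    (λ i → ≤-from-< _ _ (λ { zero p → s≤s z≤n
                           ; (suc j) p → s≤s (proj₂ (galois gν j i) (ℕₚ.<-≤-trans (proj₂ (galois gλ i (suc j)) p) (proj₂ (proj₂ strip) j))) }))
    where
    strip = hsT-at⁻ t (conjM λs) ν e

  Once-good : ∀ {λs} → Good λs → Once _≟ₗ_ P λs
  Once-good {λs} (good l nλ _) = Once-P λs l (All.map (λ x≤t → ℕₚ.m<n⇒m<1+n (s≤s x≤t)) (ninc-All t λs nλ))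

  -- Conjugation is an involution on the partitions of size at most `t` that exchanges the two kinds
  -- of strip, so it reindexes the inner partition of each step.
  K-conj : ∀ β λs → Good λs → K true β λs ≡ K false β (conjM λs)
  K-conj [] λs (good _ nλ _) = cong ⟦_⟧ (bool-iff
    (λ e → sum≡0⇒zero (conjM λs) (trans (sum-conjM λs (ninc-All t λs nλ)) (zero⇒sum≡0 λs e)))
    (λ e → sum≡0⇒zero λs (trans (sym (sum-conjM λs (ninc-All t λs nλ))) (zero⇒sum≡0 (conjM λs) e))))
  K-conj (b ∷ β) λs gd@(good _ nλ s≤t) = begin
    ∑ P (λ μ → ⟦ st true λs μ ⟧ *ℤ (⟦ sumℕ λs ≡ᵇ sumℕ μ + b ⟧ *ℤ K true β μ))
      ≡⟨ ∑-cong-∈ P (λ {μ} μ∈ → guard (st true λs μ) (λ e → let gμ = good-sub μ∈ e in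
           trans (cong₂ (λ x y → ⟦ x ≡ᵇ y + b ⟧ *ℤ K true β μ) (sym (sum-conjM λs (ninc-All t λs nλ))) (sym (sum-conjM μ (ninc-All t μ (ninc≡ gμ)))))
             (cong (⟦ sumℕ (conjM λs) ≡ᵇ sumℕ (conjM μ) + b ⟧ *ℤ_) (K-conj β μ gμ)))) ⟩
    ∑ P (λ μ → ⟦ st true λs μ ⟧ *ℤ W (conjM μ))
      ≡⟨ ∑-bij _≟ₗ_ _≟ₗ_ P P (st true λs) (hsT t (conjM λs)) conjM conjM
           (λ {μ} μ∈ e → let gμ = good-sub μ∈ e in
              vs⇒hs gd gμ (proj₁ (∧⁻ {vsᵇ λs μ} e)) , conjM-involutive gμ , Once-good (conjM-good gμ))
           (λ {ν} ν∈ e → let gν = good-sub' ν∈ e in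
              ∧⁺ (hs⇒vs gd gν e) (∧⁺ nλ (ninc≡ (conjM-good gν))) , conjM-involutive gν , Once-good (conjM-good gν))
           W ⟩
    ∑ P (λ ν → ⟦ hsT t (conjM λs) ν ⟧ *ℤ W ν) ∎
    where
    W : List ℕ → ℤ
    W ν = ⟦ sumℕ (conjM λs) ≡ᵇ sumℕ ν + b ⟧ *ℤ K false β ν
    good-sub : ∀ {μ} → μ ∈ P → st true λs μ ≡ true → Good μ
    good-sub {μ} μ∈ e = good (proj₁ (∈-listsOf⁻ (upTo N) M μ∈)) (st-ninc₂ true λs μ e) (ℕₚ.≤-trans (st-sum true λs μ e) s≤t)
    good-sub' : ∀ {ν} → ν ∈ P → hsT t (conjM λs) ν ≡ true → Good ν
    good-sub' {ν} ν∈ e = good (proj₁ (∈-listsOf⁻ (upTo N) M ν∈)) (hsT-ninc₂ t (conjM λs) ν e)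
      (ℕₚ.≤-trans (hsT-sum t (conjM λs) ν e) (sum≤ (conjM-good gd)))

-- Schur functions and the Cauchy expansions of Δ h and Δ e

∑-fillings-∷ʳ0 : ∀ l λs (f : List (List ℕ) → ℤ) → ∑ (fillings l (λs ++ 0 ∷ [])) f ≡ ∑ (fillings l λs) (λ T → f (T ++ [] ∷ []))
∑-fillings-∷ʳ0 l []       f = refl
∑-fillings-∷ʳ0 l (x ∷ λs) f = begin
  ∑ (fillings l (x ∷ λs ++ 0 ∷ [])) f
    ≡⟨ ∑-fillings l x (λs ++ 0 ∷ []) f ⟩
  ∑ (fillings l (λs ++ 0 ∷ [])) (λ T → ∑ (listsOf (upTo l) x) (λ row → f (row ∷ T)))
    ≡⟨ ∑-fillings-∷ʳ0 l λs _ ⟩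
  ∑ (fillings l λs) (λ T → ∑ (listsOf (upTo l) x) (λ row → f (row ∷ T ++ [] ∷ [])))
    ≡⟨ sym (∑-fillings l x λs (λ T → f (T ++ [] ∷ []))) ⟩
  ∑ (fillings l (x ∷ λs)) (λ T → f (T ++ [] ∷ [])) ∎

tableaux-∷ʳ0 : ∀ l c λs → tableaux l c (λs ++ 0 ∷ []) ≡ tableaux l c λs
tableaux-∷ʳ0 l c λs = trans (∑-fillings-∷ʳ0 l λs _) (∑-cong (fillings l λs) (λ T →
  cong₂ (λ a b → ⟦ a ⟧ *ℤ b) (rows T) (cong₂ (λ a b → ⟦ a ⟧ *ℤ ⟦ contᵇ l c b ⟧) (cols T) (conc T))))
  where
  rows : ∀ T → rowsᵇ (T ++ [] ∷ []) ≡ rowsᵇ T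
  rows []      = refl
  rows (r ∷ T) = cong (nondecᵇ r ∧_) (rows T)
  cols : ∀ T → colStrictᵇ (T ++ [] ∷ []) ≡ colStrictᵇ T
  cols []           = refl
  cols (r ∷ [])     = cong (_∧ true) (<ᵇ-cmp-[] r)
  cols (r ∷ r' ∷ T) = cong (<ᵇ-cmp r r' ∧_) (cols (r' ∷ T))
  conc : ∀ T → concat (T ++ [] ∷ []) ≡ concat T
  conc []      = refl
  conc (r ∷ T) = cong (r ++_) (conc T)

tableaux-pad : ∀ l c λs k → tableaux l c (λs ++ rep k 0) ≡ tableaux l c λs
tableaux-pad l c λs zero    = cong (tableaux l c) (Listₚ.++-identityʳ λs)
tableaux-pad l c λs (suc k) = begin
  tableaux l c (λs ++ 0 ∷ rep k 0)             ≡⟨ cong (tableaux l c) (sym (Listₚ.++-assoc λs (0 ∷ []) (rep k 0))) ⟩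
  tableaux l c ((λs ++ 0 ∷ []) ++ rep k 0)     ≡⟨ tableaux-pad l c (λs ++ 0 ∷ []) k ⟩
  tableaux l c (λs ++ 0 ∷ [])                  ≡⟨ tableaux-∷ʳ0 l c λs ⟩
  tableaux l c λs                              ∎

schur≡tableaux : ∀ {n} (u : Word n) l → schur {n} l u ≡ tableaux (bound u) (cntL (List.tabulate u)) l
schur≡tableaux {n} u l = begin
  schur {n} l u
    ≡⟨ count≡∑ (λ T → rowsᵇ T ∧ (colStrictᵇ T ∧ cont' T)) (fillings (bound u) l) ⟩
  ∑ (fillings (bound u) l) (λ T → ⟦ rowsᵇ T ∧ (colStrictᵇ T ∧ cont' T) ⟧)
    ≡⟨ ∑-cong (fillings (bound u) l) (λ T → trans (⟦∧⟧ (rowsᵇ T) _) (cong (⟦ rowsᵇ T ⟧ *ℤ_) (trans (⟦∧⟧ (colStrictᵇ T) _)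
         (cong (λ b → ⟦ colStrictᵇ T ⟧ *ℤ ⟦ b ⟧) (allᵇ-cong-∈ _ _ (upTo (bound u)) (λ {b} _ →
           cong (cntL (concat T) b ≡ᵇ_) (sym (count-tabulate (_≡ᵇ b) u)))))))) ⟩
  tableaux (bound u) (cntL (List.tabulate u)) l ∎
  where
  cont' : List (List ℕ) → Bool
  cont' T = allᵇ (λ b → count (λ x → x ≡ᵇ b) (concat T) ≡ᵇ count (λ i → u i ≡ᵇ b) (allFin n)) (upTo (bound u))

-- Partitions as lists padded with zeros, and the Cauchy sum over them

∈-≤-sum : ∀ {x} q → x ∈ q → x ≤ sumℕ q
∈-≤-sum (x ∷ q) (here refl) = ℕₚ.m≤m+n x (sumℕ q)
∈-≤-sum (y ∷ q) (there x∈)  = ℕₚ.≤-trans (∈-≤-sum q x∈) (ℕₚ.m≤n+m (sumℕ q) y)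

sum-++0 : ∀ q k → sumℕ (q ++ rep k 0) ≡ sumℕ q
sum-++0 []      zero    = refl
sum-++0 []      (suc k) = sum-++0 [] k
sum-++0 (x ∷ q) k       = cong (ℕ._+_ x) (sum-++0 q k)

-- Used with `z` = `M`: `partitions n` draws its parts from 1, ..., n, whereas splitting the padded
-- lists allows `M` as well, a part too large for size `n`.
∑-restrict-letters : (xs ys : List ℕ) (z : ℕ) → (∀ f → ∑ ys f ≡ ∑ xs f +ℤ f z) → ∀ m (f : List ℕ → ℤ) →
  (∀ q → z ∈ q → f q ≡ + 0) → ∑ (listsOf ys m) f ≡ ∑ (listsOf xs m) f
∑-restrict-letters xs ys z ext zero    f v = refl
∑-restrict-letters xs ys z ext (suc m) f v = begin
  ∑ (listsOf ys (suc m)) f                                          ≡⟨ ∑-lists-suc ys m f ⟩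
  ∑ (listsOf ys m) (λ q → ∑ ys (λ x → f (x ∷ q)))                   ≡⟨ ∑-cong (listsOf ys m) (λ q → trans (ext (λ x → f (x ∷ q)))
                                                                       (trans (cong (∑ xs (λ x → f (x ∷ q)) +ℤ_) (v (z ∷ q) (here refl))) (ℤₚ.+-identityʳ _))) ⟩
  ∑ (listsOf ys m) (λ q → ∑ xs (λ x → f (x ∷ q)))                   ≡⟨ ∑-restrict-letters xs ys z ext m (λ q → ∑ xs (λ x → f (x ∷ q)))
                                                                       (λ q z∈ → ∑-zero xs (λ {x} _ → v (x ∷ q) (there z∈))) ⟩
  ∑ (listsOf xs m) (λ q → ∑ xs (λ x → f (x ∷ q)))                   ≡⟨ sym (∑-lists-suc xs m f) ⟩
  ∑ (listsOf xs (suc m)) f                                          ∎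

ninc≡sorted : ∀ t λs → ninc t λs ≡ (hd λs ≤ᵇ t) ∧ sortedᵇ _≥ᵇ_ λs
ninc≡sorted t []           = refl
ninc≡sorted t (x ∷ [])     = refl
ninc≡sorted t (x ∷ y ∷ λs) = cong ((x ≤ᵇ t) ∧_) (ninc≡sorted x (y ∷ λs))

sorted-0 : ∀ k → sortedᵇ _≥ᵇ_ (rep k 0) ≡ true
sorted-0 zero          = refl
sorted-0 (suc zero)    = refl
sorted-0 (suc (suc k)) = sorted-0 (suc k)

sorted-++0 : ∀ q k → sortedᵇ _≥ᵇ_ q ≡ true → sortedᵇ _≥ᵇ_ (q ++ rep k 0) ≡ true
sorted-++0 []          k       e = sorted-0 k
sorted-++0 (x ∷ [])    zero    e = refl
sorted-++0 (x ∷ [])    (suc k) e = sorted-0 (suc k)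
sorted-++0 (x ∷ y ∷ q) k       e = ∧⁺ (proj₁ (∧⁻ {y ≤ᵇ x} e)) (sorted-++0 (y ∷ q) k (proj₂ (∧⁻ {y ≤ᵇ x} e)))

module Partitions (n : ℕ) where
  open Conjugation n
  open Cauchy n M
  open Tableaux n M

  pad : List ℕ → List ℕ
  pad l = l ++ rep (M ∸ length l) 0

  pad-good : ∀ l → length l ≤ n → nonincᵇ l ≡ true → sumℕ l ≡ n → Good (pad l)
  pad-good l len≤n dec s≡n = good
    (trans (Listₚ.length-++ l) (trans (cong (ℕ._+_ (length l)) (Listₚ.length-replicate (M ∸ length l))) (ℕₚ.m+[n∸m]≡n (ℕₚ.m≤n⇒m≤1+n len≤n))))
    (trans (ninc≡sorted n (pad l)) (∧⁺ (≤ᵇ⁺ (ℕₚ.≤-trans (hd≤sum (pad l)) (ℕₚ.≤-reflexive (trans (sum-++0 l _) s≡n))))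
      (sorted-++0 l (M ∸ length l) (trans (sym (noninc≡sorted l)) dec))))
    (ℕₚ.≤-reflexive (trans (sum-++0 l _) s≡n))

  -- Padded lists are sorted words for ≥ with final letter 0, so `split-sorted` sorts them by the
  -- number `k` of positive parts, and the term of index `k` matches the partitions with `k` parts.
  ∑-partitions : (g g' : List ℕ → ℤ) → (∀ l → Good (pad l) → sumℕ l ≡ n → g l ≡ g' (pad l)) →
    ∑ (partitions n) g ≡ ∑ P (λ λs → ⟦ ninc n λs ∧ (sumℕ λs ≡ᵇ n) ⟧ *ℤ g' λs)
  ∑-partitions g g' g≡g' = begin
    ∑ (partitions n) g
      ≡⟨ ∑-filter (λ l → nonincᵇ l ∧ (sumℕ l ≡ᵇ n)) (concatMap (λ k → map toList (allVecsOf (map suc (upTo n)) k)) (upTo (suc n))) g ⟩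
    ∑ (concatMap (λ k → map toList (allVecsOf (map suc (upTo n)) k)) (upTo (suc n))) (λ l → ⟦ nonincᵇ l ∧ (sumℕ l ≡ᵇ n) ⟧ *ℤ g l)
      ≡⟨ ∑-concatMap (λ k → map toList (allVecsOf (map suc (upTo n)) k)) (upTo (suc n)) (λ l → ⟦ nonincᵇ l ∧ (sumℕ l ≡ᵇ n) ⟧ *ℤ g l) ⟩
    ∑ (upTo (suc n)) (λ k → ∑ (map toList (allVecsOf (map suc (upTo n)) k)) (λ l → ⟦ nonincᵇ l ∧ (sumℕ l ≡ᵇ n) ⟧ *ℤ g l))
      ≡⟨ ∑-cong-∈ (upTo (suc n)) (λ {k} k∈ → trans (∑-map toList (allVecsOf (map suc (upTo n)) k) (λ l → ⟦ nonincᵇ l ∧ (sumℕ l ≡ᵇ n) ⟧ *ℤ g l))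
           (trans (∑-toList (map suc (upTo n)) k (λ l → ⟦ nonincᵇ l ∧ (sumℕ l ≡ᵇ n) ⟧ *ℤ g l)) (row k (ℕₚ.≤-pred (∈ₚ.∈-upTo⁻ k∈))))) ⟩
    ∑ (upTo (suc n)) (splitSum R xs 0 M G)
      ≡⟨ trans (sym (ℤₚ.+-identityʳ _)) (cong (∑ (upTo (suc n)) (splitSum R xs 0 M G) +ℤ_) (sym lastrow)) ⟩
    ∑ (upTo (suc n)) (splitSum R xs 0 M G) +ℤ splitSum R xs 0 M G M
      ≡⟨ sym (∑-upTo-last M (splitSum R xs 0 M G)) ⟩
    ∑ (upTo (suc M)) (splitSum R xs 0 M G)
      ≡⟨ sym (split-sorted R xs (upTo N) 0 (λ f → trans (∑-upTo-first M f) (trans (ℤₚ.+-comm (f 0) _) (cong (_+ℤ f 0) (sym (∑-map suc (upTo M) f)))))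
           (λ _ → refl) (λ x∈ → nonzero x∈) M G) ⟩
    ∑ P (λ λs → ⟦ sortedᵇ R λs ⟧ *ℤ G λs)
      ≡⟨ ∑-cong P (λ λs → trans (sym (guard-∧ (sortedᵇ R λs) (sumℕ λs ≡ᵇ n) (g' λs))) (cong (λ b → ⟦ b ⟧ *ℤ g' λs) (bool-iff
           (λ e → let (e₁ , e₂) = ∧⁻ {sortedᵇ R λs} e in ∧⁺ (trans (ninc≡sorted n λs) (∧⁺ (≤ᵇ⁺ (ℕₚ.≤-trans (hd≤sum λs) (ℕₚ.≤-reflexive (≡ᵇ⁻ {sumℕ λs} e₂)))) e₁)) e₂)
           (λ e → let (e₁ , e₂) = ∧⁻ {ninc n λs} e in ∧⁺ (proj₂ (∧⁻ {hd λs ≤ᵇ n} (trans (sym (ninc≡sorted n λs)) e₁))) e₂)))) ⟩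
    ∑ P (λ λs → ⟦ ninc n λs ∧ (sumℕ λs ≡ᵇ n) ⟧ *ℤ g' λs) ∎
    where
    R = _≥ᵇ_
    xs = map suc (upTo M)
    G : List ℕ → ℤ
    G λs = ⟦ sumℕ λs ≡ᵇ n ⟧ *ℤ g' λs
    nonzero : ∀ {x} → x ∈ xs → R 0 x ≡ false
    nonzero x∈ with ∈ₚ.∈-map⁻ suc x∈
    ... | y , _ , refl = refl
    length≤sum : ∀ q → All (_∈ xs) q → length q ≤ sumℕ q
    length≤sum []      _ = z≤n
    length≤sum (x ∷ q) (x∈ ∷ a) with ∈ₚ.∈-map⁻ suc x∈
    ... | y , _ , refl = s≤s (ℕₚ.≤-trans (length≤sum q a) (ℕₚ.m≤n+m (sumℕ q) y))
    vanish : ∀ q k → n < sumℕ q → G (q ++ rep k 0) ≡ + 0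
    vanish q k n<q = guard-false _ (≡false (λ e → ℕₚ.<⇒≢ n<q (sym (trans (sym (sum-++0 q k)) (≡ᵇ⁻ {sumℕ (q ++ rep k 0)} e)))))
    -- With `M` positive parts the sum is at least `M`, hence larger than `n`.
    lastrow : splitSum R xs 0 M G M ≡ + 0
    lastrow = ∑-zero (listsOf xs M) (λ {q} q∈ → trans (cong (λ z → ⟦ sortedᵇ R q ⟧ *ℤ (⟦ sortedᵇ R (rep (M ∸ M) 0) ⟧ *ℤ z))
        (vanish q (M ∸ M) (subst (_≤ sumℕ q) (proj₁ (∈-listsOf⁻ xs M q∈)) (length≤sum q (proj₂ (∈-listsOf⁻ xs M q∈))))))
      (trans (cong (⟦ sortedᵇ R q ⟧ *ℤ_) (ℤₚ.*-zeroʳ ⟦ sortedᵇ R (rep (M ∸ M) 0) ⟧)) (ℤₚ.*-zeroʳ ⟦ sortedᵇ R q ⟧)))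
    row : ∀ k → k ≤ n → ∑ (listsOf (map suc (upTo n)) k) (λ l → ⟦ nonincᵇ l ∧ (sumℕ l ≡ᵇ n) ⟧ *ℤ g l) ≡ splitSum R xs 0 M G k
    row k k≤n = begin
      ∑ (listsOf (map suc (upTo n)) k) (λ l → ⟦ nonincᵇ l ∧ (sumℕ l ≡ᵇ n) ⟧ *ℤ g l)
        ≡⟨ ∑-cong-∈ (listsOf (map suc (upTo n)) k) (λ {l} l∈ → term l (proj₁ (∈-listsOf⁻ (map suc (upTo n)) k l∈))) ⟩
      ∑ (listsOf (map suc (upTo n)) k) (λ l → ⟦ sortedᵇ R l ⟧ *ℤ (⟦ sortedᵇ R (rep (M ∸ k) 0) ⟧ *ℤ G (l ++ rep (M ∸ k) 0)))
        ≡⟨ sym (∑-restrict-letters (map suc (upTo n)) xs M (λ f → trans (∑-map suc (upTo M) f)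
             (trans (∑-upTo-last n (f ∘ suc)) (cong (_+ℤ f M) (sym (∑-map suc (upTo n) f))))) k _
             (λ q M∈ → trans (cong (λ z → ⟦ sortedᵇ R q ⟧ *ℤ (⟦ sortedᵇ R (rep (M ∸ k) 0) ⟧ *ℤ z)) (vanish q (M ∸ k) (∈-≤-sum q M∈)))
               (trans (cong (⟦ sortedᵇ R q ⟧ *ℤ_) (ℤₚ.*-zeroʳ ⟦ sortedᵇ R (rep (M ∸ k) 0) ⟧)) (ℤₚ.*-zeroʳ ⟦ sortedᵇ R q ⟧)))) ⟩
      splitSum R xs 0 M G k ∎
      where
      term : ∀ l → length l ≡ k → ⟦ nonincᵇ l ∧ (sumℕ l ≡ᵇ n) ⟧ *ℤ g l ≡
        ⟦ sortedᵇ R l ⟧ *ℤ (⟦ sortedᵇ R (rep (M ∸ k) 0) ⟧ *ℤ G (l ++ rep (M ∸ k) 0))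
      term l refl = begin
        ⟦ nonincᵇ l ∧ (sumℕ l ≡ᵇ n) ⟧ *ℤ g l
          ≡⟨ trans (guard-∧ (nonincᵇ l) (sumℕ l ≡ᵇ n) (g l)) (cong (λ b → ⟦ b ⟧ *ℤ (⟦ sumℕ l ≡ᵇ n ⟧ *ℤ g l)) (noninc≡sorted l)) ⟩
        ⟦ sortedᵇ R l ⟧ *ℤ (⟦ sumℕ l ≡ᵇ n ⟧ *ℤ g l)
          ≡⟨ guard (sortedᵇ R l) (λ e₁ → trans (guard (sumℕ l ≡ᵇ n) (λ e₂ → let s≡n = ≡ᵇ⁻ {sumℕ l} e₂ in
               g≡g' l (pad-good l k≤n (trans (noninc≡sorted l) e₁) s≡n) s≡n))
               (cong (λ z → ⟦ z ≡ᵇ n ⟧ *ℤ g' (pad l)) (sym (sum-++0 l (M ∸ length l))))) ⟩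
        ⟦ sortedᵇ R l ⟧ *ℤ G (pad l)
          ≡⟨ cong (⟦ sortedᵇ R l ⟧ *ℤ_) (sym (guard-true (G (pad l)) (sorted-0 (M ∸ length l)))) ⟩
        ⟦ sortedᵇ R l ⟧ *ℤ (⟦ sortedᵇ R (rep (M ∸ length l) 0) ⟧ *ℤ G (pad l)) ∎

  tableaux≡K-pad : ∀ l c λs → Good (pad λs) → tableaux l c λs ≡ K false (map c (List.downFrom l)) (pad λs)
  tableaux≡K-pad l c λs gd = trans (sym (tableaux-pad l c λs (M ∸ length λs))) (tableaux≡K l c (pad λs) (Good.len gd) (Good.ninc≡ gd))

  pad-conj : ∀ λs → Good (pad λs) → pad (conj λs) ≡ conjM (pad λs)
  pad-conj λs gd = at-ext (pad (conj λs)) (conjM (pad λs)) (trans len≡ (sym (length-conjM (pad λs)))) (λ j → trans (at-++0 (conj λs) _ j) (entry j))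
    where
    mx = foldr _⊔_ 0 λs
    conj≡ : conj λs ≡ map (λ j → count (j <ᵇ_) λs) (upTo mx)
    conj≡ = sym (Listₚ.map-∘ (upTo mx))
    mx≤ : ∀ (λs : List ℕ) → foldr _⊔_ 0 λs ≤ sumℕ λs
    mx≤ []       = z≤n
    mx≤ (x ∷ λs) = ℕₚ.⊔-lub (ℕₚ.m≤m+n x (sumℕ λs)) (ℕₚ.≤-trans (mx≤ λs) (ℕₚ.m≤n+m (sumℕ λs) x))
    mx<M : mx < M
    mx<M = s≤s (ℕₚ.≤-trans (mx≤ λs) (ℕₚ.≤-trans (ℕₚ.≤-reflexive (sym (sum-++0 λs _))) (Good.sum≤ gd)))
    len-conj : length (conj λs) ≡ mx
    len-conj = trans (cong length conj≡) (trans (Listₚ.length-map _ (upTo mx)) (Listₚ.length-upTo mx))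
    len≡ : length (pad (conj λs)) ≡ M
    len≡ = trans (Listₚ.length-++ (conj λs)) (trans (cong (ℕ._+_ (length (conj λs))) (Listₚ.length-replicate (M ∸ length (conj λs))))
      (ℕₚ.m+[n∸m]≡n (ℕₚ.≤-trans (ℕₚ.≤-reflexive len-conj) (ℕₚ.<⇒≤ mx<M))))
    count-pad : ∀ j k → count (j <ᵇ_) (λs ++ rep k 0) ≡ count (j <ᵇ_) λs
    count-pad j k = trans (count-++ (j <ᵇ_) λs (rep k 0)) (trans (cong (ℕ._+_ (count (j <ᵇ_) λs)) (zeros k)) (ℕₚ.+-identityʳ _))
      where
      zeros : ∀ k → count (j <ᵇ_) (rep k 0) ≡ 0
      zeros zero    = refl
      zeros (suc k) rewrite ≡false (λ e → ℕₚ.n≮0 (<ᵇ⁻ {j} {0} e)) = zeros k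
    count-big : ∀ j λs → foldr _⊔_ 0 λs ≤ j → count (j <ᵇ_) λs ≡ 0
    count-big j []       _ = refl
    count-big j (x ∷ λs) b rewrite ≡false (λ e → ℕₚ.<⇒≱ (<ᵇ⁻ {j} {x} e) (ℕₚ.m⊔n≤o⇒m≤o x _ b)) = count-big j λs (ℕₚ.m⊔n≤o⇒n≤o x _ b)
    entry : ∀ j → at (conj λs) j ≡ at (conjM (pad λs)) j
    entry j with j <? mx | j <? M
    ... | yes j<mx | yes j<M = trans (cong (λ l → at l j) conj≡) (trans (at-map-< _ mx j j<mx) (sym (trans (at-map-< _ M j j<M) (count-pad j _))))
    ... | yes j<mx | no ¬j<M = ⊥-elim (¬j<M (ℕₚ.<-trans j<mx mx<M))
    ... | no ¬j<mx | yes j<M = trans (cong (λ l → at l j) conj≡) (trans (at-map-≥ _ mx j (ℕₚ.≮⇒≥ ¬j<mx))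
            (sym (trans (at-map-< _ M j j<M) (trans (count-pad j _) (count-big j λs (ℕₚ.≮⇒≥ ¬j<mx))))))
    ... | no ¬j<mx | no ¬j<M = trans (cong (λ l → at l j) conj≡) (trans (at-map-≥ _ mx j (ℕₚ.≮⇒≥ ¬j<mx)) (sym (at-map-≥ _ M j (ℕₚ.≮⇒≥ ¬j<M))))

  tableaux-conj≡K : ∀ l c λs → Good (pad λs) → tableaux l c (conj λs) ≡ K true (map c (List.downFrom l)) (pad λs)
  tableaux-conj≡K l c λs gd = begin
    tableaux l c (conj λs)                                     ≡⟨ tableaux≡K-pad l c (conj λs) (subst Good (sym (pad-conj λs gd)) (conjM-good gd)) ⟩
    K false (map c (List.downFrom l)) (pad (conj λs))          ≡⟨ cong (K false (map c (List.downFrom l))) (pad-conj λs gd) ⟩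
    K false (map c (List.downFrom l)) (conjM (pad λs))         ≡⟨ sym (K-conj (map c (List.downFrom l)) (pad λs) gd) ⟩
    K true (map c (List.downFrom l)) (pad λs)                  ∎

  shape : Bool → List ℕ → List ℕ
  shape false λs = λs
  shape true  λs = conj λs

  tableaux-shape : ∀ s l c λs → Good (pad λs) → tableaux l c (shape s λs) ≡ K s (map c (List.downFrom l)) (pad λs)
  tableaux-shape false = tableaux≡K-pad
  tableaux-shape true  = tableaux-conj≡K

  shape-good : ∀ s λs → Good (pad λs) → Good (pad (shape s λs))
  shape-good false λs gd = gd
  shape-good true  λs gd = subst Good (sym (pad-conj λs gd)) (conjM-good gd)

  cauchy-tableaux : ∀ s k c l c' → sumℕ (map c (List.downFrom k)) ≡ n →
    ∑ (partitions n) (λ λs → tableaux k c λs *ℤ tableaux l c' (shape s λs)) ≡ matrices s (map c (List.downFrom k)) (map c' (List.downFrom l))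
  cauchy-tableaux s k c l c' sum≡n = begin
    ∑ (partitions n) (λ λs → tableaux k c λs *ℤ tableaux l c' (shape s λs))
      ≡⟨ ∑-partitions _ (λ λs → K false α λs *ℤ K s β λs) (λ λs gd _ → cong₂ _*ℤ_ (tableaux≡K-pad k c λs gd) (tableaux-shape s l c' λs gd)) ⟩
    ∑ P (λ λs → ⟦ ninc n λs ∧ (sumℕ λs ≡ᵇ n) ⟧ *ℤ (K false α λs *ℤ K s β λs))
      ≡⟨ ∑-cong P (λ λs → trans (sym (ℤₚ.*-assoc ⟦ ninc n λs ∧ (sumℕ λs ≡ᵇ n) ⟧ _ _))
           (cong (_*ℤ K s β λs) (trans (cong (λ z → ⟦ ninc n λs ∧ (sumℕ λs ≡ᵇ z) ⟧ *ℤ K false α λs) (sym sum≡n)) (sym (K-support false α λs))))) ⟩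
    ∑ P (λ λs → K false α λs *ℤ K s β λs)
      ≡⟨ cauchy (ℕₚ.n<1+n n) s α β (ℕₚ.≤-reflexive sum≡n) ⟩
    matrices s α β ∎
    where
    α = map c (List.downFrom k)
    β = map c' (List.downFrom l)

-- The coefficients of Δ h and Δ e as numbers of words

monotone-step : ∀ {m} {u : Word (suc m)} → Monotone u → ∀ i → u (inject₁ i) ≤ u (fsuc i)
monotone-step mu i = mu (inject₁ i) (fsuc i) (inject₁≤suc i)

monotone-tail : ∀ {m} {u : Word (suc m)} → Monotone u → Monotone (u ∘ fsuc)
monotone-tail mu i j i≤j = mu (fsuc i) (fsuc j) (s≤s i≤j)

sorted-tabulate : ∀ {n} (u : Word n) → Monotone u → sortedᵇ _≤ᵇ_ (List.tabulate u) ≡ true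
sorted-tabulate {zero}        u mu = refl
sorted-tabulate {suc zero}    u mu = refl
sorted-tabulate {suc (suc n)} u mu = ∧⁺ (≤ᵇ⁺ (mu fzero (fsuc fzero) z≤n)) (sorted-tabulate (u ∘ fsuc) (monotone-tail mu))

bs⁺ : ∀ R {m} (u w : Word (suc m)) → (∀ i → u (inject₁ i) ≡ u (fsuc i) → R (w (inject₁ i)) (w (fsuc i)) ≡ true) →
  bsᵇ R (List.tabulate u) (List.tabulate w) ≡ true
bs⁺ R {zero}  u w f = refl
bs⁺ R {suc m} u w f = ∧⁺ (⇒ᵇ⁺ {u fzero ≡ᵇ u (fsuc fzero)} (λ e → f fzero (≡ᵇ⁻ {u fzero} e))) (bs⁺ R (u ∘ fsuc) (w ∘ fsuc) (f ∘ fsuc))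

bs⁻ : ∀ R {m} (u w : Word (suc m)) → bsᵇ R (List.tabulate u) (List.tabulate w) ≡ true →
  ∀ i → u (inject₁ i) ≡ u (fsuc i) → R (w (inject₁ i)) (w (fsuc i)) ≡ true
bs⁻ R {suc m} u w e fzero    eq = ⇒ᵇ⁻ {u fzero ≡ᵇ u (fsuc fzero)} (proj₁ (∧⁻ {not (u fzero ≡ᵇ u (fsuc fzero)) ∨ R (w fzero) (w (fsuc fzero))} e)) (≡ᵇ⁺ eq)
bs⁻ R {suc m} u w e (fsuc i) eq = bs⁻ R (u ∘ fsuc) (w ∘ fsuc) (proj₂ (∧⁻ {not (u fzero ≡ᵇ u (fsuc fzero)) ∨ R (w fzero) (w (fsuc fzero))} e)) i eq

∑-downFrom : ∀ (f : ℕ → ℕ) k → + sumℕ (map f (List.downFrom k)) ≡ ∑ (upTo k) (λ b → + f b)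
∑-downFrom f zero    = refl
∑-downFrom f (suc k) = begin
  + (f k + sumℕ (map f (List.downFrom k)))       ≡⟨ cong (+ f k +ℤ_) (∑-downFrom f k) ⟩
  + f k +ℤ ∑ (upTo k) (λ b → + f b)              ≡⟨ ℤₚ.+-comm (+ f k) (∑ (upTo k) (λ b → + f b)) ⟩
  ∑ (upTo k) (λ b → + f b) +ℤ + f k              ≡⟨ sym (∑-upTo-last k (λ b → + f b)) ⟩
  ∑ (upTo (suc k)) (λ b → + f b)                 ∎

sum-content : ∀ k u → All (_< k) u → sumℕ (map (cntL u) (List.downFrom k)) ≡ length u
sum-content k u b = ℤₚ.+-injective (begin
  + sumℕ (map (cntL u) (List.downFrom k))        ≡⟨ ∑-downFrom (cntL u) k ⟩
  ∑ (upTo k) (λ b → + cntL u b)                  ≡⟨ ∑-cong (upTo k) (λ b → count≡∑ (_≡ᵇ b) u) ⟩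
  ∑ (upTo k) (λ b → ∑ u (λ x → ⟦ x ≡ᵇ b ⟧))      ≡⟨ ∑-swap (upTo k) u _ ⟩
  ∑ u (λ x → ∑ (upTo k) (λ b → ⟦ x ≡ᵇ b ⟧))      ≡⟨ ∑-cong-∈ u (λ {x} x∈ → trans (∑-cong (upTo k) (λ b → trans (cong ⟦_⟧ (bool-iff
                                                       (λ e → dec-true (b ℕₚ.≟ x) (sym (≡ᵇ⁻ {x} e))) (λ e → ≡ᵇ⁺ (sym (does-true (b ℕₚ.≟ x) e)))))
                                                       (sym (ℤₚ.*-identityʳ _)))) (Once-upTo (All.lookup b x∈) (λ _ → + 1))) ⟩
  ∑ u (λ _ → + 1)                                ≡⟨ ∑-const-1 u ⟩
  + length u                                     ∎)

module _ {m : ℕ} where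
  private
    n : ℕ
    n = suc m
  open Conjugation n using (Good; good; M; conjM-good)
  open Partitions n
  open Cauchy n M
  open Words n M

  -- The contributing words are sorted along the blocks of `u` and have the content of `v`, so they
  -- amount to matrices with these contents as margins; the Cauchy identity for Kostka numbers
  -- evaluates the count. The flag selects weak sorting for h and strict sorting for e.
  cauchy-Δ : ∀ s (f : Series n) (u v : Word n) → Monotone u →
    (∀ q → ⟦ sameContentᵇ v q ∧ inBlocksᵇ u q ⟧ *ℤ f (rk u q) ≡
      ⟦ bsᵇ (Rel s) (List.tabulate u) (toList q) ⟧ *ℤ ⟦ contᵇ (bound v) (cntL (List.tabulate v)) (toList q) ⟧) →
    Δ f u v ≡ ∑ (partitions n) (λ l → schur {n} l u *ℤ schur {n} (shape s l) v)
  cauchy-Δ s f u v mu valid≡ = begin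
    Δ f u v
      ≡⟨ Δ≡ f u v ⟩
    ∑ (allVecsOf (upTo (bound v)) n) (λ q → ⟦ sameContentᵇ v q ∧ inBlocksᵇ u q ⟧ *ℤ f (rk u q))
      ≡⟨ ∑-cong (allVecsOf (upTo (bound v)) n) valid≡ ⟩
    ∑ (allVecsOf (upTo (bound v)) n) (λ q → ⟦ bsᵇ (Rel s) U (toList q) ⟧ *ℤ ⟦ contᵇ (bound v) (cntL V) (toList q) ⟧)
      ≡⟨ ∑-toList (upTo (bound v)) n (λ q → ⟦ bsᵇ (Rel s) U q ⟧ *ℤ ⟦ contᵇ (bound v) (cntL V) q ⟧) ⟩
    ∑ (listsOf (upTo (bound v)) n) (λ q → ⟦ bsᵇ (Rel s) U q ⟧ *ℤ ⟦ contᵇ (bound v) (cntL V) q ⟧)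
      ≡⟨ cong (λ k → ∑ (listsOf (upTo (bound v)) k) (λ q → ⟦ bsᵇ (Rel s) U q ⟧ *ℤ ⟦ contᵇ (bound v) (cntL V) q ⟧)) (sym (Listₚ.length-tabulate u)) ⟩
    ∑ (listsOf (upTo (bound v)) (length U)) (λ q → ⟦ bsᵇ (Rel s) U q ⟧ *ℤ ⟦ contᵇ (bound v) (cntL V) q ⟧)
      ≡⟨ words⇒matrices s (bound u) U (bound v) (cntL V) U< (sorted-tabulate u mu)
           (ℕₚ.≤-<-trans (ℕₚ.≤-reflexive (Listₚ.length-tabulate u)) (ℕₚ.m<n⇒m<1+n (ℕₚ.n<1+n n))) ⟩
    matrices s (map (cntL U) (List.downFrom (bound u))) (map (cntL V) (List.downFrom (bound v)))
      ≡⟨ sym (cauchy-tableaux s (bound u) (cntL U) (bound v) (cntL V) (trans (sum-content (bound u) U U<) (Listₚ.length-tabulate u))) ⟩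
    ∑ (partitions n) (λ l → tableaux (bound u) (cntL U) l *ℤ tableaux (bound v) (cntL V) (shape s l))
      ≡⟨ ∑-cong (partitions n) (λ l → sym (cong₂ _*ℤ_ (schur≡tableaux u l) (schur≡tableaux v (shape s l)))) ⟩
    ∑ (partitions n) (λ l → schur {n} l u *ℤ schur {n} (shape s l) v) ∎
    where
    U = List.tabulate u
    V = List.tabulate v
    U< : All (_< bound u) U
    U< = Allₚ.tabulate⁺ (<bound u)

  sameContent≡ : ∀ (v : Word n) q → sameContentᵇ v q ≡ contᵇ (bound v) (cntL (List.tabulate v)) (toList q)
  sameContent≡ v q = allᵇ-cong-∈ _ _ (upTo (bound v)) (λ {b} _ → cong₂ _≡ᵇ_
    (sym (trans (cong (λ l → cntL l b) (toList-lookup q)) (count-tabulate (_≡ᵇ b) (lookup q)))) (sym (count-tabulate (_≡ᵇ b) v)))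

  Δh-expansion : (u v : Word n) → Monotone u → Δ (h n) u v ≡ ∑ (partitions n) (λ l → schur {n} l u *ℤ schur {n} l v)
  Δh-expansion u v mu = cauchy-Δ false (h n) u v mu (λ q → begin
    ⟦ sameContentᵇ v q ∧ inBlocksᵇ u q ⟧ *ℤ + 1
      ≡⟨ trans (ℤₚ.*-identityʳ _) (trans (⟦∧⟧ (sameContentᵇ v q) (inBlocksᵇ u q)) (ℤₚ.*-comm ⟦ sameContentᵇ v q ⟧ _)) ⟩
    ⟦ inBlocksᵇ u q ⟧ *ℤ ⟦ sameContentᵇ v q ⟧
      ≡⟨ cong₂ (λ a b → ⟦ a ⟧ *ℤ ⟦ b ⟧) (bool-iff
           (λ e → subst (λ l → bsᵇ _≤ᵇ_ (List.tabulate u) l ≡ true) (sym (toList-lookup q))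
             (bs⁺ _≤ᵇ_ u (lookup q) (λ i ui → ≤ᵇ⁺ (inBlocks⁻ u q e (inject₁ i) (fsuc i) (inject₁≤suc i) ui))))
           (λ e → inBlocks-step u q mu (λ i ui → ≤ᵇ⁻ {lookup q (inject₁ i)} (bs⁻ _≤ᵇ_ u (lookup q)
             (subst (λ l → bsᵇ _≤ᵇ_ (List.tabulate u) l ≡ true) (toList-lookup q) e) i ui)))) (sameContent≡ v q) ⟩
    ⟦ bsᵇ _≤ᵇ_ (List.tabulate u) (toList q) ⟧ *ℤ ⟦ contᵇ (bound v) (cntL (List.tabulate v)) (toList q) ⟧ ∎)

  Δe-expansion : (u v : Word n) → Monotone u → Δ (e n) u v ≡ ∑ (partitions n) (λ l → schur {n} l u *ℤ schur {n} (conj l) v)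
  Δe-expansion u v mu = cauchy-Δ true (e n) u v mu (λ q → begin
    ⟦ sameContentᵇ v q ∧ inBlocksᵇ u q ⟧ *ℤ ⟦ strictᵇ q ⟧
      ≡⟨ trans (cong (_*ℤ ⟦ strictᵇ q ⟧) (⟦∧⟧ (sameContentᵇ v q) (inBlocksᵇ u q)))
           (trans (ℤₚ.*-assoc ⟦ sameContentᵇ v q ⟧ _ _) (trans (ℤₚ.*-comm ⟦ sameContentᵇ v q ⟧ _) (cong (_*ℤ ⟦ sameContentᵇ v q ⟧) (sym (⟦∧⟧ (inBlocksᵇ u q) (strictᵇ q)))))) ⟩
    ⟦ inBlocksᵇ u q ∧ strictᵇ q ⟧ *ℤ ⟦ sameContentᵇ v q ⟧
      -- Ranks always rise from one block of `u` to the next, so strictly rising ranks only forbid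
      -- equal neighbours inside a block, turning weak sorting into strict sorting.
      ≡⟨ cong₂ (λ a b → ⟦ a ⟧ *ℤ ⟦ b ⟧) (bool-iff
           (λ e → let (e₁ , e₂) = ∧⁻ {inBlocksᵇ u q} e in subst (λ l → bsᵇ _<ᵇ_ (List.tabulate u) l ≡ true) (sym (toList-lookup q))
             (bs⁺ _<ᵇ_ u (lookup q) (λ i ui → <ᵇ⁺ (ℕₚ.≤∧≢⇒< (inBlocks⁻ u q e₁ (inject₁ i) (fsuc i) (inject₁≤suc i) ui)
               (λ qi → not-same q e₂ i (∧⁺ (≡ᵇ⁺ ui) (≡ᵇ⁺ qi)))))))
           (λ e → let adj : ∀ i → u (inject₁ i) ≡ u (fsuc i) → lookup q (inject₁ i) < lookup q (fsuc i)
                      adj i ui = <ᵇ⁻ {lookup q (inject₁ i)} (bs⁻ _<ᵇ_ u (lookup q) (subst (λ l → bsᵇ _<ᵇ_ (List.tabulate u) l ≡ true) (toList-lookup q) e) i ui)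
                  in ∧⁺ (inBlocks-step u q mu (λ i ui → ℕₚ.<⇒≤ (adj i ui)))
                        (allFinᵇ⁺ _ (λ i → trans (rk-<ᵇ u q i) (cong not (≡false (λ s → let (a , b) = ∧⁻ {u (inject₁ i) ≡ᵇ u (fsuc i)} s in
                          ℕₚ.<⇒≢ (adj i (≡ᵇ⁻ {u (inject₁ i)} a)) (≡ᵇ⁻ {lookup q (inject₁ i)} b))))))))
           (sameContent≡ v q) ⟩
    ⟦ bsᵇ _<ᵇ_ (List.tabulate u) (toList q) ⟧ *ℤ ⟦ contᵇ (bound v) (cntL (List.tabulate v)) (toList q) ⟧ ∎)
    where
    strictᵇ : Vec ℕ n → Bool
    strictᵇ q = allᵇ (λ i → rk u q (inject₁ i) <ᵇ rk u q (fsuc i)) (allFin m)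
    not-same : ∀ q → strictᵇ q ≡ true → ∀ i → sameᵇ u q i ≡ true → ⊥
    not-same q e i s with trans (sym (rk-<ᵇ u q i)) (allFinᵇ⁻ (λ i → rk u q (inject₁ i) <ᵇ rk u q (fsuc i)) e i)
    ... | z rewrite s = false≢true z

  ∈-partitions⁻ : ∀ {l} → l ∈ partitions n → nonincᵇ l ≡ true × sumℕ l ≡ n × length l ≤ n
  ∈-partitions⁻ {l} l∈ with ∈ₚ.∈-filter⁻ (Boolₚ.T? ∘ (λ l → nonincᵇ l ∧ (sumℕ l ≡ᵇ n))) {xs = concatMap (λ k → map toList (allVecsOf (map suc (upTo n)) k)) (upTo (suc n))} l∈
  ... | l∈' , t with ∈ₚ.∈-concat⁻′ (map (λ k → map toList (allVecsOf (map suc (upTo n)) k)) (upTo (suc n))) l∈'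
  ... | ls , l∈ls , ls∈ with ∈ₚ.∈-map⁻ (λ k → map toList (allVecsOf (map suc (upTo n)) k)) ls∈
  ... | k , k∈ , refl with ∈ₚ.∈-map⁻ toList l∈ls
  ... | w , _ , refl = proj₁ (∧⁻ {nonincᵇ (toList w)} (T⇒≡true t)) , ≡ᵇ⁻ {sumℕ (toList w)} (proj₂ (∧⁻ {nonincᵇ (toList w)} (T⇒≡true t))) ,
    ℕₚ.≤-trans (ℕₚ.≤-reflexive (Vecₚ.length-toList w)) (ℕₚ.≤-pred (∈ₚ.∈-upTo⁻ k∈))

  partition-good : ∀ {l} → l ∈ partitions n → Good (pad l)
  partition-good {l} l∈ with ∈-partitions⁻ l∈
  ... | dec , s≡n , len≤n = pad-good l len≤n dec s≡n

  -- The coefficient at `u` is the Kostka number with content `comp u`, and `K-↭` allows that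
  -- content to be permuted.
  schur-symmetric : ∀ s {l} → l ∈ partitions n → IsSym (schur {n} (shape s l))
  schur-symmetric s {l} l∈ u u' mu mu' perm = trans (eq u mu) (trans (K-↭ perm (pad (shape s l)) (Good.len gd) (Good.ninc≡ gd)) (sym (eq u' mu')))
    where
    open Symmetry n M
    open Contents n M
    gd = shape-good s l (partition-good l∈)
    eq : ∀ u → Monotone u → schur {n} (shape s l) u ≡ K false (comp u) (pad (shape s l))
    eq u mu = trans (schur≡tableaux u (shape s l)) (trans (tableaux≡K-pad (bound u) (cntL (List.tabulate u)) (shape s l) gd)
      (K-content≡runs (bound u) (List.tabulate u) (Allₚ.tabulate⁺ (<bound u)) (sorted-tabulate u mu) (pad (shape s l)) (Good.len gd) (Good.ninc≡ gd)))

  schur-tensor : ∀ s (f : Series2 n) → (∀ u v → Monotone u → f u v ≡ ∑ (partitions n) (λ l → schur {n} l u *ℤ schur {n} (shape s l) v)) →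
    InTensor IsSym IsSym f
  schur-tensor s f f≡ = map (λ l → schur {n} l , schur {n} (shape s l)) (partitions n) ,
    Allₚ.map⁺ (All.tabulate (λ l∈ → schur-symmetric false l∈ , schur-symmetric s l∈)) ,
    (λ u v mu _ → trans (f≡ u v mu) (sym (∑-map (λ l → schur {n} l , schur {n} (shape s l)) (partitions n) (λ { (f , g) → (f ⊗ g) u v }))))

-- Permutations and standardisation

vec-ext : ∀ {n} (v w : Vec A n) → (∀ i → lookup v i ≡ lookup w i) → v ≡ w
vec-ext []      []      e = refl
vec-ext (x ∷ v) (y ∷ w) e = cong₂ _∷_ (e fzero) (vec-ext v w (e ∘ fsuc))

∈-allVecs⁻ : (xs : List A) (k : ℕ) {v : Vec A k} → v ∈ allVecsOf xs k → ∀ i → lookup v i ∈ xs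
∈-allVecs⁻ xs (suc k) {v} v∈ i with ∈ₚ.∈-concat⁻′ (map (λ w → map (λ x → x ∷ w) xs) (allVecsOf xs k)) v∈
... | l , v∈l , l∈ with ∈ₚ.∈-map⁻ (λ w → map (λ x → x ∷ w) xs) l∈
... | w , w∈ , refl with ∈ₚ.∈-map⁻ (λ x → x ∷ w) v∈l
∈-allVecs⁻ xs (suc k) v∈ fzero    | _ | w , w∈ , refl | x , x∈ , refl = x∈
∈-allVecs⁻ xs (suc k) v∈ (fsuc i) | _ | w , w∈ , refl | x , x∈ , refl = ∈-allVecs⁻ xs k w∈ i

∈-filterᵇ⁻ : (p : A → Bool) (xs : List A) {x : A} → x ∈ filterᵇ p xs → x ∈ xs × p x ≡ true
∈-filterᵇ⁻ p xs x∈ with ∈ₚ.∈-filter⁻ (Boolₚ.T? ∘ p) {xs = xs} x∈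
... | x∈' , t = x∈' , T⇒≡true t

isPerm⁻ : ∀ {n} (σ : Vec (Fin n) n) → isPermᵇ σ ≡ true → IsPerm σ
isPerm⁻ σ e i j eq = Finₚ.toℕ-injective (≡ᵇ⁻ {toℕ i} (⇒ᵇ⁻ {toℕ (lookup σ i) ≡ᵇ toℕ (lookup σ j)}
  (allFinᵇ⁻ (λ j → not (toℕ (lookup σ i) ≡ᵇ toℕ (lookup σ j)) ∨ (toℕ i ≡ᵇ toℕ j)) (allFinᵇ⁻ _ e i) j) (≡ᵇ⁺ (cong toℕ eq))))

isPerm⁺ : ∀ {n} (σ : Vec (Fin n) n) → IsPerm σ → isPermᵇ σ ≡ true
isPerm⁺ σ p = allFinᵇ⁺ _ (λ i → allFinᵇ⁺ _ (λ j → ⇒ᵇ⁺ {toℕ (lookup σ i) ≡ᵇ toℕ (lookup σ j)} (λ e →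
  ≡ᵇ⁺ (cong toℕ (p i j (Finₚ.toℕ-injective (≡ᵇ⁻ {toℕ (lookup σ i)} e)))))))

-- Pigeonhole: punching a missed value `j` out of the range would give an injection into a set with
-- one element fewer.
perm-surjective : ∀ {m} (σ : Vec (Fin (suc m)) (suc m)) → IsPerm σ → ∀ j → Σ (Fin (suc m)) λ i → lookup σ i ≡ j
perm-surjective {m} σ p j with Finₚ.any? (λ i → lookup σ i Finₚ.≟ j)
... | yes r = r
... | no ¬r = ⊥-elim (ℕₚ.1+n≰n (Finₚ.injective⇒≤ {f = λ i → Fin.punchOut (≢ i)} (λ {i} {k} e → p i k (Finₚ.punchOut-injective (≢ i) (≢ k) e))))
  where
  ≢ : ∀ i → j ≢ lookup σ i
  ≢ i e = ¬r (i , sym e)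

-- The value `fzero` is a default that is never reached for a permutation; it keeps the inverse
-- definable without a proof argument.
preimage : ∀ {m} → Vec (Fin (suc m)) (suc m) → Fin (suc m) → Fin (suc m)
preimage σ j with Finₚ.any? (λ i → lookup σ i Finₚ.≟ j)
... | yes (i , _) = i
... | no _        = fzero

lookup-preimage : ∀ {m} (σ : Vec (Fin (suc m)) (suc m)) → IsPerm σ → ∀ j → lookup σ (preimage σ j) ≡ j
lookup-preimage σ p j with Finₚ.any? (λ i → lookup σ i Finₚ.≟ j)
... | yes (i , e) = e
... | no ¬r       = ⊥-elim (¬r (perm-surjective σ p j))

inverse : ∀ {m} → Vec (Fin (suc m)) (suc m) → Vec (Fin (suc m)) (suc m)
inverse σ = Vec.tabulate (preimage σ)

inverseʳ : ∀ {m} (σ : Vec (Fin (suc m)) (suc m)) → IsPerm σ → ∀ j → lookup σ (lookup (inverse σ) j) ≡ j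
inverseʳ σ p j = trans (cong (lookup σ) (Vecₚ.lookup∘tabulate (preimage σ) j)) (lookup-preimage σ p j)

inverseˡ : ∀ {m} (σ : Vec (Fin (suc m)) (suc m)) → IsPerm σ → ∀ i → lookup (inverse σ) (lookup σ i) ≡ i
inverseˡ σ p i = p _ _ (inverseʳ σ p (lookup σ i))

∑-reindex : ∀ {m} (σ : Vec (Fin (suc m)) (suc m)) → IsPerm σ → (g : Fin (suc m) → ℤ) →
  ∑ (allFin (suc m)) (λ i → g (lookup σ i)) ≡ ∑ (allFin (suc m)) g
∑-reindex {m} σ p g = begin
  ∑ (allFin (suc m)) (λ i → g (lookup σ i))           ≡⟨ ∑-cong (allFin (suc m)) (λ i → sym (ℤₚ.*-identityˡ (g (lookup σ i)))) ⟩
  ∑ (allFin (suc m)) (λ i → + 1 *ℤ g (lookup σ i))    ≡⟨ ∑-bij Finₚ._≟_ Finₚ._≟_ (allFin (suc m)) (allFin (suc m)) (λ _ → true) (λ _ → true)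
                                                          (lookup σ) (lookup (inverse σ))
                                                          (λ {i} _ _ → refl , inverseˡ σ p i , Once-allFin (lookup σ i))
                                                          (λ {j} _ _ → refl , inverseʳ σ p j , Once-allFin (lookup (inverse σ) j)) g ⟩
  ∑ (allFin (suc m)) (λ i → + 1 *ℤ g i)               ≡⟨ ∑-cong (allFin (suc m)) (λ i → ℤₚ.*-identityˡ (g i)) ⟩
  ∑ (allFin (suc m)) g                                ∎

count-reindex : ∀ {m} (σ : Vec (Fin (suc m)) (suc m)) → IsPerm σ → (p : Fin (suc m) → Bool) →
  count (λ i → p (lookup σ i)) (allFin (suc m)) ≡ count p (allFin (suc m))
count-reindex {m} σ σp p = ℤₚ.+-injective (trans (count≡∑ (λ i → p (lookup σ i)) (allFin (suc m)))
  (trans (∑-reindex σ σp (λ i → ⟦ p i ⟧)) (sym (count≡∑ p (allFin (suc m))))))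

count-mono : (p q : A → Bool) (xs : List A) → (∀ {x} → x ∈ xs → p x ≡ true → q x ≡ true) → count p xs ≤ count q xs
count-mono p q []       f = z≤n
count-mono p q (x ∷ xs) f with p x in px | q x in qx
... | true  | true  = s≤s (count-mono p q xs (f ∘ there))
... | true  | false = ⊥-elim (false≢true (trans (sym qx) (f (here refl) px)))
... | false | true  = ℕₚ.m≤n⇒m≤1+n (count-mono p q xs (f ∘ there))
... | false | false = count-mono p q xs (f ∘ there)

count-strict : (p q : A → Bool) (xs : List A) → (∀ {x} → x ∈ xs → p x ≡ true → q x ≡ true) →
  ∀ {x} → x ∈ xs → p x ≡ false → q x ≡ true → count p xs < count q xs
count-strict p q (x ∷ xs) f (here refl) px qx rewrite px | qx = s≤s (count-mono p q xs (f ∘ there))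
count-strict p q (x ∷ xs) f (there y∈) py qy with p x in px | q x in qx
... | true  | true  = s≤s (count-strict p q xs (f ∘ there) y∈ py qy)
... | true  | false = ⊥-elim (false≢true (trans (sym qx) (f (here refl) px)))
... | false | true  = ℕₚ.m≤n⇒m≤1+n (count-strict p q xs (f ∘ there) y∈ py qy)
... | false | false = count-strict p q xs (f ∘ there) y∈ py qy

count-true : (xs : List A) → count (λ _ → true) xs ≡ length xs
count-true []       = refl
count-true (x ∷ xs) = cong suc (count-true xs)

count-false : (xs : List A) → count (λ _ → false) xs ≡ 0
count-false []       = refl
count-false (x ∷ xs) = count-false xs

-- The permutation with the same relative order as an injective `key`. It serves both to standardise
-- words and to construct a permutation with prescribed cyclic descents.
module Standardise {n} (key : Fin n → ℕ) (key-inj : ∀ i j → key i ≡ key j → i ≡ j) where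

  rank : Fin n → ℕ
  rank i = count (λ j → key j <ᵇ key i) (allFin n)

  irr : ∀ k → (k <ᵇ k) ≡ false
  irr k = ≡false (λ e → ℕₚ.<-irrefl refl (<ᵇ⁻ {k} {k} e))

  rank<n : ∀ i → rank i < n
  rank<n i = ℕₚ.<-≤-trans (count-strict _ (λ _ → true) (allFin n) (λ _ _ → refl) (∈ₚ.∈-allFin i) (irr (key i)) refl)
    (ℕₚ.≤-reflexive (trans (count-true (allFin n)) (Listₚ.length-tabulate id)))

  std : Vec (Fin n) n
  std = Vec.tabulate (λ i → fromℕ< (rank<n i))

  toℕ-std : ∀ i → toℕ (lookup std i) ≡ rank i
  toℕ-std i = trans (cong toℕ (Vecₚ.lookup∘tabulate (λ i → fromℕ< (rank<n i)) i)) (Finₚ.toℕ-fromℕ< (rank<n i))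

  rank-mono : ∀ i j → key i < key j → rank i < rank j
  rank-mono i j lt = count-strict _ _ (allFin n) (λ {k} _ e → <ᵇ⁺ (ℕₚ.<-trans (<ᵇ⁻ {key k} e) lt)) (∈ₚ.∈-allFin i) (irr (key i)) (<ᵇ⁺ lt)

  std-mono : ∀ i j → key i < key j → toℕ (lookup std i) < toℕ (lookup std j)
  std-mono i j lt rewrite toℕ-std i | toℕ-std j = rank-mono i j lt

  std-reflect : ∀ i j → toℕ (lookup std i) < toℕ (lookup std j) → key i < key j
  std-reflect i j lt with ℕₚ.<-cmp (key i) (key j)
  ... | tri< a _ _ = a
  ... | tri≈ _ b _ = ⊥-elim (ℕₚ.<-irrefl (cong (λ k → toℕ (lookup std k)) (key-inj i j b)) lt)
  ... | tri> _ _ c = ⊥-elim (ℕₚ.<-asym lt (std-mono j i c))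

  std-perm : IsPerm std
  std-perm i j e with ℕₚ.<-cmp (key i) (key j)
  ... | tri< a _ _ = ⊥-elim (ℕₚ.<⇒≢ (std-mono i j a) (cong toℕ e))
  ... | tri≈ _ b _ = key-inj i j b
  ... | tri> _ _ c = ⊥-elim (ℕₚ.<⇒≢ (std-mono j i c) (cong toℕ (sym e)))

-- for b, d < n, the keys a * n + b and c * n + d compare like (a , b) and (c , d) lexicographically
lex-< : ∀ n a b c d → b < n → d < n → a * n + b < c * n + d → a < c ⊎ (a ≡ c × b < d)
lex-< n a b c d b<n d<n lt with ℕₚ.<-cmp a c
... | tri< x _ _    = inj₁ x
... | tri≈ _ refl _ = inj₂ (refl , ℕₚ.+-cancelˡ-< (a * n) b d lt)
... | tri> _ _ c<a  = ⊥-elim (ℕₚ.<-irrefl refl (ℕₚ.<-trans lt (ℕₚ.<-≤-trans (ℕₚ.+-monoʳ-< (c * n) d<n)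
      (ℕₚ.≤-trans (ℕₚ.≤-reflexive (ℕₚ.+-comm (c * n) n)) (ℕₚ.≤-trans (ℕₚ.*-monoˡ-≤ n c<a) (ℕₚ.m≤m+n (a * n) b))))))

lex-<⁺ : ∀ n a b c d → b < n → a < c → a * n + b < c * n + d
lex-<⁺ n a b c d b<n a<c = ℕₚ.<-≤-trans (ℕₚ.+-monoʳ-< (a * n) b<n)
  (ℕₚ.≤-trans (ℕₚ.≤-reflexive (ℕₚ.+-comm (a * n) n)) (ℕₚ.≤-trans (ℕₚ.*-monoˡ-≤ n a<c) (ℕₚ.m≤m+n (c * n) d)))

lex-inj : ∀ n a b c d → b < n → d < n → a * n + b ≡ c * n + d → a ≡ c × b ≡ d
lex-inj n a b c d b<n d<n e with ℕₚ.<-cmp a c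
... | tri< x _ _    = ⊥-elim (ℕₚ.<⇒≢ (lex-<⁺ n a b c d b<n x) e)
... | tri≈ _ refl _ = refl , ℕₚ.+-cancelˡ-≡ (a * n) b d e
... | tri> _ _ x    = ⊥-elim (ℕₚ.<⇒≢ (lex-<⁺ n c d a b d<n x) (sym e))

-- Letters below `b` occupy an initial segment of a monotone word. Thus a letter at a given position
-- can be located from the content alone.
monotone-count : ∀ {n} (v : Word n) → Monotone v → ∀ b r →
  (v r < b → toℕ r < count (λ j → v j <ᵇ b) (allFin n)) × (toℕ r < count (λ j → v j <ᵇ b) (allFin n) → v r < b)
monotone-count {suc n} v mv b r with v fzero <ᵇ b in e
monotone-count {suc n} v mv b fzero    | true = (λ _ → s≤s z≤n) , (λ _ → <ᵇ⁻ {v fzero} e)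
monotone-count {suc n} v mv b (fsuc r) | true with monotone-count (v ∘ fsuc) (monotone-tail mv) b r
... | f , g = (λ p → s≤s (subst (toℕ r <_) (sym tail≡) (f p))) , (λ { (s≤s p) → g (subst (toℕ r <_) tail≡ p) })
  where
  tail≡ : count (λ j → v j <ᵇ b) (List.tabulate fsuc) ≡ count (λ j → v (fsuc j) <ᵇ b) (allFin n)
  tail≡ = count-tabulate (λ j → v j <ᵇ b) fsuc
monotone-count {suc n} v mv b r | false = (λ p → ⊥-elim (big r p)) , (λ p → ⊥-elim (ℕₚ.n≮0 (subst (toℕ r <_) none p)))
  where
  big : ∀ r → ¬ v r < b
  big r p = false≢true (trans (sym e) (<ᵇ⁺ (ℕₚ.≤-<-trans (mv fzero r z≤n) p)))
  none : count (λ j → v j <ᵇ b) (List.tabulate fsuc) ≡ 0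
  none = ℕₚ.n≤0⇒n≡0 (ℕₚ.≤-trans (count-mono _ (λ _ → false) (List.tabulate fsuc) (λ {x} _ p → ⊥-elim (big x (<ᵇ⁻ {v x} p))))
    (ℕₚ.≤-reflexive (count-false (List.tabulate {n = n} (fsuc {n = n})))))

content-count : ∀ {n} (v w : Word n) → (∀ b → cnt v b ≡ cnt w b) → ∀ b → count (λ j → v j <ᵇ b) (allFin n) ≡ count (λ j → w j <ᵇ b) (allFin n)
content-count {n} v w e b = ℤₚ.+-injective (go b)
  where
  split : ∀ (v : Word n) b → + count (λ j → v j <ᵇ suc b) (allFin n) ≡ + count (λ j → v j <ᵇ b) (allFin n) +ℤ + cnt v b
  split v b = begin
    + count (λ j → v j <ᵇ suc b) (allFin n)                     ≡⟨ count≡∑ _ (allFin n) ⟩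
    ∑ (allFin n) (λ j → ⟦ v j <ᵇ suc b ⟧)                        ≡⟨ ∑-cong (allFin n) (λ j → pt (v j)) ⟩
    ∑ (allFin n) (λ j → ⟦ v j <ᵇ b ⟧ +ℤ ⟦ v j ≡ᵇ b ⟧)            ≡⟨ ∑-+ (allFin n) (λ j → ⟦ v j <ᵇ b ⟧) (λ j → ⟦ v j ≡ᵇ b ⟧) ⟩
    ∑ (allFin n) (λ j → ⟦ v j <ᵇ b ⟧) +ℤ ∑ (allFin n) (λ j → ⟦ v j ≡ᵇ b ⟧) ≡⟨ sym (cong₂ _+ℤ_ (count≡∑ (λ j → v j <ᵇ b) (allFin n)) (count≡∑ (λ j → v j ≡ᵇ b) (allFin n))) ⟩
    + count (λ j → v j <ᵇ b) (allFin n) +ℤ + cnt v b ∎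
    where
    pt : ∀ x → ⟦ x <ᵇ suc b ⟧ ≡ ⟦ x <ᵇ b ⟧ +ℤ ⟦ x ≡ᵇ b ⟧
    pt x with ℕₚ.<-cmp x b
    ... | tri< lt ne _ rewrite <ᵇ⁺ (ℕₚ.m<n⇒m<1+n lt) | <ᵇ⁺ lt | ≡false (λ e → ne (≡ᵇ⁻ {x} {b} e)) = refl
    ... | tri≈ ¬lt refl _ rewrite <ᵇ⁺ (ℕₚ.n<1+n x) | ≡false (λ e → ¬lt (<ᵇ⁻ {x} {x} e)) | ≡ᵇ⁺ {x} refl = refl
    ... | tri> ¬lt ne gt rewrite ≡false (λ e → ℕₚ.<⇒≱ gt (ℕₚ.≤-pred (<ᵇ⁻ {x} {suc b} e))) | ≡false (λ e → ¬lt (<ᵇ⁻ {x} {b} e)) | ≡false (λ e → ne (≡ᵇ⁻ {x} {b} e)) = refl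
  base : ∀ (v : Word n) → count (λ j → v j <ᵇ 0) (allFin n) ≡ 0
  base v = ℕₚ.n≤0⇒n≡0 (ℕₚ.≤-trans (count-mono (λ j → v j <ᵇ 0) (λ _ → false) (allFin n) (λ {x} _ p → ⊥-elim (ℕₚ.n≮0 (<ᵇ⁻ {v x} {0} p)))) (ℕₚ.≤-reflexive (count-false (allFin n))))
  go : ∀ b → + count (λ j → v j <ᵇ b) (allFin n) ≡ + count (λ j → w j <ᵇ b) (allFin n)
  go zero    = cong +_ (trans (base v) (sym (base w)))
  go (suc b) = trans (split v b) (trans (cong₂ (λ x y → x +ℤ + y) (go b) (e b)) (sym (split w b)))

sameContent⁻ : ∀ {n} (v : Word n) q → sameContentᵇ v q ≡ true → (∀ i → lookup q i < bound v) → ∀ b → cnt (lookup q) b ≡ cnt v b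
sameContent⁻ {n} v q e q< b with b <? bound v
... | yes b< = ≡ᵇ⁻ {cnt (lookup q) b} (allᵇ⁻ (λ b → cnt (lookup q) b ≡ᵇ cnt v b) (upTo (bound v)) e (∈ₚ.∈-upTo⁺ b<))
... | no ¬b< = trans (none (lookup q) q<) (sym (none v (<bound v)))
  where
  none : ∀ (w : Word n) → (∀ i → w i < bound v) → cnt w b ≡ 0
  none w w< = trans (sym (count-tabulate (_≡ᵇ b) w)) (cntL-notin (List.tabulate w) (Allₚ.tabulate⁺ (λ i wi≡b → ¬b< (subst (_< bound v) wi≡b (w< i)))))

-- The coproduct of a fundamental quasisymmetric function

FFᵇ : ∀ {m} → (Fin m → Bool) → Word (suc m) → Bool
FFᵇ {m} J u = allᵇ (λ i → not (J i) ∨ (u (inject₁ i) <ᵇ u (fsuc i))) (allFin m)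

FF⁺ : ∀ {m} (J : Fin m → Bool) (u : Word (suc m)) → (∀ i → J i ≡ true → u (inject₁ i) < u (fsuc i)) → FFᵇ J u ≡ true
FF⁺ J u f = allFinᵇ⁺ _ (λ i → ⇒ᵇ⁺ {J i} (λ e → <ᵇ⁺ (f i e)))

FF⁻ : ∀ {m} (J : Fin m → Bool) (u : Word (suc m)) → FFᵇ J u ≡ true → ∀ i → J i ≡ true → u (inject₁ i) < u (fsuc i)
FF⁻ J u e i Ji = <ᵇ⁻ {u (inject₁ i)} (⇒ᵇ⁻ {J i} (allFinᵇ⁻ (λ i → not (J i) ∨ (u (inject₁ i) <ᵇ u (fsuc i))) e i) Ji)

desᵇ : ∀ {m} → Vec (Fin (suc m)) (suc m) → Fin m → Bool
desᵇ σ i = toℕ (lookup σ (fsuc i)) <ᵇ toℕ (lookup σ (inject₁ i))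

F-Des : ∀ {m} (σ : Vec (Fin (suc m)) (suc m)) (u : Word (suc m)) → F (Des σ) u ≡ ⟦ FFᵇ (desᵇ σ) u ⟧
F-Des {m} σ u = cong ⟦_⟧ (allᵇ-cong-∈ _ _ (allFin m) (λ {i} _ → cong (λ b → not b ∨ (u (inject₁ i) <ᵇ u (fsuc i))) (Vecₚ.lookup∘tabulate (desᵇ σ) i)))

lookup-compose : ∀ {n} (σ₂ σ₁ : Vec (Fin n) n) i → lookup (compose σ₂ σ₁) i ≡ lookup σ₂ (lookup σ₁ i)
lookup-compose σ₂ σ₁ i = Vecₚ.lookup-map i (lookup σ₂) σ₁

eqVecFin⁻ : ∀ {m n} (v w : Vec (Fin m) n) → eqVecFin v w ≡ true → v ≡ w
eqVecFin⁻ []      []      e = refl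
eqVecFin⁻ (x ∷ v) (y ∷ w) e = cong₂ _∷_ (Finₚ.toℕ-injective (≡ᵇ⁻ {toℕ x} (proj₁ (∧⁻ {toℕ x ≡ᵇ toℕ y} e)))) (eqVecFin⁻ v w (proj₂ (∧⁻ {toℕ x ≡ᵇ toℕ y} e)))

eqVecFin⁺ : ∀ {m n} {v w : Vec (Fin m) n} → v ≡ w → eqVecFin v w ≡ true
eqVecFin⁺ {v = v} refl = go v
  where
  go : ∀ {n} (v : Vec (Fin _) n) → eqVecFin v v ≡ true
  go []      = refl
  go (x ∷ v) = ∧⁺ (≡ᵇ⁺ {toℕ x} refl) (go v)

_≟ₚ_ : ∀ {m n} → DecidableEquality (Vec (Fin m) n)
_≟ₚ_ = Vecₚ.≡-dec Finₚ._≟_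

Once-allPerms : ∀ {n} (σ : Vec (Fin n) n) → Once _≟ₚ_ (allVecsOf (allFin n) n) σ
Once-allPerms {n} σ = Once-allVecs Finₚ._≟_ (allFin n) _≟ₚ_ σ (λ i → Once-allFin (lookup σ i))

-- The factor σ₂ is determined as π σ₁⁻¹.
∑-factor : ∀ {m} (π σ₁ : Vec (Fin (suc m)) (suc m)) → IsPerm π → IsPerm σ₁ → (G : Vec (Fin (suc m)) (suc m) → ℤ) →
  ∑ (perms (suc m)) (λ σ₂ → ⟦ eqVecFin (compose σ₂ σ₁) π ⟧ *ℤ G σ₂) ≡ G (compose π (inverse σ₁))
∑-factor {m} π σ₁ pπ p₁ G = trans (∑-filter isPermᵇ (allVecsOf (allFin (suc m)) (suc m)) _) (trans
  (∑-cong (allVecsOf (allFin (suc m)) (suc m)) (λ σ₂ → trans (sym (guard-∧ (isPermᵇ σ₂) _ _)) (cong (λ b → ⟦ b ⟧ *ℤ G σ₂) (bool-iff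
    (λ e → dec-true (σ₂ ≟ₚ ρ) (vec-ext σ₂ ρ (λ j → begin
      lookup σ₂ j                                ≡⟨ cong (lookup σ₂) (sym (inverseʳ σ₁ p₁ j)) ⟩
      lookup σ₂ (lookup σ₁ (lookup (inverse σ₁) j)) ≡⟨ sym (lookup-compose σ₂ σ₁ _) ⟩
      lookup (compose σ₂ σ₁) (lookup (inverse σ₁) j) ≡⟨ cong (λ v → lookup v (lookup (inverse σ₁) j)) (eqVecFin⁻ (compose σ₂ σ₁) π (proj₂ (∧⁻ {isPermᵇ σ₂} e))) ⟩
      lookup π (lookup (inverse σ₁) j)           ≡⟨ sym (lookup-compose π (inverse σ₁) j) ⟩
      lookup ρ j                                 ∎)))
    (λ e → subst (λ τ → isPermᵇ τ ∧ eqVecFin (compose τ σ₁) π ≡ true) (sym (does-true (σ₂ ≟ₚ ρ) e))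
      (∧⁺ (isPerm⁺ ρ (λ i j eq → begin
          i                                    ≡⟨ sym (inverseʳ σ₁ p₁ i) ⟩
          lookup σ₁ (lookup (inverse σ₁) i)    ≡⟨ cong (lookup σ₁) (pπ _ _ (trans (sym (lookup-compose π (inverse σ₁) i)) (trans eq (lookup-compose π (inverse σ₁) j)))) ⟩
          lookup σ₁ (lookup (inverse σ₁) j)    ≡⟨ inverseʳ σ₁ p₁ j ⟩
          j                                    ∎))
          (eqVecFin⁺ (vec-ext (compose ρ σ₁) π (λ i → begin
            lookup (compose ρ σ₁) i                     ≡⟨ lookup-compose ρ σ₁ i ⟩
            lookup ρ (lookup σ₁ i)                      ≡⟨ lookup-compose π (inverse σ₁) (lookup σ₁ i) ⟩
            lookup π (lookup (inverse σ₁) (lookup σ₁ i)) ≡⟨ cong (lookup π) (inverseˡ σ₁ p₁ i) ⟩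
            lookup π i                                  ∎)))))))))
  (Once-allPerms ρ G))
  where
  ρ = compose π (inverse σ₁)

-- A descent of ρ forces a strict step of `v`, so ρ increases along each block of equal letters of
-- `v`.
equal⇒≤ : ∀ {m} (v : Word (suc m)) (ρ : Vec (Fin (suc m)) (suc m)) → Monotone v → FFᵇ (desᵇ ρ) v ≡ true →
  ∀ a b → toℕ a ≤ toℕ b → v a ≡ v b → toℕ (lookup ρ a) ≤ toℕ (lookup ρ b)
equal⇒≤ v ρ mv e a b a≤b = chain (λ k → v a ≡ v k → toℕ (lookup ρ a) ≤ toℕ (lookup ρ k)) a (λ _ → ℕₚ.≤-refl)
  (λ k a≤k IH va≡ → let
      p : v a ≤ v (inject₁ k)
      p = mv a (inject₁ k) (subst (toℕ a ≤_) (sym (Finₚ.toℕ-inject₁ k)) a≤k)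
      va≡k : v a ≡ v (inject₁ k)
      va≡k = ℕₚ.≤-antisym p (ℕₚ.≤-trans (monotone-step mv k) (ℕₚ.≤-reflexive (sym va≡)))
    in ℕₚ.≤-trans (IH va≡k) (ℕₚ.≮⇒≥ (λ desc → ℕₚ.<⇒≢ (FF⁻ (desᵇ ρ) v e k (<ᵇ⁺ desc)) (trans (sym va≡k) va≡)))) b a≤b

module _ {m : ℕ} (π : Vec (Fin (suc m)) (suc m)) (pπ : IsPerm π) (u v : Word (suc m)) (mu : Monotone u) (mv : Monotone v) where

  private
    n = suc m
    V = allVecsOf (allFin n) n
    Q = allVecsOf (upTo (bound v)) n

    ρ : Vec (Fin n) n → Vec (Fin n) n
    ρ σ = compose π (inverse σ)

    p₁ : Vec (Fin n) n → Bool
    p₁ σ = isPermᵇ σ ∧ (FFᵇ (desᵇ σ) u ∧ FFᵇ (desᵇ (ρ σ)) v)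

    p₂ : Vec ℕ n → Bool
    p₂ q = (sameContentᵇ v q ∧ inBlocksᵇ u q) ∧ FFᵇ (desᵇ π) (rk u q)

    φ : Vec (Fin n) n → Vec ℕ n
    φ σ = Vec.map v σ

    -- Lexicographic order on pairs: letters of `q` first, ties broken by the values of π. The
    -- latter are below `n`, so base `n` encodes the pair injectively.
    key : Vec ℕ n → Fin n → ℕ
    key q i = lookup q i * n + toℕ (lookup π i)

    key-inj : ∀ q i j → key q i ≡ key q j → i ≡ j
    key-inj q i j eq = pπ i j (Finₚ.toℕ-injective (proj₂ (lex-inj n (lookup q i) _ (lookup q j) _ (Finₚ.toℕ<n _) (Finₚ.toℕ<n _) eq)))

    module St (q : Vec ℕ n) = Standardise (key q) (key-inj q)

    ψ : Vec ℕ n → Vec (Fin n) n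
    ψ q = St.std q

    key-<⁻ : ∀ q i j → key q i < key q j → lookup q i < lookup q j ⊎ (lookup q i ≡ lookup q j × toℕ (lookup π i) < toℕ (lookup π j))
    key-<⁻ q i j = lex-< n (lookup q i) _ (lookup q j) _ (Finₚ.toℕ<n _) (Finₚ.toℕ<n _)

    key-<⁺ : ∀ q i j → lookup q i < lookup q j → key q i < key q j
    key-<⁺ q i j = lex-<⁺ n (lookup q i) _ (lookup q j) _ (Finₚ.toℕ<n _)

    lookup-φ : ∀ σ i → lookup (φ σ) i ≡ v (lookup σ i)
    lookup-φ σ i = Vecₚ.lookup-map i v σ

    ρσ : ∀ σ → IsPerm σ → ∀ i → lookup (ρ σ) (lookup σ i) ≡ lookup π i
    ρσ σ p i = trans (lookup-compose π (inverse σ) (lookup σ i)) (cong (lookup π) (inverseˡ σ p i))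

    to : ∀ {σ} → σ ∈ V → p₁ σ ≡ true → p₂ (φ σ) ≡ true × ψ (φ σ) ≡ σ × Once (Vecₚ.≡-dec ℕₚ._≟_) Q (φ σ)
    to {σ} _ e = ∧⁺ (∧⁺ content blocks) strict , vec-ext (ψ (φ σ)) σ (λ i → Finₚ.toℕ-injective (rank≡ i)) ,
      Once-allVecs ℕₚ._≟_ (upTo (bound v)) (Vecₚ.≡-dec ℕₚ._≟_) (φ σ) (λ i → Once-upTo (subst (_< bound v) (sym (lookup-φ σ i)) (<bound v (lookup σ i))))
      where
      p : IsPerm σ
      p = isPerm⁻ σ (proj₁ (∧⁻ {isPermᵇ σ} e))
      eu = proj₁ (∧⁻ {FFᵇ (desᵇ σ) u} (proj₂ (∧⁻ {isPermᵇ σ} e)))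
      ev = proj₂ (∧⁻ {FFᵇ (desᵇ σ) u} (proj₂ (∧⁻ {isPermᵇ σ} e)))
      content : sameContentᵇ v (φ σ) ≡ true
      content = allᵇ⁺ _ (upTo (bound v)) (λ {b} _ → ≡ᵇ⁺ (trans (count-cong _ _ (allFin n) (λ i → cong (_≡ᵇ b) (lookup-φ σ i))) (count-reindex σ p (λ a → v a ≡ᵇ b))))
      asc : ∀ i → u (inject₁ i) ≡ u (fsuc i) → toℕ (lookup σ (inject₁ i)) ≤ toℕ (lookup σ (fsuc i))
      asc i ui = ℕₚ.≮⇒≥ (λ desc → ℕₚ.<⇒≢ (FF⁻ (desᵇ σ) u eu i (<ᵇ⁺ desc)) ui)
      blocks : inBlocksᵇ u (φ σ) ≡ true
      blocks = inBlocks-step u (φ σ) mu (λ i ui → ℕₚ.≤-trans (ℕₚ.≤-reflexive (lookup-φ σ (inject₁ i)))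
        (ℕₚ.≤-trans (mv _ _ (asc i ui)) (ℕₚ.≤-reflexive (sym (lookup-φ σ (fsuc i))))))
      -- If both coordinates agree at neighbouring positions, σ increases there and ρ increases
      -- along the corresponding block of `v`; then π = ρ σ has no descent there.
      strict : FFᵇ (desᵇ π) (rk u (φ σ)) ≡ true
      strict = FF⁺ (desᵇ π) (rk u (φ σ)) (λ i d → <ᵇ⁻ {rk u (φ σ) (inject₁ i)} (trans (rk-<ᵇ u (φ σ) i) (cong not (≡false (λ s →
        let (ui , qi) = ∧⁻ {u (inject₁ i) ≡ᵇ u (fsuc i)} s in
        ℕₚ.<⇒≱ (<ᵇ⁻ {toℕ (lookup π (fsuc i))} d) (subst (_≤ toℕ (lookup π (fsuc i))) (cong toℕ (ρσ σ p (inject₁ i)))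
          (subst (toℕ (lookup (ρ σ) (lookup σ (inject₁ i))) ≤_) (cong toℕ (ρσ σ p (fsuc i)))
            (equal⇒≤ v (ρ σ) mv ev _ _ (asc i (≡ᵇ⁻ {u (inject₁ i)} ui))
              (trans (sym (lookup-φ σ (inject₁ i))) (trans (≡ᵇ⁻ {lookup (φ σ) (inject₁ i)} qi) (lookup-φ σ (fsuc i))))))))))))
      σ<⇒key< : ∀ i j → toℕ (lookup σ i) < toℕ (lookup σ j) → key (φ σ) i < key (φ σ) j
      σ<⇒key< i j lt with ℕₚ.m≤n⇒m<n∨m≡n (mv _ _ (ℕₚ.<⇒≤ lt))
      ... | inj₁ v< = key-<⁺ (φ σ) i j (subst (_< lookup (φ σ) j) (sym (lookup-φ σ i)) (subst (v (lookup σ i) <_) (sym (lookup-φ σ j)) v<))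
      ... | inj₂ v≡ = ℕₚ.≤∧≢⇒< (ℕₚ.+-mono-≤ (ℕₚ.≤-reflexive (cong (_* n) (trans (lookup-φ σ i) (trans v≡ (sym (lookup-φ σ j))))))
              (subst (_≤ toℕ (lookup π j)) (cong toℕ (ρσ σ p i)) (subst (toℕ (lookup (ρ σ) (lookup σ i)) ≤_) (cong toℕ (ρσ σ p j))
                (equal⇒≤ v (ρ σ) mv ev _ _ (ℕₚ.<⇒≤ lt) v≡))))
              (λ eq → ℕₚ.<⇒≢ lt (cong (λ k → toℕ (lookup σ k)) (key-inj (φ σ) i j eq)))
      key<⇒σ< : ∀ i j → key (φ σ) i < key (φ σ) j → toℕ (lookup σ i) < toℕ (lookup σ j)
      key<⇒σ< i j lt with ℕₚ.<-cmp (toℕ (lookup σ i)) (toℕ (lookup σ j))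
      ... | tri< a _ _ = a
      ... | tri≈ _ b _ = ⊥-elim (ℕₚ.<⇒≢ lt (cong (key (φ σ)) (p i j (Finₚ.toℕ-injective b))))
      ... | tri> _ _ c = ⊥-elim (ℕₚ.<-asym lt (σ<⇒key< j i c))
      rank≡ : ∀ i → toℕ (lookup (ψ (φ σ)) i) ≡ toℕ (lookup σ i)
      rank≡ i = ℤₚ.+-injective (begin
        + toℕ (lookup (ψ (φ σ)) i)                                                  ≡⟨ cong +_ (St.toℕ-std (φ σ) i) ⟩
        + count (λ j → key (φ σ) j <ᵇ key (φ σ) i) (allFin n)                       ≡⟨ cong +_ (count-cong _ _ (allFin n) (λ j → bool-iff
             (λ e → <ᵇ⁺ (key<⇒σ< j i (<ᵇ⁻ {key (φ σ) j} e))) (λ e → <ᵇ⁺ (σ<⇒key< j i (<ᵇ⁻ {toℕ (lookup σ j)} e))))) ⟩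
        + count (λ j → toℕ (lookup σ j) <ᵇ toℕ (lookup σ i)) (allFin n)             ≡⟨ cong +_ (count-reindex σ p (λ a → toℕ a <ᵇ toℕ (lookup σ i))) ⟩
        + count (λ a → toℕ a <ᵇ toℕ (lookup σ i)) (allFin n)                        ≡⟨ count≡∑ _ (allFin n) ⟩
        ∑ (allFin n) (λ a → ⟦ toℕ a <ᵇ toℕ (lookup σ i) ⟧)                          ≡⟨ ∑-allFin n (λ a → ⟦ a <ᵇ toℕ (lookup σ i) ⟧) ⟩
        ∑ (upTo n) (λ a → ⟦ a <ᵇ toℕ (lookup σ i) ⟧)                                ≡⟨ ∑-<ᵇ (toℕ (lookup σ i)) n (ℕₚ.<⇒≤ (Finₚ.toℕ<n _)) ⟩
        + toℕ (lookup σ i)                                                          ∎)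

    from : ∀ {q} → q ∈ Q → p₂ q ≡ true → p₁ (ψ q) ≡ true × φ (ψ q) ≡ q × Once _≟ₚ_ V (ψ q)
    from {q} q∈ e = ∧⁺ (isPerm⁺ σ (St.std-perm q)) (∧⁺ strict-u strict-v) , vec-ext (φ σ) q (λ i → trans (lookup-φ σ i) (vσ i)) , Once-allPerms σ
      where
      σ = ψ q
      σp = St.std-perm q
      e₁ = proj₁ (∧⁻ {sameContentᵇ v q} (proj₁ (∧⁻ {sameContentᵇ v q ∧ inBlocksᵇ u q} e)))
      e₂ = proj₂ (∧⁻ {sameContentᵇ v q} (proj₁ (∧⁻ {sameContentᵇ v q ∧ inBlocksᵇ u q} e)))
      e₃ = proj₂ (∧⁻ {sameContentᵇ v q ∧ inBlocksᵇ u q} e)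
      content : ∀ b → count (λ j → lookup q j <ᵇ b) (allFin n) ≡ count (λ j → v j <ᵇ b) (allFin n)
      content = content-count (lookup q) v (sameContent⁻ v q e₁ (λ i → ∈ₚ.∈-upTo⁻ (∈-allVecs⁻ (upTo (bound v)) n q∈ i)))
      -- The rank of `i` is at least the number of letters below `q` at `i` and less than the number
      -- of letters up to it. As `v` has the same content, that position of `v` carries the same
      -- letter.
      vσ : ∀ i → v (lookup σ i) ≡ lookup q i
      vσ i = ℕₚ.≤-antisym
        (ℕₚ.≤-pred (proj₂ (monotone-count v mv (suc (lookup q i)) (lookup σ i)) (subst (_< count (λ j → v j <ᵇ suc (lookup q i)) (allFin n)) (sym (St.toℕ-std q i))
          (subst (St.rank q i <_) (content (suc (lookup q i)))
            (count-strict _ _ (allFin n) (λ {j} _ lt → <ᵇ⁺ (s≤s (case key-<⁻ q j i (<ᵇ⁻ {key q j} lt) of λ where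
              (inj₁ a) → ℕₚ.<⇒≤ a
              (inj₂ (a , _)) → ℕₚ.≤-reflexive a))) (∈ₚ.∈-allFin i) (St.irr q (key q i)) (<ᵇ⁺ (ℕₚ.n<1+n (lookup q i))))))))
        (ℕₚ.≮⇒≥ (λ lt → ℕₚ.<⇒≱ (subst₂' (proj₁ (monotone-count v mv (lookup q i) (lookup σ i)) lt))
          (count-mono _ _ (allFin n) (λ {j} _ lt' → <ᵇ⁺ (key-<⁺ q j i (<ᵇ⁻ {lookup q j} lt'))))))
        where
        subst₂' : toℕ (lookup σ i) < count (λ j → v j <ᵇ lookup q i) (allFin n) → St.rank q i < count (λ j → lookup q j <ᵇ lookup q i) (allFin n)
        subst₂' lt = ℕₚ.≤-trans (s≤s (ℕₚ.≤-reflexive (sym (St.toℕ-std q i)))) (ℕₚ.≤-trans lt (ℕₚ.≤-reflexive (sym (content (lookup q i)))))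
      strict-u : FFᵇ (desᵇ σ) u ≡ true
      strict-u = FF⁺ (desᵇ σ) u (λ i d → ℕₚ.≤∧≢⇒< (monotone-step mu i) (λ ui →
        case key-<⁻ q (fsuc i) (inject₁ i) (St.std-reflect q (fsuc i) (inject₁ i) (<ᵇ⁻ {toℕ (lookup σ (fsuc i))} d)) of λ where
          (inj₁ q<) → ℕₚ.<⇒≱ q< (inBlocks⁻ u q e₂ (inject₁ i) (fsuc i) (inject₁≤suc i) ui)
          (inj₂ (q≡ , π<)) → ℕₚ.<⇒≢ (FF⁻ (desᵇ π) (rk u q) e₃ i (<ᵇ⁺ π<)) (≡ᵇ⁻ {rk u q (inject₁ i)} (trans (rk-≡ᵇ u q i) (∧⁺ (≡ᵇ⁺ ui) (≡ᵇ⁺ (sym q≡)))))))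
      -- Neighbouring positions of `v` come from increasing keys. With equal letters the tie is
      -- decided by π, which would increase, contrary to the descent of ρ.
      strict-v : FFᵇ (desᵇ (ρ σ)) v ≡ true
      strict-v = FF⁺ (desᵇ (ρ σ)) v (λ a d → let
          i = lookup (inverse σ) (inject₁ a)
          j = lookup (inverse σ) (fsuc a)
          σi = inverseʳ σ σp (inject₁ a)
          σj = inverseʳ σ σp (fsuc a)
          i<j : toℕ (lookup σ i) < toℕ (lookup σ j)
          i<j = subst₂ (λ x y → toℕ x < toℕ y) (sym σi) (sym σj) (s≤s (ℕₚ.≤-reflexive (Finₚ.toℕ-inject₁ a)))
          vi = trans (cong v (sym σi)) (vσ i)
          vj = trans (cong v (sym σj)) (vσ j)
        in case key-<⁻ q i j (St.std-reflect q i j i<j) of λ where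
          (inj₁ q<) → subst₂ _<_ (sym vi) (sym vj) q<
          (inj₂ (_ , π<)) → ⊥-elim (ℕₚ.<-asym π< (subst₂ (λ x y → toℕ x < toℕ y) (lookup-compose π (inverse σ) (fsuc a)) (lookup-compose π (inverse σ) (inject₁ a))
             (<ᵇ⁻ {toℕ (lookup (ρ σ) (fsuc a))} d))))

  -- The map σ ↦ `v` ∘ σ and standardisation with ties broken by π are inverse to each other. The
  -- weight `w` lets one bijection serve both the coproduct formula and quasisymmetry in the second
  -- alphabet.
  standardisation-sum : (w : Vec ℕ (suc m) → ℤ) →
    ∑ (allVecsOf (allFin (suc m)) (suc m)) (λ σ → ⟦ isPermᵇ σ ∧ (FFᵇ (desᵇ σ) u ∧ FFᵇ (desᵇ (compose π (inverse σ))) v) ⟧ *ℤ w (Vec.map v σ)) ≡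
    ∑ (allVecsOf (upTo (bound v)) (suc m)) (λ q → ⟦ (sameContentᵇ v q ∧ inBlocksᵇ u q) ∧ FFᵇ (desᵇ π) (rk u q) ⟧ *ℤ w q)
  standardisation-sum w = ∑-bij _≟ₚ_ (Vecₚ.≡-dec ℕₚ._≟_) V Q p₁ p₂ φ ψ to from w

  Δ-F-Des : Δ (F (Des π)) u v ≡
    ∑ (perms n) (λ σ₁ → ∑ (perms n) (λ σ₂ → ⟦ eqVecFin (compose σ₂ σ₁) π ⟧ *ℤ (F (Des σ₁) u *ℤ F (Des σ₂) v)))
  Δ-F-Des = sym (begin
    ∑ (perms n) (λ σ₁ → ∑ (perms n) (λ σ₂ → ⟦ eqVecFin (compose σ₂ σ₁) π ⟧ *ℤ (F (Des σ₁) u *ℤ F (Des σ₂) v)))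
      ≡⟨ ∑-cong-∈ (perms n) (λ {σ₁} σ∈ → ∑-factor π σ₁ pπ (isPerm⁻ σ₁ (proj₂ (∈-filterᵇ⁻ isPermᵇ V σ∈))) (λ σ₂ → F (Des σ₁) u *ℤ F (Des σ₂) v)) ⟩
    ∑ (perms n) (λ σ₁ → F (Des σ₁) u *ℤ F (Des (ρ σ₁)) v)
      ≡⟨ ∑-filter isPermᵇ V (λ σ₁ → F (Des σ₁) u *ℤ F (Des (ρ σ₁)) v) ⟩
    ∑ V (λ σ → ⟦ isPermᵇ σ ⟧ *ℤ (F (Des σ) u *ℤ F (Des (ρ σ)) v))
      ≡⟨ ∑-cong V (λ σ → begin
        ⟦ isPermᵇ σ ⟧ *ℤ (F (Des σ) u *ℤ F (Des (ρ σ)) v)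
          ≡⟨ cong (⟦ isPermᵇ σ ⟧ *ℤ_) (trans (cong₂ _*ℤ_ (F-Des σ u) (F-Des (ρ σ) v)) (sym (⟦∧⟧ (FFᵇ (desᵇ σ) u) _))) ⟩
        ⟦ isPermᵇ σ ⟧ *ℤ ⟦ FFᵇ (desᵇ σ) u ∧ FFᵇ (desᵇ (ρ σ)) v ⟧
          ≡⟨ trans (sym (⟦∧⟧ (isPermᵇ σ) _)) (sym (ℤₚ.*-identityʳ _)) ⟩
        ⟦ p₁ σ ⟧ *ℤ + 1 ∎) ⟩
    ∑ V (λ σ → ⟦ p₁ σ ⟧ *ℤ + 1)
      ≡⟨ standardisation-sum (λ _ → + 1) ⟩
    ∑ Q (λ q → ⟦ p₂ q ⟧ *ℤ + 1)
      ≡⟨ ∑-cong Q (λ q → trans (ℤₚ.*-identityʳ _) (trans (⟦∧⟧ (sameContentᵇ v q ∧ inBlocksᵇ u q) _)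
           (cong (⟦ sameContentᵇ v q ∧ inBlocksᵇ u q ⟧ *ℤ_) (sym (F-Des π (rk u q)))))) ⟩
    ∑ Q (λ q → ⟦ sameContentᵇ v q ∧ inBlocksᵇ u q ⟧ *ℤ F (Des π) (rk u q))
      ≡⟨ sym (Δ≡ (F (Des π)) u v) ⟩
    Δ (F (Des π)) u v ∎)

-- Rotations and orbits

module Mod (m : ℕ) where

  n : ℕ
  n = suc m

  toℕ-mod : ∀ a → toℕ (a mod n) ≡ a % n
  toℕ-mod a = Finₚ.toℕ-fromℕ< (DM.m%n<n a n)

  mod-cong : ∀ a b → a % n ≡ b % n → a mod n ≡ b mod n
  mod-cong a b e = Finₚ.toℕ-injective (trans (toℕ-mod a) (trans e (sym (toℕ-mod b))))

  %-+ˡ : ∀ a b → (a % n + b) % n ≡ (a + b) % n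
  %-+ˡ a b = trans (DM.%-distribˡ-+ (a % n) b n) (trans (cong (λ x → (x + b % n) % n) (DM.m%n%n≡m%n a n)) (sym (DM.%-distribˡ-+ a b n)))

  mod-+ : ∀ a b → (toℕ (a mod n) + b) mod n ≡ (a + b) mod n
  mod-+ a b = mod-cong (toℕ (a mod n) + b) (a + b) (trans (cong (λ x → (x + b) % n) (toℕ-mod a)) (%-+ˡ a b))

  mod-toℕ : ∀ (i : Fin n) → toℕ i mod n ≡ i
  mod-toℕ i = Finₚ.toℕ-injective (trans (toℕ-mod (toℕ i)) (DM.m<n⇒m%n≡m (Finₚ.toℕ<n i)))

  mod-n : ∀ a → (a + n) mod n ≡ a mod n
  mod-n a = mod-cong (a + n) a (DM.[m+n]%n≡m%n a n)

  nxt : Fin n → Fin n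
  nxt j = suc (toℕ j) mod n

  nxt-inject₁ : ∀ (i : Fin m) → nxt (inject₁ i) ≡ fsuc i
  nxt-inject₁ i = Finₚ.toℕ-injective (trans (toℕ-mod (suc (toℕ (inject₁ i)))) (trans (cong (λ x → suc x % n) (Finₚ.toℕ-inject₁ i)) (DM.m<n⇒m%n≡m (s≤s (Finₚ.toℕ<n i)))))

  nxt-last : nxt (fromℕ m) ≡ fzero
  nxt-last = Finₚ.toℕ-injective (trans (toℕ-mod (suc (toℕ (fromℕ m)))) (trans (cong (λ x → suc x % n) (Finₚ.toℕ-fromℕ m)) (DM.n%n≡0 n)))

data Last {m} : Fin (suc m) → Set where
  inj : ∀ (i : Fin m) → Last (inject₁ i)
  lst : Last (fromℕ m)

last? : ∀ {m} (i : Fin (suc m)) → Last i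
last? {zero}  fzero    = lst
last? {suc m} fzero    = inj fzero
last? {suc m} (fsuc i) with last? i
... | inj j = inj (fsuc j)
... | lst   = lst

lookup-∷ʳ-inject₁ : ∀ {m} (xs : Vec A m) x i → lookup (xs ∷ʳ x) (inject₁ i) ≡ lookup xs i
lookup-∷ʳ-inject₁ (y ∷ xs) x fzero    = refl
lookup-∷ʳ-inject₁ (y ∷ xs) x (fsuc i) = lookup-∷ʳ-inject₁ xs x i

lookup-∷ʳ-last : ∀ {m} (xs : Vec A m) x → lookup (xs ∷ʳ x) (fromℕ m) ≡ x
lookup-∷ʳ-last []       x = refl
lookup-∷ʳ-last (y ∷ xs) x = lookup-∷ʳ-last xs x

module Rot {m : ℕ} where
  open Mod m

  lookup-rotL : (v : Vec A n) → ∀ i → lookup (rotL v) i ≡ lookup v (nxt i)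
  lookup-rotL (x ∷ xs) i with last? i
  ... | inj j = trans (lookup-∷ʳ-inject₁ xs x j) (cong (lookup (x ∷ xs)) (sym (nxt-inject₁ j)))
  ... | lst   = trans (lookup-∷ʳ-last xs x) (cong (lookup (x ∷ xs)) (sym nxt-last))

  lookup-rotIter : ∀ s (v : Vec A n) i → lookup (rotIter s v) i ≡ lookup v ((toℕ i + s) mod n)
  lookup-rotIter zero    v i = cong (lookup v) (sym (trans (cong (_mod n) (ℕₚ.+-identityʳ (toℕ i))) (mod-toℕ i)))
  lookup-rotIter (suc s) v i = begin
    lookup (rotL (rotIter s v)) i              ≡⟨ lookup-rotL (rotIter s v) i ⟩
    lookup (rotIter s v) (nxt i)               ≡⟨ lookup-rotIter s v (nxt i) ⟩
    lookup v ((toℕ (nxt i) + s) mod n)         ≡⟨ cong (lookup v) (mod-+ (suc (toℕ i)) s) ⟩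
    lookup v ((suc (toℕ i) + s) mod n)         ≡⟨ cong (λ x → lookup v (x mod n)) (sym (ℕₚ.+-suc (toℕ i) s)) ⟩
    lookup v ((toℕ i + suc s) mod n)           ∎

  rotIter-n : (v : Vec A n) → rotIter n v ≡ v
  rotIter-n v = vec-ext _ _ (λ i → trans (lookup-rotIter n v i) (cong (lookup v) (trans (mod-n (toℕ i)) (mod-toℕ i))))

  rotIter-% : ∀ s (v : Vec A n) → rotIter s v ≡ rotIter (s % n) v
  rotIter-% s v = vec-ext _ _ (λ i → trans (lookup-rotIter s v i) (trans (cong (lookup v) (mod-cong (toℕ i + s) (toℕ i + s % n)
    (trans (cong (_% n) (ℕₚ.+-comm (toℕ i) s)) (trans (sym (%-+ˡ s (toℕ i))) (cong (_% n) (ℕₚ.+-comm (s % n) (toℕ i))))))) (sym (lookup-rotIter (s % n) v i))))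

  rotIter-+ : ∀ a b (v : Vec A n) → rotIter (a + b) v ≡ rotIter a (rotIter b v)
  rotIter-+ zero    b v = refl
  rotIter-+ (suc a) b v = cong rotL (rotIter-+ a b v)

  rotIter-rotL : ∀ s (v : Vec A n) → rotIter s (rotL v) ≡ rotL (rotIter s v)
  rotIter-rotL s v = trans (sym (rotIter-+ s 1 v)) (cong (λ x → rotIter x v) (ℕₚ.+-comm s 1))

  rotIter-m-rotL : (v : Vec A n) → rotIter m (rotL v) ≡ v
  rotIter-m-rotL v = trans (rotIter-rotL m v) (rotIter-n v)

  rotL-injective : (v w : Vec A n) → rotL v ≡ rotL w → v ≡ w
  rotL-injective v w e = trans (sym (rotIter-m-rotL v)) (trans (cong (rotIter m) e) (rotIter-m-rotL w))

  -- Adding `f 0` to either side gives the sum of `f 0`, ..., `f n`, because rotation by `n` is the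
  -- identity.
  cyclic-sum : (v : Vec A n) (g : Vec A n → ℤ) → ∑ (upTo n) (λ k → g (rotIter k (rotL v))) ≡ ∑ (upTo n) (λ k → g (rotIter k v))
  cyclic-sum v g = +-cancelˡℤ (f 0) _ _ (begin
    f 0 +ℤ ∑ (upTo n) (λ k → g (rotIter k (rotL v)))   ≡⟨ cong (f 0 +ℤ_) (∑-cong (upTo n) (λ k → cong g (rotIter-rotL k v))) ⟩
    f 0 +ℤ ∑ (upTo n) (f ∘ suc)                        ≡⟨ sym (∑-upTo-first n f) ⟩
    ∑ (upTo (suc n)) f                                 ≡⟨ ∑-upTo-last n f ⟩
    ∑ (upTo n) f +ℤ f n                                ≡⟨ cong (∑ (upTo n) f +ℤ_) (cong g (rotIter-n v)) ⟩
    ∑ (upTo n) f +ℤ f 0                                ≡⟨ ℤₚ.+-comm (∑ (upTo n) f) (f 0) ⟩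
    f 0 +ℤ ∑ (upTo n) f                                ∎)
    where
    f : ℕ → ℤ
    f k = g (rotIter k v)

  cyclic-sum-iter : ∀ s (v : Vec A n) (g : Vec A n → ℤ) → ∑ (upTo n) (λ k → g (rotIter k (rotIter s v))) ≡ ∑ (upTo n) (λ k → g (rotIter k v))
  cyclic-sum-iter zero    v g = refl
  cyclic-sum-iter (suc s) v g = trans (cyclic-sum (rotIter s v) g) (cyclic-sum-iter s v g)

eqVecBool⁻ : ∀ {n} (v w : Vec Bool n) → eqVecBool v w ≡ true → v ≡ w
eqVecBool⁻ []          []          e = refl
eqVecBool⁻ (true ∷ v)  (true ∷ w)  e = cong (true ∷_) (eqVecBool⁻ v w e)
eqVecBool⁻ (false ∷ v) (false ∷ w) e = cong (false ∷_) (eqVecBool⁻ v w e)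

eqVecBool⁺ : ∀ {n} {v w : Vec Bool n} → v ≡ w → eqVecBool v w ≡ true
eqVecBool⁺ {v = v} refl = eqVecBool-refl v

_≟ᵇ_ : ∀ {n} → DecidableEquality (Vec Bool n)
_≟ᵇ_ = Vecₚ.≡-dec Boolₚ._≟_

Once-allSubsets : ∀ {k} (X : Vec Bool k) → Once _≟ᵇ_ (allSubsets k) X
Once-allSubsets X = Once-allVecs Boolₚ._≟_ bools _≟ᵇ_ X (λ i → Once-bools (lookup X i))

∑-δ : ∀ {k} (X : Vec Bool k) (f : Vec Bool k → ℤ) → ∑ (allSubsets k) (λ Y → ⟦ eqVecBool X Y ⟧ *ℤ f Y) ≡ f X
∑-δ {k} X f = trans (∑-cong (allSubsets k) (λ Y → cong (λ b → ⟦ b ⟧ *ℤ f Y) (bool-iff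
    (λ e → dec-true (Y ≟ᵇ X) (sym (eqVecBool⁻ X Y e))) (λ e → eqVecBool⁺ (sym (does-true (Y ≟ᵇ X) e))))))
  (Once-allSubsets X f)

-- strictness at the elements of X other than n
FF̂ : ∀ {m} → Vec Bool (suc m) → Word (suc m) → Bool
FF̂ X = FFᵇ (λ i → lookup X (inject₁ i))

module Orbits {m : ℕ} where
  open Mod m
  open Rot {m}

  inOrbit⁺ : ∀ (X Y : Vec Bool n) → InOrbit X Y → inOrbitᵇ X Y ≡ true
  inOrbit⁺ X Y (s , e) = anyᵇ⁺ (λ s → eqVecBool (rotIter s X) Y) (upTo n) (∈ₚ.∈-upTo⁺ (DM.m%n<n s n)) (eqVecBool⁺ (trans (sym (rotIter-% s X)) e))

  inOrbit⁻ : ∀ (X Y : Vec Bool n) → inOrbitᵇ X Y ≡ true → InOrbit X Y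
  inOrbit⁻ X Y e with anyᵇ⁻ (λ s → eqVecBool (rotIter s X) Y) (upTo n) e
  ... | s , _ , eq = s , eqVecBool⁻ _ _ eq

  orbit-sym : ∀ {X Y : Vec Bool n} → InOrbit X Y → InOrbit Y X
  orbit-sym {X} {Y} (s , e) = n ∸ s % n , (begin
    rotIter (n ∸ s % n) Y                        ≡⟨ cong (rotIter (n ∸ s % n)) (trans (sym e) (rotIter-% s X)) ⟩
    rotIter (n ∸ s % n) (rotIter (s % n) X)      ≡⟨ sym (rotIter-+ (n ∸ s % n) (s % n) X) ⟩
    rotIter (n ∸ s % n + s % n) X                ≡⟨ cong (λ k → rotIter k X) (ℕₚ.m∸n+n≡m (ℕₚ.<⇒≤ (DM.m%n<n s n))) ⟩
    rotIter n X                                  ≡⟨ rotIter-n X ⟩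
    X                                            ∎)

  orbit-trans : ∀ {X Y Z : Vec Bool n} → InOrbit X Y → InOrbit Y Z → InOrbit X Z
  orbit-trans {X} (s , refl) (s' , refl) = s' + s , rotIter-+ s' s X

  inOrbit-cong : ∀ {X Y : Vec Bool n} → InOrbit X Y → ∀ Z → inOrbitᵇ X Z ≡ inOrbitᵇ Y Z
  inOrbit-cong {X} {Y} o Z = bool-iff
    (λ e → inOrbit⁺ Y Z (orbit-trans (orbit-sym o) (inOrbit⁻ X Z e)))
    (λ e → inOrbit⁺ X Z (orbit-trans o (inOrbit⁻ Y Z e)))

  inOrbit-congʳ : ∀ {X Y : Vec Bool n} → InOrbit X Y → ∀ Z → inOrbitᵇ Z X ≡ inOrbitᵇ Z Y
  inOrbit-congʳ {X} {Y} o Z = bool-iff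
    (λ e → inOrbit⁺ Z Y (orbit-trans (inOrbit⁻ Z X e) o))
    (λ e → inOrbit⁺ Z X (orbit-trans (inOrbit⁻ Z Y e) (orbit-sym o)))

  d≡∑ : ∀ (J : Vec Bool n) → + d J ≡ ∑ (upTo n) (λ k → ⟦ eqVecBool (rotIter k J) J ⟧)
  d≡∑ J = count≡∑ (λ s → eqVecBool (rotIter s J) J) (upTo n)

  eq-rotL : ∀ (X Y : Vec Bool n) → eqVecBool (rotL X) (rotL Y) ≡ eqVecBool X Y
  eq-rotL X Y = bool-iff (λ e → eqVecBool⁺ (rotL-injective X Y (eqVecBool⁻ _ _ e))) (λ e → eqVecBool⁺ (cong rotL (eqVecBool⁻ X Y e)))

  visits : Vec Bool n → Vec Bool n → ℤ
  visits J X = ∑ (upTo n) (λ k → ⟦ eqVecBool (rotIter k J) X ⟧)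

  visits-rotL : ∀ J X → visits J (rotL X) ≡ visits J X
  visits-rotL J X = trans (sym (cyclic-sum J (λ Y → ⟦ eqVecBool Y (rotL X) ⟧)))
    (∑-cong (upTo n) (λ k → cong ⟦_⟧ (trans (cong (λ Y → eqVecBool Y (rotL X)) (rotIter-rotL k J)) (eq-rotL (rotIter k J) X))))

  visits-iter : ∀ J s → visits J (rotIter s J) ≡ + d J
  visits-iter J zero    = sym (d≡∑ J)
  visits-iter J (suc s) = trans (visits-rotL J (rotIter s J)) (visits-iter J s)

  -- Orbit and stabiliser: the number of visits is constant along the orbit by `visits-rotL`, and at
  -- `J` itself it is the order of the stabiliser.
  visits≡ : ∀ J X → visits J X ≡ ⟦ inOrbitᵇ J X ⟧ *ℤ + d J
  visits≡ J X with inOrbitᵇ J X in e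
  ... | true  = let (s , r) = inOrbit⁻ J X e in trans (cong (visits J) (sym r)) (trans (visits-iter J s) (sym (ℤₚ.*-identityˡ _)))
  ... | false = ∑-zero (upTo n) (λ {k} _ → cong ⟦_⟧ (≡false (λ e' → false≢true (trans (sym e) (inOrbit⁺ J X (k , eqVecBool⁻ _ _ e'))))))

  d-orbit : ∀ {X Y : Vec Bool n} → InOrbit X Y → d X ≡ d Y
  d-orbit {X} (s , refl) = ℤₚ.+-injective (sym (begin
    + d (rotIter s X)                                                                 ≡⟨ d≡∑ (rotIter s X) ⟩
    ∑ (upTo n) (λ k → ⟦ eqVecBool (rotIter k (rotIter s X)) (rotIter s X) ⟧)           ≡⟨ cyclic-sum-iter s X (λ Y → ⟦ eqVecBool Y (rotIter s X) ⟧) ⟩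
    visits X (rotIter s X)                                                            ≡⟨ visits-iter X s ⟩
    + d X                                                                             ∎))

  orbit-sum : ∀ (J : Vec Bool n) (g : Vec Bool n → ℤ) →
    ∑ (upTo n) (λ k → g (rotIter k J)) ≡ + d J *ℤ ∑ (allSubsets n) (λ X → ⟦ inOrbitᵇ J X ⟧ *ℤ g X)
  orbit-sum J g = begin
    ∑ (upTo n) (λ k → g (rotIter k J))
      ≡⟨ ∑-cong (upTo n) (λ k → sym (∑-δ (rotIter k J) g)) ⟩
    ∑ (upTo n) (λ k → ∑ (allSubsets n) (λ X → ⟦ eqVecBool (rotIter k J) X ⟧ *ℤ g X))
      ≡⟨ ∑-swap (upTo n) (allSubsets n) _ ⟩
    ∑ (allSubsets n) (λ X → ∑ (upTo n) (λ k → ⟦ eqVecBool (rotIter k J) X ⟧ *ℤ g X))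
      ≡⟨ ∑-cong (allSubsets n) (λ X → trans (sym (∑-*ʳ (upTo n) (λ k → ⟦ eqVecBool (rotIter k J) X ⟧) (g X)))
           (trans (cong (_*ℤ g X) (visits≡ J X)) (arr ⟦ inOrbitᵇ J X ⟧ (+ d J) (g X)))) ⟩
    ∑ (allSubsets n) (λ X → + d J *ℤ (⟦ inOrbitᵇ J X ⟧ *ℤ g X))
      ≡⟨ sym (∑-*ˡ (allSubsets n) (+ d J) _) ⟩
    + d J *ℤ ∑ (allSubsets n) (λ X → ⟦ inOrbitᵇ J X ⟧ *ℤ g X) ∎
    where
    arr : ∀ a b c → (a *ℤ b) *ℤ c ≡ b *ℤ (a *ℤ c)
    arr = solve-∀ℤ

  -- For fixed `k`, reading the word from position `k` on gives `u`, and `J` is rotated accordingly.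
  -- The exempt index k - 1 becomes the last position, the one that `FF̂` disregards.
  Fcyc≡∑ : ∀ (J : Vec Bool n) u → + FcycCount J u ≡ ∑ (upTo n) (λ k → ⟦ FF̂ (rotIter k J) u ⟧)
  Fcyc≡∑ J u = begin
    + FcycCount J u
      ≡⟨ count≡∑ ok (allFin n) ⟩
    ∑ (allFin n) (λ k → ⟦ ok k ⟧)
      ≡⟨ ∑-cong (allFin n) (λ k → cong ⟦_⟧ (bool-iff (ok⇒ k) (⇒ok k))) ⟩
    ∑ (allFin n) (λ k → ⟦ FF̂ (rotIter (toℕ k) J) u ⟧)
      ≡⟨ ∑-allFin n (λ k → ⟦ FF̂ (rotIter k J) u ⟧) ⟩
    ∑ (upTo n) (λ k → ⟦ FF̂ (rotIter k J) u ⟧) ∎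
    where
    w : Fin n → Fin n → ℕ
    w k j = u ((toℕ j + (n ∸ toℕ k)) mod n)
    cond : Fin n → Fin n → Bool
    cond k j = not (lookup J j) ∨ ((toℕ (nxt j) ≡ᵇ toℕ k) ∨ (w k j <ᵇ w k (nxt j)))
    ok : Fin n → Bool
    ok k = allᵇ (cond k) (allFin n)
    back : ∀ (k : Fin n) a → (toℕ ((a + toℕ k) mod n) + (n ∸ toℕ k)) mod n ≡ a mod n
    back k a = trans (mod-+ (a + toℕ k) (n ∸ toℕ k)) (trans (cong (_mod n) (trans (ℕₚ.+-assoc a (toℕ k) _)
      (cong (ℕ._+_ a) (ℕₚ.m+[n∸m]≡n (ℕₚ.<⇒≤ (Finₚ.toℕ<n k)))))) (mod-n a))
    forth : ∀ (k : Fin n) a → (toℕ ((a + (n ∸ toℕ k)) mod n) + toℕ k) mod n ≡ a mod n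
    forth k a = trans (mod-+ (a + (n ∸ toℕ k)) (toℕ k)) (trans (cong (_mod n) (trans (ℕₚ.+-assoc a (n ∸ toℕ k) _)
      (cong (ℕ._+_ a) (ℕₚ.m∸n+n≡m (ℕₚ.<⇒≤ (Finₚ.toℕ<n k)))))) (mod-n a))
    nxt-mod : ∀ a → nxt (a mod n) ≡ suc a mod n
    nxt-mod a = trans (cong (_mod n) (ℕₚ.+-comm 1 (toℕ (a mod n)))) (trans (mod-+ a 1) (cong (_mod n) (ℕₚ.+-comm a 1)))
    ok⇒ : ∀ k → ok k ≡ true → FF̂ (rotIter (toℕ k) J) u ≡ true
    ok⇒ k e = FF⁺ (λ i → lookup (rotIter (toℕ k) J) (inject₁ i)) u (λ i Ji → let
        j = (toℕ (inject₁ i) + toℕ k) mod n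
        wj : w k j ≡ u (inject₁ i)
        wj = cong u (trans (back k (toℕ (inject₁ i))) (mod-toℕ (inject₁ i)))
        pos : (toℕ (nxt j) + (n ∸ toℕ k)) mod n ≡ fsuc i
        pos = trans (cong (λ z → (toℕ z + (n ∸ toℕ k)) mod n) (nxt-mod (toℕ (inject₁ i) + toℕ k)))
                (trans (back k (suc (toℕ (inject₁ i)))) (nxt-inject₁ i))
      in case ∨⁻ {toℕ (nxt j) ≡ᵇ toℕ k} (⇒ᵇ⁻ {lookup J j} (allFinᵇ⁻ (cond k) e j) (trans (sym (lookup-rotIter (toℕ k) J (inject₁ i))) Ji)) of λ where
        (inj₂ lt) → subst₂ _<_ wj (cong u pos) (<ᵇ⁻ {w k j} lt)
        (inj₁ eq) → ⊥-elim (λ0≢ (trans (sym (trans (cong (λ z → (z + (n ∸ toℕ k)) mod n) (≡ᵇ⁻ {toℕ (nxt j)} eq))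
                      (trans (cong (_mod n) (ℕₚ.m+[n∸m]≡n (ℕₚ.<⇒≤ (Finₚ.toℕ<n k)))) (mod-n 0)))) pos)))
      where
      λ0≢ : ∀ {i : Fin m} → 0 mod n ≡ fsuc i → ⊥
      λ0≢ {i} ()
    ⇒ok : ∀ k → FF̂ (rotIter (toℕ k) J) u ≡ true → ok k ≡ true
    ⇒ok k e = allFinᵇ⁺ (cond k) (λ j → ⇒ᵇ⁺ {lookup J j} (λ Jj → split j Jj (last? ((toℕ j + (n ∸ toℕ k)) mod n)) refl))
      where
      split : ∀ j → lookup J j ≡ true → ∀ {i'} → Last i' → (toℕ j + (n ∸ toℕ k)) mod n ≡ i' →
        (toℕ (nxt j) ≡ᵇ toℕ k) ∨ (w k j <ᵇ w k (nxt j)) ≡ true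
      split j Jj {i'} L eq = fin L eq
        where
        pos : (toℕ (nxt j) + (n ∸ toℕ k)) mod n ≡ nxt i'
        pos = trans (mod-+ (suc (toℕ j)) (n ∸ toℕ k)) (trans (sym (nxt-mod (toℕ j + (n ∸ toℕ k)))) (cong nxt eq))
        j≡ : (toℕ i' + toℕ k) mod n ≡ j
        j≡ = trans (cong (λ z → (toℕ z + toℕ k) mod n) (sym eq)) (trans (forth k (toℕ j)) (mod-toℕ j))
        fin : Last i' → (toℕ j + (n ∸ toℕ k)) mod n ≡ i' → (toℕ (nxt j) ≡ᵇ toℕ k) ∨ (w k j <ᵇ w k (nxt j)) ≡ true
        fin (inj i) eq' = ∨⁺₂ {toℕ (nxt j) ≡ᵇ toℕ k} (<ᵇ⁺ (subst₂ _<_ (cong u (sym eq')) (cong u (sym (trans pos (nxt-inject₁ i))))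
          (FF⁻ (λ i → lookup (rotIter (toℕ k) J) (inject₁ i)) u e i (trans (lookup-rotIter (toℕ k) J (inject₁ i)) (trans (cong (lookup J) j≡) Jj)))))
        -- The last position of `u` belongs to the index whose cyclic successor is `k`; there the
        -- exemption applies.
        fin lst eq' = cong (_∨ (w k j <ᵇ w k (nxt j))) (≡ᵇ⁺ (cong toℕ (begin
          nxt j                                               ≡⟨ cong nxt (sym j≡) ⟩
          nxt ((toℕ (fromℕ m) + toℕ k) mod n)                 ≡⟨ nxt-mod (toℕ (fromℕ m) + toℕ k) ⟩
          (suc (toℕ (fromℕ m)) + toℕ k) mod n                 ≡⟨ cong (λ x → (suc x + toℕ k) mod n) (Finₚ.toℕ-fromℕ m) ⟩
          (n + toℕ k) mod n                                   ≡⟨ cong (_mod n) (ℕₚ.+-comm n (toℕ k)) ⟩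
          (toℕ k + n) mod n                                   ≡⟨ trans (mod-n (toℕ k)) (mod-toℕ k) ⟩
          k                                                   ∎)))

  hat : Vec Bool n → Word n → ℕ
  hat J u = count (λ X → inOrbitᵇ J X ∧ FF̂ X u) (allSubsets n)

  hat≡∑ : ∀ J u → + hat J u ≡ ∑ (allSubsets n) (λ X → ⟦ inOrbitᵇ J X ⟧ *ℤ ⟦ FF̂ X u ⟧)
  hat≡∑ J u = trans (count≡∑ (λ X → inOrbitᵇ J X ∧ FF̂ X u) (allSubsets n)) (∑-cong (allSubsets n) (λ X → ⟦∧⟧ (inOrbitᵇ J X) (FF̂ X u)))

  -- Each set in the orbit of `J` occurs among the `n` rotations exactly `d J` times; hence the
  -- division in `hatFcyc` is exact.
  FcycCount≡ : ∀ J u → FcycCount J u ≡ hat J u * d J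
  FcycCount≡ J u = ℤₚ.+-injective (begin
    + FcycCount J u                                       ≡⟨ Fcyc≡∑ J u ⟩
    ∑ (upTo n) (λ k → ⟦ FF̂ (rotIter k J) u ⟧)             ≡⟨ orbit-sum J (λ X → ⟦ FF̂ X u ⟧) ⟩
    + d J *ℤ ∑ (allSubsets n) (λ X → ⟦ inOrbitᵇ J X ⟧ *ℤ ⟦ FF̂ X u ⟧) ≡⟨ cong (+ d J *ℤ_) (sym (hat≡∑ J u)) ⟩
    + d J *ℤ + hat J u                                    ≡⟨ ℤₚ.*-comm (+ d J) (+ hat J u) ⟩
    + hat J u *ℤ + d J                                    ≡⟨ sym (ℤₚ.pos-* (hat J u) (d J)) ⟩
    + (hat J u * d J)                                     ∎)

  hatFcyc≡ : ∀ J u → hatFcyc J u ≡ + hat J u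
  hatFcyc≡ J u = cong +_ (trans (cong (λ x → ℕ._/_ x (d J) {{d-nonZero J}}) (FcycCount≡ J u)) (DM.m*n/n≡m (hat J u) (d J) {{d-nonZero J}}))

  Fcyc≡hat : ∀ J u → Fcyc J u ≡ + d J *ℤ hatFcyc J u
  Fcyc≡hat J u = trans (cong +_ (FcycCount≡ J u)) (trans (ℤₚ.pos-* (hat J u) (d J)) (trans (ℤₚ.*-comm (+ hat J u) (+ d J)) (cong (+ d J *ℤ_) (sym (hatFcyc≡ J u)))))

  hat-orbit : ∀ {X Y} → InOrbit X Y → ∀ u → hatFcyc X u ≡ hatFcyc Y u
  hat-orbit {X} {Y} o u = trans (hatFcyc≡ X u) (trans (cong +_ (count-cong _ _ (allSubsets n) (λ Z → cong (_∧ FF̂ Z u) (inOrbit-cong o Z)))) (sym (hatFcyc≡ Y u)))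

  hat-fixed : ∀ J → (∀ s → rotIter s J ≡ J) → ∀ u → hatFcyc J u ≡ ⟦ FF̂ J u ⟧
  hat-fixed J fix u = trans (hatFcyc≡ J u) (trans (hat≡∑ J u) (trans (∑-cong (allSubsets n) (λ X → cong (λ b → ⟦ b ⟧ *ℤ ⟦ FF̂ X u ⟧) (bool-iff
    (λ e → let (s , r) = inOrbit⁻ J X e in eqVecBool⁺ (trans (sym (fix s)) r)) (λ e → inOrbit⁺ J X (0 , eqVecBool⁻ J X e))))) (∑-δ J (λ X → ⟦ FF̂ X u ⟧))))

rotIter-replicate : ∀ {m} (b : Bool) s → rotIter s (replicate (suc m) b) ≡ replicate (suc m) b
rotIter-replicate {m} b s = vec-ext _ _ (λ i → trans (Rot.lookup-rotIter s (replicate (suc m) b) i)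
  (trans (Vecₚ.lookup-replicate ((toℕ i + s) mod suc m) b) (sym (Vecₚ.lookup-replicate i b))))

hatFcyc-∅ : ∀ m → hatFcyc (replicate (suc m) false) ≈ h (suc m)
hatFcyc-∅ m u _ = trans (Orbits.hat-fixed (replicate (suc m) false) (rotIter-replicate false) u)
  (cong ⟦_⟧ (FF⁺ _ u (λ i e → ⊥-elim (false≢true (trans (sym (Vecₚ.lookup-replicate (inject₁ i) false)) e)))))

hatFcyc-full : ∀ m → hatFcyc (replicate (suc m) true) ≈ e (suc m)
hatFcyc-full m u _ = trans (Orbits.hat-fixed (replicate (suc m) true) (rotIter-replicate true) u)
  (cong ⟦_⟧ (allᵇ-cong-∈ _ _ (allFin m) (λ {i} _ → cong (λ b → not b ∨ (u (inject₁ i) <ᵇ u (fsuc i))) (Vecₚ.lookup-replicate (inject₁ i) true))))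

-- Cyclic descents and orbit representatives

module CyclicDescents {m : ℕ} where
  open Mod m
  open Rot {m}
  open Orbits {m}

  lookup-cDes : ∀ (σ : Vec (Fin n) n) i → lookup (cDes σ) i ≡ (toℕ (lookup σ (nxt i)) <ᵇ toℕ (lookup σ i))
  lookup-cDes σ i = trans (Vecₚ.lookup-zipWith (λ a b → b <ᵇ a) i (Vec.map toℕ σ) (Vec.map toℕ (rotL σ)))
    (cong₂ (λ a b → b <ᵇ a) (Vecₚ.lookup-map i toℕ σ) (trans (Vecₚ.lookup-map i toℕ (rotL σ)) (cong toℕ (lookup-rotL σ i))))

  cDes-rotL : ∀ (σ : Vec (Fin n) n) → cDes (rotL σ) ≡ rotL (cDes σ)
  cDes-rotL σ = vec-ext _ _ (λ i → begin
    lookup (cDes (rotL σ)) i                                          ≡⟨ lookup-cDes (rotL σ) i ⟩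
    (toℕ (lookup (rotL σ) (nxt i)) <ᵇ toℕ (lookup (rotL σ) i))        ≡⟨ cong₂ (λ a b → toℕ a <ᵇ toℕ b) (lookup-rotL σ (nxt i)) (lookup-rotL σ i) ⟩
    (toℕ (lookup σ (nxt (nxt i))) <ᵇ toℕ (lookup σ (nxt i)))          ≡⟨ sym (lookup-cDes σ (nxt i)) ⟩
    lookup (cDes σ) (nxt i)                                           ≡⟨ sym (lookup-rotL (cDes σ) i) ⟩
    lookup (rotL (cDes σ)) i                                          ∎)

  cDes-rotIter : ∀ k (σ : Vec (Fin n) n) → cDes (rotIter k σ) ≡ rotIter k (cDes σ)
  cDes-rotIter zero    σ = refl
  cDes-rotIter (suc k) σ = trans (cDes-rotL (rotIter k σ)) (cong rotL (cDes-rotIter k σ))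

  FF̂-cDes : ∀ (σ : Vec (Fin n) n) u → ⟦ FF̂ (cDes σ) u ⟧ ≡ F (Des σ) u
  FF̂-cDes σ u = trans (cong ⟦_⟧ (allᵇ-cong-∈ _ _ (allFin m) (λ {i} _ → cong (λ b → not b ∨ (u (inject₁ i) <ᵇ u (fsuc i)))
    (trans (lookup-cDes σ (inject₁ i)) (cong (λ k → toℕ (lookup σ k) <ᵇ toℕ (lookup σ (inject₁ i))) (nxt-inject₁ i)))))) (sym (F-Des σ u))

  Fcyc-cDes : ∀ (σ : Vec (Fin n) n) u → Fcyc (cDes σ) u ≡ ∑ (upTo n) (λ k → F (Des (rotIter k σ)) u)
  Fcyc-cDes σ u = trans (Fcyc≡∑ (cDes σ) u) (∑-cong (upTo n) (λ k →
    trans (cong (λ X → ⟦ FF̂ X u ⟧) (sym (cDes-rotIter k σ))) (FF̂-cDes (rotIter k σ) u)))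

  rotIter-perm : ∀ k (σ : Vec (Fin n) n) → IsPerm σ → IsPerm (rotIter k σ)
  rotIter-perm k σ p i j e = begin
    i                                                      ≡⟨ sym (undo i) ⟩
    (toℕ ((toℕ i + k) mod n) + (n ∸ k % n)) mod n           ≡⟨ cong (λ z → (toℕ z + (n ∸ k % n)) mod n)
                                                               (p _ _ (trans (sym (lookup-rotIter k σ i)) (trans e (lookup-rotIter k σ j)))) ⟩
    (toℕ ((toℕ j + k) mod n) + (n ∸ k % n)) mod n           ≡⟨ undo j ⟩
    j                                                      ∎
    where
    undo : ∀ i → (toℕ ((toℕ i + k) mod n) + (n ∸ k % n)) mod n ≡ i
    undo i = begin
      (toℕ ((toℕ i + k) mod n) + (n ∸ k % n)) mod n         ≡⟨ mod-+ (toℕ i + k) (n ∸ k % n) ⟩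
      ((toℕ i + k) + (n ∸ k % n)) mod n                     ≡⟨ mod-cong ((toℕ i + k) + (n ∸ k % n)) (k % n + (toℕ i + (n ∸ k % n)))
                                                                 (trans (cong (_% n) (arr (toℕ i) k (n ∸ k % n))) (sym (%-+ˡ k (toℕ i + (n ∸ k % n))))) ⟩
      (k % n + (toℕ i + (n ∸ k % n))) mod n                 ≡⟨ cong (_mod n) (arr' (k % n) (toℕ i) (n ∸ k % n)) ⟩
      (toℕ i + (k % n + (n ∸ k % n))) mod n                 ≡⟨ cong (λ z → (toℕ i + z) mod n) (ℕₚ.m+[n∸m]≡n (ℕₚ.<⇒≤ (DM.m%n<n k n))) ⟩
      (toℕ i + n) mod n                                     ≡⟨ trans (mod-n (toℕ i)) (mod-toℕ i) ⟩
      i                                                     ∎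
      where
      arr : ∀ a b c → (a + b) + c ≡ b + (a + c)
      arr = solve-∀
      arr' : ∀ a b c → a + (b + c) ≡ b + (a + c)
      arr' = solve-∀

  ∑-perms-rotL : (G : Vec (Fin n) n → ℤ) → ∑ (perms n) (λ σ → G (rotL σ)) ≡ ∑ (perms n) G
  ∑-perms-rotL G = trans (∑-filter isPermᵇ (allVecsOf (allFin n) n) (G ∘ rotL)) (trans
    (∑-bij _≟ₚ_ _≟ₚ_ (allVecsOf (allFin n) n) (allVecsOf (allFin n) n) isPermᵇ isPermᵇ rotL (rotIter m)
      (λ {σ} _ e → isPerm⁺ (rotL σ) (rotIter-perm 1 σ (isPerm⁻ σ e)) , rotIter-m-rotL σ , Once-allPerms (rotL σ))
      (λ {σ} _ e → isPerm⁺ (rotIter m σ) (rotIter-perm m σ (isPerm⁻ σ e)) , rotIter-n σ , Once-allPerms (rotIter m σ)) G)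
    (sym (∑-filter isPermᵇ (allVecsOf (allFin n) n) G)))

  ∑-perms-rotIter : ∀ k (G : Vec (Fin n) n → ℤ) → ∑ (perms n) (λ σ → G (rotIter k σ)) ≡ ∑ (perms n) G
  ∑-perms-rotIter zero    G = refl
  ∑-perms-rotIter (suc k) G = trans (∑-perms-rotIter k (G ∘ rotL)) (∑-perms-rotL G)

  compose-rotIter : ∀ k (σ₂ σ₁ : Vec (Fin n) n) → compose σ₂ (rotIter k σ₁) ≡ rotIter k (compose σ₂ σ₁)
  compose-rotIter k σ₂ σ₁ = vec-ext _ _ (λ i → begin
    lookup (compose σ₂ (rotIter k σ₁)) i                ≡⟨ lookup-compose σ₂ (rotIter k σ₁) i ⟩
    lookup σ₂ (lookup (rotIter k σ₁) i)                 ≡⟨ cong (lookup σ₂) (lookup-rotIter k σ₁ i) ⟩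
    lookup σ₂ (lookup σ₁ ((toℕ i + k) mod n))           ≡⟨ sym (lookup-compose σ₂ σ₁ ((toℕ i + k) mod n)) ⟩
    lookup (compose σ₂ σ₁) ((toℕ i + k) mod n)          ≡⟨ sym (lookup-rotIter k (compose σ₂ σ₁) i) ⟩
    lookup (rotIter k (compose σ₂ σ₁)) i                ∎)

  rotIter-injective : ∀ k (v w : Vec (Fin n) n) → rotIter k v ≡ rotIter k w → v ≡ w
  rotIter-injective zero    v w e = e
  rotIter-injective (suc k) v w e = rotIter-injective k v w (rotL-injective (rotIter k v) (rotIter k w) e)

  eq-rotIter : ∀ k (v w : Vec (Fin n) n) → eqVecFin (rotIter k v) (rotIter k w) ≡ eqVecFin v w
  eq-rotIter k v w = bool-iff (λ e → eqVecFin⁺ (rotIter-injective k v w (eqVecFin⁻ (rotIter k v) (rotIter k w) e)))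
    (λ e → eqVecFin⁺ (cong (rotIter k) (eqVecFin⁻ v w e)))

  -- Rotating π and σ₁ simultaneously preserves σ₂ σ₁ = π.
  Δ-Fcyc : ∀ (π : Vec (Fin n) n) → IsPerm π → ∀ u v → Monotone u → Monotone v →
    Δ (Fcyc (cDes π)) u v ≡
    ∑ (perms n) (λ σ₁ → ∑ (perms n) (λ σ₂ → ⟦ eqVecFin (compose σ₂ σ₁) π ⟧ *ℤ (Fcyc (cDes σ₁) u *ℤ F (Des σ₂) v)))
  Δ-Fcyc π pπ u v mu mv = begin
    Δ (Fcyc (cDes π)) u v
      ≡⟨ Δ-cong {f = Fcyc (cDes π)} {g = λ w → ∑ (upTo n) (λ k → + 1 *ℤ F (Des (rotIter k π)) w)} (λ w _ → trans (Fcyc-cDes π w)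
           (∑-cong (upTo n) (λ k → sym (ℤₚ.*-identityˡ (F (Des (rotIter k π)) w))))) u v ⟩
    Δ (λ w → ∑ (upTo n) (λ k → + 1 *ℤ F (Des (rotIter k π)) w)) u v
      ≡⟨ Δ-∑ (upTo n) (λ _ → + 1) (λ k → F (Des (rotIter k π))) u v ⟩
    ∑ (upTo n) (λ k → + 1 *ℤ Δ (F (Des (rotIter k π))) u v)
      ≡⟨ ∑-cong (upTo n) (λ k → trans (ℤₚ.*-identityˡ _) (trans (Δ-F-Des (rotIter k π) (rotIter-perm k π pπ) u v mu mv) (shift k))) ⟩
    ∑ (upTo n) (λ k → ∑ (perms n) (λ σ₁ → ∑ (perms n) (λ σ₂ → ⟦ eqVecFin (compose σ₂ σ₁) π ⟧ *ℤ (F (Des (rotIter k σ₁)) u *ℤ F (Des σ₂) v))))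
      ≡⟨ ∑-swap (upTo n) (perms n) _ ⟩
    ∑ (perms n) (λ σ₁ → ∑ (upTo n) (λ k → ∑ (perms n) (λ σ₂ → ⟦ eqVecFin (compose σ₂ σ₁) π ⟧ *ℤ (F (Des (rotIter k σ₁)) u *ℤ F (Des σ₂) v))))
      ≡⟨ ∑-cong (perms n) (λ σ₁ → trans (∑-swap (upTo n) (perms n) _) (∑-cong (perms n) (λ σ₂ → begin
        ∑ (upTo n) (λ k → ⟦ eqVecFin (compose σ₂ σ₁) π ⟧ *ℤ (F (Des (rotIter k σ₁)) u *ℤ F (Des σ₂) v))
          ≡⟨ sym (∑-*ˡ (upTo n) ⟦ eqVecFin (compose σ₂ σ₁) π ⟧ (λ k → F (Des (rotIter k σ₁)) u *ℤ F (Des σ₂) v)) ⟩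
        ⟦ eqVecFin (compose σ₂ σ₁) π ⟧ *ℤ ∑ (upTo n) (λ k → F (Des (rotIter k σ₁)) u *ℤ F (Des σ₂) v)
          ≡⟨ cong (⟦ eqVecFin (compose σ₂ σ₁) π ⟧ *ℤ_) (trans (sym (∑-*ʳ (upTo n) (λ k → F (Des (rotIter k σ₁)) u) (F (Des σ₂) v)))
               (cong (_*ℤ F (Des σ₂) v) (sym (Fcyc-cDes σ₁ u)))) ⟩
        ⟦ eqVecFin (compose σ₂ σ₁) π ⟧ *ℤ (Fcyc (cDes σ₁) u *ℤ F (Des σ₂) v) ∎))) ⟩
    ∑ (perms n) (λ σ₁ → ∑ (perms n) (λ σ₂ → ⟦ eqVecFin (compose σ₂ σ₁) π ⟧ *ℤ (Fcyc (cDes σ₁) u *ℤ F (Des σ₂) v))) ∎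
    where
    shift : ∀ k → ∑ (perms n) (λ σ₁ → ∑ (perms n) (λ σ₂ → ⟦ eqVecFin (compose σ₂ σ₁) (rotIter k π) ⟧ *ℤ (F (Des σ₁) u *ℤ F (Des σ₂) v))) ≡
      ∑ (perms n) (λ σ₁ → ∑ (perms n) (λ σ₂ → ⟦ eqVecFin (compose σ₂ σ₁) π ⟧ *ℤ (F (Des (rotIter k σ₁)) u *ℤ F (Des σ₂) v)))
    shift k = trans
      (sym (∑-perms-rotIter k (λ σ₁ → ∑ (perms n) (λ σ₂ → ⟦ eqVecFin (compose σ₂ σ₁) (rotIter k π) ⟧ *ℤ (F (Des σ₁) u *ℤ F (Des σ₂) v)))))
      (∑-cong (perms n) (λ σ₁ → ∑-cong (perms n) (λ σ₂ → cong (λ b → ⟦ b ⟧ *ℤ (F (Des (rotIter k σ₁)) u *ℤ F (Des σ₂) v))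
        (trans (cong (λ z → eqVecFin z (rotIter k π)) (compose-rotIter k σ₂ σ₁)) (eq-rotIter k (compose σ₂ σ₁) π)))))

nonempty⁺ : ∀ {k} (X : Vec Bool k) i → lookup X i ≡ true → nonemptyᵇ X ≡ true
nonempty⁺ (x ∷ X) fzero    refl = refl
nonempty⁺ (x ∷ X) (fsuc i) e    = ∨⁺₂ {x} (nonempty⁺ X i e)

nonempty⁻ : ∀ {k} (X : Vec Bool k) → nonemptyᵇ X ≡ true → Σ (Fin k) λ i → lookup X i ≡ true
nonempty⁻ (true ∷ X)  e = fzero , refl
nonempty⁻ (false ∷ X) e = let (i , p) = nonempty⁻ X e in fsuc i , p

proper⁺ : ∀ {k} (X : Vec Bool k) i → lookup X i ≡ false → properᵇ X ≡ true
proper⁺ (x ∷ X) fzero    refl = refl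
proper⁺ (false ∷ X) (fsuc i) e = refl
proper⁺ (true ∷ X)  (fsuc i) e = proper⁺ X i e

proper⁻ : ∀ {k} (X : Vec Bool k) → properᵇ X ≡ true → Σ (Fin k) λ i → lookup X i ≡ false
proper⁻ (false ∷ X) e = fzero , refl
proper⁻ (true ∷ X)  e = let (i , p) = proper⁻ X e in fsuc i , p

code-injective : ∀ {k} (X Y : Vec Bool k) → code X ≡ code Y → X ≡ Y
code-injective []          []          e = refl
code-injective (true ∷ X)  (true ∷ Y)  e = cong (true ∷_) (code-injective X Y (ℕₚ.*-cancelˡ-≡ (code X) (code Y) 2 (ℕₚ.suc-injective e)))
code-injective (false ∷ X) (false ∷ Y) e = cong (false ∷_) (code-injective X Y (ℕₚ.*-cancelˡ-≡ (code X) (code Y) 2 e))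
code-injective (true ∷ X)  (false ∷ Y) e = ⊥-elim (ℕₚ.even≢odd (code Y) (code X) (sym e))
code-injective (false ∷ X) (true ∷ Y)  e = ⊥-elim (ℕₚ.even≢odd (code X) (code Y) e)

argmin : (f : ℕ → ℕ) (k : ℕ) → Σ ℕ λ s → s < suc k × (∀ s' → s' < suc k → f s ≤ f s')
argmin f zero = 0 , s≤s z≤n , λ { zero _ → ℕₚ.≤-refl ; (suc _) (s≤s ()) }
argmin f (suc k) with argmin f k
... | s , s< , min with ℕₚ.≤-total (f s) (f (suc k))
...   | inj₁ le = s , ℕₚ.m<n⇒m<1+n s< , λ s' s'< → case ℕₚ.m≤n⇒m<n∨m≡n (ℕₚ.≤-pred s'<) of λ where
          (inj₁ lt)   → min s' lt
          (inj₂ refl) → le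
...   | inj₂ ge = suc k , ℕₚ.n<1+n (suc k) , λ s' s'< → case ℕₚ.m≤n⇒m<n∨m≡n (ℕₚ.≤-pred s'<) of λ where
          (inj₁ lt)   → ℕₚ.≤-trans ge (min s' lt)
          (inj₂ refl) → ℕₚ.≤-refl

module Representatives {m : ℕ} where
  open Mod m
  open Rot {m}
  open Orbits {m}
  open CyclicDescents {m}

  npᵇ : Vec Bool n → Bool
  npᵇ X = nonemptyᵇ X ∧ properᵇ X

  np-rotIter : ∀ s X → npᵇ X ≡ true → npᵇ (rotIter s X) ≡ true
  np-rotIter zero    X e = e
  np-rotIter (suc s) X e = ∧⁺
    (nonempty⁺ (rotL Y) _ (trans (back Y _) (proj₂ (nonempty⁻ Y (proj₁ (∧⁻ {nonemptyᵇ Y} e'))))))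
    (proper⁺ (rotL Y) _ (trans (back Y _) (proj₂ (proper⁻ Y (proj₂ (∧⁻ {nonemptyᵇ Y} e'))))))
    where
    Y = rotIter s X
    e' = np-rotIter s X e
    back : ∀ Y i → lookup (rotL Y) ((toℕ i + m) mod n) ≡ lookup Y i
    back Y i = trans (sym (lookup-rotIter m (rotL Y) i)) (cong (λ Z → lookup Z i) (rotIter-m-rotL Y))

  -- The rotation of least `code`; it is the only representative in its orbit because `code` is
  -- injective.
  representative : ∀ X → Σ (Vec Bool n) λ R → InOrbit X R × isRepᵇ R ≡ true × (∀ A → InOrbit X A → isRepᵇ A ≡ true → A ≡ R)
  representative X with argmin (λ s → code (rotIter s X)) m
  ... | s , _ , min = rotIter s X , (s , refl) , rep⁺ , unique
    where
    minimal : ∀ s' → code (rotIter s X) ≤ code (rotIter s' X)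
    minimal s' = subst (λ Z → code (rotIter s X) ≤ code Z) (sym (rotIter-% s' X)) (min (s' % n) (DM.m%n<n s' n))
    rep⁺ : isRepᵇ (rotIter s X) ≡ true
    rep⁺ = allᵇ⁺ _ (upTo n) (λ {s'} _ → ≤ᵇ⁺ (subst (λ Z → code (rotIter s X) ≤ code Z) (rotIter-+ s' s X) (minimal (s' + s))))
    unique : ∀ A → InOrbit X A → isRepᵇ A ≡ true → A ≡ rotIter s X
    unique A o@(s' , refl) e with orbit-trans (orbit-sym o) (s , refl)
    ... | r , eq = code-injective A (rotIter s X) (ℕₚ.≤-antisym
      (subst (λ Z → code A ≤ code Z) (trans (sym (rotIter-% r A)) eq)
        (≤ᵇ⁻ {code A} (allᵇ⁻ (λ s → code A ≤ᵇ code (rotIter s A)) (upTo n) e (∈ₚ.∈-upTo⁺ (DM.m%n<n r n)))))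
      (minimal s'))

  ∑-reps : ∀ X → npᵇ X ≡ true → (f : Vec Bool n → ℤ) →
    ∑ (orbitReps n) (λ A → ⟦ inOrbitᵇ X A ⟧ *ℤ f A) ≡ f (proj₁ (representative X))
  ∑-reps X npX f = trans (∑-filter (λ A → nonemptyᵇ A ∧ properᵇ A ∧ isRepᵇ A) (allSubsets n) _) (trans
    (∑-cong (allSubsets n) (λ A → trans (sym (guard-∧ (nonemptyᵇ A ∧ properᵇ A ∧ isRepᵇ A) (inOrbitᵇ X A) (f A))) (cong (λ b → ⟦ b ⟧ *ℤ f A) (bool-iff
      (λ e → let (e₁ , e₂) = ∧⁻ {nonemptyᵇ A ∧ properᵇ A ∧ isRepᵇ A} e
                 (_ , e₃) = ∧⁻ {nonemptyᵇ A} e₁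
                 (_ , e₄) = ∧⁻ {properᵇ A} e₃
             in eqVecBool⁺ (sym (unique A (inOrbit⁻ X A e₂) e₄)))
      (λ e → subst (λ A → (nonemptyᵇ A ∧ properᵇ A ∧ isRepᵇ A) ∧ inOrbitᵇ X A ≡ true) (eqVecBool⁻ R A e)
        (let (s , eq) = o ; np' = subst (λ Z → npᵇ Z ≡ true) eq (np-rotIter s X npX) in
         ∧⁺ (∧⁺ (proj₁ (∧⁻ {nonemptyᵇ R} np')) (∧⁺ (proj₂ (∧⁻ {nonemptyᵇ R} np')) rp)) (inOrbit⁺ X R o)))))))
    (∑-δ R f))
    where
    R = proj₁ (representative X)
    o = proj₁ (proj₂ (representative X))
    rp = proj₁ (proj₂ (proj₂ (representative X)))
    unique = proj₂ (proj₂ (proj₂ (representative X)))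

module Expansion {m' : ℕ} where
  m : ℕ
  m = suc m'
  open Mod m
  open Rot {m}
  open Orbits {m}
  open CyclicDescents {m}
  open Representatives {m}

  nxt≢ : ∀ i → nxt i ≢ i
  nxt≢ i with last? i
  ... | inj j = λ e → ℕₚ.<⇒≢ (ℕₚ.n<1+n (toℕ j)) (sym (trans (cong toℕ (trans (sym (nxt-inject₁ j)) e)) (Finₚ.toℕ-inject₁ j)))
  ... | lst   = λ e → case trans (sym nxt-last) e of λ ()

  -- The position of the largest value is a cyclic descent and that of the smallest is not; since n
  -- ≥ 2, a position differs from its cyclic successor.
  cDes-np : ∀ (σ : Vec (Fin n) n) → IsPerm σ → npᵇ (cDes σ) ≡ true
  cDes-np σ p = ∧⁺
    (nonempty⁺ (cDes σ) top (trans (lookup-cDes σ top) (<ᵇ⁺ (ℕₚ.≤∧≢⇒<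
      (subst (λ z → toℕ (lookup σ (nxt top)) ≤ toℕ z) (sym (inverseʳ σ p (fromℕ m))) (subst (toℕ (lookup σ (nxt top)) ≤_) (sym (Finₚ.toℕ-fromℕ m)) (ℕₚ.≤-pred (Finₚ.toℕ<n _))))
      (λ e → nxt≢ top (p _ _ (Finₚ.toℕ-injective e)))))))
    (proper⁺ (cDes σ) bot (trans (lookup-cDes σ bot) (≡false (λ e → ℕₚ.n≮0 (subst (λ z → toℕ (lookup σ (nxt bot)) < toℕ z) (inverseʳ σ p fzero) (<ᵇ⁻ {toℕ (lookup σ (nxt bot))} e))))))
    where
    top = lookup (inverse σ) (fromℕ m)
    bot = lookup (inverse σ) fzero

  ã≡∑ : ∀ (π : Vec (Fin n) n) A J → + ãcount π A J ≡
    ∑ (perms n) (λ σ₁ → ∑ (perms n) (λ σ₂ → ⟦ inOrbitᵇ (cDes σ₁) A ⟧ *ℤ (⟦ eqVecBool (Des σ₂) J ⟧ *ℤ ⟦ eqVecFin (compose σ₂ σ₁) π ⟧)))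
  ã≡∑ π A J = trans (sumℕ≡∑ (λ σ₁ → count (λ σ₂ → inOrbitᵇ (cDes σ₁) A ∧ eqVecBool (Des σ₂) J ∧ eqVecFin (compose σ₂ σ₁) π) (perms n)) (perms n))
    (∑-cong (perms n) (λ σ₁ → trans (count≡∑ (λ σ₂ → inOrbitᵇ (cDes σ₁) A ∧ eqVecBool (Des σ₂) J ∧ eqVecFin (compose σ₂ σ₁) π) (perms n)) (∑-cong (perms n) (λ σ₂ →
      trans (⟦∧⟧ (inOrbitᵇ (cDes σ₁) A) _) (cong (⟦ inOrbitᵇ (cDes σ₁) A ⟧ *ℤ_) (⟦∧⟧ (eqVecBool (Des σ₂) J) _))))))

  ã-orbit : ∀ (π : Vec (Fin n) n) {A A'} J → InOrbit A A' → ãcount π A J ≡ ãcount π A' J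
  ã-orbit π {A} {A'} J o = ℤₚ.+-injective (trans (ã≡∑ π A J) (trans (∑-cong (perms n) (λ σ₁ → ∑-cong (perms n) (λ σ₂ →
    cong (λ b → ⟦ b ⟧ *ℤ (⟦ eqVecBool (Des σ₂) J ⟧ *ℤ ⟦ eqVecFin (compose σ₂ σ₁) π ⟧)) (inOrbit-congʳ o (cDes σ₁))))) (sym (ã≡∑ π A' J))))

  Δ-Fcyc-orbits : ∀ (π : Vec (Fin n) n) → IsPerm π → ∀ u v → Monotone u → Monotone v →
    Δ (Fcyc (cDes π)) u v ≡ ∑ (orbitReps n) (λ A → ∑ (allSubsets m) (λ J → + ãcount π A J *ℤ (Fcyc A u *ℤ F J v)))
  Δ-Fcyc-orbits π pπ u v mu mv = begin
    Δ (Fcyc (cDes π)) u v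
      ≡⟨ Δ-Fcyc π pπ u v mu mv ⟩
    ∑ (perms n) (λ σ₁ → ∑ (perms n) (λ σ₂ → E σ₁ σ₂ *ℤ (Fcyc (cDes σ₁) u *ℤ F (Des σ₂) v)))
      ≡⟨ ∑-cong-∈ (perms n) (λ {σ₁} σ∈ → ∑-cong (perms n) (λ σ₂ → term σ₁ σ₂ (isPerm⁻ σ₁ (proj₂ (∈-filterᵇ⁻ isPermᵇ (allVecsOf (allFin n) n) σ∈))))) ⟩
    ∑ (perms n) (λ σ₁ → ∑ (perms n) (λ σ₂ → ∑ (orbitReps n) (λ A → ∑ (allSubsets m) (λ J → X σ₁ σ₂ A J *ℤ (Fcyc A u *ℤ F J v)))))
      ≡⟨ ∑-cong (perms n) (λ σ₁ → ∑-swap (perms n) (orbitReps n) _) ⟩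
    ∑ (perms n) (λ σ₁ → ∑ (orbitReps n) (λ A → ∑ (perms n) (λ σ₂ → ∑ (allSubsets m) (λ J → X σ₁ σ₂ A J *ℤ (Fcyc A u *ℤ F J v)))))
      ≡⟨ ∑-swap (perms n) (orbitReps n) _ ⟩
    ∑ (orbitReps n) (λ A → ∑ (perms n) (λ σ₁ → ∑ (perms n) (λ σ₂ → ∑ (allSubsets m) (λ J → X σ₁ σ₂ A J *ℤ (Fcyc A u *ℤ F J v)))))
      ≡⟨ ∑-cong (orbitReps n) (λ A → trans (∑-cong (perms n) (λ σ₁ → ∑-swap (perms n) (allSubsets m) _)) (trans (∑-swap (perms n) (allSubsets m) _)
           (∑-cong (allSubsets m) (λ J → begin
             ∑ (perms n) (λ σ₁ → ∑ (perms n) (λ σ₂ → X σ₁ σ₂ A J *ℤ (Fcyc A u *ℤ F J v)))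
               ≡⟨ ∑-cong (perms n) (λ σ₁ → sym (∑-*ʳ (perms n) (λ σ₂ → X σ₁ σ₂ A J) (Fcyc A u *ℤ F J v))) ⟩
             ∑ (perms n) (λ σ₁ → ∑ (perms n) (λ σ₂ → X σ₁ σ₂ A J) *ℤ (Fcyc A u *ℤ F J v))
               ≡⟨ sym (∑-*ʳ (perms n) (λ σ₁ → ∑ (perms n) (λ σ₂ → X σ₁ σ₂ A J)) (Fcyc A u *ℤ F J v)) ⟩
             ∑ (perms n) (λ σ₁ → ∑ (perms n) (λ σ₂ → X σ₁ σ₂ A J)) *ℤ (Fcyc A u *ℤ F J v)
               ≡⟨ cong (_*ℤ (Fcyc A u *ℤ F J v)) (sym (ã≡∑ π A J)) ⟩
             + ãcount π A J *ℤ (Fcyc A u *ℤ F J v) ∎)))) ⟩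
    ∑ (orbitReps n) (λ A → ∑ (allSubsets m) (λ J → + ãcount π A J *ℤ (Fcyc A u *ℤ F J v))) ∎
    where
    E : Vec (Fin n) n → Vec (Fin n) n → ℤ
    E σ₁ σ₂ = ⟦ eqVecFin (compose σ₂ σ₁) π ⟧
    X : Vec (Fin n) n → Vec (Fin n) n → Vec Bool n → Vec Bool m → ℤ
    X σ₁ σ₂ A J = ⟦ inOrbitᵇ (cDes σ₁) A ⟧ *ℤ (⟦ eqVecBool (Des σ₂) J ⟧ *ℤ E σ₁ σ₂)
    arr : ∀ e a f b g → e *ℤ ((a *ℤ f) *ℤ (b *ℤ g)) ≡ (a *ℤ (b *ℤ e)) *ℤ (f *ℤ g)
    arr = solve-∀ℤ
    Fcyc-rep : ∀ σ₁ → IsPerm σ₁ → Fcyc (cDes σ₁) u ≡ ∑ (orbitReps n) (λ A → ⟦ inOrbitᵇ (cDes σ₁) A ⟧ *ℤ Fcyc A u)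
    Fcyc-rep σ₁ p = sym (trans (∑-reps (cDes σ₁) (cDes-np σ₁ p) (λ A → Fcyc A u)) (let R = proj₁ (representative (cDes σ₁)); o = proj₁ (proj₂ (representative (cDes σ₁))) in
      trans (Fcyc≡hat R u) (trans (sym (cong₂ (λ a b → + a *ℤ b) (d-orbit {cDes σ₁} {R} o) (hat-orbit {cDes σ₁} {R} o u))) (sym (Fcyc≡hat (cDes σ₁) u)))))
    term : ∀ σ₁ σ₂ → IsPerm σ₁ → E σ₁ σ₂ *ℤ (Fcyc (cDes σ₁) u *ℤ F (Des σ₂) v) ≡
      ∑ (orbitReps n) (λ A → ∑ (allSubsets m) (λ J → X σ₁ σ₂ A J *ℤ (Fcyc A u *ℤ F J v)))
    term σ₁ σ₂ p = begin
      E σ₁ σ₂ *ℤ (Fcyc (cDes σ₁) u *ℤ F (Des σ₂) v)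
        ≡⟨ cong₂ (λ a b → E σ₁ σ₂ *ℤ (a *ℤ b)) (Fcyc-rep σ₁ p) (sym (∑-δ (Des σ₂) (λ J → F J v))) ⟩
      E σ₁ σ₂ *ℤ (∑ (orbitReps n) (λ A → ⟦ inOrbitᵇ (cDes σ₁) A ⟧ *ℤ Fcyc A u) *ℤ ∑ (allSubsets m) (λ J → ⟦ eqVecBool (Des σ₂) J ⟧ *ℤ F J v))
        ≡⟨ cong (E σ₁ σ₂ *ℤ_) (∑-*ʳ (orbitReps n) _ _) ⟩
      E σ₁ σ₂ *ℤ ∑ (orbitReps n) (λ A → ⟦ inOrbitᵇ (cDes σ₁) A ⟧ *ℤ Fcyc A u *ℤ ∑ (allSubsets m) (λ J → ⟦ eqVecBool (Des σ₂) J ⟧ *ℤ F J v))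
        ≡⟨ ∑-*ˡ (orbitReps n) (E σ₁ σ₂) _ ⟩
      ∑ (orbitReps n) (λ A → E σ₁ σ₂ *ℤ (⟦ inOrbitᵇ (cDes σ₁) A ⟧ *ℤ Fcyc A u *ℤ ∑ (allSubsets m) (λ J → ⟦ eqVecBool (Des σ₂) J ⟧ *ℤ F J v)))
        ≡⟨ ∑-cong (orbitReps n) (λ A → trans (cong (E σ₁ σ₂ *ℤ_) (∑-*ˡ (allSubsets m) (⟦ inOrbitᵇ (cDes σ₁) A ⟧ *ℤ Fcyc A u) _))
             (trans (∑-*ˡ (allSubsets m) (E σ₁ σ₂) _) (∑-cong (allSubsets m) (λ J → arr (E σ₁ σ₂) ⟦ inOrbitᵇ (cDes σ₁) A ⟧ (Fcyc A u) ⟦ eqVecBool (Des σ₂) J ⟧ (F J v))))) ⟩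
      ∑ (orbitReps n) (λ A → ∑ (allSubsets m) (λ J → X σ₁ σ₂ A J *ℤ (Fcyc A u *ℤ F J v))) ∎

-- Unitriangularity, and integrality of the structure constants

Div : ℤ → ℤ → Set
Div k x = Σ ℤ λ q → x ≡ q *ℤ k

Div-0 : ∀ k → Div k (+ 0)
Div-0 k = + 0 , refl

Div-+ : ∀ {k x y} → Div k x → Div k y → Div k (x +ℤ y)
Div-+ {k} (p , refl) (q , refl) = p +ℤ q , sym (ℤₚ.*-distribʳ-+ k p q)

Div-*ʳ : ∀ {k x} c → Div k x → Div k (x *ℤ c)
Div-*ʳ {k} c (q , refl) = c *ℤ q , trans (ℤₚ.*-comm (q *ℤ k) c) (sym (ℤₚ.*-assoc c q k))

Div-∑ : ∀ {k} (xs : List A) {f : A → ℤ} → (∀ {x} → x ∈ xs → Div k (f x)) → Div k (∑ xs f)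
Div-∑ []       d = Div-0 _
Div-∑ (x ∷ xs) d = Div-+ (d (here refl)) (Div-∑ xs (d ∘ there))

-- Triangular systems can be solved modulo k; k = 0 gives uniqueness, k ≠ 0 gives divisibility.
unitriangular : (_≟_ : DecidableEquality A) (xs : List A) (size : A → ℕ) (φ : A → A → ℤ) (T : A → ℤ) (k : ℤ) →
  (∀ {y} → y ∈ xs → Once _≟_ xs y) →
  (∀ {x y} → x ∈ xs → y ∈ xs → size y ≤ size x → φ y x ≡ ⟦ does (x ≟ y) ⟧) →
  (∀ {y} → y ∈ xs → Div k (∑ xs (λ x → T x *ℤ φ y x))) →
  ∀ {y} → y ∈ xs → Div k (T y)
unitriangular _≟_ xs size φ T k once tri total {y} y∈ = go (suc (size y)) y∈ (ℕₚ.n<1+n (size y))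
  where
  go : ∀ b {y} → y ∈ xs → size y < b → Div k (T y)
  go (suc b) {y} y∈ (s≤s y≤b) = subst (Div k) (begin
      ∑ xs (λ x → T x *ℤ φ y x) +ℤ ∑ xs (λ x → T x *ℤ (⟦ does (x ≟ y) ⟧ +ℤ -ℤ φ y x))
        ≡⟨ sym (∑-+ xs (λ x → T x *ℤ φ y x) (λ x → T x *ℤ (⟦ does (x ≟ y) ⟧ +ℤ -ℤ φ y x))) ⟩
      ∑ xs (λ x → T x *ℤ φ y x +ℤ T x *ℤ (⟦ does (x ≟ y) ⟧ +ℤ -ℤ φ y x))
        ≡⟨ ∑-cong xs (λ x → arr (T x) (φ y x) ⟦ does (x ≟ y) ⟧) ⟩
      ∑ xs (λ x → ⟦ does (x ≟ y) ⟧ *ℤ T x)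
        ≡⟨ once y∈ T ⟩
      T y ∎)
    (Div-+ (total y∈) (Div-∑ xs (λ {x} x∈ → small x x∈)))
    where
    arr : ∀ t p e → t *ℤ p +ℤ t *ℤ (e +ℤ -ℤ p) ≡ e *ℤ t
    arr = solve-∀ℤ
    arr' : ∀ t e → t *ℤ (e +ℤ -ℤ e) ≡ + 0
    arr' = solve-∀ℤ
    small : ∀ x → x ∈ xs → Div k (T x *ℤ (⟦ does (x ≟ y) ⟧ +ℤ -ℤ φ y x))
    small x x∈ with size x <? size y
    ... | yes lt = Div-*ʳ _ (go b x∈ (ℕₚ.<-≤-trans lt y≤b))
    ... | no ¬lt = subst (Div k) (sym (trans (cong (λ e → T x *ℤ (⟦ does (x ≟ y) ⟧ +ℤ -ℤ e)) (tri x∈ y∈ (ℕₚ.≮⇒≥ ¬lt))) (arr' (T x) ⟦ does (x ≟ y) ⟧))) (Div-0 k)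

-- the word whose strict steps are exactly the i with Y i
wordOf : ∀ {m} → (Fin m → Bool) → Word (suc m)
wordOf {m} Y j = count (λ i → Y i ∧ (toℕ i <ᵇ toℕ j)) (allFin m)

wordOf-monotone : ∀ {m} (Y : Fin m → Bool) → Monotone (wordOf Y)
wordOf-monotone {m} Y i j i≤j = count-mono _ _ (allFin m) (λ {k} _ e → let (a , b) = ∧⁻ {Y k} e in ∧⁺ a (<ᵇ⁺ (ℕₚ.<-≤-trans (<ᵇ⁻ {toℕ k} b) i≤j)))

wordOf-strict : ∀ {m} (Y : Fin m → Bool) i → Y i ≡ true → wordOf Y (inject₁ i) < wordOf Y (fsuc i)
wordOf-strict {m} Y i Yi = count-strict _ _ (allFin m)
  (λ {k} _ e → let (a , b) = ∧⁻ {Y k} e in ∧⁺ a (<ᵇ⁺ (ℕₚ.<-≤-trans (<ᵇ⁻ {toℕ k} b) (inject₁≤suc i))))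
  (∈ₚ.∈-allFin i)
  (≡false (λ e → ℕₚ.<-irrefl (sym (Finₚ.toℕ-inject₁ i)) (<ᵇ⁻ {toℕ i} (proj₂ (∧⁻ {Y i} e)))))
  (∧⁺ Yi (<ᵇ⁺ (ℕₚ.n<1+n (toℕ i))))

wordOf-weak : ∀ {m} (Y : Fin m → Bool) i → Y i ≡ false → wordOf Y (inject₁ i) ≡ wordOf Y (fsuc i)
wordOf-weak {m} Y i ¬Yi = ℕₚ.≤-antisym (wordOf-monotone Y (inject₁ i) (fsuc i) (inject₁≤suc i))
  (count-mono _ _ (allFin m) (λ {k} _ e → let (a , b) = ∧⁻ {Y k} e in ∧⁺ a (<ᵇ⁺ (subst (toℕ k <_) (sym (Finₚ.toℕ-inject₁ i))
    (ℕₚ.≤∧≢⇒< (ℕₚ.≤-pred (<ᵇ⁻ {toℕ k} b)) (λ k≡i → false≢true (trans (sym ¬Yi) (subst (λ z → Y z ≡ true) (Finₚ.toℕ-injective k≡i) a))))))))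

FF-wordOf : ∀ {m} (X Y : Fin m → Bool) → FFᵇ X (wordOf Y) ≡ true → ∀ i → X i ≡ true → Y i ≡ true
FF-wordOf X Y e i Xi with Y i in Yi
... | true  = refl
... | false = ⊥-elim (ℕₚ.<⇒≢ (FF⁻ X (wordOf Y) e i Xi) (wordOf-weak Y i Yi))

card : ∀ {k} → Vec Bool k → ℕ
card []      = 0
card (b ∷ X) = (if b then 1 else 0) + card X

⊆-card : ∀ {k} (X Y : Vec Bool k) → (∀ i → lookup X i ≡ true → lookup Y i ≡ true) → card X ≤ card Y
⊆-card []          []          f = z≤n
⊆-card (false ∷ X) (y ∷ Y)     f = ℕₚ.≤-trans (⊆-card X Y (f ∘ fsuc)) (ℕₚ.m≤n+m (card Y) _)
⊆-card (true ∷ X)  (true ∷ Y)  f = s≤s (⊆-card X Y (f ∘ fsuc))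
⊆-card (true ∷ X)  (false ∷ Y) f = ⊥-elim (false≢true (f fzero refl))

⊆-card-≡ : ∀ {k} (X Y : Vec Bool k) → (∀ i → lookup X i ≡ true → lookup Y i ≡ true) → card Y ≤ card X → X ≡ Y
⊆-card-≡ []          []          f c = refl
⊆-card-≡ (false ∷ X) (false ∷ Y) f c = cong (false ∷_) (⊆-card-≡ X Y (f ∘ fsuc) c)
⊆-card-≡ (true ∷ X)  (true ∷ Y)  f c = cong (true ∷_) (⊆-card-≡ X Y (f ∘ fsuc) (ℕₚ.≤-pred c))
⊆-card-≡ (true ∷ X)  (false ∷ Y) f c = ⊥-elim (false≢true (f fzero refl))
⊆-card-≡ (false ∷ X) (true ∷ Y)  f c = ⊥-elim (ℕₚ.<⇒≱ c (⊆-card X Y (f ∘ fsuc)))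

card-rotIter : ∀ {k} s (X : Vec Bool k) → card (rotIter s X) ≡ card X
card-rotIter zero    X = refl
card-rotIter (suc s) X = trans (rot (rotIter s X)) (card-rotIter s X)
  where
  snoc : ∀ {k} (X : Vec Bool k) b → card (X ∷ʳ b) ≡ (if b then 1 else 0) + card X
  snoc []      b = refl
  snoc (c ∷ X) b = trans (cong (ℕ._+_ (if c then 1 else 0)) (snoc X b)) (arr (if c then 1 else 0) (if b then 1 else 0) (card X))
    where
    arr : ∀ x y z → x + (y + z) ≡ y + (x + z)
    arr = solve-∀
  rot : ∀ {k} (X : Vec Bool k) → card (rotL X) ≡ card X
  rot []      = refl
  rot (b ∷ X) = snoc X b

Once-filter : (_≟_ : DecidableEquality A) (p : A → Bool) (xs : List A) {x : A} → Once _≟_ xs x → p x ≡ true → Once _≟_ (filterᵇ p xs) x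
Once-filter _≟_ p xs {x} o px f = begin
  ∑ (filterᵇ p xs) (λ y → ⟦ does (y ≟ x) ⟧ *ℤ f y)              ≡⟨ ∑-filter p xs _ ⟩
  ∑ xs (λ y → ⟦ p y ⟧ *ℤ (⟦ does (y ≟ x) ⟧ *ℤ f y))            ≡⟨ ∑-cong xs (λ y → *-swapℤ ⟦ p y ⟧ ⟦ does (y ≟ x) ⟧ (f y)) ⟩
  ∑ xs (λ y → ⟦ does (y ≟ x) ⟧ *ℤ (⟦ p y ⟧ *ℤ f y))            ≡⟨ o (λ y → ⟦ p y ⟧ *ℤ f y) ⟩
  ⟦ p x ⟧ *ℤ f x                                               ≡⟨ guard-true (f x) px ⟩
  f x                                                          ∎

bools-complete : ∀ b → b ∈ bools
bools-complete true  = here refl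
bools-complete false = there (here refl)

allSubsets-complete : ∀ {k} (J : Vec Bool k) → J ∈ allSubsets k
allSubsets-complete []      = here refl
allSubsets-complete (b ∷ J) = ∈ₚ.∈-concat⁺′ (∈ₚ.∈-map⁺ (_∷ J) (bools-complete b)) (∈ₚ.∈-map⁺ (λ v → map (λ x → x ∷ v) bools) (allSubsets-complete J))

sumℤ-concatMap : (xs : List A) (ys : List B) (f : A → B → ℤ) → sumℤ (concatMap (λ x → map (f x) ys) xs) ≡ ∑ xs (λ x → ∑ ys (f x))
sumℤ-concatMap []       ys f = refl
sumℤ-concatMap (x ∷ xs) ys f = trans (app (map (f x) ys) _) (cong (∑ ys (f x) +ℤ_) (sumℤ-concatMap xs ys f))
  where
  app : ∀ as bs → sumℤ (as ++ bs) ≡ sumℤ as +ℤ sumℤ bs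
  app []       bs = sym (ℤₚ.+-identityˡ _)
  app (a ∷ as) bs = trans (cong (a +ℤ_) (app as bs)) (sym (ℤₚ.+-assoc a _ _))

module StructureConstants {m' : ℕ} where
  open Expansion {m'} using (m; nxt≢; cDes-np; ã-orbit; Δ-Fcyc-orbits)
  open Mod m
  open Rot {m}
  open Orbits {m}
  open CyclicDescents {m}
  open Representatives {m}

  -- The word of J' has its strict steps exactly at J', so the coefficient tests J ⊆ J', and the
  -- cardinalities leave only equality.
  F-test : ∀ J J' → card J' ≤ card J → F {n} J (wordOf (lookup J')) ≡ ⟦ does (J ≟ᵇ J') ⟧
  F-test J J' c = cong ⟦_⟧ (bool-iff
    (λ e → dec-true (J ≟ᵇ J') (⊆-card-≡ J J' (FF-wordOf (lookup J) (lookup J') e) c))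
    (λ e → FF⁺ (lookup J) (wordOf (lookup J')) (λ i Ji → wordOf-strict (lookup J') i (subst (λ Z → lookup Z i ≡ true) (does-true (J ≟ᵇ J') e) Ji))))

  closed : ∀ A → nonemptyᵇ A ≡ true → Σ ℕ λ s → lookup (rotIter s A) (fromℕ m) ≡ true
  closed A e = let (i , Ai) = nonempty⁻ A e in suc (toℕ i) , (begin
    lookup (rotIter (suc (toℕ i)) A) (fromℕ m)          ≡⟨ lookup-rotIter (suc (toℕ i)) A (fromℕ m) ⟩
    lookup A ((toℕ (fromℕ m) + suc (toℕ i)) mod n)      ≡⟨ cong (λ x → lookup A ((x + suc (toℕ i)) mod n)) (Finₚ.toℕ-fromℕ m) ⟩
    lookup A ((m + suc (toℕ i)) mod n)                  ≡⟨ cong (λ x → lookup A (x mod n)) (trans (ℕₚ.+-suc m (toℕ i)) (ℕₚ.+-comm n (toℕ i))) ⟩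
    lookup A ((toℕ i + n) mod n)                        ≡⟨ cong (lookup A) (trans (mod-n (toℕ i)) (mod-toℕ i)) ⟩
    lookup A i                                          ≡⟨ Ai ⟩
    true                                                ∎)

  -- `FF̂` does not see the element n. Rotating the set so that it contains n turns the test on the
  -- smaller elements into containment of whole sets. The `no` branch is a default for the empty
  -- set.
  testSet : Vec Bool n → Vec Bool n
  testSet A with nonemptyᵇ A Boolₚ.≟ true
  ... | yes e = rotIter (proj₁ (closed A e)) A
  ... | no _  = A

  testSet-spec : ∀ A → nonemptyᵇ A ≡ true → InOrbit A (testSet A) × lookup (testSet A) (fromℕ m) ≡ true
  testSet-spec A ne with nonemptyᵇ A Boolₚ.≟ true
  ... | yes e = (proj₁ (closed A e) , refl) , proj₂ (closed A e)
  ... | no ¬e = ⊥-elim (¬e ne)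

  testWord : Vec Bool n → Word n
  testWord A = wordOf (λ i → lookup (testSet A) (inject₁ i))

  ∈-reps⁻ : ∀ {A} → A ∈ orbitReps n → npᵇ A ≡ true × isRepᵇ A ≡ true
  ∈-reps⁻ {A} A∈ = let (_ , e) = ∈-filterᵇ⁻ (λ A → nonemptyᵇ A ∧ properᵇ A ∧ isRepᵇ A) (allSubsets n) A∈
                       (a , b) = ∧⁻ {nonemptyᵇ A} e
                       (c , r) = ∧⁻ {properᵇ A} b
                   in ∧⁺ a c , r

  Once-reps : ∀ {A} → A ∈ orbitReps n → Once _≟ᵇ_ (orbitReps n) A
  Once-reps {A} A∈ = Once-filter _≟ᵇ_ (λ A → nonemptyᵇ A ∧ properᵇ A ∧ isRepᵇ A) (allSubsets n) (Once-allSubsets A)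
    (proj₂ (∈-filterᵇ⁻ (λ A → nonemptyᵇ A ∧ properᵇ A ∧ isRepᵇ A) (allSubsets n) A∈))

  -- Only the sets of the orbit of A contained in `testSet A'` are counted. All have the size of A,
  -- which is at least that of A', so the only candidate is `testSet A'` itself.
  hat-test : ∀ {A A'} → A ∈ orbitReps n → A' ∈ orbitReps n → card A' ≤ card A → hatFcyc A (testWord A') ≡ ⟦ does (A ≟ᵇ A') ⟧
  hat-test {A} {A'} A∈ A'∈ c = begin
    hatFcyc A (testWord A')
      ≡⟨ trans (hatFcyc≡ A (testWord A')) (hat≡∑ A (testWord A')) ⟩
    ∑ (allSubsets n) (λ X → ⟦ inOrbitᵇ A X ⟧ *ℤ ⟦ FF̂ X (testWord A') ⟧)
      ≡⟨ ∑-cong (allSubsets n) (λ X → trans (guard (inOrbitᵇ A X) (λ e → cong ⟦_⟧ (only X (inOrbit⁻ A X e)))) (ℤₚ.*-comm ⟦ inOrbitᵇ A X ⟧ _)) ⟩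
    ∑ (allSubsets n) (λ X → ⟦ eqVecBool Y X ⟧ *ℤ ⟦ inOrbitᵇ A X ⟧)
      ≡⟨ ∑-δ Y (λ X → ⟦ inOrbitᵇ A X ⟧) ⟩
    ⟦ inOrbitᵇ A Y ⟧
      ≡⟨ cong ⟦_⟧ (bool-iff
           (λ e → dec-true (A ≟ᵇ A') (trans (unique A (0 , refl) (proj₂ (∈-reps⁻ A∈))) (sym (unique A' (orbit-trans {A} {Y} {A'} (inOrbit⁻ A Y e) (orbit-sym {A'} {Y} o)) (proj₂ (∈-reps⁻ A'∈))))))
           (λ e → inOrbit⁺ A Y (subst (λ Z → InOrbit Z Y) (sym (does-true (A ≟ᵇ A') e)) o))) ⟩
    ⟦ does (A ≟ᵇ A') ⟧ ∎
    where
    Y = testSet A'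
    ne = proj₁ (∧⁻ {nonemptyᵇ A'} (proj₁ (∈-reps⁻ A'∈)))
    o = proj₁ (testSet-spec A' ne)
    Ylast = proj₂ (testSet-spec A' ne)
    unique = proj₂ (proj₂ (proj₂ (representative A)))
    card-Y : card Y ≡ card A'
    card-Y = trans (cong card (sym (proj₂ o))) (card-rotIter (proj₁ o) A')
    only : ∀ X → InOrbit A X → FF̂ X (testWord A') ≡ eqVecBool Y X
    only X (s , eq) = bool-iff
      (λ e → eqVecBool⁺ (sym (⊆-card-≡ X Y (sub e) (ℕₚ.≤-trans (ℕₚ.≤-reflexive card-Y) (ℕₚ.≤-trans c (ℕₚ.≤-reflexive (trans (sym (card-rotIter s A)) (cong card eq))))))))
      (λ e → subst (λ Z → FF̂ Z (testWord A') ≡ true) (eqVecBool⁻ Y X e) (FF⁺ (λ i → lookup Y (inject₁ i)) (testWord A') (λ i Yi → wordOf-strict (λ i → lookup Y (inject₁ i)) i Yi)))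
      where
      sub : FF̂ X (testWord A') ≡ true → ∀ i → lookup X i ≡ true → lookup Y i ≡ true
      sub e i Xi with last? i
      ... | inj j = FF-wordOf (λ i → lookup X (inject₁ i)) (λ i → lookup Y (inject₁ i)) e j Xi
      ... | lst   = Ylast

  -- Triangularity is applied once in each tensor factor: first the coefficients of the `F J` are
  -- isolated at a fixed test word in x, then, for the given `J`, those of the `hatFcyc A`.
  divisible : ∀ (k : ℤ) (T : Vec Bool n → Vec Bool m → ℤ) →
    (∀ (u v : Word n) → Monotone u → Monotone v → Div k (∑ (orbitReps n) (λ A → ∑ (allSubsets m) (λ J → T A J *ℤ (hatFcyc A u *ℤ F J v))))) →
    ∀ {A} → A ∈ orbitReps n → ∀ J → Div k (T A J)
  divisible k T total A∈ J = unitriangular _≟ᵇ_ (orbitReps n) card (λ A' A → hatFcyc A (testWord A')) (λ A → T A J) k Once-reps hat-test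
    (λ {A'} _ → unitriangular _≟ᵇ_ (allSubsets m) card (λ J' J → F {n} J (wordOf (lookup J')))
      (λ J → ∑ (orbitReps n) (λ A → T A J *ℤ hatFcyc A (testWord A'))) k (λ {J} _ → Once-allSubsets J) (λ {J} {J'} _ _ c → F-test J J' c)
      (λ {J'} _ → subst (Div k) (rearrange (testWord A') (wordOf (lookup J')))
        (total (testWord A') (wordOf (lookup J')) (wordOf-monotone (λ i → lookup (testSet A') (inject₁ i))) (wordOf-monotone (lookup J')))) (allSubsets-complete J)) A∈
    where
    rearrange : ∀ u v → ∑ (orbitReps n) (λ A → ∑ (allSubsets m) (λ J → T A J *ℤ (hatFcyc A u *ℤ F {n} J v))) ≡
      ∑ (allSubsets m) (λ J → ∑ (orbitReps n) (λ A → T A J *ℤ hatFcyc A u) *ℤ F {n} J v)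
    rearrange u v = trans (∑-swap (orbitReps n) (allSubsets m) _) (∑-cong (allSubsets m) (λ J → trans
      (∑-cong (orbitReps n) (λ A → sym (ℤₚ.*-assoc (T A J) (hatFcyc A u) (F {n} J v)))) (sym (∑-*ʳ (orbitReps n) (λ A → T A J *ℤ hatFcyc A u) (F {n} J v)))))

  T̃ : Vec (Fin n) n → Vec Bool n → Vec Bool m → ℕ
  T̃ π A J = d A * ãcount π A J

  -- The expansion of F^cyc with F^cyc_A = d_A F̂^cyc_A substituted on both sides. It is d_B times
  -- the desired formula, so no quotient appears yet.
  expansion : ∀ (B : Vec Bool n) (π : Vec (Fin n) n) → IsPerm π → InOrbit (cDes π) B → ∀ (u v : Word n) → Monotone u → Monotone v →
    ∑ (orbitReps n) (λ A → ∑ (allSubsets m) (λ J → + T̃ π A J *ℤ (hatFcyc A u *ℤ F J v))) ≡ + d B *ℤ Δ (hatFcyc B) u v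
  expansion B π pπ o u v mu mv = begin
    ∑ (orbitReps n) (λ A → ∑ (allSubsets m) (λ J → + T̃ π A J *ℤ (hatFcyc A u *ℤ F J v)))
      ≡⟨ ∑-cong (orbitReps n) (λ A → ∑-cong (allSubsets m) (λ J → trans (cong (_*ℤ (hatFcyc A u *ℤ F J v)) (ℤₚ.pos-* (d A) (ãcount π A J)))
           (trans (arr (+ d A) (+ ãcount π A J) (hatFcyc A u) (F J v)) (cong (λ x → + ãcount π A J *ℤ (x *ℤ F J v)) (sym (Fcyc≡hat A u)))))) ⟩
    ∑ (orbitReps n) (λ A → ∑ (allSubsets m) (λ J → + ãcount π A J *ℤ (Fcyc A u *ℤ F J v)))
      ≡⟨ sym (Δ-Fcyc-orbits π pπ u v mu mv) ⟩
    Δ (Fcyc (cDes π)) u v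
      ≡⟨ Δ-cong {f = Fcyc (cDes π)} {g = λ w → ∑ (B ∷ []) (λ X → + d B *ℤ hatFcyc X w)} (λ w _ → trans (Fcyc≡hat (cDes π) w)
           (trans (cong₂ (λ a b → + a *ℤ b) (d-orbit {cDes π} {B} o) (hat-orbit {cDes π} {B} o w)) (sym (ℤₚ.+-identityʳ _)))) u v ⟩
    Δ (λ w → ∑ (B ∷ []) (λ X → + d B *ℤ hatFcyc X w)) u v
      ≡⟨ Δ-∑ (B ∷ []) (λ _ → + d B) hatFcyc u v ⟩
    ∑ (B ∷ []) (λ X → + d B *ℤ Δ (hatFcyc X) u v)
      ≡⟨ ℤₚ.+-identityʳ _ ⟩
    + d B *ℤ Δ (hatFcyc B) u v ∎
    where
    arr : ∀ a b c e → (a *ℤ b) *ℤ (c *ℤ e) ≡ b *ℤ ((a *ℤ c) *ℤ e)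
    arr = solve-∀ℤ

  representative-∈ : ∀ A → NonemptyProper A → proj₁ (representative A) ∈ orbitReps n
  representative-∈ A np = ∈ₚ.∈-filter⁺ (Boolₚ.T? ∘ (λ A → nonemptyᵇ A ∧ properᵇ A ∧ isRepᵇ A)) (allSubsets-complete R)
      (≡true⇒T (∧⁺ (proj₁ (∧⁻ {nonemptyᵇ R} np')) (∧⁺ (proj₂ (∧⁻ {nonemptyᵇ R} np')) rp)))
    where
    R = proj₁ (representative A)
    o = proj₁ (proj₂ (representative A))
    rp = proj₁ (proj₂ (proj₂ (representative A)))
    np' : npᵇ R ≡ true
    np' = subst (λ Z → npᵇ Z ≡ true) (proj₂ o) (np-rotIter (proj₁ o) A (T⇒≡true np))

  T̃-orbit : ∀ π J {A A'} → InOrbit A A' → T̃ π A J ≡ T̃ π A' J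
  T̃-orbit π J {A} {A'} o = cong₂ _*_ (d-orbit {A} {A'} o) (ã-orbit π {A} {A'} J o)

  -- The right-hand side of `expansion` does not mention π, so the two coefficient families have
  -- difference zero by `divisible` with modulus 0. They are compared at the representative of A,
  -- and d_A is cancelled.
  ã-independent : ∀ (B : Vec Bool n) (π π' : Vec (Fin n) n) → IsPerm π → IsPerm π' → InOrbit (cDes π) B → InOrbit (cDes π') B →
    ∀ A → NonemptyProper A → ∀ J → ãcount π A J ≡ ãcount π' A J
  ã-independent B π π' p p' o o' A np J = ℕₚ.*-cancelˡ-≡ (ãcount π A J) (ãcount π' A J) (d A) {{d-nonZero A}} (begin
      T̃ π A J      ≡⟨ T̃-orbit π J {A} {R} oR ⟩
      T̃ π R J      ≡⟨ ℤₚ.+-injective (ℤₚ.i-j≡0⇒i≡j (+ T̃ π R J) (+ T̃ π' R J) (trans (proj₂ difference) (ℤₚ.*-zeroʳ (proj₁ difference)))) ⟩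
      T̃ π' R J     ≡⟨ sym (T̃-orbit π' J {A} {R} oR) ⟩
      T̃ π' A J     ∎)
    where
    R = proj₁ (representative A)
    oR = proj₁ (proj₂ (representative A))
    arr : ∀ a b c → (a -ℤ b) *ℤ c ≡ a *ℤ c +ℤ (-ℤ + 1) *ℤ (b *ℤ c)
    arr = solve-∀ℤ
    arr' : ∀ a → a +ℤ (-ℤ + 1) *ℤ a ≡ + 0
    arr' = solve-∀ℤ
    S : Vec (Fin n) n → Word n → Word n → ℤ
    S π u v = ∑ (orbitReps n) (λ A → ∑ (allSubsets m) (λ J → + T̃ π A J *ℤ (hatFcyc A u *ℤ F J v)))
    difference : Div (+ 0) (+ T̃ π R J -ℤ + T̃ π' R J)
    difference = divisible (+ 0) (λ A J → + T̃ π A J -ℤ + T̃ π' A J) (λ u v mu mv → subst (Div (+ 0)) (sym (begin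
        ∑ (orbitReps n) (λ A → ∑ (allSubsets m) (λ J → (+ T̃ π A J -ℤ + T̃ π' A J) *ℤ (hatFcyc A u *ℤ F J v)))
          ≡⟨ ∑-cong (orbitReps n) (λ A → trans (∑-cong (allSubsets m) (λ J → arr (+ T̃ π A J) (+ T̃ π' A J) (hatFcyc A u *ℤ F J v)))
               (∑-+ (allSubsets m) (λ J → + T̃ π A J *ℤ (hatFcyc A u *ℤ F J v)) (λ J → (-ℤ + 1) *ℤ (+ T̃ π' A J *ℤ (hatFcyc A u *ℤ F J v))))) ⟩
        ∑ (orbitReps n) (λ A → ∑ (allSubsets m) (λ J → + T̃ π A J *ℤ (hatFcyc A u *ℤ F J v)) +ℤ
                               ∑ (allSubsets m) (λ J → (-ℤ + 1) *ℤ (+ T̃ π' A J *ℤ (hatFcyc A u *ℤ F J v))))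
          ≡⟨ ∑-+ (orbitReps n) (λ A → ∑ (allSubsets m) (λ J → + T̃ π A J *ℤ (hatFcyc A u *ℤ F J v)))
               (λ A → ∑ (allSubsets m) (λ J → (-ℤ + 1) *ℤ (+ T̃ π' A J *ℤ (hatFcyc A u *ℤ F J v)))) ⟩
        S π u v +ℤ ∑ (orbitReps n) (λ A → ∑ (allSubsets m) (λ J → (-ℤ + 1) *ℤ (+ T̃ π' A J *ℤ (hatFcyc A u *ℤ F J v))))
          ≡⟨ cong (S π u v +ℤ_) (sym (trans (∑-*ˡ (orbitReps n) (-ℤ + 1) (λ A → ∑ (allSubsets m) (λ J → + T̃ π' A J *ℤ (hatFcyc A u *ℤ F J v))))
               (∑-cong (orbitReps n) (λ A → ∑-*ˡ (allSubsets m) (-ℤ + 1) (λ J → + T̃ π' A J *ℤ (hatFcyc A u *ℤ F J v)))))) ⟩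
        S π u v +ℤ (-ℤ + 1) *ℤ S π' u v
          ≡⟨ cong₂ (λ a b → a +ℤ (-ℤ + 1) *ℤ b) (expansion B π p o u v mu mv) (expansion B π' p' o' u v mu mv) ⟩
        + d B *ℤ Δ (hatFcyc B) u v +ℤ (-ℤ + 1) *ℤ (+ d B *ℤ Δ (hatFcyc B) u v)
          ≡⟨ arr' (+ d B *ℤ Δ (hatFcyc B) u v) ⟩
        + 0 ∎)) (Div-0 (+ 0))) (representative-∈ A np) J

  -- By `expansion` the series with coefficients d_A ã takes values divisible by d_B; `divisible`
  -- transfers this to the coefficients, and then d_B is cancelled from the expansion.
  structure-constants : ∀ (B : Vec Bool n) (π : Vec (Fin n) n) → IsPerm π → InOrbit (cDes π) B →
    Σ (Vec Bool n → Vec Bool m → ℕ) λ c →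
      (∀ A → NonemptyProper A → ∀ J → c A J * d B ≡ d A * ãcount π A J) ×
      (∀ (u v : Word n) → Monotone u → Monotone v →
        Δ (hatFcyc B) u v ≡ ∑ (orbitReps n) (λ A → ∑ (allSubsets m) (λ J → + c A J *ℤ (hatFcyc A u *ℤ F J v))))
  structure-constants B π p o = c , integral , expand
    where
    c : Vec Bool n → Vec Bool m → ℕ
    c A J = ℕ._/_ (T̃ π A J) (d B) {{d-nonZero B}}
    exact : ∀ x → Div (+ d B) (+ x) → ℕ._/_ x (d B) {{d-nonZero B}} * d B ≡ x
    exact x (q , e) = trans (cong (_* d B) (trans (cong (λ y → ℕ._/_ y (d B) {{d-nonZero B}}) x≡) (DM.m*n/n≡m ℤ.∣ q ∣ (d B) {{d-nonZero B}}))) (sym x≡)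
      where
      x≡ : x ≡ ℤ.∣ q ∣ * d B
      x≡ = trans (cong ℤ.∣_∣ e) (ℤₚ.abs-* q (+ d B))
    onReps : ∀ {A} → A ∈ orbitReps n → ∀ J → c A J * d B ≡ T̃ π A J
    onReps {A} A∈ J = exact (T̃ π A J) (divisible (+ d B) (λ A J → + T̃ π A J)
      (λ u v mu mv → Δ (hatFcyc B) u v , trans (expansion B π p o u v mu mv) (ℤₚ.*-comm (+ d B) _)) A∈ J)
    integral : ∀ A → NonemptyProper A → ∀ J → c A J * d B ≡ d A * ãcount π A J
    integral A np J = let R = proj₁ (representative A) ; oR = proj₁ (proj₂ (representative A)) ; eq = T̃-orbit π J {A} {R} oR in
      trans (cong (λ x → ℕ._/_ x (d B) {{d-nonZero B}} * d B) eq) (trans (onReps (representative-∈ A np) J) (sym eq))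
    expand : ∀ (u v : Word n) → Monotone u → Monotone v →
        Δ (hatFcyc B) u v ≡ ∑ (orbitReps n) (λ A → ∑ (allSubsets m) (λ J → + c A J *ℤ (hatFcyc A u *ℤ F J v)))
    expand u v mu mv = ℤₚ.*-cancelˡ-≡ (+ d B) _ _ {{d-nonZero B}} (begin
      + d B *ℤ Δ (hatFcyc B) u v
        ≡⟨ sym (expansion B π p o u v mu mv) ⟩
      ∑ (orbitReps n) (λ A → ∑ (allSubsets m) (λ J → + T̃ π A J *ℤ (hatFcyc A u *ℤ F J v)))
        ≡⟨ ∑-cong-∈ (orbitReps n) (λ {A} A∈ → trans (∑-cong (allSubsets m) (λ J → trans
             (cong (λ x → + x *ℤ (hatFcyc A u *ℤ F J v)) (sym (onReps A∈ J))) (trans (cong (_*ℤ (hatFcyc A u *ℤ F J v)) (ℤₚ.pos-* (c A J) (d B)))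
               (arr (+ c A J) (+ d B) (hatFcyc A u *ℤ F J v))))) (sym (∑-*ˡ (allSubsets m) (+ d B) (λ J → + c A J *ℤ (hatFcyc A u *ℤ F J v))))) ⟩
      ∑ (orbitReps n) (λ A → + d B *ℤ ∑ (allSubsets m) (λ J → + c A J *ℤ (hatFcyc A u *ℤ F J v)))
        ≡⟨ sym (∑-*ˡ (orbitReps n) (+ d B) (λ A → ∑ (allSubsets m) (λ J → + c A J *ℤ (hatFcyc A u *ℤ F J v)))) ⟩
      + d B *ℤ ∑ (orbitReps n) (λ A → ∑ (allSubsets m) (λ J → + c A J *ℤ (hatFcyc A u *ℤ F J v))) ∎)
      where
      arr : ∀ a b x → (a *ℤ b) *ℤ x ≡ b *ℤ (a *ℤ x)
      arr = solve-∀ℤ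

  -- Rotate B so that it contains n; the permutation whose descending runs take successive increasing blocks of values does it.
  cDes-surjective : ∀ (B : Vec Bool n) → NonemptyProper B → ∃[ π ] (IsPerm π × InOrbit (cDes π) B)
  cDes-surjective B np = std , std-perm , subst (λ Z → InOrbit Z B) (sym cDes≡) (orbit-sym {B} {B'} (s , refl))
    where
    s = proj₁ (closed B (proj₁ (∧⁻ {nonemptyᵇ B} (T⇒≡true np))))
    B' = rotIter s B
    B'last : lookup B' (fromℕ m) ≡ true
    B'last = proj₂ (closed B (proj₁ (∧⁻ {nonemptyᵇ B} (T⇒≡true np))))
    f : Word n
    f = wordOf (λ i → not (lookup B' (inject₁ i)))
    mf : Monotone f
    mf = wordOf-monotone (λ i → not (lookup B' (inject₁ i)))
    -- `f` grows exactly after the positions outside B', so it numbers the descending runs; inside a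
    -- run the second component decreases.
    key : Fin n → ℕ
    key i = f i * n + (m ∸ toℕ i)
    rem<n : ∀ i → m ∸ toℕ i < n
    rem<n i = s≤s (ℕₚ.m∸n≤m m (toℕ i))
    key-inj : ∀ i j → key i ≡ key j → i ≡ j
    key-inj i j e = Finₚ.toℕ-injective (ℕₚ.∸-cancelˡ-≡ (ℕₚ.≤-pred (Finₚ.toℕ<n i)) (ℕₚ.≤-pred (Finₚ.toℕ<n j))
      (proj₂ (lex-inj n (f i) _ (f j) _ (rem<n i) (rem<n j) e)))
    open Standardise key key-inj
    key-asc : ∀ i → lookup B' (inject₁ i) ≡ false → key (inject₁ i) < key (fsuc i)
    key-asc i e = lex-<⁺ n (f (inject₁ i)) _ (f (fsuc i)) _ (rem<n (inject₁ i)) (wordOf-strict (λ i → not (lookup B' (inject₁ i))) i (cong not e))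
    key-des : ∀ i → lookup B' (inject₁ i) ≡ true → key (fsuc i) < key (inject₁ i)
    key-des i e = subst (λ x → f (fsuc i) * n + (m ∸ toℕ (fsuc i)) < x * n + (m ∸ toℕ (inject₁ i))) (sym (wordOf-weak (λ i → not (lookup B' (inject₁ i))) i (cong not e)))
      (ℕₚ.+-monoʳ-< (f (fsuc i) * n) (ℕₚ.∸-monoʳ-< (s≤s (ℕₚ.≤-reflexive (Finₚ.toℕ-inject₁ i))) (Finₚ.toℕ<n i)))
    -- B' is proper and contains n, so some smaller position is an ascent. Hence the last run lies
    -- above the first, which makes n a cyclic descent.
    key-last : key fzero < key (fromℕ m)
    key-last with proper⁻ B' (proj₂ (∧⁻ {nonemptyᵇ B'} (np-rotIter s B (T⇒≡true np))))
    ... | i₀ , e₀ with last? i₀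
    ...   | lst   = ⊥-elim (false≢true (trans (sym e₀) B'last))
    ...   | inj j = lex-<⁺ n (f fzero) _ (f (fromℕ m)) _ (rem<n fzero)
              (ℕₚ.≤-<-trans (mf fzero (inject₁ j) z≤n) (ℕₚ.<-≤-trans (wordOf-strict (λ i → not (lookup B' (inject₁ i))) j (cong not e₀))
                (mf (fsuc j) (fromℕ m) (ℕₚ.≤-trans (ℕₚ.≤-pred (Finₚ.toℕ<n (fsuc j))) (ℕₚ.≤-reflexive (sym (Finₚ.toℕ-fromℕ m)))))))
    bit : ∀ i → lookup (cDes std) i ≡ lookup B' i
    bit i with last? i
    ... | lst = trans (lookup-cDes std (fromℕ m)) (trans (cong (λ k → toℕ (lookup std k) <ᵇ toℕ (lookup std (fromℕ m))) nxt-last)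
            (trans (<ᵇ⁺ (std-mono fzero (fromℕ m) key-last)) (sym B'last)))
    ... | inj j = trans (lookup-cDes std (inject₁ j)) (trans (cong (λ k → toℕ (lookup std k) <ᵇ toℕ (lookup std (inject₁ j))) (nxt-inject₁ j)) bits)
      where
      bits : (toℕ (lookup std (fsuc j)) <ᵇ toℕ (lookup std (inject₁ j))) ≡ lookup B' (inject₁ j)
      bits with lookup B' (inject₁ j) in e
      ... | true  = <ᵇ⁺ (std-mono (fsuc j) (inject₁ j) (key-des j e))
      ... | false = ≡false (λ lt → ℕₚ.<-asym (std-mono (inject₁ j) (fsuc j) (key-asc j e)) (<ᵇ⁻ {toℕ (lookup std (fsuc j))} lt))
    cDes≡ : cDes std ≡ B'
    cDes≡ = vec-ext (cDes std) B' bit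

-- Compositions as patterns of equal neighbours

-- A bit is true if its letter equals the next one. The final bit is always false, so a rotated
-- pattern never joins the last letter to the first.
adj : List ℕ → List Bool
adj []           = []
adj (x ∷ [])     = false ∷ []
adj (x ∷ y ∷ ys) = (x ≡ᵇ y) ∷ adj (y ∷ ys)

blockLengths : ℕ → List Bool → List ℕ
blockLengths c []           = []
blockLengths c (true ∷ bs)  = blockLengths (suc c) bs
blockLengths c (false ∷ bs) = c ∷ blockLengths 1 bs

runs≡ : ∀ xs → runs xs ≡ blockLengths 1 (adj xs)
runs≡ []       = refl
runs≡ (x ∷ xs) = go x 1 xs
  where
  go : ∀ x c ys → runsFrom x c ys ≡ blockLengths c (adj (x ∷ ys))
  go x c []       = refl
  go x c (y ∷ ys) with x ≡ᵇ y in e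
  ... | true  = subst (λ z → runsFrom x (suc c) ys ≡ blockLengths (suc c) (adj (z ∷ ys))) (≡ᵇ⁻ {x} {y} e) (go x (suc c) ys)
  ... | false = cong (c ∷_) (go y 1 ys)

-- Patterns that stop at the end of a block. On them `unrun` inverts `blockLengths 1`, and
-- concatenating patterns concatenates compositions; thus rotating a composition by parts becomes
-- rotating a pattern by letters.
data Closed : List Bool → Set where
  []    : Closed []
  false : ∀ {bs} → Closed bs → Closed (false ∷ bs)
  true  : ∀ {b bs} → Closed (b ∷ bs) → Closed (true ∷ b ∷ bs)

unrun : List ℕ → List Bool
unrun []       = []
unrun (c ∷ cs) = List.replicate (pred c) true ++ false ∷ unrun cs

unrun-++ : ∀ as bs → unrun (as ++ bs) ≡ unrun as ++ unrun bs
unrun-++ []       bs = refl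
unrun-++ (a ∷ as) bs = trans (cong (λ l → List.replicate (pred a) true ++ false ∷ l) (unrun-++ as bs)) (sym (Listₚ.++-assoc (List.replicate (pred a) true) (false ∷ unrun as) (unrun bs)))

unrun-closed : ∀ cs → Closed (unrun cs)
unrun-closed []       = []
unrun-closed (c ∷ cs) = go (pred c)
  where
  go : ∀ k → Closed (List.replicate k true ++ false ∷ unrun cs)
  go zero          = false (unrun-closed cs)
  go (suc zero)    = true (go zero)
  go (suc (suc k)) = true (go (suc k))

unrun-blockLengths : ∀ p → Closed p → unrun (blockLengths 1 p) ≡ p
unrun-blockLengths []      [] = refl
unrun-blockLengths (b ∷ p) c  = go 0 c
  where
  go : ∀ k {b p} → Closed (b ∷ p) → unrun (blockLengths (suc k) (b ∷ p)) ≡ List.replicate k true ++ b ∷ p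
  go k (false {p} c) = cong (λ l → List.replicate k true ++ false ∷ l) (unrun-blockLengths p c)
  go k (true {b} {p} c) = trans (go (suc k) c) (shift k (b ∷ p))
    where
    shift : ∀ k (l : List Bool) → true ∷ (List.replicate k true ++ l) ≡ List.replicate k true ++ true ∷ l
    shift zero    l = refl
    shift (suc k) l = cong (true ∷_) (shift k l)

blockLengths-++ : ∀ p q → Closed p → blockLengths 1 (p ++ q) ≡ blockLengths 1 p ++ blockLengths 1 q
blockLengths-++ []      q [] = refl
blockLengths-++ (b ∷ p) q c  = go 1 c
  where
  go : ∀ k {b p} → Closed (b ∷ p) → blockLengths k ((b ∷ p) ++ q) ≡ blockLengths k (b ∷ p) ++ blockLengths 1 q
  go k (false {p} c)    = cong (k ∷_) (blockLengths-++ p q c)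
  go k (true {b} {p} c) = go (suc k) c

adj-closed : ∀ xs → Closed (adj xs)
adj-closed []           = []
adj-closed (x ∷ [])     = false []
adj-closed (x ∷ y ∷ ys) = cons (x ≡ᵇ y) ys (adj-closed (y ∷ ys))
  where
  cons : ∀ b ys → Closed (adj (y ∷ ys)) → Closed (b ∷ adj (y ∷ ys))
  cons false ys      c = false c
  cons true  []      c = true c
  cons true  (_ ∷ _) c = true c

adj≡unrun : ∀ xs → adj xs ≡ unrun (runs xs)
adj≡unrun xs = sym (trans (cong unrun (runs≡ xs)) (unrun-blockLengths (adj xs) (adj-closed xs)))

-- The product word has blocks that refine those of the first word, so a cut between blocks of `u`
-- is also a cut between blocks of the product word.
zipAnd-closed : ∀ p q → Closed p → length p ≡ length q → Closed (zipWith _∧_ p q)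
zipAnd-closed []                q           []       _ = []
zipAnd-closed (false ∷ p)       (c ∷ q)     (false cl) l = false (zipAnd-closed p q cl (ℕₚ.suc-injective l))
zipAnd-closed (true ∷ b ∷ p)    (false ∷ c ∷ q) (true cl) l = false (zipAnd-closed (b ∷ p) (c ∷ q) cl (ℕₚ.suc-injective l))
zipAnd-closed (true ∷ b ∷ p)    (true ∷ c ∷ q) (true cl) l = true (zipAnd-closed (b ∷ p) (c ∷ q) cl (ℕₚ.suc-injective l))

zipWith-++ : ∀ {C : Set} (f : A → B → C) as as' bs bs' → length as ≡ length bs →
  zipWith f (as ++ as') (bs ++ bs') ≡ zipWith f as bs ++ zipWith f as' bs'
zipWith-++ f []       as' []       bs' _ = refl
zipWith-++ f (a ∷ as) as' (b ∷ bs) bs' l = cong (f a b ∷_) (zipWith-++ f as as' bs bs' (ℕₚ.suc-injective l))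

adjF : ∀ {m} → Word (suc m) → Fin (suc m) → Bool
adjF {zero}  w i        = false
adjF {suc m} w fzero    = w fzero ≡ᵇ w (fsuc fzero)
adjF {suc m} w (fsuc i) = adjF (w ∘ fsuc) i

adjF-inject₁ : ∀ {m} (w : Word (suc m)) i → adjF w (inject₁ i) ≡ (w (inject₁ i) ≡ᵇ w (fsuc i))
adjF-inject₁ {suc m} w fzero    = refl
adjF-inject₁ {suc m} w (fsuc i) = adjF-inject₁ (w ∘ fsuc) i

adjF-last : ∀ {m} (w : Word (suc m)) → adjF w (fromℕ m) ≡ false
adjF-last {zero}  w = refl
adjF-last {suc m} w = adjF-last (w ∘ fsuc)

adj-tabulate : ∀ {m} (w : Word (suc m)) → adj (List.tabulate w) ≡ List.tabulate (adjF w)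
adj-tabulate {zero}  w = refl
adj-tabulate {suc m} w = cong ((w fzero ≡ᵇ w (fsuc fzero)) ∷_) (adj-tabulate (w ∘ fsuc))

tabulate-injective : ∀ {k} (f g : Fin k → A) → List.tabulate f ≡ List.tabulate g → ∀ i → f i ≡ g i
tabulate-injective f g e fzero    = Listₚ.∷-injectiveˡ e
tabulate-injective f g e (fsuc i) = tabulate-injective (f ∘ fsuc) (g ∘ fsuc) (Listₚ.∷-injectiveʳ e) i

zipWith-tabulate : ∀ {C : Set} {k} (f : A → B → C) (a : Fin k → A) (b : Fin k → B) →
  zipWith f (List.tabulate a) (List.tabulate b) ≡ List.tabulate (λ i → f (a i) (b i))
zipWith-tabulate {k = zero}  f a b = refl
zipWith-tabulate {k = suc k} f a b = cong (f (a fzero) (b fzero) ∷_) (zipWith-tabulate f (a ∘ fsuc) (b ∘ fsuc))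

comp⇒adj : ∀ {m} (v v' : Word (suc m)) → comp v ≡ comp v' → ∀ i → (v (inject₁ i) ≡ᵇ v (fsuc i)) ≡ (v' (inject₁ i) ≡ᵇ v' (fsuc i))
comp⇒adj v v' e i = trans (sym (adjF-inject₁ v i)) (trans (tabulate-injective (adjF v) (adjF v') (trans (sym (adj-tabulate v))
  (trans (adj≡unrun (List.tabulate v)) (trans (cong unrun e) (trans (sym (adj≡unrun (List.tabulate v'))) (adj-tabulate v'))))) (inject₁ i)) (adjF-inject₁ v' i))

adj⇒comp : ∀ {m} (v v' : Word (suc m)) → (∀ i → (v (inject₁ i) ≡ᵇ v (fsuc i)) ≡ (v' (inject₁ i) ≡ᵇ v' (fsuc i))) → comp v ≡ comp v'
adj⇒comp v v' e = trans (runs≡ (List.tabulate v)) (trans (cong (blockLengths 1) (trans (adj-tabulate v) (trans (Listₚ.tabulate-cong bits) (sym (adj-tabulate v')))))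
  (sym (runs≡ (List.tabulate v'))))
  where
  bits : ∀ i → adjF v i ≡ adjF v' i
  bits i with last? i
  ... | inj j = trans (adjF-inject₁ v j) (trans (e j) (sym (adjF-inject₁ v' j)))
  ... | lst   = trans (adjF-last v) (sym (adjF-last v'))

≡ᵇ-everywhere : ∀ {m} (v v' : Word (suc m)) → Monotone v → Monotone v' →
  (∀ i → (v (inject₁ i) ≡ᵇ v (fsuc i)) ≡ (v' (inject₁ i) ≡ᵇ v' (fsuc i))) → ∀ a b → (v a ≡ᵇ v b) ≡ (v' a ≡ᵇ v' b)
≡ᵇ-everywhere {m} v v' mv mv' e a b = bool-iff
  (λ p → ≡ᵇ⁺ (go v v' mv e a b (≡ᵇ⁻ {v a} p))) (λ p → ≡ᵇ⁺ (go v' v mv' (λ i → sym (e i)) a b (≡ᵇ⁻ {v' a} p)))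
  where
  up : ∀ (v v' : Word (suc m)) → Monotone v → (∀ i → (v (inject₁ i) ≡ᵇ v (fsuc i)) ≡ (v' (inject₁ i) ≡ᵇ v' (fsuc i))) →
    ∀ a b → toℕ a ≤ toℕ b → v a ≡ v b → v' a ≡ v' b
  up v v' mv e a b a≤b = chain (λ k → v a ≡ v k → v' a ≡ v' k) a (λ _ → refl)
    (λ k a≤k IH va≡ → let
        p = mv a (inject₁ k) (subst (toℕ a ≤_) (sym (Finₚ.toℕ-inject₁ k)) a≤k)
        va≡k = ℕₚ.≤-antisym p (ℕₚ.≤-trans (monotone-step mv k) (ℕₚ.≤-reflexive (sym va≡)))
      in trans (IH va≡k) (≡ᵇ⁻ {v' (inject₁ k)} (trans (sym (e k)) (≡ᵇ⁺ (trans (sym va≡k) va≡))))) b a≤b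
  go : ∀ (v v' : Word (suc m)) → Monotone v → (∀ i → (v (inject₁ i) ≡ᵇ v (fsuc i)) ≡ (v' (inject₁ i) ≡ᵇ v' (fsuc i))) →
    ∀ a b → v a ≡ v b → v' a ≡ v' b
  go v v' mv e a b eq with ℕₚ.≤-total (toℕ a) (toℕ b)
  ... | inj₁ a≤b = up v v' mv e a b a≤b eq
  ... | inj₂ b≤a = sym (up v v' mv e b a b≤a (sym eq))

-- The coproduct is quasisymmetric in the second alphabet

identity : ∀ n → Vec (Fin n) n
identity n = Vec.tabulate id

identity-perm : ∀ n → IsPerm (identity n)
identity-perm n i j e = trans (sym (Vecₚ.lookup∘tabulate id i)) (trans e (Vecₚ.lookup∘tabulate id j))

-- Standardisation with π the identity, which has no descents, so the condition on the ranks is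
-- void. The new range of summation does not depend on `v`, which makes different `v` comparable
-- term by term.
Δ-standard : ∀ {m} (f : Series (suc m)) (u v : Word (suc m)) → Monotone u → Monotone v → Δ f u v ≡
  ∑ (allVecsOf (allFin (suc m)) (suc m)) (λ σ → ⟦ isPermᵇ σ ∧ (FFᵇ (desᵇ σ) u ∧ FFᵇ (desᵇ (compose (identity (suc m)) (inverse σ))) v) ⟧ *ℤ f (rk u (Vec.map v σ)))
Δ-standard {m} f u v mu mv = trans (Δ≡ f u v) (trans
  (∑-cong (allVecsOf (upTo (bound v)) (suc m)) (λ q → cong (λ b → ⟦ b ⟧ *ℤ f (rk u q)) (sym (trans
    (cong ((sameContentᵇ v q ∧ inBlocksᵇ u q) ∧_) (FF⁺ (desᵇ (identity (suc m))) (rk u q) (λ i d → ⊥-elim (noDescent i d)))) (Boolₚ.∧-identityʳ _)))))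
  (sym (standardisation-sum (identity (suc m)) (identity-perm (suc m)) u v mu mv (λ q → f (rk u q)))))
  where
  noDescent : ∀ i → desᵇ (identity (suc m)) i ≡ true → ⊥
  noDescent i d = ℕₚ.<⇒≱ (subst₂ (λ a b → toℕ a < toℕ b) (Vecₚ.lookup∘tabulate id (fsuc i)) (Vecₚ.lookup∘tabulate id (inject₁ i))
    (<ᵇ⁻ {toℕ (lookup (identity (suc m)) (fsuc i))} d)) (inject₁≤suc i)

<ᵇ-from-≡ᵇ : ∀ {a b a' b'} → a ≤ b → a' ≤ b' → (a ≡ᵇ b) ≡ (a' ≡ᵇ b') → (a <ᵇ b) ≡ (a' <ᵇ b')
<ᵇ-from-≡ᵇ {a} {b} {a'} {b'} a≤b a'≤b' e = bool-iff
  (λ p → <ᵇ⁺ (ℕₚ.≤∧≢⇒< a'≤b' (λ q → ℕₚ.<⇒≢ (<ᵇ⁻ {a} p) (≡ᵇ⁻ {a} (trans e (≡ᵇ⁺ q))))))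
  (λ p → <ᵇ⁺ (ℕₚ.≤∧≢⇒< a≤b (λ q → ℕₚ.<⇒≢ (<ᵇ⁻ {a'} p) (≡ᵇ⁻ {a'} (trans (sym e) (≡ᵇ⁺ q))))))

FF-comp : ∀ {m} (J : Fin m → Bool) (v v' : Word (suc m)) → Monotone v → Monotone v' → comp v ≡ comp v' → FFᵇ J v ≡ FFᵇ J v'
FF-comp {m} J v v' mv mv' e = allᵇ-cong-∈ _ _ (allFin m) (λ {i} _ → cong (not (J i) ∨_)
  (<ᵇ-from-≡ᵇ (monotone-step mv i) (monotone-step mv' i) (comp⇒adj v v' e i)))

F-isQSym : ∀ {m} J → IsQSym (F {suc m} J)
F-isQSym J v v' mv mv' e = cong ⟦_⟧ (FF-comp (lookup J) v v' mv mv' e)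

-- In `Δ-standard` the word `v` enters through the strictness test, and through the pattern of equal
-- neighbours of the product word. Both depend only on the composition of `v`.
Δ-qsym : ∀ {m} (f : Series (suc m)) → IsQSym f → ∀ u → Monotone u → IsQSym (Δ f u)
Δ-qsym {m} f qf u mu v v' mv mv' e = trans (Δ-standard f u v mu mv) (trans
  (∑-cong (allVecsOf (allFin (suc m)) (suc m)) (λ σ → cong₂ (λ b x → ⟦ isPermᵇ σ ∧ (FFᵇ (desᵇ σ) u ∧ b) ⟧ *ℤ x)
    (FF-comp (desᵇ (compose (identity (suc m)) (inverse σ))) v v' mv mv' e)
    (qf (rk u (Vec.map v σ)) (rk u (Vec.map v' σ)) (rk-monotone u (Vec.map v σ)) (rk-monotone u (Vec.map v' σ)) (adj⇒comp (rk u (Vec.map v σ)) (rk u (Vec.map v' σ)) (λ i →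
      trans (rk-≡ᵇ u (Vec.map v σ) i) (trans (cong ((u (inject₁ i) ≡ᵇ u (fsuc i)) ∧_) (trans
          (cong₂ _≡ᵇ_ (Vecₚ.lookup-map (inject₁ i) v σ) (Vecₚ.lookup-map (fsuc i) v σ))
          (trans (≡ᵇ-everywhere v v' mv mv' (comp⇒adj v v' e) (lookup σ (inject₁ i)) (lookup σ (fsuc i)))
            (sym (cong₂ _≡ᵇ_ (Vecₚ.lookup-map (inject₁ i) v' σ) (Vecₚ.lookup-map (fsuc i) v' σ))))))
        (sym (rk-≡ᵇ u (Vec.map v' σ) i))))))))
  (sym (Δ-standard f u v' mu mv')))

-- The coproduct preserves cyclic quasisymmetry in the first alphabet

toList-rotIter : ∀ {k} (v : Vec A k) as bs → toList v ≡ as ++ bs → toList (rotIter (length as) v) ≡ bs ++ as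
toList-rotIter v []       bs e = trans e (sym (Listₚ.++-identityʳ bs))
toList-rotIter (x ∷ v) (a ∷ as) bs e = begin
  toList (rotL (rotIter (length as) (x ∷ v)))      ≡⟨ cong toList (sym (Rot.rotIter-rotL (length as) (x ∷ v))) ⟩
  toList (rotIter (length as) (v ∷ʳ x))            ≡⟨ toList-rotIter (v ∷ʳ x) as (bs ++ a ∷ []) (trans (snoc v x) (trans (cong₂ (λ l y → l ++ y ∷ []) (Listₚ.∷-injectiveʳ e) (Listₚ.∷-injectiveˡ e)) (Listₚ.++-assoc as bs (a ∷ [])))) ⟩
  (bs ++ a ∷ []) ++ as                             ≡⟨ Listₚ.++-assoc bs (a ∷ []) as ⟩
  bs ++ a ∷ as                                     ∎
  where
  snoc : ∀ {k} (v : Vec _ k) x → toList (v ∷ʳ x) ≡ toList v ++ x ∷ []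
  snoc []      x = refl
  snoc (y ∷ v) x = cong (y ∷_) (snoc v x)

module CyclicQSym {m : ℕ} where
  open Mod m
  open Rot {m}

  -- The last letter is compared with the first so that the pattern rotates along with the word. The
  -- false final bit of the pattern of `u` masks that comparison.
  cyc : (ℕ → ℕ → Bool) → Vec ℕ n → Vec Bool n
  cyc r q = Vec.zipWith r q (rotL q)

  lookup-cyc : ∀ r q i → lookup (cyc r q) i ≡ r (lookup q i) (lookup q (nxt i))
  lookup-cyc r q i = trans (Vecₚ.lookup-zipWith r i q (rotL q)) (cong (r (lookup q i)) (lookup-rotL q i))

  cyc-rotIter : ∀ r s q → cyc r (rotIter s q) ≡ rotIter s (cyc r q)
  cyc-rotIter r zero    q = refl
  cyc-rotIter r (suc s) q = trans (vec-ext _ _ (λ i → begin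
    lookup (cyc r (rotL q')) i                                   ≡⟨ lookup-cyc r (rotL q') i ⟩
    r (lookup (rotL q') i) (lookup (rotL q') (nxt i))            ≡⟨ cong₂ r (lookup-rotL q' i) (lookup-rotL q' (nxt i)) ⟩
    r (lookup q' (nxt i)) (lookup q' (nxt (nxt i)))              ≡⟨ sym (lookup-cyc r q' (nxt i)) ⟩
    lookup (cyc r q') (nxt i)                                    ≡⟨ sym (lookup-rotL (cyc r q') i) ⟩
    lookup (rotL (cyc r q')) i                                   ∎)) (cong rotL (cyc-rotIter r s q))
    where
    q' = rotIter s q

  adj-rk : ∀ (u : Word n) q → adj (List.tabulate (rk u q)) ≡ zipWith _∧_ (adj (List.tabulate u)) (toList (cyc _≡ᵇ_ q))
  adj-rk u q = begin
    adj (List.tabulate (rk u q))                                                        ≡⟨ adj-tabulate (rk u q) ⟩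
    List.tabulate (adjF (rk u q))                                                       ≡⟨ Listₚ.tabulate-cong bits ⟩
    List.tabulate (λ i → adjF u i ∧ lookup (cyc _≡ᵇ_ q) i)                               ≡⟨ sym (zipWith-tabulate _∧_ (adjF u) (lookup (cyc _≡ᵇ_ q))) ⟩
    zipWith _∧_ (List.tabulate (adjF u)) (List.tabulate (lookup (cyc _≡ᵇ_ q)))           ≡⟨ sym (cong₂ (zipWith _∧_) (adj-tabulate u) (toList-lookup (cyc _≡ᵇ_ q))) ⟩
    zipWith _∧_ (adj (List.tabulate u)) (toList (cyc _≡ᵇ_ q))                            ∎
    where
    bits : ∀ i → adjF (rk u q) i ≡ adjF u i ∧ lookup (cyc _≡ᵇ_ q) i
    bits i with last? i
    ... | inj j = trans (adjF-inject₁ (rk u q) j) (trans (rk-≡ᵇ u q j) (cong₂ _∧_ (sym (adjF-inject₁ u j))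
            (sym (trans (lookup-cyc _≡ᵇ_ q (inject₁ j)) (cong (λ k → lookup q (inject₁ j) ≡ᵇ lookup q k) (nxt-inject₁ j))))))
    ... | lst   = trans (adjF-last (rk u q)) (sym (cong (_∧ lookup (cyc _≡ᵇ_ q) (fromℕ m)) (adjF-last u)))

  imp : Bool → Bool → Bool
  imp a b = not a ∨ b

  blocks≡ : ∀ (u : Word n) q → Monotone u → inBlocksᵇ u q ≡ allᵇ id (zipWith imp (adj (List.tabulate u)) (toList (cyc _≤ᵇ_ q)))
  blocks≡ u q mu = trans (bool-iff to from) (sym (cong (allᵇ id) (trans (cong₂ (zipWith imp) (adj-tabulate u) (toList-lookup (cyc _≤ᵇ_ q)))
    (zipWith-tabulate imp (adjF u) (lookup (cyc _≤ᵇ_ q))))))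
    where
    b : Fin n → Bool
    b i = imp (adjF u i) (lookup (cyc _≤ᵇ_ q) i)
    b-inj : ∀ j → b (inject₁ j) ≡ imp (u (inject₁ j) ≡ᵇ u (fsuc j)) (lookup q (inject₁ j) ≤ᵇ lookup q (fsuc j))
    b-inj j = cong₂ imp (adjF-inject₁ u j) (trans (lookup-cyc _≤ᵇ_ q (inject₁ j)) (cong (λ k → lookup q (inject₁ j) ≤ᵇ lookup q k) (nxt-inject₁ j)))
    to : inBlocksᵇ u q ≡ true → allᵇ id (List.tabulate b) ≡ true
    to e = allᵇ⁺ id (List.tabulate b) (λ x∈ → let (i , eq) = ∈ₚ.∈-tabulate⁻ {f = b} x∈ in trans eq (bit i))
      where
      bit : ∀ i → b i ≡ true
      bit i with last? i
      ... | inj j = trans (b-inj j) (⇒ᵇ⁺ {u (inject₁ j) ≡ᵇ u (fsuc j)} (λ p → ≤ᵇ⁺ (inBlocks⁻ u q e (inject₁ j) (fsuc j) (inject₁≤suc j) (≡ᵇ⁻ {u (inject₁ j)} p))))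
      ... | lst   = cong (λ a → imp a (lookup (cyc _≤ᵇ_ q) (fromℕ m))) (adjF-last u)
    from : allᵇ id (List.tabulate b) ≡ true → inBlocksᵇ u q ≡ true
    from e = inBlocks-step u q mu (λ j uj → ≤ᵇ⁻ {lookup q (inject₁ j)} (⇒ᵇ⁻ {u (inject₁ j) ≡ᵇ u (fsuc j)}
      (trans (sym (b-inj j)) (allᵇ⁻ id (List.tabulate b) e (∈ₚ.∈-tabulate⁺ {f = b} (inject₁ j)))) (≡ᵇ⁺ uj)))

  split-at : ∀ {k} (v : Vec A k) (as bs : List B) → length as + length bs ≡ k →
    Σ (List A) λ cs → Σ (List A) λ ds → toList v ≡ cs ++ ds × length as ≡ length cs × length bs ≡ length ds
  split-at v []       bs l = [] , toList v , refl , refl , trans l (sym (Vecₚ.length-toList v))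
  split-at (x ∷ v) (a ∷ as) bs l with split-at v as bs (ℕₚ.suc-injective l)
  ... | cs , ds , e , l₁ , l₂ = x ∷ cs , ds , cong (x ∷_) e , cong suc l₁ , l₂

  allᵇ-++-comm : ∀ (as bs : List Bool) → allᵇ id (as ++ bs) ≡ allᵇ id (bs ++ as)
  allᵇ-++-comm as bs = trans (app as bs) (trans (Boolₚ.∧-comm (allᵇ id as) (allᵇ id bs)) (sym (app bs as)))
    where
    app : ∀ as bs → allᵇ id (as ++ bs) ≡ allᵇ id as ∧ allᵇ id bs
    app []       bs = refl
    app (a ∷ as) bs = trans (cong (a ∧_) (app as bs)) (sym (Boolₚ.∧-assoc a (allᵇ id as) (allᵇ id bs)))

  length-adj : ∀ (u : Word n) → length (adj (List.tabulate u)) ≡ n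
  length-adj u = trans (cong length (adj-tabulate u)) (Listₚ.length-tabulate (adjF u))

  -- Rotating the composition of `u` by whole blocks rotates its pattern by a number `s` of letters;
  -- rotating each `q` by the same `s` is a bijection on the contributing words. Comparisons across
  -- the seam are masked by false bits of `u`, and the composition of the product word is again
  -- rotated by whole blocks.
  Δ-cqsym : ∀ (f : Series n) → IsCQSym f → ∀ v → IsCQSym (λ u → Δ f u v)
  Δ-cqsym f cf v u u' mu mu' k rot = begin
    Δ f u v
      ≡⟨ Δ≡ f u v ⟩
    ∑ Q (λ q → ⟦ sameContentᵇ v q ∧ inBlocksᵇ u q ⟧ *ℤ f (rk u q))
      ≡⟨ ∑-cong Q (λ q → cong (⟦ sameContentᵇ v q ∧ inBlocksᵇ u q ⟧ *ℤ_) (f-rot q)) ⟩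
    ∑ Q (λ q → ⟦ sameContentᵇ v q ∧ inBlocksᵇ u q ⟧ *ℤ f (rk u' (rotIter s q)))
      ≡⟨ ∑-bij _≟v_ _≟v_ Q Q (λ q → sameContentᵇ v q ∧ inBlocksᵇ u q) (λ q → sameContentᵇ v q ∧ inBlocksᵇ u' q) (rotIter s) (rotIter (n ∸ s))
           (λ {q} q∈ e → trans (sym (valid-rot q)) e , back q , once q∈ s)
           (λ {q} q∈ e → trans (valid-rot (rotIter (n ∸ s) q)) (trans (cong (λ z → sameContentᵇ v z ∧ inBlocksᵇ u' z) (forth q)) e) , forth q , once q∈ (n ∸ s))
           (λ q → f (rk u' q)) ⟩
    ∑ Q (λ q → ⟦ sameContentᵇ v q ∧ inBlocksᵇ u' q ⟧ *ℤ f (rk u' q))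
      ≡⟨ sym (Δ≡ f u' v) ⟩
    Δ f u' v ∎
    where
    Q = allVecsOf (upTo (bound v)) n
    _≟v_ : DecidableEquality (Vec ℕ n)
    _≟v_ = Vecₚ.≡-dec ℕₚ._≟_
    R = comp u
    a = unrun (take k R)
    b = unrun (drop k R)
    -- The number of letters in the first `k` blocks of `u`.
    s = length a
    adj-u : adj (List.tabulate u) ≡ a ++ b
    adj-u = trans (adj≡unrun (List.tabulate u)) (trans (cong unrun (sym (Listₚ.take++drop≡id k R))) (unrun-++ (take k R) (drop k R)))
    adj-u' : adj (List.tabulate u') ≡ b ++ a
    adj-u' = trans (adj≡unrun (List.tabulate u')) (trans (cong unrun (sym rot)) (unrun-++ (drop k R) (take k R)))
    ab≡n : s + length b ≡ n
    ab≡n = trans (sym (Listₚ.length-++ a)) (trans (cong length (sym adj-u)) (length-adj u))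
    s≤n : s ≤ n
    s≤n = subst (s ≤_) ab≡n (ℕₚ.m≤m+n s (length b))
    back : ∀ q → rotIter (n ∸ s) (rotIter s q) ≡ q
    back q = trans (sym (rotIter-+ (n ∸ s) s q)) (trans (cong (λ z → rotIter z q) (ℕₚ.m∸n+n≡m s≤n)) (rotIter-n q))
    forth : ∀ q → rotIter s (rotIter (n ∸ s) q) ≡ q
    forth q = trans (sym (rotIter-+ s (n ∸ s) q)) (trans (cong (λ z → rotIter z q) (ℕₚ.m+[n∸m]≡n s≤n)) (rotIter-n q))
    once : ∀ {q} → q ∈ Q → ∀ r → Once _≟v_ Q (rotIter r q)
    once {q} q∈ r = Once-allVecs ℕₚ._≟_ (upTo (bound v)) _≟v_ (rotIter r q) (λ i →
      Once-upTo (subst (_< bound v) (sym (lookup-rotIter r q i)) (∈ₚ.∈-upTo⁻ (∈-allVecs⁻ (upTo (bound v)) n q∈ ((toℕ i + r) mod n)))))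
    content-rot : ∀ q → sameContentᵇ v q ≡ sameContentᵇ v (rotIter s q)
    content-rot q with split-at q a b ab≡n
    ... | cs , ds , e , l₁ , l₂ = allᵇ-cong-∈ _ _ (upTo (bound v)) (λ {x} _ → cong (_≡ᵇ cnt v x) (begin
        cnt (lookup q) x                             ≡⟨ sym (cnt≡ q x) ⟩
        cntL (toList q) x                            ≡⟨ cong (λ l → cntL l x) e ⟩
        cntL (cs ++ ds) x                            ≡⟨ trans (count-++ (_≡ᵇ x) cs ds) (trans (ℕₚ.+-comm (cntL cs x) (cntL ds x)) (sym (count-++ (_≡ᵇ x) ds cs))) ⟩
        cntL (ds ++ cs) x                            ≡⟨ cong (λ l → cntL l x) (sym (trans (cong (λ z → toList (rotIter z q)) l₁) (toList-rotIter q cs ds e))) ⟩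
        cntL (toList (rotIter s q)) x                ≡⟨ cnt≡ (rotIter s q) x ⟩
        cnt (lookup (rotIter s q)) x                 ∎))
      where
      cnt≡ : ∀ (q : Vec ℕ n) x → cntL (toList q) x ≡ cnt (lookup q) x
      cnt≡ q x = trans (cong (λ l → cntL l x) (toList-lookup q)) (count-tabulate (_≡ᵇ x) (lookup q))
    zips : ∀ (z : Bool → Bool → Bool) (r : ℕ → ℕ → Bool) q → Σ (List Bool) λ cs → Σ (List Bool) λ ds →
      (length a ≡ length cs × length b ≡ length ds) ×
      zipWith z (adj (List.tabulate u)) (toList (cyc r q)) ≡ zipWith z a cs ++ zipWith z b ds ×
      zipWith z (adj (List.tabulate u')) (toList (cyc r (rotIter s q))) ≡ zipWith z b ds ++ zipWith z a cs
    zips z r q with split-at (cyc r q) a b ab≡n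
    ... | cs , ds , e , l₁ , l₂ = cs , ds , (l₁ , l₂) ,
      trans (cong₂ (zipWith z) adj-u e) (zipWith-++ z a b cs ds l₁) ,
      trans (cong₂ (zipWith z) adj-u' (trans (cong toList (cyc-rotIter r s q)) (trans (cong (λ x → toList (rotIter x (cyc r q))) l₁) (toList-rotIter (cyc r q) cs ds e))))
        (zipWith-++ z b a ds cs l₂)
    valid-rot : ∀ q → sameContentᵇ v q ∧ inBlocksᵇ u q ≡ sameContentᵇ v (rotIter s q) ∧ inBlocksᵇ u' (rotIter s q)
    valid-rot q = cong₂ _∧_ (content-rot q) (let (cs , ds , _ , e₁ , e₂) = zips imp _≤ᵇ_ q in
      trans (blocks≡ u q mu) (trans (cong (allᵇ id) e₁) (trans (allᵇ-++-comm (zipWith imp a cs) (zipWith imp b ds)) (sym (trans (blocks≡ u' (rotIter s q) mu') (cong (allᵇ id) e₂))))))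
    f-rot : ∀ q → f (rk u q) ≡ f (rk u' (rotIter s q))
    f-rot q with zips _∧_ _≡ᵇ_ q
    ... | cs , ds , (l₁ , l₂) , e₁ , e₂ = cf (rk u q) (rk u' (rotIter s q)) (rk-monotone u q) (rk-monotone u' (rotIter s q)) (length C) (begin
        rotateList (length C) (comp (rk u q))                       ≡⟨ cong (rotateList (length C)) (trans (runs≡ (List.tabulate (rk u q))) (cong (blockLengths 1) (trans (adj-rk u q) e₁))) ⟩
        rotateList (length C) (blockLengths 1 (p₁ ++ p₂))           ≡⟨ cong (rotateList (length C)) (blockLengths-++ p₁ p₂ (zipAnd-closed a cs (unrun-closed (take k R)) l₁)) ⟩
        rotateList (length C) (C ++ D)                              ≡⟨ cong₂ _++_ (drop-length C D) (take-length C D) ⟩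
        D ++ C                                                      ≡⟨ sym (blockLengths-++ p₂ p₁ (zipAnd-closed b ds (unrun-closed (drop k R)) l₂)) ⟩
        blockLengths 1 (p₂ ++ p₁)                                   ≡⟨ sym (trans (runs≡ (List.tabulate (rk u' (rotIter s q)))) (cong (blockLengths 1) (trans (adj-rk u' (rotIter s q)) e₂))) ⟩
        comp (rk u' (rotIter s q))                                  ∎)
      where
      p₁ = zipWith _∧_ a cs
      p₂ = zipWith _∧_ b ds
      C = blockLengths 1 p₁
      D = blockLengths 1 p₂
      drop-length : ∀ (C D : List ℕ) → drop (length C) (C ++ D) ≡ D
      drop-length []      D = refl
      drop-length (_ ∷ C) D = drop-length C D
      take-length : ∀ (C D : List ℕ) → take (length C) (C ++ D) ≡ C
      take-length []      D = refl
      take-length (x ∷ C) D = cong (x ∷_) (take-length C D)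

-- Tensor membership

InTensor-≈ : ∀ {n} {P Q : Series n → Set} {g g' : Series2 n} → g' ≈₂ g → InTensor P Q g → InTensor P Q g'
InTensor-≈ e (ts , all , eq) = ts , all , λ u v mu mv → trans (e u v mu mv) (eq u v mu mv)

InTensor-⊗ : ∀ {n} {P Q : Series n → Set} (f g : Series n) → P f → Q g → InTensor P Q (λ u v → f u *ℤ g v)
InTensor-⊗ f g Pf Qg = (f , g) ∷ [] , (Pf , Qg) ∷ [] , λ u v _ _ → sym (ℤₚ.+-identityʳ (f u *ℤ g v))

InTensor-∑ : ∀ {n} {P Q : Series n → Set} → (∀ c {f} → P f → P (λ u → c *ℤ f u)) →
  (xs : List A) (c : A → ℤ) (g : A → Series2 n) → (∀ {x} → x ∈ xs → InTensor P Q (g x)) →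
  InTensor P Q (λ u v → ∑ xs (λ x → c x *ℤ g x u v))
InTensor-∑ scale [] c g _ = [] , [] , λ _ _ _ _ → refl
InTensor-∑ {P = P} {Q} scale (x ∷ xs) c g hyp with hyp (here refl) | InTensor-∑ {P = P} {Q} scale xs c g (hyp ∘ there)
... | ts , all , eq | ts' , all' , eq' = map scaled ts ++ ts' ,
    Allₚ.++⁺ (Allₚ.map⁺ (All.map (λ { (p , q) → scale (c x) p , q }) all)) all' ,
    λ u v mu mv → begin
      c x *ℤ g x u v +ℤ ∑ xs (λ x → c x *ℤ g x u v)
        ≡⟨ cong₂ _+ℤ_ (trans (cong (c x *ℤ_) (eq u v mu mv)) (trans (∑-*ˡ ts (c x) (term u v))
             (trans (∑-cong ts (λ t → sym (ℤₚ.*-assoc (c x) (proj₁ t u) (proj₂ t v)))) (sym (∑-map scaled ts (term u v)))))) (eq' u v mu mv) ⟩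
      ∑ (map scaled ts) (term u v) +ℤ ∑ ts' (term u v)
        ≡⟨ sym (∑-++ (map scaled ts) ts' (term u v)) ⟩
      ∑ (map scaled ts ++ ts') (term u v) ∎
  where
  scaled : Series _ × Series _ → Series _ × Series _
  scaled (f , f') = (λ u → c x *ℤ f u) , f'
  term : Word _ → Word _ → Series _ × Series _ → ℤ
  term u v = λ { (f , f') → (f ⊗ f') u v }

-- A series quasisymmetric in y is the sum over J of its values at the test words `wordOf J` times
-- the monomial quasisymmetric functions `monomial J`; as functions of x these values are cyclic
-- quasisymmetric.
Δ-cqsym-tensor : ∀ n (f : Series n) → IsCQSym f → InTensor IsCQSym IsQSym (Δ f)
Δ-cqsym-tensor zero f _ = ((λ _ → f (lookup [])) , (λ _ → + 1)) ∷ [] , ((λ _ _ _ _ _ _ → refl) , (λ _ _ _ _ _ → refl)) ∷ [] ,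
  λ _ _ _ _ → cong (_+ℤ + 0) (sym (ℤₚ.*-identityʳ (f (lookup []))))
Δ-cqsym-tensor (suc m) f cf = map factors (allSubsets m) ,
  Allₚ.map⁺ (All.tabulate (λ {J} _ → CyclicQSym.Δ-cqsym f cf (wordOf (lookup J)) , monomial-qsym J)) ,
  λ u v mu mv → begin
    Δ f u v
      ≡⟨ Δ-qsym f qf u mu v (wordOf (lookup (strictSet v))) mv (wordOf-monotone _) (adj⇒comp v (wordOf (lookup (strictSet v))) (sameAdj v)) ⟩
    Δ f u (wordOf (lookup (strictSet v)))
      ≡⟨ sym (∑-δ (strictSet v) (λ J → Δ f u (wordOf (lookup J)))) ⟩
    ∑ (allSubsets m) (λ J → ⟦ eqVecBool (strictSet v) J ⟧ *ℤ Δ f u (wordOf (lookup J)))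
      ≡⟨ ∑-cong (allSubsets m) (λ J → ℤₚ.*-comm ⟦ eqVecBool (strictSet v) J ⟧ (Δ f u (wordOf (lookup J)))) ⟩
    ∑ (allSubsets m) (λ J → Δ f u (wordOf (lookup J)) *ℤ monomial J v)
      ≡⟨ sym (∑-map factors (allSubsets m) (λ { (f , g) → (f ⊗ g) u v })) ⟩
    sumS2 (map factors (allSubsets m)) u v ∎
  where
  qf : IsQSym f
  qf u u' mu mu' e = cf u u' mu mu' 0 (trans (Listₚ.++-identityʳ (comp u)) e)
  strictSet : Word (suc m) → Vec Bool m
  strictSet v = Vec.tabulate (λ i → not (v (inject₁ i) ≡ᵇ v (fsuc i)))
  monomial : Vec Bool m → Series (suc m)
  monomial J v = ⟦ eqVecBool (strictSet v) J ⟧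
  factors : Vec Bool m → Series (suc m) × Series (suc m)
  factors J = (λ u → Δ f u (wordOf (lookup J))) , monomial J
  monomial-qsym : ∀ J → IsQSym (monomial J)
  monomial-qsym J v v' _ _ e = cong (λ X → ⟦ eqVecBool X J ⟧) (Vecₚ.tabulate-cong (λ i → cong not (comp⇒adj v v' e i)))
  sameAdj : ∀ v i → (v (inject₁ i) ≡ᵇ v (fsuc i)) ≡ (wordOf (lookup (strictSet v)) (inject₁ i) ≡ᵇ wordOf (lookup (strictSet v)) (fsuc i))
  sameAdj v i with v (inject₁ i) ≡ᵇ v (fsuc i) in e
  ... | true  = sym (≡ᵇ⁺ (wordOf-weak (lookup (strictSet v)) i (trans (Vecₚ.lookup∘tabulate _ i) (cong not e))))
  ... | false = sym (≡false (λ p → ℕₚ.<⇒≢ (wordOf-strict (lookup (strictSet v)) i (trans (Vecₚ.lookup∘tabulate _ i) (cong not e)))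
                  (≡ᵇ⁻ {wordOf (lookup (strictSet v)) (inject₁ i)} p)))

minus-scale : ∀ {n} c {f : Series n} → IsCQSymMinus f → IsCQSymMinus (λ u → c *ℤ f u)
minus-scale {zero}        c (k , e) = c *ℤ k , λ u mu → cong (c *ℤ_) (e u mu)
minus-scale {suc zero}    c (k , e) = c *ℤ k , λ u mu → trans (cong (c *ℤ_) (e u mu)) (sym (ℤₚ.*-assoc c k (+ 1)))
minus-scale {suc (suc m)} c (k , e) = (λ J → c *ℤ k J) , λ u mu → trans (cong (c *ℤ_) (e u mu))
  (trans (∑-*ˡ Js c (λ J → k J *ℤ hatFcyc J u)) (∑-cong Js (λ J → sym (ℤₚ.*-assoc c (k J) (hatFcyc J u)))))
  where
  Js = filterᵇ (λ J → nonemptyᵇ J ∧ properᵇ J) (allSubsets (suc (suc m)))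

hatFcyc-minus : ∀ {m} (A : Vec Bool (suc (suc m))) → nonemptyᵇ A ∧ properᵇ A ≡ true → IsCQSymMinus (hatFcyc A)
hatFcyc-minus {m} A np = (λ J → ⟦ eqVecBool A J ⟧) , λ u _ → sym (begin
  ∑ (filterᵇ (λ J → nonemptyᵇ J ∧ properᵇ J) (allSubsets (suc (suc m)))) (λ J → ⟦ eqVecBool A J ⟧ *ℤ hatFcyc J u)
    ≡⟨ ∑-filter (λ J → nonemptyᵇ J ∧ properᵇ J) (allSubsets (suc (suc m))) (λ J → ⟦ eqVecBool A J ⟧ *ℤ hatFcyc J u) ⟩
  ∑ (allSubsets (suc (suc m))) (λ J → ⟦ nonemptyᵇ J ∧ properᵇ J ⟧ *ℤ (⟦ eqVecBool A J ⟧ *ℤ hatFcyc J u))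
    ≡⟨ ∑-cong (allSubsets (suc (suc m))) (λ J → *-swapℤ ⟦ nonemptyᵇ J ∧ properᵇ J ⟧ ⟦ eqVecBool A J ⟧ (hatFcyc J u)) ⟩
  ∑ (allSubsets (suc (suc m))) (λ J → ⟦ eqVecBool A J ⟧ *ℤ (⟦ nonemptyᵇ J ∧ properᵇ J ⟧ *ℤ hatFcyc J u))
    ≡⟨ ∑-δ A (λ J → ⟦ nonemptyᵇ J ∧ properᵇ J ⟧ *ℤ hatFcyc J u) ⟩
  ⟦ nonemptyᵇ A ∧ properᵇ A ⟧ *ℤ hatFcyc A u
    ≡⟨ guard-true (hatFcyc A u) np ⟩
  hatFcyc A u ∎)

-- `cDes-surjective` supplies a permutation for the orbit of B, so the expansion is available; its
-- integer coefficients are absorbed into the first tensor factors.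
Δ-hatFcyc-tensor : ∀ {m} (B : Vec Bool (suc (suc m))) → NonemptyProper B → InTensor IsCQSymMinus IsQSym (Δ (hatFcyc B))
Δ-hatFcyc-tensor {m} B np = InTensor-≈ {P = IsCQSymMinus} {IsQSym} {g = λ u v → ∑ reps (λ A → + 1 *ℤ part A u v)} {g' = Δ (hatFcyc B)}
  (λ u v mu mv → trans (expand u v mu mv) (∑-cong reps (λ A → sym (ℤₚ.*-identityˡ (part A u v)))))
  (InTensor-∑ {P = IsCQSymMinus} {IsQSym} minus-scale reps (λ _ → + 1) part
    (λ {A} A∈ → InTensor-∑ {P = IsCQSymMinus} {IsQSym} minus-scale (allSubsets (suc m)) (λ J → + c A J) (λ J u v → hatFcyc A u *ℤ F J v)
      (λ {J} _ → InTensor-⊗ {P = IsCQSymMinus} {IsQSym} (hatFcyc A) (F J) (hatFcyc-minus A (proj₁ (∈-reps⁻ A∈))) (F-isQSym J))))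
  where
  open StructureConstants {m}
  reps : List (Vec Bool (suc (suc m)))
  reps = orbitReps (suc (suc m))
  witness : ∃[ π ] (IsPerm π × InOrbit (cDes π) B)
  witness = cDes-surjective B np
  constants : Σ (Vec Bool (suc (suc m)) → Vec Bool (suc m) → ℕ) λ c → _ × _
  constants = structure-constants B (proj₁ witness) (proj₁ (proj₂ witness)) (proj₂ (proj₂ witness))
  c : Vec Bool (suc (suc m)) → Vec Bool (suc m) → ℕ
  c = proj₁ constants
  part : Vec Bool (suc (suc m)) → Series2 (suc (suc m))
  part A u v = ∑ (allSubsets (suc m)) (λ J → + c A J *ℤ (hatFcyc A u *ℤ F J v))
  expand : ∀ u v → Monotone u → Monotone v → Δ (hatFcyc B) u v ≡ ∑ reps (λ A → part A u v)
  expand = proj₂ (proj₂ constants)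

Δ-minus-tensor : ∀ n (f : Series n) → IsCQSymMinus f → InTensor IsCQSymMinus IsQSym (Δ f)
Δ-minus-tensor zero f (c , e) = ((λ _ → c) , (λ _ → + 1)) ∷ [] , ((c , λ _ _ → refl) , (λ _ _ _ _ _ → refl)) ∷ [] ,
  λ _ _ _ _ → cong (_+ℤ + 0) (trans (e (lookup []) (λ ())) (sym (ℤₚ.*-identityʳ c)))
-- In degree 1 the series e_1 is the only fundamental function, and the coproduct formula for the
-- identity gives Δ e_1 = e_1 ⊗ e_1.
Δ-minus-tensor (suc zero) f (c , e₁) = ((λ u → c *ℤ e 1 u) , (λ _ → + 1)) ∷ [] , ((c , λ _ _ → refl) , (λ _ _ _ _ _ → refl)) ∷ [] ,
  λ u v mu mv → begin
    Δ f u v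
      ≡⟨ Δ-cong {f = f} {g = λ w → ∑ (c ∷ []) (λ x → x *ℤ F (Des (identity 1)) w)} (λ w mw → trans (e₁ w mw) (sym (ℤₚ.+-identityʳ (c *ℤ + 1)))) u v ⟩
    Δ (λ w → ∑ (c ∷ []) (λ x → x *ℤ F (Des (identity 1)) w)) u v
      ≡⟨ Δ-∑ (c ∷ []) id (λ _ → F (Des (identity 1))) u v ⟩
    c *ℤ Δ (F (Des (identity 1))) u v +ℤ + 0
      ≡⟨ cong (λ x → c *ℤ x +ℤ + 0) (Δ-F-Des (identity 1) (identity-perm 1) u v mu mv) ⟩
    c *ℤ + 1 +ℤ + 0
      ≡⟨ cong (_+ℤ + 0) (sym (ℤₚ.*-identityʳ (c *ℤ + 1))) ⟩
    c *ℤ + 1 *ℤ + 1 +ℤ + 0 ∎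
Δ-minus-tensor (suc (suc m)) f (c , e) = InTensor-≈ {P = IsCQSymMinus} {IsQSym} {g' = Δ f}
  (λ u v _ _ → trans (Δ-cong {f = f} {g = λ w → ∑ Js (λ J → c J *ℤ hatFcyc J w)} e u v) (Δ-∑ Js c hatFcyc u v))
  (InTensor-∑ {P = IsCQSymMinus} {IsQSym} minus-scale Js c (λ J → Δ (hatFcyc J))
    (λ {J} J∈ → Δ-hatFcyc-tensor J (≡true⇒T (proj₂ (∈-filterᵇ⁻ (λ J → nonemptyᵇ J ∧ properᵇ J) (allSubsets (suc (suc m))) J∈)))))
  where
  Js = filterᵇ (λ J → nonemptyᵇ J ∧ properᵇ J) (allSubsets (suc (suc m)))

theorem6p1 :
  -- Δ_n(cQSym_n) ⊆ cQSym_n ⊗ QSym_n, for all n ≥ 0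
  (∀ (n : ℕ) (f : Series n) → IsCQSym f → InTensor IsCQSym IsQSym (Δ f))
  -- Δ_n(cQSym⁻_n) ⊆ cQSym⁻_n ⊗ QSym_n, for all n ≥ 0
  × (∀ (n : ℕ) (f : Series n) → IsCQSymMinus f → InTensor IsCQSymMinus IsQSym (Δ f))
  -- n > 1, B = orbit of a nonempty proper subset of [n]
  × (∀ (n : ℕ) → 2 ≤ n → (B : Vec Bool n) → NonemptyProper B →
      -- some π has cDes(π) ∈ B
      (∃[ π ] (IsPerm π × InOrbit (cDes π) B))
      -- ã_B^{AJ} does not depend on π
      × (∀ (π π' : Vec (Fin n) n) → IsPerm π → IsPerm π' →
           InOrbit (cDes π) B → InOrbit (cDes π') B →
           (A : Vec Bool n) → NonemptyProper A → (J : Vec Bool (n ∸ 1)) →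
           ãcount π A J ≡ ãcount π' A J)
      -- the structure constants (d_A/d_B) ã are nonnegative integers c_{A,J}
      -- and give the expansion of Δ_n(\hat F^cyc_{n,B})
      × (∀ (π : Vec (Fin n) n) → IsPerm π → InOrbit (cDes π) B →
           Σ (Vec Bool n → Vec Bool (n ∸ 1) → ℕ) λ c →
             (∀ (A : Vec Bool n) → NonemptyProper A → (J : Vec Bool (n ∸ 1)) →
                c A J * d B ≡ d A * ãcount π A J)
             × (Δ (hatFcyc B) ≈₂
                 (λ u v → sumℤ (concatMap (λ A → map (λ J → + c A J *ℤ (hatFcyc A u *ℤ F J v))
                                                     (allSubsets (n ∸ 1)))
                                          (orbitReps n))))))
  -- n ≥ 1 : \hat F^cyc_{n,∅} = h_n, Δ_n(h_n) = Σ_λ s_λ ⊗ s_λ ∈ Sym_n ⊗ Sym_n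
  × (∀ (n : ℕ) → 1 ≤ n →
      (hatFcyc (replicate n false) ≈ h n)
      × (Δ (hatFcyc (replicate n false)) ≈₂ Δ (h n))
      × (Δ (h n) ≈₂ (λ u v → sumℤ (map (λ l → schur l u *ℤ schur l v) (partitions n))))
      × InTensor IsSym IsSym (Δ (h n)))
  -- n ≥ 1 : \hat F^cyc_{n,[n]} = e_n, Δ_n(e_n) = Σ_λ s_λ ⊗ s_λ' ∈ Sym_n ⊗ Sym_n
  × (∀ (n : ℕ) → 1 ≤ n →
      (hatFcyc (replicate n true) ≈ e n)
      × (Δ (hatFcyc (replicate n true)) ≈₂ Δ (e n))
      × (Δ (e n) ≈₂ (λ u v → sumℤ (map (λ l → schur l u *ℤ schur (conj l) v) (partitions n))))
      × InTensor IsSym IsSym (Δ (e n)))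
theorem6p1 = Δ-cqsym-tensor , Δ-minus-tensor , part₃ , part₄ , part₅
  where
  part₃ : ∀ (n : ℕ) → 2 ≤ n → (B : Vec Bool n) → NonemptyProper B → _
  part₃ (suc (suc m)) (s≤s (s≤s z≤n)) B np = cDes-surjective B np , ã-independent B ,
    λ π p o → let (c , integral , expand) = structure-constants B π p o in c , integral ,
      λ u v mu mv → trans (expand u v mu mv)
        (sym (sumℤ-concatMap (orbitReps (suc (suc m))) (allSubsets (suc m)) (λ A J → + c A J *ℤ (hatFcyc A u *ℤ F J v))))
    where open StructureConstants {m}
  part₄ : ∀ (n : ℕ) → 1 ≤ n → _
  part₄ (suc m) (s≤s z≤n) = hatFcyc-∅ m , (λ u v _ _ → Δ-cong {f = hatFcyc (replicate (suc m) false)} {g = h (suc m)} (hatFcyc-∅ m) u v) ,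
    (λ u v mu _ → Δh-expansion u v mu) , schur-tensor false (Δ (h (suc m))) Δh-expansion
  part₅ : ∀ (n : ℕ) → 1 ≤ n → _
  part₅ (suc m) (s≤s z≤n) = hatFcyc-full m , (λ u v _ _ → Δ-cong {f = hatFcyc (replicate (suc m) true)} {g = e (suc m)} (hatFcyc-full m) u v) ,
    (λ u v mu _ → Δe-expansion u v mu) , schur-tensor true (Δ (e (suc m))) Δe-expansion
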